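{- There exists a deterministic algorithm in the CONGEST model (local wakeup model) that maintains a maximal independent set of a graph $G=(V,E)$, starting from the empty graph on $n$ vertices, under edge insertions and deletions, using $O(\log^2 n)$ amortized rounds and $O(m_{max}^{2/3}\log^2 n)$ amortized messages per update, where $m_{max}$ is the maximum number of edges present in the graph at any time during the update sequence.
   Context: A maximal independent set (MIS) of a graph is an independent set not contained in any larger independent set. In the CONGEST model computation proceeds in synchronous rounds in which each vertex may send an $O(\log n)$-bit message to each neighbor; vertices know their neighbors' IDs. Local wakeup model: the graph starts empty; after an update of edge $(u,v)$ only $u$ and $v$ wake up, and other vertices act only after receiving a message; messages are unicast. After each update the maintained set must be an MIS of the current graph. Amortized round (resp. message) complexity is the average, over a worst-case update sequence, of the number of rounds (resp. messages) per update. -}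

module Defs where

open import Data.Nat using (ℕ; zero; suc; _+_; _*_; _^_; _⊔_)
open import Data.Nat.Logarithm using (⌊log₂_⌋)
open import Data.Fin using (Fin; toℕ)
open import Data.Fin.Properties using () renaming (_≟_ to _≟ᶠ_)
open import Data.Bool using (Bool; true; false; if_then_else_; _∧_; _∨_; not)
open import Data.Maybe using (Maybe; just; nothing; is-just)
open import Data.Product using (_×_; _,_; proj₁; proj₂; ∃)
open import Data.List using (List; []; _∷_; map; allFin; foldr)
open import Data.Nat.ListAction using (sum)
open import Data.Bool.ListAction using (all; any)
open import Relation.Nullary using (¬_; does)
open import Relation.Binary.PropositionalEquality using (_≡_)

-- Graphs on the vertex set Fin n, as a (symmetric, loop-free) adjacency
-- predicate.  Vertex IDs are the elements of Fin n.

Graph : ℕ → Set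
Graph n = Fin n → Fin n → Bool

emptyGraph : ∀ {n} → Graph n
emptyGraph _ _ = false

countFin : ∀ {n} → (Fin n → Bool) → ℕ
countFin {n} p = sum (map (λ i → if p i then 1 else 0) (allFin n))

edgeCount : ∀ {n} → Graph n → ℕ
edgeCount {n} G =
  sum (map (λ u → countFin (λ v → (does (suc (toℕ u) Data.Nat.≤? toℕ v)) ∧ G u v)) (allFin n))

data Update (n : ℕ) : Set where
  insert : Fin n → Fin n → Update n
  delete : Fin n → Fin n → Update n

eqᵇ : ∀ {n} → Fin n → Fin n → Bool
eqᵇ a b = does (a ≟ᶠ b)

samePair : ∀ {n} → Fin n → Fin n → Fin n → Fin n → Bool
samePair u v a b = (eqᵇ a u ∧ eqᵇ b v) ∨ (eqᵇ a v ∧ eqᵇ b u)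

applyUpdate : ∀ {n} → Graph n → Update n → Graph n
applyUpdate G (insert u v) a b = samePair u v a b ∨ G a b
applyUpdate G (delete u v) a b = not (samePair u v a b) ∧ G a b

data ValidUpdate {n : ℕ} (G : Graph n) : Update n → Set where
  ins : ∀ {u v} → ¬ (u ≡ v) → G u v ≡ false → ValidUpdate G (insert u v)
  del : ∀ {u v} → ¬ (u ≡ v) → G u v ≡ true  → ValidUpdate G (delete u v)

data ValidSeq {n : ℕ} : Graph n → List (Update n) → Set where
  []  : ∀ {G} → ValidSeq G []
  _∷_ : ∀ {G x xs} → ValidUpdate G x → ValidSeq (applyUpdate G x) xs → ValidSeq G (x ∷ xs)

Independent : ∀ {n} → Graph n → (Fin n → Bool) → Set
Independent G S = ∀ u v → G u v ≡ true → S u ≡ true → S v ≡ false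

IsMIS : ∀ {n} → Graph n → (Fin n → Bool) → Set
IsMIS G S =
  Independent G S ×
  (∀ T → Independent G T → (∀ v → S v ≡ true → T v ≡ true) → ∀ v → T v ≡ true → S v ≡ true)

-- Deterministic CONGEST algorithms in the local wakeup model.
-- Messages have O(log n) bits: a message is an element of Fin ((n+1)^B)
-- for a constant B of the algorithm.

Msg : ℕ → ℕ → Set
Msg n B = Fin (suc n ^ B)

-- what an endpoint of an updated edge learns when it wakes up
data Event (n : ℕ) : Set where
  added   : Fin n → Event n
  removed : Fin n → Event n

record Algorithm (n B : ℕ) : Set₁ where
  field
    State : Set
    init  : Fin n → State
    wake  : State → Event n → State
    -- one round of local computation: given the messages received (indexed by sender),
    -- produce the new state and the unicast messages to send (indexed by receiver)
    step  : State → (Fin n → Maybe (Msg n B)) → State × (Fin n → Maybe (Msg n B))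
    done  : State → Bool
    inMIS : State → Bool

module Exec {n B : ℕ} (A : Algorithm n B) where
  open Algorithm A

  -- inbox v u = message sent by u to v in the previous round
  record Config : Set where
    constructor config
    field
      states : Fin n → State
      awake  : Fin n → Bool
      inbox  : Fin n → Fin n → Maybe (Msg n B)
  open Config

  hasMsg : (Fin n → Maybe (Msg n B)) → Bool
  hasMsg m = any (λ u → is-just (m u)) (allFin n)

  -- One synchronous round on graph G.  A vertex computes iff it is awake
  -- (woken by the update, or by an earlier message during this update) or
  -- receives a message.  Messages are delivered only along edges of G.
  -- Returns the new configuration, the number of messages sent, and
  -- whether the update is finished (no messages sent and every awake
  -- vertex is done).
  round : Graph n → Config → Config × ℕ × Bool
  round G c = (config st' aw' inb' , cnt , quiet)
    where
      active : Fin n → Bool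
      active v = awake c v ∨ hasMsg (inbox c v)
      res : Fin n → State × (Fin n → Maybe (Msg n B))
      res v = if active v then step (states c v) (inbox c v) else (states c v , λ _ → nothing)
      st' : Fin n → State
      st' v = proj₁ (res v)
      aw' : Fin n → Bool
      aw' = active
      inb' : Fin n → Fin n → Maybe (Msg n B)
      inb' w u = if G u w then proj₂ (res u) w else nothing
      cnt : ℕ
      cnt = sum (map (λ v → countFin (λ w → is-just (proj₂ (res v) w))) (allFin n))
      quiet : Bool
      quiet = does (cnt Data.Nat.≟ 0) ∧ all (λ v → not (aw' v) ∨ done (st' v)) (allFin n)

  runUpdate : ℕ → Graph n → Config → Maybe ((Fin n → State) × ℕ × ℕ)
  runUpdate zero G c = nothing
  runUpdate (suc f) G c with round G c
  ... | (c' , m , true)  = just (states c' , 1 , m)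
  ... | (c' , m , false) with runUpdate f G c'
  ...   | nothing            = nothing
  ...   | just (s , r , ms)  = just (s , suc r , m + ms)

  endpoints : Update n → Fin n → Bool
  endpoints (insert u v) x = eqᵇ x u ∨ eqᵇ x v
  endpoints (delete u v) x = eqᵇ x u ∨ eqᵇ x v

  wakeAll : (Fin n → State) → Update n → Fin n → State
  wakeAll s (insert u v) x =
    if eqᵇ x u then wake (s x) (added v) else if eqᵇ x v then wake (s x) (added u) else s x
  wakeAll s (delete u v) x =
    if eqᵇ x u then wake (s x) (removed v) else if eqᵇ x v then wake (s x) (removed u) else s x

  record Outcome : Set where
    constructor outcome
    field
      graph  : Graph n
      mis    : Fin n → Bool
      rounds : ℕ
      msgs   : ℕ

  runSeq : ℕ → Graph n → (Fin n → State) → List (Update n) → Maybe (List Outcome)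
  runSeq f G s [] = just []
  runSeq f G s (x ∷ xs) with runUpdate f (applyUpdate G x)
                                (config (wakeAll s x) (endpoints x) (λ _ _ → nothing))
  ... | nothing = nothing
  ... | just (s' , r , m) with runSeq f (applyUpdate G x) s' xs
  ...   | nothing = nothing
  ...   | just os = just (outcome (applyUpdate G x) (λ v → inMIS (s' v)) r m ∷ os)

  run : ℕ → List (Update n) → Maybe (List Outcome)
  run f = runSeq f emptyGraph init

open Exec public using (Outcome; outcome; run)
open Outcome public

totalRounds : ∀ {n B} {A : Algorithm n B} → List (Outcome A) → ℕ
totalRounds os = sum (map rounds os)

totalMsgs : ∀ {n B} {A : Algorithm n B} → List (Outcome A) → ℕ
totalMsgs os = sum (map msgs os)

mMax : ∀ {n B} {A : Algorithm n B} → List (Outcome A) → ℕ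
mMax os = foldr (λ o m → edgeCount (graph o) ⊔ m) 0 os

-- log n, normalised to be ≥ 1
lg : ℕ → ℕ
lg n = suc ⌊log₂ n ⌋

{-# OPTIONS --safe #-}
-- Every vertex is light or heavy.  Light vertices inform all their neighbours of their state, which
-- is cheap because their degree is O(m^{2/3}), and ignore heavy vertices; heavy vertices inform
-- only heavy ones.  Hence a light vertex that joins the set may evict heavy neighbours, and a
-- change at a vertex w only affects heavy vertices close to w.  Let r be the number of these and δ
-- their least degree.  As rδ ≤ 2m, the test δ ≤ r² certifies δ³ ≤ (rδ)² = O(m²), and the vertex of
-- degree δ becomes light.  If the test fails then r³ < rδ ≤ 2m, so that it is cheap to let the r
-- heavy vertices talk to each other; they repair the set by Luby's algorithm, derandomised by the
-- method of conditional expectations over the seeds of a pairwise independent (Toeplitz) hash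
-- family, in O(log² n) rounds.  The potential that counts 2 for each heavy vertex and 1 for each
-- light vertex outside the set pays for the repairs: an update raises it by O(1), and it drops
-- whenever a vertex becomes light or a light vertex joins the set.
module Submission where

-- The algorithm never learns the number of edges: the test compares only quantities that a pulse
-- has just counted. The scale `ρ`, with `ρ³` between the maximal number of edges and 8 times it,
-- occurs in the analysis alone; there light vertices have degree at most `2ρ²` and heavy ones at
-- most `2ρ + 3` heavy neighbours. Insertion is the obstacle. A new edge could spoil the degree
-- bound of a light endpoint or join two light members of the set. So both endpoints are first made
-- heavy, which raises the potential by at most 2 each, and pinned, so that repairs in between
-- cannot lighten them again. The heavy vertices around an endpoint are reduced to at most `2ρ + 2`
-- beforehand, which leaves room for one more. Messages are not amortised on their own: every round
-- is charged `μ = 11ρ²` of them, a pulse for its five rounds together, so the message bound follows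
-- from the one on rounds. The estimator for a seed is a difference of sums of local terms.
-- Comparing two halves of an interval of seeds thus takes four aggregated numbers, and one pulse
-- per seed bit.

open import Defs
open import Data.Nat using (ℕ; zero; suc; _+_; _*_; _^_; _∸_; _⊓_; _⊔_; _≤_; _<_; z≤n; s≤s; NonZero; _≤?_; _<?_; _≤ᵇ_; _<ᵇ_; _/_; _%_; >-nonZero; ⌊_/2⌋)
open import Data.Nat.Properties hiding (_≟_)
open import Data.Nat.DivMod using (m<n⇒m%n≡m; [m+kn]%n≡m%n; m<n⇒m/n≡0; m*n/n≡m; m/n*n≤m; m≡m%n+[m/n]*n; m%n<n; +-distrib-/-∣ʳ)
open import Data.Nat.Divisibility using (n∣m*n)
open import Data.Nat.Logarithm using (⌊log₂_⌋; ⌊log₂⌋-mono-≤; ⌊log₂⌊n/2⌋⌋≡⌊log₂n⌋∸1; ⌊log₂[2^n]⌋≡n)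
open import Data.Nat.ListAction using (sum)
open import Data.Nat.Tactic.RingSolver using (solve-∀)
open import Data.Fin using (Fin; zero; suc; toℕ; fromℕ<)
open import Data.Fin.Properties using (toℕ<n; toℕ-fromℕ<; toℕ-injective; _≟_)
open import Data.Bool using (Bool; true; false; if_then_else_; _∧_; _∨_; not; _xor_)
open import Data.Bool.Properties using (∧-comm; ∨-comm; ∧-zeroʳ; ∧-identityʳ; ∨-identityʳ)
open import Data.Bool.ListAction using (any; all)
open import Data.Maybe using (Maybe; just; nothing; is-just; maybe)
open import Data.Product using (Σ; ∃; _×_; _,_; proj₁; proj₂)
open import Data.Sum using (_⊎_; inj₁; inj₂)
open import Data.Unit using (⊤; tt)
open import Data.Empty using (⊥; ⊥-elim)
open import Data.List using (List; []; _∷_; map; allFin; length; foldr)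
open import Data.List.Properties using (map-tabulate)
open import Data.List.Relation.Unary.All using (All; []; _∷_)
open import Data.Vec using (Vec; []; _∷_; lookup; tabulate)
open import Data.Vec.Properties using (lookup∘tabulate; tabulate∘lookup; tabulate-cong)
open import Function using (_∘_; id; case_of_)
open import Relation.Nullary using (¬_; Dec; yes; no; does)
open import Relation.Nullary.Decidable using (dec-true; dec-false)
open import Relation.Binary.PropositionalEquality using (_≡_; _≢_; refl; sym; trans; cong; cong₂; subst; module ≡-Reasoning)
open import Relation.Binary.Definitions using (tri<; tri≈; tri>)

-- Finite sums

∑ : ∀ {n} → (Fin n → ℕ) → ℕ
∑ {zero}  f = 0
∑ {suc n} f = f zero + ∑ (f ∘ suc)

sum-map-allFin : ∀ {n} (f : Fin n → ℕ) → sum (map f (allFin n)) ≡ ∑ f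
sum-map-allFin {n} f = trans (cong sum (map-tabulate id f)) (go f)
  where
  go : ∀ {m} (g : Fin m → ℕ) → sum (Data.List.tabulate g) ≡ ∑ g
  go {zero}  g = refl
  go {suc m} g = cong (g zero +_) (go (g ∘ suc))

∑-cong : ∀ {n} {f g : Fin n → ℕ} → (∀ i → f i ≡ g i) → ∑ f ≡ ∑ g
∑-cong {zero}  h = refl
∑-cong {suc n} h = cong₂ _+_ (h zero) (∑-cong (h ∘ suc))

∑-mono : ∀ {n} {f g : Fin n → ℕ} → (∀ i → f i ≤ g i) → ∑ f ≤ ∑ g
∑-mono {zero}  h = z≤n
∑-mono {suc n} h = +-mono-≤ (h zero) (∑-mono (h ∘ suc))

∑-+ : ∀ {n} (f g : Fin n → ℕ) → ∑ (λ i → f i + g i) ≡ ∑ f + ∑ g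
∑-+ {zero}  f g = refl
∑-+ {suc n} f g = trans (cong (f zero + g zero +_) (∑-+ (f ∘ suc) (g ∘ suc)))
  (interchange (f zero) (g zero) (∑ (f ∘ suc)) (∑ (g ∘ suc)))
  where
  interchange : ∀ a b c d → a + b + (c + d) ≡ a + c + (b + d)
  interchange = solve-∀

∑-*ˡ : ∀ {n} c (f : Fin n → ℕ) → ∑ (λ i → c * f i) ≡ c * ∑ f
∑-*ˡ {zero}  c f = sym (*-zeroʳ c)
∑-*ˡ {suc n} c f = trans (cong (c * f zero +_) (∑-*ˡ c (f ∘ suc))) (sym (*-distribˡ-+ c (f zero) _))

∑-*ʳ : ∀ {n} c (f : Fin n → ℕ) → ∑ (λ i → f i * c) ≡ ∑ f * c
∑-*ʳ c f = trans (∑-cong (λ i → *-comm (f i) c)) (trans (∑-*ˡ c f) (*-comm c (∑ f)))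

∑-zero : ∀ {n} {f : Fin n → ℕ} → (∀ i → f i ≡ 0) → ∑ f ≡ 0
∑-zero {zero}  h = refl
∑-zero {suc n} h = cong₂ _+_ (h zero) (∑-zero (h ∘ suc))

∑-bound : ∀ {n} {f : Fin n → ℕ} c → (∀ i → f i ≤ c) → ∑ f ≤ n * c
∑-bound {zero}  c h = z≤n
∑-bound {suc n} c h = +-mono-≤ (h zero) (∑-bound c (h ∘ suc))

∑-swap : ∀ {m n} (f : Fin m → Fin n → ℕ) → ∑ (λ i → ∑ (f i)) ≡ ∑ (λ j → ∑ (λ i → f i j))
∑-swap {zero}  {n} f = sym (∑-zero {n} (λ _ → refl))
∑-swap {suc m} f = trans (cong (∑ (f zero) +_) (∑-swap (f ∘ suc))) (sym (∑-+ (f zero) _))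

term≤∑ : ∀ {n} (f : Fin n → ℕ) i → f i ≤ ∑ f
term≤∑ f zero    = m≤m+n _ _
term≤∑ f (suc i) = ≤-trans (term≤∑ (f ∘ suc) i) (m≤n+m _ _)

∑≡0⇒ : ∀ {n} (f : Fin n → ℕ) → ∑ f ≡ 0 → ∀ i → f i ≡ 0
∑≡0⇒ f e i = n≤0⇒n≡0 (≤-trans (term≤∑ f i) (≤-reflexive e))

-- Indicators, counting and Boolean reasoning over finite sets

b2n : Bool → ℕ
b2n b = if b then 1 else 0

b2n≤1 : ∀ b → b2n b ≤ 1
b2n≤1 true  = s≤s z≤n
b2n≤1 false = z≤n

b2n-mono : ∀ {a b} → (a ≡ true → b ≡ true) → b2n a ≤ b2n b
b2n-mono {false} h = z≤n
b2n-mono {true}  h = ≤-reflexive (cong b2n (sym (h refl)))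

count : ∀ {n} → (Fin n → Bool) → ℕ
count p = ∑ (λ i → b2n (p i))

countFin-count : ∀ {n} (p : Fin n → Bool) → countFin p ≡ count p
countFin-count p = sum-map-allFin (λ i → if p i then 1 else 0)

count≤n : ∀ {n} (p : Fin n → Bool) → count p ≤ n
count≤n {n} p = ≤-trans (∑-bound 1 (λ i → b2n≤1 (p i))) (≤-reflexive (*-identityʳ n))

count-mono : ∀ {n} {p q : Fin n → Bool} → (∀ i → p i ≡ true → q i ≡ true) → count p ≤ count q
count-mono h = ∑-mono (λ i → b2n-mono (h i))

eqᵇ-refl : ∀ {n} (a : Fin n) → eqᵇ a a ≡ true
eqᵇ-refl a = dec-true (a ≟ a) refl

eqᵇ-≢ : ∀ {n} {a b : Fin n} → a ≢ b → eqᵇ a b ≡ false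
eqᵇ-≢ {a = a} {b} h = dec-false (a ≟ b) h

eqᵇ⇒≡ : ∀ {n} {a b : Fin n} → eqᵇ a b ≡ true → a ≡ b
eqᵇ⇒≡ {a = a} {b} h with a ≟ b
... | yes p = p
... | no _  = case h of λ ()

eqᵇ-false : ∀ {n} {a b : Fin n} → eqᵇ a b ≡ false → a ≢ b
eqᵇ-false {a = a} h refl = case trans (sym h) (eqᵇ-refl a) of λ ()

eqᵇ-suc : ∀ {n} (a b : Fin n) → eqᵇ (Fin.suc a) (suc b) ≡ eqᵇ a b
eqᵇ-suc a b with a ≟ b
... | yes p = refl
... | no p  = refl

count-eq≤1 : ∀ {n} (a : Fin n) → count (λ i → eqᵇ i a) ≤ 1
count-eq≤1 {suc n} zero = ≤-reflexive (cong suc (∑-zero {n} {λ i → b2n (eqᵇ (Fin.suc i) zero)}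
  (λ i → cong b2n (eqᵇ-≢ {a = Fin.suc i} {zero} (λ ())))))
count-eq≤1 (suc a) = ≤-trans (≤-reflexive (∑-cong (λ i → cong b2n (eqᵇ-suc i a)))) (count-eq≤1 a)

∧-trueˡ : ∀ {a b} → a ∧ b ≡ true → a ≡ true
∧-trueˡ {true} h = refl

∧-trueʳ : ∀ {a b} → a ∧ b ≡ true → b ≡ true
∧-trueʳ {true} h = h

∧-intro : ∀ {a b} → a ≡ true → b ≡ true → a ∧ b ≡ true
∧-intro refl refl = refl

∨-introˡ : ∀ {a b} → a ≡ true → a ∨ b ≡ true
∨-introˡ refl = refl

∨-introʳ : ∀ {a b} → b ≡ true → a ∨ b ≡ true
∨-introʳ {true}  h = refl
∨-introʳ {false} h = h

∨-elim : ∀ {a b} {ℓ} {P : Set ℓ} → a ∨ b ≡ true → (a ≡ true → P) → (b ≡ true → P) → P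
∨-elim {true}  h f g = f refl
∨-elim {false} h f g = g h

∨-falseˡ : ∀ {a b} → a ∨ b ≡ false → a ≡ false
∨-falseˡ {false} h = refl

∨-falseʳ : ∀ {a b} → a ∨ b ≡ false → b ≡ false
∨-falseʳ {false} h = h

¬true⇒false : ∀ {b} → (b ≡ true → ⊥) → b ≡ false
¬true⇒false {false} h = refl
¬true⇒false {true}  h = ⊥-elim (h refl)

¬false⇒true : ∀ {b} → (b ≡ false → ⊥) → b ≡ true
¬false⇒true {true}  h = refl
¬false⇒true {false} h = ⊥-elim (h refl)

true≢false : ∀ {b} {ℓ} {P : Set ℓ} → b ≡ true → b ≡ false → P
true≢false refl ()

bool-ext : ∀ {a b} → (a ≡ true → b ≡ true) → (b ≡ true → a ≡ true) → a ≡ b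
bool-ext {true}          f g = sym (f refl)
bool-ext {false} {true}  f g = g refl
bool-ext {false} {false} f g = refl

not-true : ∀ {b} → not b ≡ true → b ≡ false
not-true {false} h = refl

not-false : ∀ {b} → b ≡ false → not b ≡ true
not-false refl = refl

boolCase : ∀ {ℓ} {P : Set ℓ} (b : Bool) → (b ≡ true → P) → (b ≡ false → P) → P
boolCase true  f g = f refl
boolCase false f g = g refl

if-true : ∀ {ℓ} {A : Set ℓ} {b} {x y : A} → b ≡ true → (if b then x else y) ≡ x
if-true refl = refl

if-false : ∀ {ℓ} {A : Set ℓ} {b} {x y : A} → b ≡ false → (if b then x else y) ≡ y
if-false refl = refl

anyF : ∀ {n} → (Fin n → Bool) → Bool
anyF {zero}  p = false
anyF {suc n} p = p zero ∨ anyF (p ∘ suc)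

anyF-intro : ∀ {n} (p : Fin n → Bool) i → p i ≡ true → anyF p ≡ true
anyF-intro p zero    h = ∨-introˡ h
anyF-intro p (suc i) h = ∨-introʳ {p zero} (anyF-intro (p ∘ suc) i h)

anyF-elim : ∀ {n} (p : Fin n → Bool) → anyF p ≡ true → ∃ λ i → p i ≡ true
anyF-elim {suc n} p h = ∨-elim {p zero} h (λ e → zero , e)
  (λ e → let (i , f) = anyF-elim (p ∘ suc) e in suc i , f)

anyF-false : ∀ {n} (p : Fin n → Bool) → anyF p ≡ false → ∀ i → p i ≡ false
anyF-false p h i = ¬true⇒false (λ e → true≢false (anyF-intro p i e) h)

anyF-none : ∀ {n} (p : Fin n → Bool) → (∀ i → p i ≡ false) → anyF p ≡ false
anyF-none p h = ¬true⇒false (λ e → let (i , f) = anyF-elim p e in true≢false f (h i))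

anyF-cong : ∀ {n} {p q : Fin n → Bool} → (∀ i → p i ≡ q i) → anyF p ≡ anyF q
anyF-cong {zero}  h = refl
anyF-cong {suc n} h = cong₂ _∨_ (h zero) (anyF-cong (h ∘ suc))

any-allFin : ∀ {n} (p : Fin n → Bool) i → p i ≡ true → any p (allFin n) ≡ true
any-allFin p i h = trans (cong (foldr _∨_ false) (map-tabulate id p)) (go p i h)
  where
  go : ∀ {m} (q : Fin m → Bool) i → q i ≡ true → foldr _∨_ false (Data.List.tabulate q) ≡ true
  go q zero    h = ∨-introˡ h
  go q (suc i) h = ∨-introʳ {q zero} (go (q ∘ suc) i h)

any-allFin-false : ∀ {n} (p : Fin n → Bool) → any p (allFin n) ≡ false → ∀ i → p i ≡ false
any-allFin-false p h i = ¬true⇒false (λ e → true≢false (any-allFin p i e) h)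

all-allFin : ∀ {n} (p : Fin n → Bool) → (∀ i → p i ≡ true) → all p (allFin n) ≡ true
all-allFin p h = trans (cong (foldr _∧_ true) (map-tabulate id p)) (go p h)
  where
  go : ∀ {m} (q : Fin m → Bool) → (∀ i → q i ≡ true) → foldr _∧_ true (Data.List.tabulate q) ≡ true
  go {zero}  q h = refl
  go {suc m} q h = ∧-intro (h zero) (go (q ∘ suc) (h ∘ suc))

all-allFin-false : ∀ {n} (p : Fin n → Bool) i → p i ≡ false → all p (allFin n) ≡ false
all-allFin-false p i h = trans (cong (foldr _∧_ true) (map-tabulate id p)) (go p i h)
  where
  go : ∀ {m} (q : Fin m → Bool) i → q i ≡ false → foldr _∧_ true (Data.List.tabulate q) ≡ false
  go q zero    h = cong (_∧ foldr _∧_ true (Data.List.tabulate (q ∘ suc))) h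
  go q (suc i) h = trans (cong (q zero ∧_) (go (q ∘ suc) i h)) (∧-zeroʳ (q zero))

-- Sums over initial segments of ℕ and over bit vectors

sumTo : ℕ → (ℕ → ℕ) → ℕ
sumTo zero    f = 0
sumTo (suc m) f = f 0 + sumTo m (f ∘ suc)

sumTo-cong : ∀ m {f g : ℕ → ℕ} → (∀ i → i < m → f i ≡ g i) → sumTo m f ≡ sumTo m g
sumTo-cong zero    h = refl
sumTo-cong (suc m) h = cong₂ _+_ (h 0 (s≤s z≤n)) (sumTo-cong m (λ i i<m → h (suc i) (s≤s i<m)))

sumTo-split : ∀ m k f → sumTo (m + k) f ≡ sumTo m f + sumTo k (λ i → f (m + i))
sumTo-split zero    k f = refl
sumTo-split (suc m) k f = trans (cong (f 0 +_) (sumTo-split m k (f ∘ suc))) (sym (+-assoc (f 0) _ _))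

sumTo-bound : ∀ m {f : ℕ → ℕ} c → (∀ i → f i ≤ c) → sumTo m f ≤ m * c
sumTo-bound zero    c h = z≤n
sumTo-bound (suc m) c h = +-mono-≤ (h 0) (sumTo-bound m c (h ∘ suc))

sumTo-∑ : ∀ m {n} (f : Fin n → ℕ → ℕ) → sumTo m (λ t → ∑ (λ i → f i t)) ≡ ∑ (λ i → sumTo m (f i))
sumTo-∑ zero    {n} f = sym (∑-zero {n} (λ _ → refl))
sumTo-∑ (suc m) f = trans (cong (∑ (λ i → f i 0) +_) (sumTo-∑ m (λ i → f i ∘ suc)))
  (sym (∑-+ (λ i → f i 0) (λ i → sumTo m (f i ∘ suc))))

sumTo-< : ∀ m t → t ≤ m → sumTo m (λ i → b2n (i <ᵇ t)) ≡ t
sumTo-< zero    zero    _       = refl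
sumTo-< (suc m) zero    _       = trans (sumTo-cong m {g = λ _ → 0} (λ _ _ → refl)) (zeros m)
  where
  zeros : ∀ m → sumTo m (λ _ → 0) ≡ 0
  zeros zero    = refl
  zeros (suc m) = zeros m
sumTo-< (suc m) (suc t) (s≤s h) = cong suc (sumTo-< m t h)

sumB : ∀ k → (Vec Bool k → ℕ) → ℕ
sumB zero    f = f []
sumB (suc k) f = sumB k (λ v → f (false ∷ v)) + sumB k (λ v → f (true ∷ v))

sumB-cong : ∀ k {f g : Vec Bool k → ℕ} → (∀ v → f v ≡ g v) → sumB k f ≡ sumB k g
sumB-cong zero    h = h []
sumB-cong (suc k) h = cong₂ _+_ (sumB-cong k (λ v → h _)) (sumB-cong k (λ v → h _))

sumB-+ : ∀ k (f g : Vec Bool k → ℕ) → sumB k (λ v → f v + g v) ≡ sumB k f + sumB k g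
sumB-+ zero    f g = refl
sumB-+ (suc k) f g = trans
  (cong₂ _+_ (sumB-+ k (f ∘ (false ∷_)) (g ∘ (false ∷_))) (sumB-+ k (f ∘ (true ∷_)) (g ∘ (true ∷_))))
  (interchange (sumB k (f ∘ (false ∷_))) (sumB k (g ∘ (false ∷_))) (sumB k (f ∘ (true ∷_))) (sumB k (g ∘ (true ∷_))))
  where
  interchange : ∀ a b c d → a + b + (c + d) ≡ a + c + (b + d)
  interchange = solve-∀

sumB-*ˡ : ∀ k c (f : Vec Bool k → ℕ) → sumB k (λ v → c * f v) ≡ c * sumB k f
sumB-*ˡ zero    c f = refl
sumB-*ˡ (suc k) c f = trans (cong₂ _+_ (sumB-*ˡ k c (f ∘ (false ∷_))) (sumB-*ˡ k c (f ∘ (true ∷_))))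
  (sym (*-distribˡ-+ c (sumB k (f ∘ (false ∷_))) (sumB k (f ∘ (true ∷_)))))

sumB-const : ∀ k c → sumB k (λ _ → c) ≡ 2 ^ k * c
sumB-const zero    c = sym (+-identityʳ c)
sumB-const (suc k) c = trans (cong₂ _+_ (sumB-const k c) (sumB-const k c)) (eq (2 ^ k) c)
  where
  eq : ∀ a c → a * c + a * c ≡ 2 * a * c
  eq = solve-∀

sumB-swap : ∀ k l (f : Vec Bool k → Vec Bool l → ℕ) →
  sumB k (λ v → sumB l (f v)) ≡ sumB l (λ w → sumB k (λ v → f v w))
sumB-swap zero    l f = refl
sumB-swap (suc k) l f = trans
  (cong₂ _+_ (sumB-swap k l (f ∘ (false ∷_))) (sumB-swap k l (f ∘ (true ∷_))))
  (sym (sumB-+ l (λ w → sumB k (λ v → f (false ∷ v) w)) (λ w → sumB k (λ v → f (true ∷ v) w))))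

num : ∀ {k} → Vec Bool k → ℕ
num []              = 0
num {suc k} (b ∷ v) = (if b then 2 ^ k else 0) + num v

bits : ∀ k → ℕ → Vec Bool k
bits zero    t = []
bits (suc k) t = if t <ᵇ 2 ^ k then false ∷ bits k t else true ∷ bits k (t ∸ 2 ^ k)

<ᵇ-true : ∀ {m n} → m < n → (m <ᵇ n) ≡ true
<ᵇ-true {m} {n} h = dec-true (m <? n) h

<ᵇ-false : ∀ {m n} → n ≤ m → (m <ᵇ n) ≡ false
<ᵇ-false {m} {n} h = dec-false (m <? n) (≤⇒≯ h)

<ᵇ⇒<′ : ∀ {m n} → (m <ᵇ n) ≡ true → m < n
<ᵇ⇒<′ {m} {n} h = <ᵇ⇒< m n (subst Data.Bool.T (sym h) tt)

<ᵇ-false⇒ : ∀ {m n} → (m <ᵇ n) ≡ false → n ≤ m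
<ᵇ-false⇒ {m} {n} h with m <? n
... | yes p = true≢false (<ᵇ-true p) h
... | no  p = ≮⇒≥ p

double-^ : ∀ k → 2 ^ suc k ≡ 2 ^ k + 2 ^ k
double-^ k = cong (2 ^ k +_) (+-identityʳ _)

bits-low : ∀ k t → t < 2 ^ k → bits (suc k) t ≡ false ∷ bits k t
bits-low k t h = if-true (<ᵇ-true h)

bits-high : ∀ k t → bits (suc k) (2 ^ k + t) ≡ true ∷ bits k t
bits-high k t = trans (if-false (<ᵇ-false (m≤m+n (2 ^ k) t))) (cong (λ z → true ∷ bits k z) (m+n∸m≡n (2 ^ k) t))

num-bits : ∀ k t → t < 2 ^ k → num (bits k t) ≡ t
num-bits zero    zero    h = refl
num-bits zero    (suc t) (s≤s ())
num-bits (suc k) t h with t <? 2 ^ k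
... | yes p = trans (cong num (bits-low k t p)) (num-bits k t p)
... | no p  = trans (cong num (trans (cong (bits (suc k)) (sym e)) (bits-high k (t ∸ 2 ^ k))))
                (trans (cong (2 ^ k +_) (num-bits k (t ∸ 2 ^ k) lt)) e)
  where
  e : 2 ^ k + (t ∸ 2 ^ k) ≡ t
  e = m+[n∸m]≡n (≮⇒≥ p)
  lt : t ∸ 2 ^ k < 2 ^ k
  lt = +-cancelˡ-< (2 ^ k) _ _ (subst (_< 2 ^ k + 2 ^ k) (sym e) (subst (t <_) (double-^ k) h))

sumTo-bits : ∀ k (f : Vec Bool k → ℕ) → sumTo (2 ^ k) (λ t → f (bits k t)) ≡ sumB k f
sumTo-bits zero    f = +-identityʳ _
sumTo-bits (suc k) f = trans (cong (λ m → sumTo m (λ t → f (bits (suc k) t))) (double-^ k))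
  (trans (sumTo-split (2 ^ k) (2 ^ k) _)
    (cong₂ _+_
      (trans (sumTo-cong (2 ^ k) (λ t h → cong f (bits-low k t h))) (sumTo-bits k (λ v → f (false ∷ v))))
      (trans (sumTo-cong (2 ^ k) (λ t h → cong f (bits-high k t))) (sumTo-bits k (λ v → f (true ∷ v))))))

num<2^ : ∀ {k} (v : Vec Bool k) → num v < 2 ^ k
num<2^ [] = s≤s z≤n
num<2^ {suc k} (false ∷ v) = <-≤-trans (num<2^ v) (m≤m+n (2 ^ k) _)
num<2^ {suc k} (true ∷ v)  = subst (2 ^ k + num v <_) (sym (double-^ k)) (+-monoʳ-< (2 ^ k) (num<2^ v))

sumB-num : ∀ k (f : ℕ → ℕ) → sumB k (λ v → f (num v)) ≡ sumTo (2 ^ k) f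
sumB-num zero    f = sym (+-identityʳ _)
sumB-num (suc k) f = trans (cong₂ _+_ (sumB-num k f) (sumB-num k (λ t → f (2 ^ k + t))))
  (trans (sym (sumTo-split (2 ^ k) (2 ^ k) f)) (cong (λ m → sumTo m f) (sym (double-^ k))))

-- Pairwise independent hashing with Toeplitz matrices

-- The shorter vector is padded with zeros.
dot : ∀ {k l} → Vec Bool k → Vec Bool l → Bool
dot []      y       = false
dot (a ∷ x) []      = false
dot (a ∷ x) (b ∷ y) = (a ∧ b) xor dot x y

-- The product of x with the b-row Toeplitz matrix whose rows are the suffixes of a.
conv : ∀ {k l} b → Vec Bool k → Vec Bool l → Vec Bool b
conv zero    a       x = []
conv (suc b) []      x = false ∷ conv b [] x
conv (suc b) (a ∷ v) x = dot (a ∷ v) x ∷ conv b v x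

infixl 6 _⊕_
_⊕_ : ∀ {k} → Vec Bool k → Vec Bool k → Vec Bool k
[]      ⊕ []      = []
(a ∷ x) ⊕ (b ∷ y) = (a xor b) ∷ (x ⊕ y)

zeros : ∀ k → Vec Bool k
zeros zero    = []
zeros (suc k) = false ∷ zeros k

xor-cancel : ∀ a b c → (b xor a) xor (a xor c) ≡ b xor c
xor-cancel false false c     = refl
xor-cancel false true  c     = refl
xor-cancel true  false false = refl
xor-cancel true  false true  = refl
xor-cancel true  true  false = refl
xor-cancel true  true  true  = refl

xor-dist : ∀ a x y d e → ((a ∧ x) xor d) xor ((a ∧ y) xor e) ≡ (a ∧ (x xor y)) xor (d xor e)
xor-dist false x     y     d     e     = refl
xor-dist true  false false false false = refl
xor-dist true  false false false true  = refl
xor-dist true  false false true  false = refl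
xor-dist true  false false true  true  = refl
xor-dist true  false true  false false = refl
xor-dist true  false true  false true  = refl
xor-dist true  false true  true  false = refl
xor-dist true  false true  true  true  = refl
xor-dist true  true  false false false = refl
xor-dist true  true  false false true  = refl
xor-dist true  true  false true  false = refl
xor-dist true  true  false true  true  = refl
xor-dist true  true  true  false false = refl
xor-dist true  true  true  false true  = refl
xor-dist true  true  true  true  false = refl
xor-dist true  true  true  true  true  = refl

⊕-cancel : ∀ {k} (a b c : Vec Bool k) → (b ⊕ a) ⊕ (a ⊕ c) ≡ b ⊕ c
⊕-cancel []      []      []      = refl
⊕-cancel (a ∷ x) (b ∷ y) (c ∷ z) = cong₂ _∷_ (xor-cancel a b c) (⊕-cancel x y z)

dot-⊕ : ∀ {k l} (a : Vec Bool k) (x y : Vec Bool l) → dot a x xor dot a y ≡ dot a (x ⊕ y)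
dot-⊕ []      x       y       = refl
dot-⊕ (a ∷ v) []      []      = refl
dot-⊕ (a ∷ v) (b ∷ x) (c ∷ y) =
  trans (xor-dist a b c (dot v x) (dot v y)) (cong ((a ∧ (b xor c)) xor_) (dot-⊕ v x y))

conv-⊕ : ∀ {k l} b (a : Vec Bool k) (x y : Vec Bool l) → conv b a x ⊕ conv b a y ≡ conv b a (x ⊕ y)
conv-⊕ zero    a       x y = refl
conv-⊕ (suc b) []      x y = cong (false ∷_) (conv-⊕ b [] x y)
conv-⊕ (suc b) (a ∷ v) x y = cong₂ _∷_ (dot-⊕ (a ∷ v) x y) (conv-⊕ b v x y)

conv-[] : ∀ {l m} b (x : Vec Bool l) (y : Vec Bool m) → conv b [] x ≡ conv b [] y
conv-[] zero    x y = refl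
conv-[] (suc b) x y = cong (false ∷_) (conv-[] b x y)

-- A leading zero of the argument blanks out the first column of the matrix. As the rows are
-- suffixes of one vector, deleting that column gives the matrix of the tail.
conv-false : ∀ {k l} b a (v : Vec Bool k) (z : Vec Bool l) → conv b (a ∷ v) (false ∷ z) ≡ conv b v z
conv-false zero    a v        z = refl
conv-false (suc b) a []       z = cong₂ _∷_ (cong (_xor false) (∧-zeroʳ a)) (conv-[] b (false ∷ z) z)
conv-false (suc b) a (a′ ∷ v) z =
  cong₂ _∷_ (cong (_xor dot (a′ ∷ v) z) (∧-zeroʳ a)) (conv-false b a′ v z)

sumB-⊕ : ∀ k d (f : Vec Bool k → ℕ) → sumB k (λ c → f (d ⊕ c)) ≡ sumB k f
sumB-⊕ zero    []          f = refl
sumB-⊕ (suc k) (false ∷ d) f = cong₂ _+_ (sumB-⊕ k d (f ∘ (false ∷_))) (sumB-⊕ k d (f ∘ (true ∷_)))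
sumB-⊕ (suc k) (true ∷ d)  f =
  trans (cong₂ _+_ (sumB-⊕ k d (f ∘ (true ∷_))) (sumB-⊕ k d (f ∘ (false ∷_))))
        (+-comm (sumB k (f ∘ (true ∷_))) _)

⊕-comm : ∀ {k} (a b : Vec Bool k) → a ⊕ b ≡ b ⊕ a
⊕-comm []      []      = refl
⊕-comm (a ∷ x) (b ∷ y) = cong₂ _∷_ (xc a b) (⊕-comm x y)
  where
  xc : ∀ a b → a xor b ≡ b xor a
  xc false false = refl
  xc false true  = refl
  xc true  false = refl
  xc true  true  = refl

-- Each row of the product has a bit of a that no later row uses.
conv-uniform-lead : ∀ {l} b k (z : Vec Bool l) (g : Vec Bool b → ℕ) → b ≤ k →
  2 ^ b * sumB k (λ a → g (conv b a (true ∷ z))) ≡ 2 ^ k * sumB b g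
conv-uniform-lead zero    k       z g h = trans (+-identityʳ _) (sumB-const k (g []))
conv-uniform-lead (suc b) (suc k) z g (s≤s h) = begin
  2 * 2 ^ b * (sumB k (λ as → g (dot (false ∷ as) (true ∷ z) ∷ c as)) + sumB k (λ as → g (dot (true ∷ as) (true ∷ z) ∷ c as)))
    ≡⟨ cong (2 * 2 ^ b *_) (sym (sumB-+ k (λ as → g (dot (false ∷ as) (true ∷ z) ∷ c as)) (λ as → g (dot (true ∷ as) (true ∷ z) ∷ c as)))) ⟩
  2 * 2 ^ b * sumB k (λ as → g (dot as z ∷ c as) + g (not (dot as z) ∷ c as))
    ≡⟨ cong (2 * 2 ^ b *_) (sumB-cong k (λ as → flip-bit (dot as z) (λ b → g (b ∷ c as)))) ⟩
  2 * 2 ^ b * sumB k (λ as → g′ (c as))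
    ≡⟨ *-assoc 2 (2 ^ b) _ ⟩
  2 * (2 ^ b * sumB k (λ as → g′ (c as)))
    ≡⟨ cong (2 *_) (conv-uniform-lead b k z g′ h) ⟩
  2 * (2 ^ k * sumB b g′)
    ≡⟨ sym (*-assoc 2 (2 ^ k) _) ⟩
  2 * 2 ^ k * sumB b g′
    ≡⟨ cong (2 * 2 ^ k *_) (sumB-+ b (g ∘ (false ∷_)) (g ∘ (true ∷_))) ⟩
  2 * 2 ^ k * (sumB b (g ∘ (false ∷_)) + sumB b (g ∘ (true ∷_))) ∎
  where
  open ≡-Reasoning
  c : Vec Bool k → Vec Bool b
  c as = conv b as (true ∷ z)
  g′ : Vec Bool b → ℕ
  g′ v = g (false ∷ v) + g (true ∷ v)
  flip-bit : ∀ d (f : Bool → ℕ) → f d + f (not d) ≡ f false + f true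
  flip-bit false f = refl
  flip-bit true  f = +-comm (f true) (f false)

-- Induction on the position of the leading one. Each zero before it consumes one entry of `a`,
-- whose two values contribute equally; `l + b ≤ k` ensures that enough entries are left at the
-- leading one.
conv-uniform : ∀ {l} b k (z : Vec Bool l) (g : Vec Bool b → ℕ) → z ≢ zeros l → l + b ≤ k →
  2 ^ b * sumB k (λ a → g (conv b a z)) ≡ 2 ^ k * sumB b g
conv-uniform b k       []          g nz h = ⊥-elim (nz refl)
conv-uniform b k       (true ∷ z)  g nz h = conv-uniform-lead b k z g (m+n≤o⇒n≤o _ h)
conv-uniform b (suc k) (false ∷ z) g nz (s≤s h) = begin
  2 ^ b * (sumB k (λ a → g (conv b (false ∷ a) (false ∷ z))) + sumB k (λ a → g (conv b (true ∷ a) (false ∷ z))))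
    ≡⟨ cong (2 ^ b *_) (cong₂ _+_ (sumB-cong k (λ a → cong g (conv-false b false a z))) (sumB-cong k (λ a → cong g (conv-false b true a z)))) ⟩
  2 ^ b * (s + s) ≡⟨ *-distribˡ-+ (2 ^ b) s s ⟩
  2 ^ b * s + 2 ^ b * s ≡⟨ cong₂ _+_ ih ih ⟩
  2 ^ k * sumB b g + 2 ^ k * sumB b g ≡⟨ sym (*-distribʳ-+ (sumB b g) (2 ^ k) (2 ^ k)) ⟩
  (2 ^ k + 2 ^ k) * sumB b g ≡⟨ cong (_* sumB b g) (sym (double-^ k)) ⟩
  2 ^ suc k * sumB b g ∎
  where
  open ≡-Reasoning
  s : ℕ
  s = sumB k (λ a → g (conv b a z))
  ih : 2 ^ b * s ≡ 2 ^ k * sumB b g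
  ih = conv-uniform b k z g (λ e → nz (cong (false ∷_) e)) h

⊕-zeros : ∀ {k} (x y : Vec Bool k) → x ⊕ y ≡ zeros k → x ≡ y
⊕-zeros []          []          e = refl
⊕-zeros (false ∷ x) (false ∷ y) e = cong (false ∷_) (⊕-zeros x y (cong Data.Vec.tail e))
⊕-zeros (true ∷ x)  (true ∷ y)  e = cong (true ∷_) (⊕-zeros x y (cong Data.Vec.tail e))
⊕-zeros (false ∷ x) (true ∷ y)  ()
⊕-zeros (true ∷ x)  (false ∷ y) ()

splitV : ∀ k {l} → Vec Bool (k + l) → Vec Bool k × Vec Bool l
splitV zero    v       = [] , v
splitV (suc k) (b ∷ v) = (b ∷ proj₁ (splitV k v)) , proj₂ (splitV k v)

sumB-splitV : ∀ k l (f : Vec Bool k → Vec Bool l → ℕ) →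
  sumB (k + l) (λ s → f (proj₁ (splitV k s)) (proj₂ (splitV k s))) ≡ sumB k (λ v → sumB l (f v))
sumB-splitV zero    l f = refl
sumB-splitV (suc k) l f = cong₂ _+_ (sumB-splitV k l (f ∘ (false ∷_))) (sumB-splitV k l (f ∘ (true ∷_)))

-- Seeds are numbers below 2 ^ seedLen b, keys and hash values are numbers below 2 ^ b.
seedLen : ℕ → ℕ
seedLen b = (b + b) + b

-- An affine map: the first `b + b` seed bits are the Toeplitz entries, the last `b` bits a shift.
-- The shift makes single values uniform, the matrix makes differences uniform.
hashV : ∀ b → Vec Bool (seedLen b) → Vec Bool b → Vec Bool b
hashV b s x = conv b (proj₁ (splitV (b + b) s)) x ⊕ proj₂ (splitV (b + b) s)

hash : ℕ → ℕ → ℕ → ℕ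
hash b s x = num (hashV b (bits (seedLen b) s) (bits b x))

-- For each choice of the Toeplitz part, the shift alone runs through all translates.
hash-single : ∀ b x (f : ℕ → ℕ) →
  sumTo (2 ^ seedLen b) (λ s → f (hash b s x)) ≡ 2 ^ (b + b) * sumTo (2 ^ b) f
hash-single b x f = begin
  sumTo (2 ^ seedLen b) (λ s → f (hash b s x))
    ≡⟨ sumTo-bits (seedLen b) (λ s → f (num (hashV b s (bits b x)))) ⟩
  sumB (seedLen b) (λ s → f (num (hashV b s (bits b x))))
    ≡⟨ sumB-splitV (b + b) b (λ a c → f (num (conv b a (bits b x) ⊕ c))) ⟩
  sumB (b + b) (λ a → sumB b (λ c → f (num (conv b a (bits b x) ⊕ c))))
    ≡⟨ sumB-cong (b + b) (λ a → trans (sumB-⊕ b (conv b a (bits b x)) (f ∘ num)) (sumB-num b f)) ⟩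
  sumB (b + b) (λ a → sumTo (2 ^ b) f)
    ≡⟨ sumB-const (b + b) _ ⟩
  2 ^ (b + b) * sumTo (2 ^ b) f ∎
  where open ≡-Reasoning

-- Translating the shift by the image of `X` turns the first hash value into the shift itself and
-- the second into the image of `Y ⊕ X` plus the shift. As `Y ⊕ X` is nonzero, its image is uniform
-- for every fixed shift.
hash-pair : ∀ b x y → x < 2 ^ b → y < 2 ^ b → x ≢ y → (F : ℕ → ℕ → ℕ) →
  2 ^ b * sumTo (2 ^ seedLen b) (λ s → F (hash b s x) (hash b s y))
    ≡ 2 ^ (b + b) * sumTo (2 ^ b) (λ i → sumTo (2 ^ b) (F i))
hash-pair b x y x< y< x≢y F = begin
  2 ^ b * sumTo (2 ^ seedLen b) (λ s → F (hash b s x) (hash b s y))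
    ≡⟨ cong (2 ^ b *_) (sumTo-bits (seedLen b) (λ s → F (num (hashV b s X)) (num (hashV b s Y)))) ⟩
  2 ^ b * sumB (seedLen b) (λ s → F (num (hashV b s X)) (num (hashV b s Y)))
    ≡⟨ cong (2 ^ b *_) (sumB-splitV (b + b) b (λ a c → F (num (conv b a X ⊕ c)) (num (conv b a Y ⊕ c)))) ⟩
  2 ^ b * sumB (b + b) (λ a → sumB b (λ c → F (num (conv b a X ⊕ c)) (num (conv b a Y ⊕ c))))
    ≡⟨ cong (2 ^ b *_) (sumB-cong (b + b) shift) ⟩
  2 ^ b * sumB (b + b) (λ a → sumB b (λ c → F (num c) (num (conv b a Z ⊕ c))))
    ≡⟨ cong (2 ^ b *_) (sumB-swap (b + b) b (λ a c → F (num c) (num (conv b a Z ⊕ c)))) ⟩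
  2 ^ b * sumB b (λ c → sumB (b + b) (λ a → F (num c) (num (conv b a Z ⊕ c))))
    ≡⟨ sym (sumB-*ˡ b (2 ^ b) _) ⟩
  sumB b (λ c → 2 ^ b * sumB (b + b) (λ a → F (num c) (num (conv b a Z ⊕ c))))
    ≡⟨ sumB-cong b (λ c → conv-uniform b (b + b) Z (λ d → F (num c) (num (d ⊕ c))) Z≢0 ≤-refl) ⟩
  sumB b (λ c → 2 ^ (b + b) * sumB b (λ d → F (num c) (num (d ⊕ c))))
    ≡⟨ sumB-cong b (λ c → cong (2 ^ (b + b) *_) (inner c)) ⟩
  sumB b (λ c → 2 ^ (b + b) * sumTo (2 ^ b) (F (num c)))
    ≡⟨ sumB-*ˡ b (2 ^ (b + b)) _ ⟩
  2 ^ (b + b) * sumB b (λ c → sumTo (2 ^ b) (F (num c)))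
    ≡⟨ cong (2 ^ (b + b) *_) (sumB-num b (λ i → sumTo (2 ^ b) (F i))) ⟩
  2 ^ (b + b) * sumTo (2 ^ b) (λ i → sumTo (2 ^ b) (F i)) ∎
  where
  open ≡-Reasoning
  X Y Z : Vec Bool b
  X = bits b x
  Y = bits b y
  Z = Y ⊕ X
  Z≢0 : Z ≢ zeros b
  Z≢0 e = x≢y (trans (sym (num-bits b x x<)) (trans (cong num (sym (⊕-zeros Y X e))) (num-bits b y y<)))
  inner : ∀ c → sumB b (λ d → F (num c) (num (d ⊕ c))) ≡ sumTo (2 ^ b) (F (num c))
  inner c = trans (sumB-cong b (λ d → cong (F (num c) ∘ num) (⊕-comm d c)))
    (trans (sumB-⊕ b c (λ d → F (num c) (num d))) (sumB-num b (F (num c))))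
  shift : ∀ a → sumB b (λ c → F (num (conv b a X ⊕ c)) (num (conv b a Y ⊕ c)))
              ≡ sumB b (λ c → F (num c) (num (conv b a Z ⊕ c)))
  shift a = trans
    (sumB-cong b (λ c → cong (F (num (conv b a X ⊕ c)) ∘ num)
      (trans (sym (⊕-cancel (conv b a X) (conv b a Y) c)) (cong (_⊕ (conv b a X ⊕ c)) (conv-⊕ b a Y X)))))
    (sumB-⊕ b (conv b a X) (λ c → F (num c) (num (conv b a Z ⊕ c))))

sumTo-*ˡ : ∀ m c f → sumTo m (λ i → c * f i) ≡ c * sumTo m f
sumTo-*ˡ zero    c f = sym (*-zeroʳ c)
sumTo-*ˡ (suc m) c f = trans (cong (c * f 0 +_) (sumTo-*ˡ m c (f ∘ suc))) (sym (*-distribˡ-+ c (f 0) _))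

hash-below : ∀ b x t → t ≤ 2 ^ b →
  sumTo (2 ^ seedLen b) (λ s → b2n (hash b s x <ᵇ t)) ≡ 2 ^ (b + b) * t
hash-below b x t h = trans (hash-single b x (λ i → b2n (i <ᵇ t))) (cong (2 ^ (b + b) *_) (sumTo-< (2 ^ b) t h))

hash-below² : ∀ b x y → x < 2 ^ b → y < 2 ^ b → x ≢ y → ∀ t → t ≤ 2 ^ b →
  2 ^ b * sumTo (2 ^ seedLen b) (λ s → b2n (hash b s x <ᵇ t) * b2n (hash b s y <ᵇ t)) ≡ 2 ^ (b + b) * (t * t)
hash-below² b x y x< y< x≢y t h =
  trans (hash-pair b x y x< y< x≢y (λ i j → b2n (i <ᵇ t) * b2n (j <ᵇ t)))
    (cong (2 ^ (b + b) *_)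
      (trans (sumTo-cong (2 ^ b) (λ i _ → trans (sumTo-*ˡ (2 ^ b) (b2n (i <ᵇ t)) (λ j → b2n (j <ᵇ t)))
                                            (trans (cong (b2n (i <ᵇ t) *_) (sumTo-< (2 ^ b) t h)) (*-comm _ t))))
        (trans (sumTo-*ˡ (2 ^ b) t (λ i → b2n (i <ᵇ t))) (cong (t *_) (sumTo-< (2 ^ b) t h)))))

-- Derandomised Luby phases

infixr 6.5 _·_
_·_ : Bool → ℕ → ℕ
b · m = if b then m else 0

·-cong : ∀ {a b x y} → a ≡ b → (a ≡ true → x ≡ y) → a · x ≡ b · y
·-cong {true}  refl h = h refl
·-cong {false} refl h = refl

·-mono : ∀ {a x y} → (a ≡ true → x ≤ y) → a · x ≤ a · y
·-mono {true}  h = h refl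
·-mono {false} h = z≤n

·≤ : ∀ a {x} → a · x ≤ x
·≤ true  = ≤-refl
·≤ false = z≤n

·-*ˡ : ∀ a c x → c * (a · x) ≡ a · (c * x)
·-*ˡ true  c x = refl
·-*ˡ false c x = *-zeroʳ c

·-+ : ∀ a x y → a · (x + y) ≡ a · x + a · y
·-+ true  x y = refl
·-+ false x y = refl

·-b2n : ∀ a x → a · x ≡ x * b2n a
·-b2n true  x = sym (*-identityʳ x)
·-b2n false x = sym (*-zeroʳ x)

sumTo-· : ∀ m a f → sumTo m (λ t → a · f t) ≡ a · sumTo m f
sumTo-· m true  f = refl
sumTo-· m false f = zs m
  where
  zs : ∀ m → sumTo m (λ _ → 0) ≡ 0
  zs zero    = refl
  zs (suc m) = zs m

sumTo-+ : ∀ m f g → sumTo m (λ t → f t + g t) ≡ sumTo m f + sumTo m g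
sumTo-+ zero    f g = refl
sumTo-+ (suc m) f g = trans (cong (f 0 + g 0 +_) (sumTo-+ m (f ∘ suc) (g ∘ suc))) (ic (f 0) (g 0) _ _)
  where
  ic : ∀ a b c d → a + b + (c + d) ≡ a + c + (b + d)
  ic = solve-∀

-- For a pair of adjacent vertices of total degree D, one of them is likely to have the only
-- hash value below θ b D in both neighbourhoods.
θ : ℕ → ℕ → ℕ
θ b D = 2 ^ b / suc (D + D)

below : ∀ {n} → ℕ → ℕ → ℕ → Fin n → Bool
below b t s v = hash b s (toℕ v) <ᵇ t

-- What a vertex of degree d with neighbours N of degrees dn contributes to the estimator of
-- the number of edges removed by seed s (expected gain minus pairwise collisions).
gain : ∀ {n} → ℕ → (Fin n → Bool) → (Fin n → ℕ) → ℕ → Fin n → ℕ → ℕ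
gain b N dn d v s = ∑ (λ u → N u · dn u * b2n (below b (θ b (d + dn u)) s v))

both : ∀ {n} → ℕ → ℕ → ℕ → Fin n → Fin n → ℕ
both b t s v w = b2n (below b t s v) * b2n (below b t s w)

-- Collisions are split so that each vertex can evaluate its share from the degrees of its own
-- neighbours: `loss₁` charges a candidate that collides with one of its neighbours, `loss₂` charges
-- the vertex to be removed for collisions between two of its neighbours.
loss₁ : ∀ {n} → ℕ → (Fin n → Bool) → (Fin n → ℕ) → ℕ → Fin n → ℕ → ℕ
loss₁ b N dn d v s = ∑ (λ u → N u · dn u * ∑ (λ w → N w · both b (θ b (d + dn u)) s v w))

loss₂ : ∀ {n} → ℕ → (Fin n → Bool) → (Fin n → ℕ) → ℕ → ℕ → ℕ
loss₂ b N dn d s = ∑ (λ v → N v · d * ∑ (λ w → (N w ∧ not (eqᵇ w v)) · both b (θ b (d + dn v)) s v w))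

loss : ∀ {n} → ℕ → (Fin n → Bool) → (Fin n → ℕ) → ℕ → Fin n → ℕ → ℕ
loss b N dn d v s = loss₁ b N dn d v s + loss₂ b N dn d s

module _ {n} (b : ℕ) {N N′ : Fin n → Bool} {dn dn′ : Fin n → ℕ} {d d′ : ℕ}
  (hN : ∀ u → N u ≡ N′ u) (hdn : ∀ u → N u ≡ true → dn u ≡ dn′ u) (hd : d ≡ d′) where

  gain-cong : ∀ v s → gain b N dn d v s ≡ gain b N′ dn′ d′ v s
  gain-cong v s = ∑-cong (λ u → ·-cong (hN u)
    (λ e → cong₂ (λ x y → y * b2n (below b (θ b (x + y)) s v)) hd (hdn u e)))

  loss-cong : ∀ v s → loss b N dn d v s ≡ loss b N′ dn′ d′ v s
  loss-cong v s = cong₂ _+_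
    (∑-cong (λ u → ·-cong (hN u) (λ e → cong₂ _*_ (hdn u e)
      (∑-cong (λ w → ·-cong (hN w) (λ _ → cong₂ (λ x y → both b (θ b (x + y)) s v w) hd (hdn u e)))))))
    (∑-cong (λ u → ·-cong (hN u) (λ e → cong₂ _*_ hd
      (∑-cong (λ w → ·-cong (cong (_∧ not (eqᵇ w u)) (hN w)) (λ _ → cong₂ (λ x y → both b (θ b (x + y)) s u w) hd (hdn u e)))))))

both≤1 : ∀ {n} b t s (v w : Fin n) → both b t s v w ≤ 1
both≤1 b t s v w = *-mono-≤ (b2n≤1 (below b t s v)) (b2n≤1 (below b t s w))

module _ {n} (b : ℕ) (N : Fin n → Bool) (dn : Fin n → ℕ) (d : ℕ) (hdn : ∀ u → N u ≡ true → dn u ≤ n) (hd : d ≤ n) where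

  gain-bound : ∀ v s → gain b N dn d v s ≤ n * (n * 1)
  gain-bound v s = ∑-bound (n * 1) λ u → bnd u (N u) refl
    where
    bnd : ∀ u a → N u ≡ a → a · dn u * b2n (below b (θ b (d + dn u)) s v) ≤ n * 1
    bnd u true  e = *-mono-≤ (hdn u e) (b2n≤1 (below b (θ b (d + dn u)) s v))
    bnd u false e = z≤n

  loss-bound : ∀ v s → loss b N dn d v s ≤ n * (n * (n * 1)) + n * (n * (n * 1))
  loss-bound v s = +-mono-≤
    (∑-bound (n * (n * 1)) λ u → bnd u (N u) refl)
    (∑-bound (n * (n * 1)) λ u → ≤-trans (·≤ (N u)) (*-mono-≤ hd (∑-bound 1 λ w → ≤-trans (·≤ (N w ∧ not (eqᵇ w u))) (both≤1 b (θ b (d + dn u)) s u w))))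
    where
    bnd : ∀ u a → N u ≡ a → a · dn u * ∑ (λ w → N w · both b (θ b (d + dn u)) s v w) ≤ n * (n * 1)
    bnd u true  e = *-mono-≤ (hdn u e) (∑-bound 1 λ w → ≤-trans (·≤ (N w)) (both≤1 b (θ b (d + dn u)) s v w))
    bnd u false e = z≤n

-- Among `D` vertices, at most half a hash value is expected below the threshold. This makes
-- collisions cost at most half of the gain.
θ-upper : ∀ b D → 2 * (D * θ b D) ≤ 2 ^ b
θ-upper b D = ≤-trans (≤-trans (≤-reflexive (eq D (θ b D))) (*-monoʳ-≤ (θ b D) (n≤1+n (D + D)))) (m/n*n≤m (2 ^ b) (suc (D + D)))
  where
  eq : ∀ D t → 2 * (D * t) ≡ t * (D + D)
  eq = solve-∀

θ≤ : ∀ b D → θ b D ≤ 2 ^ b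
θ≤ b D = ≤-trans (m≤m*n (θ b D) (suc (D + D))) (m/n*n≤m (2 ^ b) (suc (D + D)))

-- The quotient is at least 1 by the last hypothesis, so rounding it down loses at most a factor 2;
-- a factor 3 comes from `2D + 1 ≤ 3D`.
θ-lower : ∀ b D → 1 ≤ D → suc (D + D) ≤ 2 ^ b → 2 ^ b ≤ 6 * (D * θ b D)
θ-lower b D 1≤D h = begin
  2 ^ b                         ≡⟨ m≡m%n+[m/n]*n (2 ^ b) k ⟩
  2 ^ b % k + θ b D * k         ≤⟨ +-monoˡ-≤ _ (<⇒≤ (m%n<n (2 ^ b) k)) ⟩
  k + θ b D * k                 ≤⟨ +-monoˡ-≤ _ k≤ ⟩
  θ b D * k + θ b D * k         ≤⟨ +-mono-≤ (*-monoʳ-≤ (θ b D) k≤3D) (*-monoʳ-≤ (θ b D) k≤3D) ⟩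
  θ b D * (3 * D) + θ b D * (3 * D) ≡⟨ eq D (θ b D) ⟩
  6 * (D * θ b D) ∎
  where
  open ≤-Reasoning
  k : ℕ
  k = suc (D + D)
  eq : ∀ D t → t * (3 * D) + t * (3 * D) ≡ 6 * (D * t)
  eq = solve-∀
  k≤3D : k ≤ 3 * D
  k≤3D = ≤-trans (+-monoˡ-≤ (D + D) 1≤D) (≤-reflexive (cong (λ z → D + (D + z)) (sym (+-identityʳ D))))
  1≤θ : 1 ≤ θ b D
  1≤θ = Data.Nat.DivMod.m≥n⇒m/n>0 h
  k≤ : k ≤ θ b D * k
  k≤ = ≤-trans (≤-reflexive (sym (*-identityˡ k))) (*-monoˡ-≤ k 1≤θ)

count-unique : ∀ {n} (p : Fin n → Bool) → (∀ i j → p i ≡ true → p j ≡ true → i ≡ j) → count p ≤ b2n (anyF p)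
count-unique {zero}  p h = z≤n
count-unique {suc n} p h = go (p zero) refl
  where
  go : ∀ c → p zero ≡ c → b2n c + count (p ∘ suc) ≤ b2n (c ∨ anyF (p ∘ suc))
  go true  e = ≤-reflexive (cong suc (∑-zero {n} {λ i → b2n (p (suc i))} (λ i → cong b2n (¬true⇒false (λ e′ → case h zero (suc i) e e′ of λ ())))))
  go false e = count-unique (p ∘ suc) (λ i j ei ej → case h (suc i) (suc j) ei ej of λ { refl → refl })

-- `E` is the graph on the alive vertices of one phase. The size of `b` makes the keys of the
-- vertices distinct `b`-bit numbers, and makes the threshold of every edge positive, since the
-- total degree of its ends is at most `2n`.
module Phase {n} (b : ℕ) (b-big : suc (4 * n) ≤ 2 ^ b) (E : Fin n → Fin n → Bool)
  (E-sym : ∀ u v → E u v ≡ E v u) (E-irr : ∀ u → E u u ≡ false) where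

  dE : Fin n → ℕ
  dE v = count (E v)

  E2 : ℕ
  E2 = ∑ dE

  t : Fin n → Fin n → ℕ
  t v u = θ b (dE v + dE u)

  t-sym : ∀ v u → t v u ≡ t u v
  t-sym v u = cong (θ b) (+-comm (dE v) (dE u))

  Gain Loss : ℕ → ℕ
  Gain s = ∑ (λ v → gain b (E v) dE (dE v) v s)
  Loss s = ∑ (λ v → loss b (E v) dE (dE v) v s)

  Σs : (ℕ → ℕ) → ℕ
  Σs = sumTo (2 ^ seedLen b)

  Q : ℕ
  Q = 2 ^ (b + b)

  P : ℕ
  P = ∑ (λ u → ∑ (λ v → E u v · dE u * t u v))

  key< : ∀ (v : Fin n) → toℕ v < 2 ^ b
  key< v = <-≤-trans (toℕ<n v) (≤-trans (m≤n*m n 4) (≤-trans (n≤1+n _) b-big))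

  Σ-gain : Σs Gain ≡ Q * P
  Σ-gain = begin
    Σs Gain ≡⟨ sumTo-∑ (2 ^ seedLen b) (λ v s → gain b (E v) dE (dE v) v s) ⟩
    ∑ (λ v → Σs (gain b (E v) dE (dE v) v)) ≡⟨ ∑-cong (λ v → sumTo-∑ (2 ^ seedLen b) (λ u s → E v u · dE u * b2n (below b (t v u) s v))) ⟩
    ∑ (λ v → ∑ (λ u → Σs (λ s → E v u · dE u * b2n (below b (t v u) s v)))) ≡⟨ ∑-cong (λ v → ∑-cong (λ u → one v u)) ⟩
    ∑ (λ v → ∑ (λ u → Q * (E u v · dE u * t u v))) ≡⟨ ∑-swap (λ v u → Q * (E u v · dE u * t u v)) ⟩
    ∑ (λ u → ∑ (λ v → Q * (E u v · dE u * t u v))) ≡⟨ ∑-cong (λ u → ∑-*ˡ Q (λ v → E u v · dE u * t u v)) ⟩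
    ∑ (λ u → Q * ∑ (λ v → E u v · dE u * t u v)) ≡⟨ ∑-*ˡ Q (λ u → ∑ (λ v → E u v · dE u * t u v)) ⟩
    Q * P ∎
    where
    open ≡-Reasoning
    eq : ∀ d Q t → d * (Q * t) ≡ Q * (d * t)
    eq = solve-∀
    one : ∀ v u → Σs (λ s → E v u · dE u * b2n (below b (t v u) s v)) ≡ Q * (E u v · dE u * t u v)
    one v u = begin
      Σs (λ s → E v u · dE u * b2n (below b (t v u) s v)) ≡⟨ sumTo-· (2 ^ seedLen b) (E v u) (λ s → dE u * b2n (below b (t v u) s v)) ⟩
      E v u · Σs (λ s → dE u * b2n (below b (t v u) s v)) ≡⟨ cong (E v u ·_) (sumTo-*ˡ (2 ^ seedLen b) (dE u) (λ s → b2n (below b (t v u) s v))) ⟩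
      E v u · dE u * Σs (λ s → b2n (below b (t v u) s v)) ≡⟨ cong (λ z → E v u · dE u * z) (hash-below b (toℕ v) (t v u) (θ≤ b (dE v + dE u))) ⟩
      E v u · dE u * (Q * t v u) ≡⟨ cong (E v u ·_) (eq (dE u) Q (t v u)) ⟩
      E v u · Q * (dE u * t v u) ≡⟨ cong₂ (λ a z → a · Q * (dE u * z)) (E-sym v u) (t-sym v u) ⟩
      E u v · Q * (dE u * t u v) ≡⟨ sym (·-*ˡ (E u v) Q (dE u * t u v)) ⟩
      Q * (E u v · dE u * t u v) ∎

  -- Every edge occurs in `P` in both directions. The two weights add up to the total degree times
  -- the threshold, at least a sixth of `2 ^ b`; `E2` counts both directions as well, hence 12.
  P-lower : 2 ^ b * E2 ≤ 12 * P
  P-lower = begin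
    2 ^ b * E2 ≡⟨ sym (∑-*ˡ (2 ^ b) dE) ⟩
    ∑ (λ u → 2 ^ b * dE u) ≡⟨ ∑-cong (λ u → sym (∑-*ˡ (2 ^ b) (λ v → b2n (E u v)))) ⟩
    ∑ (λ u → ∑ (λ v → 2 ^ b * b2n (E u v))) ≤⟨ ∑-mono (λ u → ∑-mono (λ v → edge u v (E u v) refl)) ⟩
    ∑ (λ u → ∑ (λ v → 6 * (f u v + f v u))) ≡⟨ ∑-cong (λ u → ∑-*ˡ 6 (λ v → f u v + f v u)) ⟩
    ∑ (λ u → 6 * ∑ (λ v → f u v + f v u)) ≡⟨ ∑-*ˡ 6 (λ u → ∑ (λ v → f u v + f v u)) ⟩
    6 * ∑ (λ u → ∑ (λ v → f u v + f v u)) ≡⟨ cong (6 *_) (∑-cong (λ u → ∑-+ (f u) (λ v → f v u))) ⟩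
    6 * ∑ (λ u → ∑ (f u) + ∑ (λ v → f v u)) ≡⟨ cong (6 *_) (∑-+ (λ u → ∑ (f u)) (λ u → ∑ (λ v → f v u))) ⟩
    6 * (P + ∑ (λ u → ∑ (λ v → f v u))) ≡⟨ cong (λ z → 6 * (P + z)) (sym (∑-swap f)) ⟩
    6 * (P + P) ≡⟨ eq P ⟩
    12 * P ∎
    where
    open ≤-Reasoning
    f : Fin n → Fin n → ℕ
    f u v = E u v · dE u * t u v
    eq : ∀ p → 6 * (p + p) ≡ 12 * p
    eq = solve-∀
    edge : ∀ u v a → E u v ≡ a → 2 ^ b * b2n a ≤ 6 * (f u v + f v u)
    edge u v false e = ≤-trans (≤-reflexive (*-zeroʳ (2 ^ b))) z≤n
    edge u v true  e = begin
      2 ^ b * 1 ≡⟨ *-identityʳ _ ⟩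
      2 ^ b ≤⟨ θ-lower b (dE u + dE v) (≤-trans 1≤ (m≤m+n (dE u) (dE v))) big ⟩
      6 * ((dE u + dE v) * t u v) ≡⟨ cong (6 *_) (*-distribʳ-+ (t u v) (dE u) (dE v)) ⟩
      6 * (dE u * t u v + dE v * t u v) ≡⟨ cong₂ (λ x y → 6 * (x + y))
          (sym (cong (_· dE u * t u v) e)) (sym (trans (cong (_· dE v * t v u) (trans (E-sym v u) e)) (cong (dE v *_) (t-sym v u)))) ⟩
      6 * (f u v + f v u) ∎
      where
      1≤ : 1 ≤ dE u
      1≤ = ≤-trans (≤-reflexive (cong b2n (sym e))) (term≤∑ (λ w → b2n (E u w)) v)
      eq4 : ∀ n → (n + n) + (n + n) ≡ 4 * n
      eq4 = solve-∀
      big : suc ((dE u + dE v) + (dE u + dE v)) ≤ 2 ^ b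
      big = ≤-trans (s≤s (≤-trans (+-mono-≤ D≤ D≤) (≤-reflexive (eq4 n)))) b-big
        where
        D≤ : dE u + dE v ≤ n + n
        D≤ = +-mono-≤ (count≤n (E u)) (count≤n (E v))

  Σ-both : ∀ v w → v ≢ w → ∀ k → k ≤ 2 ^ b → 2 ^ b * Σs (λ s → both b k s v w) ≡ Q * (k * k)
  Σ-both v w v≢w k h = hash-below² b (toℕ v) (toℕ w) (key< v) (key< w) (λ e → v≢w (toℕ-injective e)) k h

  -- By pairwise independence both values of a pair lie below `k` for a fraction `(k / 2^b)²` of the
  -- seeds. Independence needs different keys, so `v` itself must not be in `M`.
  Σ-collisions : ∀ c v k → k ≤ 2 ^ b → (M : Fin n → Bool) → (∀ w → M w ≡ true → v ≢ w) → ∀ m → count M ≤ m →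
    2 ^ b * Σs (λ s → c * ∑ (λ w → M w · both b k s v w)) ≤ Q * (c * m * k * k)
  Σ-collisions c v k h M M≢ m M≤ = begin
    2 ^ b * Σs (λ s → c * ∑ (λ w → M w · both b k s v w)) ≡⟨ cong (2 ^ b *_) (sumTo-*ˡ (2 ^ seedLen b) c (λ s → ∑ (λ w → M w · both b k s v w))) ⟩
    2 ^ b * (c * Σs (λ s → ∑ (λ w → M w · both b k s v w))) ≡⟨ cong (λ z → 2 ^ b * (c * z)) (sumTo-∑ (2 ^ seedLen b) (λ w s → M w · both b k s v w)) ⟩
    2 ^ b * (c * ∑ (λ w → Σs (λ s → M w · both b k s v w))) ≡⟨ cong (λ z → 2 ^ b * (c * z)) (∑-cong (λ w → sumTo-· (2 ^ seedLen b) (M w) (λ s → both b k s v w))) ⟩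
    2 ^ b * (c * ∑ (λ w → M w · Σs (λ s → both b k s v w))) ≡⟨ eq1 (2 ^ b) c _ ⟩
    c * (2 ^ b * ∑ (λ w → M w · Σs (λ s → both b k s v w))) ≡⟨ cong (c *_) (sym (∑-*ˡ (2 ^ b) (λ w → M w · Σs (λ s → both b k s v w)))) ⟩
    c * ∑ (λ w → 2 ^ b * (M w · Σs (λ s → both b k s v w))) ≡⟨ cong (c *_) (∑-cong one) ⟩
    c * ∑ (λ w → (Q * (k * k)) * b2n (M w)) ≡⟨ cong (c *_) (∑-*ˡ (Q * (k * k)) (λ w → b2n (M w))) ⟩
    c * (Q * (k * k) * count M) ≤⟨ *-monoʳ-≤ c (*-monoʳ-≤ (Q * (k * k)) M≤) ⟩
    c * (Q * (k * k) * m) ≡⟨ eq2 c Q k m ⟩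
    Q * (c * m * k * k) ∎
    where
    open ≤-Reasoning
    eq1 : ∀ a c z → a * (c * z) ≡ c * (a * z)
    eq1 = solve-∀
    eq2 : ∀ c Q k m → c * (Q * (k * k) * m) ≡ Q * (c * m * k * k)
    eq2 = solve-∀
    one : ∀ w → 2 ^ b * (M w · Σs (λ s → both b k s v w)) ≡ (Q * (k * k)) * b2n (M w)
    one w = trans (·-*ˡ (M w) (2 ^ b) _) (trans (·-cong {M w} refl (λ e → Σ-both v w (M≢ w e) k h)) (·-b2n (M w) _))

  E-≢ : ∀ u v → E u v ≡ true → u ≢ v
  E-≢ u v e refl = true≢false e (E-irr u)

  R : Fin n → Fin n → ℕ
  R u v = E u v · Q * (dE u * t u v * ((dE u + dE v) * t u v))

  -- The candidate `v` of a pair can collide with its `dE v` neighbours and with the other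
  -- neighbours of `u`, at most `dE u`. The sum of the two degrees is the one in the threshold,
  -- which prepares the use of `θ-upper`.
  Σ-loss : 2 ^ b * Σs Loss ≤ ∑ (λ u → ∑ (λ v → R u v))
  Σ-loss = begin
    2 ^ b * Σs Loss ≡⟨ cong (2 ^ b *_) (trans (sumTo-cong (2 ^ seedLen b) (λ s _ → ∑-+ (λ v → loss₁ b (E v) dE (dE v) v s) (λ v → loss₂ b (E v) dE (dE v) s))) (sumTo-+ (2 ^ seedLen b) L1 L2)) ⟩
    2 ^ b * (Σs L1 + Σs L2) ≡⟨ *-distribˡ-+ (2 ^ b) (Σs L1) (Σs L2) ⟩
    2 ^ b * Σs L1 + 2 ^ b * Σs L2 ≤⟨ +-mono-≤ part₁ part₂ ⟩
    ∑ (λ u → ∑ (R₁ u)) + ∑ (λ u → ∑ (R₂ u)) ≡⟨ sym (∑-+ (λ u → ∑ (R₁ u)) (λ u → ∑ (R₂ u))) ⟩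
    ∑ (λ u → ∑ (R₁ u) + ∑ (R₂ u)) ≡⟨ ∑-cong (λ u → sym (∑-+ (R₁ u) (R₂ u))) ⟩
    ∑ (λ u → ∑ (λ v → R₁ u v + R₂ u v)) ≡⟨ ∑-cong (λ u → ∑-cong (λ v → trans (sym (·-+ (E u v) _ _)) (cong (E u v ·_) (eqR Q (dE u) (dE v) (t u v))))) ⟩
    ∑ (λ u → ∑ (R u)) ∎
    where
    open ≤-Reasoning
    L1 L2 : ℕ → ℕ
    L1 s = ∑ (λ v → loss₁ b (E v) dE (dE v) v s)
    L2 s = ∑ (λ v → loss₂ b (E v) dE (dE v) s)
    R₁ R₂ : Fin n → Fin n → ℕ
    R₁ u v = E u v · Q * (dE u * dE v * t u v * t u v)
    R₂ u v = E u v · Q * (dE u * dE u * t u v * t u v)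
    eqR : ∀ Q a c t → Q * (a * c * t * t) + Q * (a * a * t * t) ≡ Q * (a * t * ((a + c) * t))
    eqR = solve-∀
    push : (f : Fin n → Fin n → ℕ → ℕ) → 2 ^ b * Σs (λ s → ∑ (λ v → ∑ (λ u → f v u s))) ≡ ∑ (λ v → ∑ (λ u → 2 ^ b * Σs (f v u)))
    push f = trans (cong (2 ^ b *_) (trans (sumTo-∑ (2 ^ seedLen b) (λ v s → ∑ (λ u → f v u s))) (∑-cong (λ v → sumTo-∑ (2 ^ seedLen b) (f v)))))
      (trans (sym (∑-*ˡ (2 ^ b) (λ v → ∑ (λ u → Σs (f v u))))) (∑-cong (λ v → sym (∑-*ˡ (2 ^ b) (λ u → Σs (f v u))))))
    guard : ∀ a (f : ℕ → ℕ) r → (a ≡ true → 2 ^ b * Σs f ≤ r) → 2 ^ b * Σs (λ s → a · f s) ≤ a · r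
    guard a f r h = ≤-trans (≤-reflexive (trans (cong (2 ^ b *_) (sumTo-· (2 ^ seedLen b) a f)) (·-*ˡ a (2 ^ b) (Σs f)))) (·-mono h)
    part₁ : 2 ^ b * Σs L1 ≤ ∑ (λ u → ∑ (R₁ u))
    part₁ = begin
      2 ^ b * Σs L1 ≡⟨ push (λ v u s → E v u · dE u * ∑ (λ w → E v w · both b (t v u) s v w)) ⟩
      ∑ (λ v → ∑ (λ u → 2 ^ b * Σs (λ s → E v u · dE u * ∑ (λ w → E v w · both b (t v u) s v w))))
        ≤⟨ ∑-mono (λ v → ∑-mono (λ u → guard (E v u) _ _ (λ e → Σ-collisions (dE u) v (t v u) (θ≤ b (dE v + dE u)) (E v) (E-≢ v) (dE v) ≤-refl))) ⟩
      ∑ (λ v → ∑ (λ u → E v u · Q * (dE u * dE v * t v u * t v u)))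
        ≡⟨ ∑-cong (λ v → ∑-cong (λ u → cong₂ (λ a z → a · Q * (dE u * dE v * z * z)) (E-sym v u) (t-sym v u))) ⟩
      ∑ (λ v → ∑ (λ u → R₁ u v)) ≡⟨ ∑-swap (λ v u → R₁ u v) ⟩
      ∑ (λ u → ∑ (R₁ u)) ∎
    part₂ : 2 ^ b * Σs L2 ≤ ∑ (λ u → ∑ (R₂ u))
    part₂ = begin
      2 ^ b * Σs L2 ≡⟨ push (λ u v s → E u v · dE u * ∑ (λ w → (E u w ∧ not (eqᵇ w v)) · both b (t u v) s v w)) ⟩
      ∑ (λ u → ∑ (λ v → 2 ^ b * Σs (λ s → E u v · dE u * ∑ (λ w → (E u w ∧ not (eqᵇ w v)) · both b (t u v) s v w))))
        ≤⟨ ∑-mono (λ u → ∑-mono (λ v → guard (E u v) _ _ (λ e → Σ-collisions (dE u) v (t u v) (θ≤ b (dE u + dE v)) (λ w → E u w ∧ not (eqᵇ w v))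
             (λ w h → λ v≡w → eqᵇ-false (not-true (∧-trueʳ {E u w} h)) (sym v≡w)) (dE u) (count-mono {q = E u} (λ w h → ∧-trueˡ h))))) ⟩
      ∑ (λ u → ∑ (R₂ u)) ∎

  Σ-loss≤gain : 2 * Σs Loss ≤ Σs Gain
  Σ-loss≤gain = *-cancelˡ-≤ (2 ^ b) {{m^n≢0 2 b}} (begin
    2 ^ b * (2 * Σs Loss) ≡⟨ eq (2 ^ b) (Σs Loss) ⟩
    2 * (2 ^ b * Σs Loss) ≤⟨ *-monoʳ-≤ 2 Σ-loss ⟩
    2 * ∑ (λ u → ∑ (R u)) ≡⟨ sym (∑-*ˡ 2 (λ u → ∑ (R u))) ⟩
    ∑ (λ u → 2 * ∑ (R u)) ≡⟨ ∑-cong (λ u → sym (∑-*ˡ 2 (R u))) ⟩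
    ∑ (λ u → ∑ (λ v → 2 * R u v)) ≤⟨ ∑-mono (λ u → ∑-mono (λ v → one u v)) ⟩
    ∑ (λ u → ∑ (λ v → (2 ^ b * Q) * (E u v · dE u * t u v))) ≡⟨ ∑-cong (λ u → ∑-*ˡ (2 ^ b * Q) (λ v → E u v · dE u * t u v)) ⟩
    ∑ (λ u → (2 ^ b * Q) * ∑ (λ v → E u v · dE u * t u v)) ≡⟨ ∑-*ˡ (2 ^ b * Q) (λ u → ∑ (λ v → E u v · dE u * t u v)) ⟩
    2 ^ b * Q * P ≡⟨ *-assoc (2 ^ b) Q P ⟩
    2 ^ b * (Q * P) ≡⟨ cong (2 ^ b *_) (sym Σ-gain) ⟩
    2 ^ b * Σs Gain ∎)
    where
    open ≤-Reasoning
    eq : ∀ a l → a * (2 * l) ≡ 2 * (a * l)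
    eq = solve-∀
    eq3 : ∀ Q x d → 2 * (Q * (x * d)) ≡ Q * x * (2 * d)
    eq3 = solve-∀
    eq4 : ∀ Q x d → Q * x * d ≡ d * Q * x
    eq4 = solve-∀
    one : ∀ u v → 2 * R u v ≤ (2 ^ b * Q) * (E u v · dE u * t u v)
    one u v = begin
      2 * R u v ≡⟨ ·-*ˡ (E u v) 2 _ ⟩
      E u v · 2 * (Q * (dE u * t u v * ((dE u + dE v) * t u v))) ≡⟨ cong (E u v ·_) (eq3 Q (dE u * t u v) ((dE u + dE v) * t u v)) ⟩
      E u v · Q * (dE u * t u v) * (2 * ((dE u + dE v) * t u v)) ≤⟨ ·-mono {E u v} (λ _ → *-monoʳ-≤ (Q * (dE u * t u v)) (θ-upper b (dE u + dE v))) ⟩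
      E u v · Q * (dE u * t u v) * 2 ^ b ≡⟨ cong (E u v ·_) (eq4 Q (dE u * t u v) (2 ^ b)) ⟩
      E u v · 2 ^ b * Q * (dE u * t u v) ≡⟨ sym (·-*ˡ (E u v) (2 ^ b * Q) _) ⟩
      (2 ^ b * Q) * (E u v · dE u * t u v) ∎

  -- The starting point of the conditional expectations. On average the gain is at least `E2 / 12`,
  -- and the loss is at most half the gain; doubling 12 absorbs the loss.
  average : 2 ^ seedLen b * E2 + 24 * Σs Loss ≤ 24 * Σs Gain
  average = begin
    2 ^ seedLen b * E2 + 24 * Σs Loss ≤⟨ +-mono-≤ low (≤-trans (≤-reflexive (eq24 (Σs Loss))) (*-monoʳ-≤ 12 Σ-loss≤gain)) ⟩
    12 * Σs Gain + 12 * Σs Gain ≡⟨ sym (*-distribʳ-+ (Σs Gain) 12 12) ⟩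
    24 * Σs Gain ∎
    where
    open ≤-Reasoning
    eq24 : ∀ l → 24 * l ≡ 12 * (2 * l)
    eq24 = solve-∀
    eqQ : ∀ q p → q * (12 * p) ≡ 12 * (q * p)
    eqQ = solve-∀
    low : 2 ^ seedLen b * E2 ≤ 12 * Σs Gain
    low = begin
      2 ^ seedLen b * E2 ≡⟨ cong (_* E2) (^-distribˡ-+-* 2 (b + b) b) ⟩
      Q * 2 ^ b * E2 ≡⟨ *-assoc Q (2 ^ b) E2 ⟩
      Q * (2 ^ b * E2) ≤⟨ *-monoʳ-≤ Q P-lower ⟩
      Q * (12 * P) ≡⟨ eqQ Q P ⟩
      12 * (Q * P) ≡⟨ cong (12 *_) (sym Σ-gain) ⟩
      12 * Σs Gain ∎

  module Seed (s : ℕ) where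

    h : Fin n → ℕ
    h v = hash b s (toℕ v)

    -- Ties beat both sides, so the unbeaten vertices are strict local minima and form an
    -- independent set whatever the seed.
    beaten : Fin n → Bool
    beaten v = anyF (λ u → E v u ∧ not (h v <ᵇ h u))

    killed : Fin n → Bool
    killed u = anyF (λ v → E u v ∧ not (beaten v))

    -- `alone u v` certifies that `v` removes `u`: among `v`, its neighbours and the neighbours of
    -- `u`, only `v` hashes below the threshold of the pair.
    rival₁ rival₂ alone : Fin n → Fin n → Bool
    rival₁ u v = anyF (λ w → E v w ∧ (h w <ᵇ t u v))
    rival₂ u v = anyF (λ w → (E u w ∧ not (eqᵇ w v)) ∧ (h w <ᵇ t u v))
    alone u v = E u v ∧ ((h v <ᵇ t u v) ∧ (not (rival₁ u v) ∧ not (rival₂ u v)))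

    alone-E : ∀ u v → alone u v ≡ true → E u v ≡ true
    alone-E u v e = ∧-trueˡ e

    alone-< : ∀ u v → alone u v ≡ true → h v < t u v
    alone-< u v e = <ᵇ⇒<′ (∧-trueˡ (∧-trueʳ {E u v} e))

    alone-≥₁ : ∀ u v → alone u v ≡ true → ∀ w → E v w ≡ true → t u v ≤ h w
    alone-≥₁ u v e w ew = <ᵇ-false⇒ (¬true⇒false λ lt →
      true≢false (∧-intro ew lt) (anyF-false _ (not-true (∧-trueˡ {not (rival₁ u v)} (∧-trueʳ {h v <ᵇ t u v} (∧-trueʳ {E u v} e)))) w))

    alone-≥₂ : ∀ u v → alone u v ≡ true → ∀ w → E u w ≡ true → w ≢ v → t u v ≤ h w
    alone-≥₂ u v e w ew w≢v = <ᵇ-false⇒ (¬true⇒false λ lt →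
      true≢false (∧-intro (∧-intro ew (not-false (eqᵇ-≢ w≢v))) lt)
        (anyF-false _ (not-true (∧-trueʳ {not (rival₁ u v)} (∧-trueʳ {h v <ᵇ t u v} (∧-trueʳ {E u v} e)))) w))

    -- Otherwise each of the two would hash below its own threshold while not below that of the
    -- other, and each hash value would be smaller than the other. Hence the degree of `u` is
    -- credited at most once, although the thresholds of its pairs differ.
    alone-unique : ∀ u v v′ → alone u v ≡ true → alone u v′ ≡ true → v ≡ v′
    alone-unique u v v′ e e′ with v ≟ v′
    ... | yes p = p
    ... | no p  = ⊥-elim (<⇒≱ (<-≤-trans (alone-< u v′ e′) (alone-≥₂ u v′ e′ v (alone-E u v e) p))
                    (<⇒≤ (<-≤-trans (alone-< u v e) (alone-≥₂ u v e v′ (alone-E u v′ e′) (p ∘ sym)))))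

    alone-kills : ∀ u v → alone u v ≡ true → killed u ≡ true
    alone-kills u v e = anyF-intro _ v (∧-intro (alone-E u v e) (not-false (anyF-none _ λ w → ¬true⇒false λ ew →
      true≢false (<ᵇ-true (<-≤-trans (alone-< u v e) (alone-≥₁ u v e w (∧-trueˡ ew)))) (not-true (∧-trueʳ {E v w} ew)))))

    some : ∀ (M : Fin n → Bool) v k → below b k s v ≡ true → anyF (λ w → M w ∧ (h w <ᵇ k)) ≡ true →
      1 ≤ ∑ (λ w → M w · both b k s v w)
    some M v k e a = let (w , ew) = anyF-elim _ a in
      ≤-trans (≤-reflexive (sym (trans (if-true (∧-trueˡ {M w} ew)) (cong₂ (λ x y → b2n x * b2n y) e (∧-trueʳ {M w} ew))))) (term≤∑ (λ w → M w · both b k s v w) w)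

    -- A candidate below the threshold is either alone or has a rival of one of the two kinds, and a
    -- rival contributes at least 1 to the corresponding sum of collisions.
    pair-bound : ∀ u v → E u v ≡ true →
      b2n (below b (t u v) s v) ≤ ∑ (λ w → E v w · both b (t u v) s v w)
        + ∑ (λ w → (E u w ∧ not (eqᵇ w v)) · both b (t u v) s v w) + b2n (alone u v)
    pair-bound u v e = go (below b (t u v) s v) refl (rival₁ u v) refl (rival₂ u v) refl
      where
      go : ∀ a → below b (t u v) s v ≡ a → ∀ r₁ → rival₁ u v ≡ r₁ → ∀ r₂ → rival₂ u v ≡ r₂ →
        b2n a ≤ ∑ (λ w → E v w · both b (t u v) s v w)
          + ∑ (λ w → (E u w ∧ not (eqᵇ w v)) · both b (t u v) s v w) + b2n (alone u v)
      go false ea r₁ e₁ r₂ e₂ = z≤n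
      go true ea true e₁ r₂ e₂ = ≤-trans (some (E v) v (t u v) ea e₁) (≤-trans (m≤m+n _ _) (m≤m+n _ _))
      go true ea false e₁ true e₂ = ≤-trans (some (λ w → E u w ∧ not (eqᵇ w v)) v (t u v) ea e₂) (≤-trans (m≤n+m _ (∑ (λ w → E v w · both b (t u v) s v w))) (m≤m+n _ _))
      go true ea false e₁ false e₂ = ≤-trans (≤-reflexive (cong b2n (sym (∧-intro e (∧-intro ea (∧-intro (not-false e₁) (not-false e₂))))))) (m≤n+m _ _)

    Killed : ℕ
    Killed = ∑ (λ u → dE u * b2n (killed u))

    -- Holds for every seed, not only on average: gain minus loss is a pessimistic estimator of the
    -- removed degrees, and unlike these it is a sum of terms with known averages.
    realised : Gain s ≤ Loss s + Killed
    realised = begin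
      Gain s ≡⟨ trans (∑-swap (λ v u → E v u · dE u * b2n (below b (t v u) s v)))
                  (∑-cong (λ u → ∑-cong (λ v → cong₂ (λ a k → a · dE u * b2n (below b k s v)) (E-sym v u) (t-sym v u)))) ⟩
      ∑ (λ u → ∑ (λ v → E u v · dE u * b2n (below b (t u v) s v))) ≤⟨ ∑-mono per ⟩
      ∑ (λ u → (∑ (l₁ u) + ∑ (l₂ u)) + dE u * b2n (killed u)) ≡⟨ ∑-+ (λ u → ∑ (l₁ u) + ∑ (l₂ u)) (λ u → dE u * b2n (killed u)) ⟩
      ∑ (λ u → ∑ (l₁ u) + ∑ (l₂ u)) + Killed ≡⟨ cong (_+ Killed) (trans (∑-+ (λ u → ∑ (l₁ u)) (λ u → ∑ (l₂ u)))
            (trans (cong (_+ ∑ (λ u → ∑ (l₂ u))) (trans (∑-swap l₁) (∑-cong (λ v → ∑-cong (λ u → cong₂ (λ a k → a · dE u * ∑ (λ w → E v w · both b k s v w)) (E-sym u v) (t-sym u v))))))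
              (sym (∑-+ (λ v → loss₁ b (E v) dE (dE v) v s) (λ v → loss₂ b (E v) dE (dE v) s))))) ⟩
      Loss s + Killed ∎
      where
      open ≤-Reasoning
      l₁ l₂ l₃ : Fin n → Fin n → ℕ
      l₁ u v = E u v · dE u * ∑ (λ w → E v w · both b (t u v) s v w)
      l₂ u v = E u v · dE u * ∑ (λ w → (E u w ∧ not (eqᵇ w v)) · both b (t u v) s v w)
      l₃ u v = dE u * b2n (alone u v)
      term : ∀ u v → E u v · dE u * b2n (below b (t u v) s v) ≤ (l₁ u v + l₂ u v) + l₃ u v
      term u v = go (E u v) refl
        where
        go : ∀ a → E u v ≡ a → a · dE u * b2n (below b (t u v) s v) ≤ (l₁ u v + l₂ u v) + l₃ u v
        go false e = z≤n
        go true  e = ≤-trans (*-monoʳ-≤ (dE u) (pair-bound u v e)) (≤-reflexive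
          (trans (*-distribˡ-+ (dE u) (x + y) (b2n (alone u v)))
            (cong (_+ l₃ u v) (trans (*-distribˡ-+ (dE u) x y) (cong₂ _+_ (sym (cong (_· dE u * x) e)) (sym (cong (_· dE u * y) e)))))))
          where
          x y : ℕ
          x = ∑ (λ w → E v w · both b (t u v) s v w)
          y = ∑ (λ w → (E u w ∧ not (eqᵇ w v)) · both b (t u v) s v w)
      per : ∀ u → ∑ (λ v → E u v · dE u * b2n (below b (t u v) s v)) ≤ (∑ (l₁ u) + ∑ (l₂ u)) + dE u * b2n (killed u)
      per u = begin
        ∑ (λ v → E u v · dE u * b2n (below b (t u v) s v)) ≤⟨ ∑-mono (term u) ⟩
        ∑ (λ v → (l₁ u v + l₂ u v) + l₃ u v) ≡⟨ trans (∑-+ (λ v → l₁ u v + l₂ u v) (l₃ u)) (cong (_+ ∑ (l₃ u)) (∑-+ (l₁ u) (l₂ u))) ⟩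
        (∑ (l₁ u) + ∑ (l₂ u)) + ∑ (l₃ u) ≡⟨ cong ((∑ (l₁ u) + ∑ (l₂ u)) +_) (∑-*ˡ (dE u) (λ v → b2n (alone u v))) ⟩
        (∑ (l₁ u) + ∑ (l₂ u)) + dE u * count (alone u) ≤⟨ +-monoʳ-≤ (∑ (l₁ u) + ∑ (l₂ u)) (*-monoʳ-≤ (dE u)
            (≤-trans (count-unique (alone u) (alone-unique u)) (b2n-mono (λ a → let (v , e) = anyF-elim _ a in alone-kills u v e)))) ⟩
        (∑ (l₁ u) + ∑ (l₂ u)) + dE u * b2n (killed u) ∎

    -- A killed vertex loses all its edges, so the remaining degrees and `Killed` together fit into
    -- `E2`; a good seed makes `Killed` at least `E2 / 24`.
    progress : (E′ : Fin n → Fin n → Bool) → (∀ u v → E′ u v ≡ true → E u v ≡ true × killed u ≡ false) →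
      E2 + 24 * Loss s ≤ 24 * Gain s → 24 * ∑ (λ u → count (E′ u)) ≤ 23 * E2
    progress E′ sub good = +-cancelˡ-≤ E2 _ _ (begin
      E2 + 24 * E2′ ≤⟨ +-monoˡ-≤ (24 * E2′) (+-cancelʳ-≤ (24 * Loss s) E2 (24 * Killed) (begin
          E2 + 24 * Loss s ≤⟨ good ⟩
          24 * Gain s ≤⟨ *-monoʳ-≤ 24 realised ⟩
          24 * (Loss s + Killed) ≡⟨ eq1 (Loss s) Killed ⟩
          24 * Killed + 24 * Loss s ∎)) ⟩
      24 * Killed + 24 * E2′ ≡⟨ sym (*-distribˡ-+ 24 Killed E2′) ⟩
      24 * (Killed + E2′) ≤⟨ *-monoʳ-≤ 24 (≤-trans (≤-reflexive (sym (∑-+ (λ u → dE u * b2n (killed u)) (λ u → count (E′ u))))) (∑-mono (λ u → per u (killed u) refl))) ⟩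
      24 * E2 ≡⟨ refl ⟩
      E2 + 23 * E2 ∎)
      where
      open ≤-Reasoning
      E2′ : ℕ
      E2′ = ∑ (λ u → count (E′ u))
      eq1 : ∀ l k → 24 * (l + k) ≡ 24 * k + 24 * l
      eq1 = solve-∀
      per : ∀ u k → killed u ≡ k → dE u * b2n k + count (E′ u) ≤ dE u
      per u false e = ≤-trans (≤-reflexive (cong (_+ count (E′ u)) (*-zeroʳ (dE u)))) (count-mono (λ v e′ → proj₁ (sub u v e′)))
      per u true  e = ≤-reflexive (trans (cong₂ _+_ (*-identityʳ (dE u)) (∑-zero (λ v → cong b2n (¬true⇒false (λ e′ → true≢false e (proj₂ (sub u v e′))))))) (+-identityʳ (dE u)))

-- The half with the larger excess of gain over loss has at least half of the total excess. The
-- excesses are compared through sums, which avoids truncated subtraction.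
choose-half : ∀ e G₀ L₀ G₁ L₁ → (e + e) + 24 * (L₀ + L₁) ≤ 24 * (G₀ + G₁) →
  (G₁ + L₀ ≤ G₀ + L₁ → e + 24 * L₀ ≤ 24 * G₀) × (¬ (G₁ + L₀ ≤ G₀ + L₁) → e + 24 * L₁ ≤ 24 * G₁)
choose-half e G₀ L₀ G₁ L₁ h = (λ c → half G₀ L₀ G₁ L₁ h c) ,
  (λ c → half G₁ L₁ G₀ L₀ (≤-trans (≤-reflexive (cong (λ z → e + e + 24 * z) (+-comm L₁ L₀))) (≤-trans h (≤-reflexive (cong (24 *_) (+-comm G₀ G₁)))))
           (<⇒≤ (≰⇒> c)))
  where
  eq1 : ∀ e l l′ → (e + 24 * l) + (e + 24 * l′) ≡ (e + e) + 24 * (l + l′)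
  eq1 = solve-∀
  half : ∀ g l g′ l′ → (e + e) + 24 * (l + l′) ≤ 24 * (g + g′) → g′ + l ≤ g + l′ → e + 24 * l ≤ 24 * g
  half g l g′ l′ h c = ≮⇒≥ λ lt → <⇒≱ (begin-strict
    24 * (g + g′) ≡⟨ *-distribˡ-+ 24 g g′ ⟩
    24 * g + 24 * g′ <⟨ +-mono-< lt (lt′ lt) ⟩
    (e + 24 * l) + (e + 24 * l′) ≡⟨ eq1 e l l′ ⟩
    (e + e) + 24 * (l + l′) ∎) h
    where
    open ≤-Reasoning
    eq2 : ∀ e l l′ → e + 24 * l + 24 * l′ ≡ 24 * l + (e + 24 * l′)
    eq2 = solve-∀
    lt′ : 24 * g < e + 24 * l → 24 * g′ < e + 24 * l′
    lt′ lt = +-cancelˡ-< (24 * l) _ _ (begin-strict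
      24 * l + 24 * g′ ≡⟨ trans (+-comm (24 * l) (24 * g′)) (sym (*-distribˡ-+ 24 g′ l)) ⟩
      24 * (g′ + l) ≤⟨ *-monoʳ-≤ 24 c ⟩
      24 * (g + l′) ≡⟨ *-distribˡ-+ 24 g l′ ⟩
      24 * g + 24 * l′ <⟨ +-monoˡ-< (24 * l′) lt ⟩
      e + 24 * l + 24 * l′ ≡⟨ eq2 e l l′ ⟩
      24 * l + (e + 24 * l′) ∎)

-- Choosing the first defined value of a family

_>>=ᴹ_ : ∀ {A B : Set} → Maybe A → (A → Maybe B) → Maybe B
just x  >>=ᴹ f = f x
nothing >>=ᴹ f = nothing

pickJ : ∀ {m} {A : Set} → Maybe A → Maybe (Fin m × A) → Maybe (Fin (suc m) × A)
pickJ (just a) _              = just (zero , a)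
pickJ nothing  (just (i , a)) = just (suc i , a)
pickJ nothing  nothing        = nothing

firstJ : ∀ {m} {A : Set} → (Fin m → Maybe A) → Maybe (Fin m × A)
firstJ {zero}  f = nothing
firstJ {suc m} f = pickJ (f zero) (firstJ (f ∘ suc))

firstJ-none : ∀ {m} {A : Set} (f : Fin m → Maybe A) → (∀ i → f i ≡ nothing) → firstJ f ≡ nothing
firstJ-none {zero}  f h = refl
firstJ-none {suc m} f h = cong₂ pickJ (h zero) (firstJ-none (f ∘ suc) (h ∘ suc))

firstJ-cong : ∀ {m} {A : Set} {f g : Fin m → Maybe A} → (∀ i → f i ≡ g i) → firstJ f ≡ firstJ g
firstJ-cong {zero} h = refl
firstJ-cong {suc m} h = cong₂ pickJ (h zero) (firstJ-cong (h ∘ suc))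

firstJ-unique : ∀ {m} {A : Set} (f : Fin m → Maybe A) i a → f i ≡ just a → (∀ j → j ≢ i → f j ≡ nothing) →
  firstJ f ≡ just (i , a)
firstJ-unique f zero    a e h = cong (λ x → pickJ x (firstJ (f ∘ suc))) e
firstJ-unique f (suc i) a e h = cong₂ pickJ (h zero (λ ()))
  (firstJ-unique (f ∘ suc) i a e (λ j j≢ → h (suc j) (λ { refl → j≢ refl })))

firstJ-just : ∀ {m} {A : Set} (f : Fin m → Maybe A) {i a} → firstJ f ≡ just (i , a) → f i ≡ just a
firstJ-just {suc m} f h with f zero in e | firstJ (f ∘ suc) in e′
firstJ-just {suc m} f refl | just a  | _            = e
firstJ-just {suc m} f refl | nothing | just (i , a) = firstJ-just (f ∘ suc) e′

firstJ-nothing : ∀ {m} {A : Set} (f : Fin m → Maybe A) → firstJ f ≡ nothing → ∀ i → f i ≡ nothing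
firstJ-nothing {suc m} f h i with f zero in e | firstJ (f ∘ suc) in e′
firstJ-nothing {suc m} f () i       | just a  | _
firstJ-nothing {suc m} f () i       | nothing | just _
firstJ-nothing {suc m} f h  zero    | nothing | nothing = e
firstJ-nothing {suc m} f h  (suc i) | nothing | nothing = firstJ-nothing (f ∘ suc) e′ i

count-eq≡1 : ∀ {n} (a : Fin n) → count (λ i → eqᵇ i a) ≡ 1
count-eq≡1 a = ≤-antisym (count-eq≤1 a) (≤-trans (≤-reflexive (cong b2n (sym (eqᵇ-refl a)))) (term≤∑ (λ i → b2n (eqᵇ i a)) a))


-- Domination, seen globally

module Domination {n : ℕ} (N : Fin n → Fin n → Bool) (H : Fin n → Bool) where

  -- Domination as far as a vertex can test it. A light vertex is not told which heavy neighbours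
  -- are in the set, so only light dominators count for it; a light vertex whose dominators are all
  -- heavy is undominated and will displace them.
  LD AD dom UD : (Fin n → Bool) → Fin n → Bool
  LD I v = anyF (λ u → N v u ∧ (I u ∧ not (H u)))
  AD I v = anyF (λ u → N v u ∧ I u)
  dom I v = if H v then AD I v else LD I v
  UD I v = not (I v) ∧ not (dom I v)

  Ind : (Fin n → Bool) → Set
  Ind I = ∀ u v → N u v ≡ true → I u ≡ true → I v ≡ true → ⊥

  LD-mono : ∀ {I J} → (∀ u → H u ≡ false → I u ≡ true → J u ≡ true) → ∀ v → LD I v ≡ true → LD J v ≡ true
  LD-mono {I} {J} h v e with anyF-elim _ e
  ... | u , p = anyF-intro _ u (∧-intro {N v u} (∧-trueˡ {N v u} p) (∧-intro {J u} (h u (not-true (∧-trueʳ {I u} (∧-trueʳ {N v u} p))) (∧-trueˡ {I u} (∧-trueʳ {N v u} p))) (∧-trueʳ {I u} (∧-trueʳ {N v u} p))))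

  AD-mono : ∀ {I J} → (∀ u → I u ≡ true → J u ≡ true) → ∀ v → AD I v ≡ true → AD J v ≡ true
  AD-mono h v e with anyF-elim _ e
  ... | u , p = anyF-intro _ u (∧-intro (∧-trueˡ p) (h u (∧-trueʳ {N v u} p)))

  dom-mono : ∀ {I J} → (∀ u → I u ≡ true → J u ≡ true) → ∀ v → dom I v ≡ true → dom J v ≡ true
  dom-mono h v = go (H v)
    where
    go : ∀ c → (if c then AD _ v else LD _ v) ≡ true → (if c then AD _ v else LD _ v) ≡ true
    go true  = AD-mono h v
    go false = LD-mono (λ u _ → h u) v

  UD-in : ∀ {I v} → UD I v ≡ true → I v ≡ false
  UD-in {I} {v} e = not-true (∧-trueˡ {not (I v)} e)

  UD-dom : ∀ {I v} → UD I v ≡ true → dom I v ≡ false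
  UD-dom {I} {v} e = not-true (∧-trueʳ {not (I v)} e)

  UD-intro : ∀ {I v} → I v ≡ false → dom I v ≡ false → UD I v ≡ true
  UD-intro a b = ∧-intro (not-false a) (not-false b)

  UD-mono : ∀ {I J} → (∀ u → I u ≡ true → J u ≡ true) → ∀ v → UD J v ≡ true → UD I v ≡ true
  UD-mono h v e = UD-intro (¬true⇒false λ i → true≢false (h v i) (UD-in e)) (¬true⇒false λ d → true≢false (dom-mono h v d) (UD-dom e))

  dom-heavy : ∀ {I v} → H v ≡ true → ∀ u → N v u ≡ true → I u ≡ true → dom I v ≡ true
  dom-heavy h u n i = trans (if-true h) (anyF-intro _ u (∧-intro n i))

  dom-light : ∀ {I v} → H v ≡ false → ∀ u → N v u ≡ true → I u ≡ true → H u ≡ false → dom I v ≡ true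
  dom-light h u n i l = trans (if-false h) (anyF-intro _ u (∧-intro n (∧-intro i (not-false l))))

  UD-in-nbr : ∀ {I v} → H v ≡ true → UD I v ≡ true → ∀ u → N v u ≡ true → I u ≡ true → ⊥
  UD-in-nbr h e u n i = true≢false (dom-heavy h u n i) (UD-dom e)

-- `23^m · d < 24^m` expresses that `m` phases, each leaving at most 23/24 of the edges, bring `d`
-- below 1.
halving : ∀ e d → 24 * e ≤ 23 * d → ∀ m → 23 ^ suc m * d < 24 ^ suc m → 23 ^ m * e < 24 ^ m
halving e d h m lt = *-cancelˡ-< 24 (23 ^ m * e) (24 ^ m) (begin-strict
  24 * (23 ^ m * e) ≡⟨ eq 24 (23 ^ m) e ⟩
  23 ^ m * (24 * e) ≤⟨ *-monoʳ-≤ (23 ^ m) h ⟩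
  23 ^ m * (23 * d) ≡⟨ trans (sym (*-assoc (23 ^ m) 23 d)) (cong (_* d) (*-comm (23 ^ m) 23)) ⟩
  23 ^ suc m * d <⟨ lt ⟩
  24 ^ suc m ∎)
  where
  open ≤-Reasoning
  eq : ∀ a x e → a * (x * e) ≡ x * (a * e)
  eq = solve-∀


-- The part of all local states that the analysis follows. `Nb` may lag behind the graph: while an
-- insertion is prepared, the new edge exists but is not yet used.
record Glob (n : ℕ) : Set where
  constructor glob
  field
    Nb : Fin n → Fin n → Bool
    Hv Pn In : Fin n → Bool
open Glob public

-- Degrees, edge counts and updates of graphs

∑∑-edges : ∀ {n} (G : Graph n) → (∀ u v → G u v ≡ G v u) → (∀ u → G u u ≡ false) → ∑ (λ v → count (G v)) ≡ 2 * edgeCount G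
∑∑-edges {n} G G-sym G-irr = begin
  ∑ (λ u → count (G u)) ≡⟨ ∑-cong (λ u → trans (∑-cong (λ v → split u v)) (∑-+ (up u) (λ v → up v u))) ⟩
  ∑ (λ u → ∑ (up u) + ∑ (λ v → up v u)) ≡⟨ ∑-+ (λ u → ∑ (up u)) (λ u → ∑ (λ v → up v u)) ⟩
  ∑ (λ u → ∑ (up u)) + ∑ (λ u → ∑ (λ v → up v u)) ≡⟨ cong (∑ (λ u → ∑ (up u)) +_) (sym (∑-swap up)) ⟩
  ∑ (λ u → ∑ (up u)) + ∑ (λ u → ∑ (up u)) ≡⟨ cong (∑ (λ u → ∑ (up u)) +_) (sym (+-identityʳ _)) ⟩
  2 * ∑ (λ u → ∑ (up u)) ≡⟨ cong (2 *_) (sym (trans (sum-map-allFin (λ u → countFin (λ v → does (suc (toℕ u) ≤? toℕ v) ∧ G u v))) (∑-cong (λ u → countFin-count (λ v → does (suc (toℕ u) ≤? toℕ v) ∧ G u v))))) ⟩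
  2 * edgeCount G ∎
  where
  open ≡-Reasoning
  up : Fin n → Fin n → ℕ
  up u v = b2n (does (suc (toℕ u) ≤? toℕ v) ∧ G u v)
  split : ∀ u v → b2n (G u v) ≡ up u v + up v u
  split u v with <-cmp (toℕ u) (toℕ v)
  ... | tri< lt _ ¬gt = sym (trans (cong₂ (λ x y → b2n (x ∧ G u v) + b2n (y ∧ G v u)) (dec-true (suc (toℕ u) ≤? toℕ v) lt) (dec-false (suc (toℕ v) ≤? toℕ u) ¬gt)) (+-identityʳ _))
  ... | tri> ¬lt _ gt = sym (trans (cong₂ (λ x y → b2n (x ∧ G u v) + b2n (y ∧ G v u)) (dec-false (suc (toℕ u) ≤? toℕ v) ¬lt) (dec-true (suc (toℕ v) ≤? toℕ u) gt)) (cong b2n (G-sym v u)))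
  ... | tri≈ ¬lt e ¬gt = trans (cong b2n (trans (cong (G u) (sym (toℕ-injective e))) (G-irr u))) (sym (cong₂ (λ x y → b2n (x ∧ G u v) + b2n (y ∧ G v u)) (dec-false (suc (toℕ u) ≤? toℕ v) ¬lt) (dec-false (suc (toℕ v) ≤? toℕ u) ¬gt)))

apply-sym : ∀ {n} {G : Graph n} x → (∀ u v → G u v ≡ G v u) → ∀ u v → applyUpdate G x u v ≡ applyUpdate G x v u
apply-sym {n} {G} x h u v = go x
  where
  pair-sym : ∀ (a c : Fin n) → samePair a c u v ≡ samePair a c v u
  pair-sym a c = trans (∨-comm (eqᵇ u a ∧ eqᵇ v c) _) (cong₂ _∨_ (∧-comm (eqᵇ u c) _) (∧-comm (eqᵇ u a) _))
  go : ∀ x → applyUpdate G x u v ≡ applyUpdate G x v u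
  go (insert a c) = cong₂ _∨_ (pair-sym a c) (h u v)
  go (delete a c) = cong₂ (λ p q → not p ∧ q) (pair-sym a c) (h u v)

apply-irr : ∀ {n} {G : Graph n} {x} → ValidUpdate G x → (∀ u → G u u ≡ false) → ∀ u → applyUpdate G x u u ≡ false
apply-irr {G = G} (ins {a} {c} p _) h u = trans (cong (_∨ G u u) (¬true⇒false λ e → ∨-elim {eqᵇ u a ∧ eqᵇ u c} e
  (λ q → clash (∧-trueˡ {eqᵇ u a} q) (∧-trueʳ {eqᵇ u a} q)) (λ q → clash (∧-trueʳ {eqᵇ u c} q) (∧-trueˡ {eqᵇ u c} q)))) (h u)
  where
  clash : eqᵇ u a ≡ true → eqᵇ u c ≡ true → ⊥
  clash q r = p (trans (sym (eqᵇ⇒≡ {a = u} {a} q)) (eqᵇ⇒≡ {a = u} {c} r))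
apply-irr {G = G} (del {a} {c} p _) h u = trans (cong (not (samePair a c u u) ∧_) (h u)) (∧-zeroʳ _)

maxEdges : ∀ {n} → Graph n → List (Update n) → ℕ
maxEdges G []       = 0
maxEdges G (x ∷ xs) = edgeCount (applyUpdate G x) ⊔ maxEdges (applyUpdate G x) xs

-- Closed forms of `lubyT` and `suc Ki` below, free of the parameters of the analysis.
lubyRounds : ℕ → ℕ → ℕ
lubyRounds phm b = 5 + (suc phm * (5 + (5 + (seedLen b * 5 + 5))) + 5)

updateRounds : ℕ → ℕ
updateRounds l = suc (25 + (20 + l) + ((30 + (20 + l) + (c + c)) + (30 + (20 + l) + (c + c))))
  where
  c : ℕ
  c = (60 + (20 + l)) + (60 + (20 + l))

-- Encoding of finite data as bounded numbers

record Codec (N k : ℕ) (A : Set) : Set where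
  field
    encode     : A → ℕ
    decode   : ℕ → A
    encode<    : ∀ a → encode a < N ^ k
    decode-encode : ∀ a → decode (encode a) ≡ a
open Codec

module Codecs (N : ℕ) (2≤N : 2 ≤ N) where

  N^>0 : ∀ k → 0 < N ^ k
  N^>0 k = m^n>0 N {{>-nonZero (≤-trans (s≤s z≤n) 2≤N)}} k

  unit : Codec N 0 ⊤
  unit = record { encode = λ _ → 0 ; decode = λ _ → tt ; encode< = λ _ → s≤s z≤n ; decode-encode = λ _ → refl }

  retract : ∀ {k A A′} (f : A → A′) (g : A′ → A) → (∀ a → g (f a) ≡ a) → Codec N k A′ → Codec N k A
  retract f g h c = record { encode = encode c ∘ f ; decode = g ∘ decode c ; encode< = λ a → encode< c (f a) ; decode-encode = λ a → trans (cong g (decode-encode c (f a))) (h a) }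

  bounded : ∀ {m} k → 1 ≤ m → m ≤ N ^ k → Codec N k (Fin m)
  bounded {suc m} k 1≤m m≤ = record
    { encode = toℕ ; decode = λ i → fromℕ< {i ⊓ m} (s≤s (m⊓n≤n i m)) ; encode< = λ a → <-≤-trans (toℕ<n a) m≤
    ; decode-encode = λ a → toℕ-injective (trans (toℕ-fromℕ< (s≤s (m⊓n≤n (toℕ a) m))) (m≤n⇒m⊓n≡m (≤-pred (toℕ<n a)))) }

  -- One more digit holds the tag, because `N ≥ 2` gives `N^k + N^l ≤ N^(k+l+1)`. All codecs are
  -- powers of `N`, so message sizes are sums of exponents independent of the number of vertices.
  sum-codec : ∀ {k l A A′} → Codec N k A → Codec N l A′ → Codec N (suc (k + l)) (A ⊎ A′)
  sum-codec {k} {l} {A} {A′} c d = record { encode = cd ; decode = dc ; encode< = cd< ; decode-encode = dcd }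
    where
    cd : A ⊎ A′ → ℕ
    cd (inj₁ a) = encode c a
    cd (inj₂ x) = N ^ k + encode d x
    dc : ℕ → A ⊎ A′
    dc i = if i <ᵇ N ^ k then inj₁ (decode c i) else inj₂ (decode d (i ∸ N ^ k))
    both≤ : N ^ k + N ^ l ≤ N ^ suc (k + l)
    both≤ = ≤-trans (+-mono-≤ (^-monoʳ-≤ N {{>-nonZero (≤-trans (s≤s z≤n) 2≤N)}} (m≤m+n k l)) (^-monoʳ-≤ N {{>-nonZero (≤-trans (s≤s z≤n) 2≤N)}} (m≤n+m l k)))
      (≤-trans (≤-reflexive (cong (N ^ (k + l) +_) (sym (+-identityʳ (N ^ (k + l)))))) (*-monoˡ-≤ (N ^ (k + l)) 2≤N))
    cd< : ∀ x → cd x < N ^ suc (k + l)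
    cd< (inj₁ a) = <-≤-trans (encode< c a) (≤-trans (m≤m+n (N ^ k) (N ^ l)) both≤)
    cd< (inj₂ x) = <-≤-trans (+-monoʳ-< (N ^ k) (encode< d x)) both≤
    dcd : ∀ x → dc (cd x) ≡ x
    dcd (inj₁ a) = trans (if-true (<ᵇ-true (encode< c a))) (cong inj₁ (decode-encode c a))
    dcd (inj₂ x) = trans (if-false (<ᵇ-false (m≤m+n (N ^ k) (encode d x)))) (cong inj₂ (trans (cong (decode d) (m+n∸m≡n (N ^ k) (encode d x))) (decode-encode d x)))

  pair-codec : ∀ {k l A A′} → Codec N k A → Codec N l A′ → Codec N (k + l) (A × A′)
  pair-codec {k} {l} {A} {A′} c d = record
    { encode = λ { (a , x) → encode c a + encode d x * N ^ k }
    ; decode = λ i → decode c ((i % N ^ k) {{nz}}) , decode d ((i / N ^ k) {{nz}})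
    ; encode< = λ { (a , x) → <-≤-trans (+-monoˡ-< (encode d x * N ^ k) (encode< c a)) (≤-trans (*-monoˡ-≤ (N ^ k) (encode< d x)) (≤-reflexive (trans (*-comm (N ^ l) (N ^ k)) (sym (^-distribˡ-+-* N k l))))) }
    ; decode-encode = λ { (a , x) → cong₂ _,_
        (trans (cong (decode c) (trans ([m+kn]%n≡m%n (encode c a) (encode d x) (N ^ k) {{nz}}) (m<n⇒m%n≡m {{nz}} (encode< c a)))) (decode-encode c a))
        (trans (cong (decode d) (quot (encode c a) (encode d x) (encode< c a))) (decode-encode d x)) } }
    where
    nz : NonZero (N ^ k)
    nz = >-nonZero (N^>0 k)
    quot : ∀ r q → r < N ^ k → ((r + q * N ^ k) / N ^ k) {{nz}} ≡ q
    quot r q lt = trans (+-distrib-/-∣ʳ r {q * N ^ k} {N ^ k} {{nz}} (n∣m*n q)) (trans (cong₂ _+_ (m<n⇒m/n≡0 {{nz}} lt) (m*n/n≡m q (N ^ k) {{nz}})) refl)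

  bool-codec : Codec N 1 Bool
  bool-codec = retract {A′ = ⊤ ⊎ ⊤} (λ c → if c then inj₁ tt else inj₂ tt) (λ { (inj₁ _) → true ; (inj₂ _) → false }) (λ { true → refl ; false → refl }) (sum-codec unit unit)

-- The algorithm

-- A single token moves through the graph.  Its holder w runs a program whose basic operation,
-- the pulse, reaches the neighbours X of w and possibly their neighbours Y, makes all of them
-- perform an operation on their local state, and aggregates their answers at w.

module MIS (n vmax b phm : ℕ) (b-big : suc (4 * n) ≤ 2 ^ b) (small : 23 ^ phm * (n * n) < 24 ^ phm)
  (fits : n * (2 ^ seedLen b * (n * (n * (n * 1)) + n * (n * (n * 1)))) ≤ vmax) (fitSeed : 2 ^ seedLen b ≤ vmax) (fitN : n ≤ vmax) where

  V : Set
  V = Fin n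

  -- Numbers in messages; toV saturates.
  Val : Set
  Val = Fin (suc vmax)

  toV : ℕ → Val
  toV m = fromℕ< (s≤s (m⊓n≤n m vmax))

  record Info : Set where
    constructor mkInfo
    field
      hv inn al : Bool
      dg : Val
  open Info public

  -- hv: heavy; inn: in the independent set; pin: must stay heavy; al, dg: alive and number of
  -- alive neighbours during a Luby phase; tab: last known Info of the other vertices.
  record Loc : Set where
    constructor mkLoc
    field
      me  : V
      nbr : V → Bool
      inf : Info
      pin : Bool
      tab : Vec Info n
  open Loc public

  setInf : Info → Loc → Loc
  setInf i l = record l { inf = i }

  tb : Loc → V → Info
  tb l u = lookup (tab l) u

  heavyNbr fwd alNbr : Loc → V → Bool
  heavyNbr l u = nbr l u ∧ hv (tb l u)
  fwd l u = heavyNbr l u ∧ not (eqᵇ u (me l))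
  alNbr l u = nbr l u ∧ al (tb l u)

  domL domA dominated ud : Loc → Bool
  domL l = anyF (λ u → nbr l u ∧ (inn (tb l u) ∧ not (hv (tb l u))))
  domA l = anyF (λ u → nbr l u ∧ inn (tb l u))
  dominated l = if hv (inf l) then domA l else domL l
  ud l = not (inn (inf l)) ∧ not (dominated l)

  -- `poll` looks for an undominated light neighbour and informs all neighbours. `cnt` and `cntD`
  -- count the unpinned heavy vertices at distance one, respectively up to two, and pick one of
  -- least degree. `kick` evicts heavy members with a light neighbour in the set. `alv`, `dgr`,
  -- `bit` and `jn` are the steps of a Luby phase.
  data Op : Set where
    poll cnt cntD kick alv dgr : Op
    bit : Val → Val → Op
    jn  : Val → Op

  -- `allScope`: light neighbours belong to X too. `deep`: the pulse continues to Y. `ann`: vertices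
  -- of Y announce their new `Info` to their heavy neighbours; those of X do so by forwarding the
  -- pulse.
  allScope deep ann : Op → Bool
  allScope poll = true
  allScope _    = false
  deep poll = false
  deep cnt  = false
  deep _    = true
  ann poll = false
  ann cnt  = false
  ann cntD = false
  ann _    = true

  beatenL : ℕ → Loc → Bool
  beatenL s l = anyF (λ u → alNbr l u ∧ not (hash b s (toℕ (me l)) <ᵇ hash b s (toℕ u)))

  act : Op → Loc → Info
  act kick   l = record (inf l) { inn = inn (inf l) ∧ not (hv (inf l) ∧ domL l) }
  act alv    l = record (inf l) { al = hv (inf l) ∧ ud l }
  act dgr    l = record (inf l) { dg = toV (count (alNbr l)) }
  act (jn s) l = record (inf l) { inn = inn (inf l) ∨ (al (inf l) ∧ not (beatenL (toℕ s) l)) }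
  act _      l = inf l

  record Res : Set where
    constructor mkRes
    field
      r₀ r₁ r₂ r₃ : Val
      pk : Maybe (Val × V)
  open Res public

  -- Besides the least candidate, `bst` keeps the neighbour that reported it, because a vertex at
  -- distance two can be reached only by way of that neighbour.
  record Ans : Set where
    constructor mkAns
    field
      s₀ s₁ s₂ s₃ : ℕ
      bst : Maybe (V × (Val × V))
  open Ans public

  gainOn lossOn : Loc → ℕ → ℕ → ℕ
  gainOn l a j = sumTo (2 ^ j) (λ t → gain b (alNbr l) (λ u → toℕ (dg (tb l u))) (toℕ (dg (inf l))) (me l) (a + t))
  lossOn l a j = sumTo (2 ^ j) (λ t → loss b (alNbr l) (λ u → toℕ (dg (tb l u))) (toℕ (dg (inf l))) (me l) (a + t))

  noRes : Res
  noRes = mkRes (toV 0) (toV 0) (toV 0) (toV 0) nothing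

  val : Op → Loc → Res
  val poll l = if not (hv (inf l)) ∧ ud l then record noRes { pk = just (toV 0 , me l) } else noRes
  val cnt  l = if pin l then noRes else record noRes { r₀ = toV 1 ; pk = just (toV (count (nbr l)) , me l) }
  val cntD l = if pin l then noRes else record noRes { r₀ = toV 1 ; pk = just (toV (count (nbr l)) , me l) }
  val (bit a j) l = if al (inf l)
    then mkRes (toV (gainOn l (toℕ a) (toℕ j))) (toV (lossOn l (toℕ a) (toℕ j)))
               (toV (gainOn l (toℕ a + 2 ^ toℕ j) (toℕ j))) (toV (lossOn l (toℕ a + 2 ^ toℕ j) (toℕ j))) nothing
    else noRes
  val _ l = noRes

  better : ∀ {m} → Maybe (Fin m × (Val × V)) → Maybe (Fin m × (Val × V)) → Maybe (Fin m × (Val × V))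
  better nothing y = y
  better (just x) nothing = just x
  better (just (i , d , z)) (just (i′ , d′ , z′)) =
    if toℕ d ≤ᵇ toℕ d′ then just (i , d , z) else just (i′ , d′ , z′)

  sucIdx : ∀ {m} → Maybe (Fin m × (Val × V)) → Maybe (Fin (suc m) × (Val × V))
  sucIdx nothing = nothing
  sucIdx (just (i , p)) = just (suc i , p)

  zeroIdx : ∀ {m} → Maybe (Val × V) → Maybe (Fin (suc m) × (Val × V))
  zeroIdx nothing = nothing
  zeroIdx (just p) = just (zero , p)

  best : ∀ {m} → (Fin m → Maybe (Val × V)) → Maybe (Fin m × (Val × V))
  best {zero}  f = nothing
  best {suc m} f = better (zeroIdx (f zero)) (sucIdx (best (f ∘ suc)))

  field₀ : (Res → Val) → Maybe Res → ℕ
  field₀ g (just r) = toℕ (g r)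
  field₀ g nothing  = 0

  agg : (V → Maybe Res) → Ans
  agg f = mkAns (∑ (field₀ r₀ ∘ f)) (∑ (field₀ r₁ ∘ f)) (∑ (field₀ r₂ ∘ f)) (∑ (field₀ r₃ ∘ f)) (best (λ u → f u >>=ᴹ pk))

  squash : Ans → Res
  squash a = mkRes (toV (s₀ a)) (toV (s₁ a)) (toV (s₂ a)) (toV (s₃ a)) (bst a >>=ᴹ (λ p → just (proj₂ p)))

  -- Programs contain functions and cannot be sent. A call sends one of these names instead, and
  -- recursion goes through them, so that `Prog` stays inductive although `red` and `fix` loop.
  data Code : Set where
    red settle up demote fix : Code
    relay link : V → Code

  data Prog : Set where
    halt  : Prog
    upd   : (Loc → Loc) → Prog → Prog
    ask   : (Loc → Prog) → Prog
    pulse : Op → (Ans → Prog) → Prog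
    call  : V → Code → Prog → Prog
    goto  : Code → Prog
    sub   : Code → Prog → Prog

  -- A vertex of minimal degree δ among r heavy ones is certified to be cheap if δ ≤ r².
  certify : ℕ → V × (Val × V) → Maybe (V × V)
  certify r (x , δ , z) = if toℕ δ ≤ᵇ r * r then just (x , z) else nothing

  cert : Ans → Maybe (V × V)
  cert a = bst a >>=ᴹ certify (s₀ a)

  -- The candidates are the `2^j` seeds from `a` on. The answer contains gain and loss of both
  -- halves, and the half with the larger difference is kept.
  bitsP : ℕ → ℕ → (ℕ → Prog) → Prog
  bitsP zero    a k = k a
  bitsP (suc j) a k = pulse (bit (toV a) (toV j)) λ r →
    bitsP j (if s₂ r + s₁ r ≤ᵇ s₀ r + s₃ r then a else a + 2 ^ j) k

  phases : ℕ → Prog → Prog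
  phases zero    k = k
  phases (suc m) k = pulse alv λ _ → pulse dgr λ _ → bitsP (seedLen b) 0 λ s → pulse (jn (toV s)) λ _ → phases m k

  -- `kick` resolves the conflicts of a light holder that has just joined. The phase in excess of
  -- `phm` lets those vertices join that are alive when no edge between alive vertices is left.
  luby : Prog
  luby = pulse kick λ _ → phases (suc phm) (pulse alv λ _ → halt)

  join lighten toHeavy setPin : Loc → Loc
  join l = setInf (record (inf l) { inn = true }) l
  lighten l = setInf (record (inf l) { hv = false }) l
  toHeavy l = record l { inf = record (inf l) { hv = true ; inn = false } ; pin = true }
  setPin l = record l { pin = true }

  -- Recording the new edge also removes the pin: a pin lasts from the moment an endpoint has been
  -- made heavy until the edge is in use. `linkTo` resolves the only possible new conflict, that
  -- between the endpoints.
  addNbr delNbr linkTo : V → Loc → Loc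
  addNbr v l = record l { nbr = λ x → if eqᵇ x v then true else nbr l x ; pin = false }
  delNbr v l = record l { nbr = λ x → if eqᵇ x v then false else nbr l x }
  linkTo v l = setInf (record (inf l) { inn = inn (inf l) ∧ not (inn (tb l v)) }) (addNbr v l)

  redDeep : Maybe (V × V) → Prog
  redDeep nothing        = halt
  redDeep (just (x , z)) = call x (if eqᵇ x z then up else relay z) (goto red)

  redShallow : Maybe (V × V) → Prog
  redShallow nothing        = pulse cntD (λ a → redDeep (cert a))
  redShallow (just p)       = redDeep (just p)

  -- A joining vertex announces itself to those entitled to know, which are the heavy neighbours for
  -- a heavy one and all neighbours for a light one. Luby's algorithm runs in either case, since
  -- heavy vertices nearby may be undominated even if the holder is not.
  settleAct : Loc → Prog
  settleAct l = if ud l then upd join (pulse (if hv (inf l) then cnt else poll) (λ _ → luby)) else luby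

  demoteAct : Loc → Prog
  demoteAct l = if hv (inf l) then upd setPin halt else upd toHeavy (pulse poll (λ _ → goto fix))

  fixNext : Maybe (V × (Val × V)) → Prog
  fixNext nothing        = goto settle
  fixNext (just (x , _)) = call x settle (goto fix)

  code : Code → Prog
  code red       = pulse cnt (λ a → redShallow (cert a))
  code settle    = sub red (ask settleAct)
  code up        = upd lighten (pulse poll (λ _ → goto settle))
  code demote    = sub red (ask demoteAct)
  code fix       = pulse poll (λ a → fixNext (bst a))
  code (relay z) = call z up halt
  code (link v)  = upd (linkTo v) (pulse cnt (λ _ → goto settle))

  -- Both endpoints become heavy with few heavy neighbours before the edge is used, so that neither
  -- the degree bound of a light vertex nor the bound on heavy neighbours can break. The call of
  -- `link` carries the `Info` of `u` that `v` needs.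
  insProg : V → V → Prog
  insProg u v = sub demote (call v demote (upd (addNbr v) (call v (link u) halt)))

  -- The flag of `p3` separates the answer to the parent in X from a mere announcement to other
  -- heavy neighbours, so that each value is collected only once.
  data Kind : Set where
    p1 p2 : Op → Kind
    p3 : Bool → Res → Kind
    p4 : Res → Kind
    callK : Code → Kind
    retK : Kind

  record M : Set where
    constructor mkM
    field
      kind : Kind
      info : Info
  open M public

  getP1 getP2 : M → Maybe Op
  getP1 (mkM (p1 o) _) = just o
  getP1 _ = nothing
  getP2 (mkM (p2 o) _) = just o
  getP2 _ = nothing

  getUp getP4 : M → Maybe Res
  getUp (mkM (p3 true r) _) = just r
  getUp _ = nothing
  getP4 (mkM (p4 r) _) = just r
  getP4 _ = nothing

  getCall : M → Maybe Code
  getCall (mkM (callK c) _) = just c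
  getCall _ = nothing

  getRet : M → Maybe ⊤
  getRet (mkM retK _) = just tt
  getRet _ = nothing

  -- Every vertex keeps a stack, because the token may revisit a vertex whose own program is still
  -- suspended in a call.
  data Frame : Set where
    ret : V → Frame
    res : Prog → Frame

  data Ctl : Set where
    idle : Ctl
    exec : Prog → Ctl
    pulsing : ℕ → (Ans → Prog) → Ctl

  -- A vertex of X remembers whom it owes an answer, together with its own value, and counts the
  -- rounds until the answers of Y have arrived.
  data Mem : Set where
    none : Mem
    hold : ℕ → V → Res → Mem

  record State : Set where
    constructor mkSt
    field
      loc : Loc
      ctl : Ctl
      stk : List Frame
      mem : Mem
  open State public

  Inbox : Set
  Inbox = Vec (Maybe M) n

  Out : Set
  Out = V → Maybe M

  -- Every message carries the `Info` of its sender, so messages of any kind refresh the table.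
  mg : Inbox → Loc → Loc
  mg iv l = record l { tab = tabulate (λ u → maybe info (tb l u) (lookup iv u)) }

  grab : ∀ {A : Set} → (M → Maybe A) → Inbox → V → Maybe A
  grab g iv u = lookup iv u >>=ᴹ g

  silent : Out
  silent _ = nothing

  sendTo : V → Kind → Loc → Out
  sendTo z k l u = if eqᵇ u z then just (mkM k (inf l)) else nothing

  scope : Op → Loc → V → Bool
  scope o l u = (nbr l u ∧ (allScope o ∨ hv (tb l u))) ∧ not (eqᵇ u (me l))

  haltStep : Loc → List Frame → State × Out
  haltStep l []          = mkSt l idle [] none , silent
  haltStep l (res p ∷ k) = mkSt l (exec p) k none , silent
  haltStep l (ret u ∷ k) = mkSt l idle k none , sendTo u retK l

  execStep : Loc → Prog → List Frame → State × Out
  execStep l halt         k = haltStep l k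
  execStep l (upd f p)    k = mkSt (f l) (exec p) k none , silent
  execStep l (ask f)      k = mkSt l (exec (f l)) k none , silent
  execStep l (goto c)     k = mkSt l (exec (code c)) k none , silent
  execStep l (sub c p)    k = mkSt l (exec (code c)) (res p ∷ k) none , silent
  execStep l (call z c p) k = mkSt l idle (res p ∷ k) none , sendTo z (callK c) l
  execStep l (pulse o f)  k = mkSt l (pulsing 3 f) k none , (λ u → if scope o l u then just (mkM (p1 o) (inf l)) else nothing)

  -- `act` reads the table before the messages of the round are merged. Together with the order of
  -- the rounds this lets all vertices of a pulse act on the state before it, although they are
  -- reached at different times.
  atX : Inbox → Loc → Op → Loc
  atX iv l o = mg iv (setInf (act o l) l)

  sendX : Loc → Op → Info → Out
  sendX l o i u = if deep o ∧ fwd l u then just (mkM (p2 o) i) else nothing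

  sendY : Loc → Op → V → Info → Out
  sendY l o x i u = if eqᵇ u x ∨ (ann o ∧ fwd l u) then just (mkM (p3 (eqᵇ u x) (val o l)) i) else nothing

  resume : Loc → List Frame → State
  resume l []          = mkSt l idle [] none
  resume l (res p ∷ k) = mkSt l (exec p) k none
  resume l (ret u ∷ k) = mkSt l idle (ret u ∷ k) none

  -- Only idle vertices without pending answer get here. When the requests for Y arrive, the holder
  -- and the vertices of X are counting rounds and so ignore them; any other vertex takes the first
  -- sender as its parent.
  dispatch : Loc → List Frame → Inbox → Maybe (V × Op) → Maybe (V × Op) → Maybe (V × Code) → Maybe (V × ⊤) → State × Out
  dispatch l k iv (just (w , o)) _ _ _ =
    mkSt (atX iv l o) idle k (hold 1 w (val o l)) , sendX l o (act o l)
  dispatch l k iv nothing (just (x , o)) _ _ =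
    mkSt (atX iv l o) idle k none , sendY l o x (act o l)
  dispatch l k iv nothing nothing (just (w , c)) _ = mkSt (mg iv l) (exec (code c)) (ret w ∷ k) none , silent
  dispatch l k iv nothing nothing nothing (just _) = resume (mg iv l) k , silent
  dispatch l k iv nothing nothing nothing nothing  = mkSt (mg iv l) idle k none , silent

  total : Loc → Res → (V → Maybe Res) → Res
  total l r f = squash (agg (λ u → if eqᵇ u (me l) then just r else f u))

  vstep : State → Inbox → State × Out
  vstep (mkSt l (exec p) k m) iv = execStep l p k
  vstep (mkSt l (pulsing (suc j) f) k m) iv = mkSt (mg iv l) (pulsing j f) k none , silent
  vstep (mkSt l (pulsing zero f) k m) iv = mkSt (mg iv l) (exec (f (agg (grab getP4 iv)))) k none , silent
  vstep (mkSt l idle k (hold (suc j) w r)) iv = mkSt (mg iv l) idle k (hold j w r) , silent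
  vstep (mkSt l idle k (hold zero w r)) iv = mkSt (mg iv l) idle k none , sendTo w (p4 (total l r (grab getUp iv))) l
  vstep (mkSt l idle k none) iv =
    dispatch l k iv (firstJ (grab getP1 iv)) (firstJ (grab getP2 iv)) (firstJ (grab getCall iv)) (firstJ (grab getRet iv))

  inert : State → Bool
  inert (mkSt l idle k none) = true
  inert _ = false

  -- On the empty graph every vertex is light and in the set, so the potential starts at 0.
  start : V → State
  start v = mkSt (mkLoc v (λ _ → false) (mkInfo false true false (toV 0)) false
    (tabulate (λ _ → mkInfo false true false (toV 0)))) idle [] none

  -- An update must create at most one token. After an insertion the smaller ID takes it; after a
  -- deletion at most one endpoint is undominated, since an endpoint loses its domination only if
  -- the other one is in the set.
  onAdded onRemoved : V → State → State
  onAdded v s = if toℕ (me (loc s)) <ᵇ toℕ v then record s { ctl = exec (insProg (me (loc s)) v) } else s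
  onRemoved v s = let l = delNbr v (loc s) in
    record s { loc = l ; ctl = if ud l then exec (code settle) else idle }

  -- One pulse, round by round: L₂, L₃, L₄ are the local states and O₁ … O₄ the messages (from u to v).
  module PulseOf (σ : V → Loc) (w : V) (o : Op) where

    isX : V → Bool
    isX v = scope o (σ w) v

    O₁ : V → V → Maybe M
    O₁ u v = if eqᵇ u w ∧ isX v then just (mkM (p1 o) (inf (σ w))) else nothing

    L₂ : V → Loc
    L₂ v = mg (tabulate (λ u → O₁ u v)) (if isX v then setInf (act o (σ v)) (σ v) else σ v)

    O₂ : V → V → Maybe M
    O₂ u v = if isX u ∧ (deep o ∧ fwd (σ u) v) then just (mkM (p2 o) (act o (σ u))) else nothing

    parY : V → Maybe (V × Op)
    parY v = if isX v ∨ eqᵇ v w then nothing else firstJ (λ u → O₂ u v >>=ᴹ getP2)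

    memY : Maybe (V × Op) → Loc → Loc
    memY nothing        l = l
    memY (just (x , o′)) l = setInf (act o′ l) l

    L₃ : V → Loc
    L₃ v = mg (tabulate (λ u → O₂ u v)) (memY (parY v) (L₂ v))

    outY : Maybe (V × Op) → Loc → Out
    outY nothing        l = silent
    outY (just (x , o′)) l = sendY l o′ x (act o′ l)

    O₃ : V → V → Maybe M
    O₃ u v = outY (parY u) (L₂ u) v

    L₄ : V → Loc
    L₄ v = mg (tabulate (λ u → O₃ u v)) (L₃ v)

    tot : V → Res
    tot x = total (L₃ x) (val o (σ x)) (λ u → O₃ u x >>=ᴹ getUp)

    O₄ : V → V → Maybe M
    O₄ u v = if isX u ∧ eqᵇ v w then just (mkM (p4 (tot u)) (inf (L₃ u))) else nothing

    after : V → Loc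
    after v = mg (tabulate (λ u → O₄ u v)) (L₄ v)

    answer : Ans
    answer = agg (λ u → O₄ u w >>=ᴹ getP4)

    pulseMsgs : ℕ
    pulseMsgs = ((∑ (λ u → count (λ v → is-just (O₁ u v))) + ∑ (λ u → count (λ v → is-just (O₂ u v))))
      + ∑ (λ u → count (λ v → is-just (O₃ u v)))) + ∑ (λ u → count (λ v → is-just (O₄ u v)))

  setL : V → Loc → (V → Loc) → V → Loc
  setL w l σ v = if eqᵇ v w then l else σ v

  learn : V → Info → Loc → Loc
  learn u i l = mg (tabulate (λ x → if eqᵇ x u then just (mkM retK i) else nothing)) l

  hear : V → V → (V → Loc) → V → Loc
  hear u v σ = setL v (learn u (inf (σ u)) (σ v)) σ

  -- Run G μ w p σ t σ′: on the graph G, program p run at w turns σ into σ′ in t rounds, with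
  -- at most t * μ messages.
  data Run (G : Graph n) (μ : ℕ) (w : V) : Prog → (V → Loc) → ℕ → (V → Loc) → Set where
    halt : ∀ {σ} → Run G μ w halt σ 0 σ
    upd : ∀ {f p σ t σ′} → Run G μ w p (setL w (f (σ w)) σ) t σ′ → Run G μ w (upd f p) σ (suc t) σ′
    ask : ∀ {f σ t σ′} → Run G μ w (f (σ w)) σ t σ′ → Run G μ w (ask f) σ (suc t) σ′
    goto : ∀ {c σ t σ′} → Run G μ w (code c) σ t σ′ → Run G μ w (goto c) σ (suc t) σ′
    sub : ∀ {c p σ t₁ σ₁ t₂ σ₂} → Run G μ w (code c) σ t₁ σ₁ → Run G μ w p σ₁ t₂ σ₂ →
      Run G μ w (sub c p) σ (suc t₁ + suc t₂) σ₂
    call : ∀ {z c p σ t₁ σ₁ t₂ σ₂} → w ≢ z → G w z ≡ true → Run G μ z (code c) (hear w z σ) t₁ σ₁ →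
      Run G μ w p (hear z w σ₁) t₂ σ₂ → Run G μ w (call z c p) σ ((2 + t₁) + (2 + t₂)) σ₂
    pulse : ∀ {o f σ t σ′} → (∀ v → me (σ v) ≡ v) → (∀ u v → nbr (σ u) v ≡ true → G u v ≡ true) →
      PulseOf.pulseMsgs σ w o ≤ 5 * μ → Run G μ w (f (PulseOf.answer σ w o)) (PulseOf.after σ w o) t σ′ →
      Run G μ w (pulse o f) σ (5 + t) σ′

  -- The effect of a pulse

  tb-mg : ∀ (O : V → Maybe M) l u → tb (mg (tabulate O) l) u ≡ maybe info (tb l u) (O u)
  tb-mg O l u = trans (lookup∘tabulate (λ u → maybe info (tb l u) (lookup (tabulate O) u)) u) (cong (maybe info (tb l u)) (lookup∘tabulate O u))

  mg-none : ∀ (O : V → Maybe M) l → (∀ u → O u ≡ nothing) → mg (tabulate O) l ≡ l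
  mg-none O l h = cong (λ t → record l { tab = t })
    (trans (tabulate-cong (λ u → cong (maybe info (tb l u)) (trans (lookup∘tabulate O u) (h u)))) (tabulate∘lookup (tab l)))

  record Wf (σ : V → Loc) : Set where
    field
      me≡ : ∀ v → me (σ v) ≡ v
      nbr-sym : ∀ u v → nbr (σ u) v ≡ nbr (σ v) u
      nbr-irr : ∀ u → nbr (σ u) u ≡ false
  open Wf public

  toV-id : ∀ {m} → m ≤ vmax → toℕ (toV m) ≡ m
  toV-id {m} h = trans (toℕ-fromℕ< (s≤s (m⊓n≤n m vmax))) (m≤n⇒m⊓n≡m h)

  best-just : ∀ {m} (f : Fin m → Maybe (Val × V)) {i d z} → best f ≡ just (i , d , z) →
    f i ≡ just (d , z) × (∀ j d′ z′ → f j ≡ just (d′ , z′) → toℕ d ≤ toℕ d′)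
  best-nothing : ∀ {m} (f : Fin m → Maybe (Val × V)) → best f ≡ nothing → ∀ j → f j ≡ nothing

  best-just {suc m} f {i} {d} {z} h = go (f zero) refl (best (f ∘ suc)) refl h
    where
    go : ∀ a → f zero ≡ a → ∀ r → best (f ∘ suc) ≡ r → better (zeroIdx a) (sucIdx r) ≡ just (i , d , z) →
      f i ≡ just (d , z) × (∀ j d′ z′ → f j ≡ just (d′ , z′) → toℕ d ≤ toℕ d′)
    go nothing e₀ (just (i′ , d′ , z′)) e refl = proj₁ ih , λ
      { zero d″ z″ h → case trans (sym e₀) h of λ () ; (suc j) d″ z″ h → proj₂ ih j d″ z″ h }
      where ih = best-just (f ∘ suc) e
    go (just (d′ , z′)) e₀ nothing e refl = e₀ , λ
      { zero d″ z″ h → ≤-reflexive (cong toℕ (same h)) ; (suc j) d″ z″ h → case trans (sym (best-nothing (f ∘ suc) e j)) h of λ () }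
      where
      same : ∀ {d″ z″} → f zero ≡ just (d″ , z″) → d′ ≡ d″
      same h with trans (sym e₀) h
      ... | refl = refl
    go (just (d₀ , z₀)) e₀ (just (i₁ , d₁ , z₁)) e h′ = go′ (toℕ d₀ ≤ᵇ toℕ d₁) refl h′
      where
      ih = best-just (f ∘ suc) e
      same : ∀ {d″ z″} → f zero ≡ just (d″ , z″) → d₀ ≡ d″
      same h with trans (sym e₀) h
      ... | refl = refl
      go′ : ∀ c → (toℕ d₀ ≤ᵇ toℕ d₁) ≡ c → (if c then just (zero , d₀ , z₀) else just (suc i₁ , d₁ , z₁)) ≡ just (i , d , z) →
        f i ≡ just (d , z) × (∀ j d′ z′ → f j ≡ just (d′ , z′) → toℕ d ≤ toℕ d′)
      go′ true  c refl = e₀ , λ { zero d″ z″ h → ≤-reflexive (cong toℕ (same h))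
                                ; (suc j) d″ z″ h → ≤-trans (≤ᵇ⇒≤ (toℕ d₀) (toℕ d₁) (subst Data.Bool.T (sym c) tt)) (proj₂ ih j d″ z″ h) }
      go′ false c refl = proj₁ ih , λ { zero d″ z″ h → ≤-trans (<⇒≤ (≰⇒> (λ le → true≢false (dec-true (toℕ d₀ ≤? toℕ d₁) le) c))) (≤-reflexive (cong toℕ (same h)))
                                      ; (suc j) d″ z″ h → proj₂ ih j d″ z″ h }

  best-nothing {suc m} f h j = go (f zero) refl (best (f ∘ suc)) refl h j
    where
    go : ∀ a → f zero ≡ a → ∀ r → best (f ∘ suc) ≡ r → better (zeroIdx a) (sucIdx r) ≡ nothing → ∀ j → f j ≡ nothing
    go nothing e₀ nothing e h zero = e₀
    go nothing e₀ nothing e h (suc j) = best-nothing (f ∘ suc) e j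
    go (just (d₀ , z₀)) e₀ (just (i₁ , d₁ , z₁)) e h j = go′ (toℕ d₀ ≤ᵇ toℕ d₁) h
      where
      go′ : ∀ c → (if c then just (zero , d₀ , z₀) else just (suc i₁ , d₁ , z₁)) ≡ nothing → f j ≡ nothing
      go′ true ()
      go′ false ()

  act-hv : ∀ o l → hv (act o l) ≡ hv (inf l)
  act-hv poll l = refl
  act-hv cnt l = refl
  act-hv cntD l = refl
  act-hv kick l = refl
  act-hv alv l = refl
  act-hv dgr l = refl
  act-hv (bit _ _) l = refl
  act-hv (jn _) l = refl

  -- Only a light vertex may be ignorant of a heavy neighbour, which could have too many light
  -- neighbours to inform. The flag `hv` is always known: a vertex changes its weight only while its
  -- degree is small enough for a `poll`.
  record Knows (σ : V → Loc) (v u : V) : Set where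
    constructor knows
    field
      full : (hv (inf (σ v)) ≡ true ⊎ hv (inf (σ u)) ≡ false) → tb (σ v) u ≡ inf (σ u)
      flag : hv (tb (σ v) u) ≡ hv (inf (σ u))
  open Knows public

  module Effect (σ : V → Loc) (w : V) (o : Op) (wf : Wf σ) where
    open PulseOf σ w o public

    X-root : isX w ≡ false
    X-root = trans (cong (λ z → (nbr (σ w) w ∧ (allScope o ∨ hv (tb (σ w) w))) ∧ z) (cong not (trans (cong (eqᵇ w) (me≡ wf w)) (eqᵇ-refl w)))) (∧-zeroʳ _)

    isX⇒nbr : ∀ v → isX v ≡ true → nbr (σ w) v ≡ true
    isX⇒nbr v e = ∧-trueˡ (∧-trueˡ {nbr (σ w) v ∧ _} e)

    isX⇒≢ : ∀ v → isX v ≡ true → v ≢ w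
    isX⇒≢ v e refl = true≢false e X-root

    O₁-notX : ∀ u v → isX v ≡ false → O₁ u v ≡ nothing
    O₁-notX u v e = if-false (trans (cong (eqᵇ u w ∧_) e) (∧-zeroʳ _))

    L₂-notX : ∀ v → isX v ≡ false → L₂ v ≡ σ v
    L₂-notX v e = trans (mg-none (λ u → O₁ u v) _ (λ u → O₁-notX u v e)) (if-false e)

    data Rank (v : V) : Set where
      isRoot : v ≡ w → Rank v
      isXr   : isX v ≡ true → Rank v
      isYr   : ∀ x → isX v ≡ false → v ≢ w → parY v ≡ just (x , o) → isX x ≡ true → deep o ≡ true → fwd (σ x) v ≡ true → Rank v
      isO    : isX v ≡ false → v ≢ w → parY v ≡ nothing → Rank v

    fromO₂ : ∀ u v {o′} → (O₂ u v >>=ᴹ getP2) ≡ just o′ → o′ ≡ o × (isX u ≡ true × deep o ≡ true × fwd (σ u) v ≡ true)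
    fromO₂ u v {o′} h = go (isX u ∧ (deep o ∧ fwd (σ u) v)) refl h
      where
      go : ∀ c → (isX u ∧ (deep o ∧ fwd (σ u) v)) ≡ c → ((if c then just (mkM (p2 o) (act o (σ u))) else nothing) >>=ᴹ getP2) ≡ just o′ →
        o′ ≡ o × (isX u ≡ true × deep o ≡ true × fwd (σ u) v ≡ true)
      go true e refl = refl , ∧-trueˡ e , ∧-trueˡ (∧-trueʳ {isX u} e) , ∧-trueʳ {deep o} (∧-trueʳ {isX u} e)

    rank : ∀ v → Rank v
    rank v with v ≟ w
    ... | yes p = isRoot p
    ... | no p = go (isX v) refl
      where
      go : ∀ c → isX v ≡ c → Rank v
      go true e = isXr e
      go false e = go′ (firstJ (λ u → O₂ u v >>=ᴹ getP2)) refl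
        where
        par : parY v ≡ firstJ (λ u → O₂ u v >>=ᴹ getP2)
        par = if-false (trans (cong (_∨ eqᵇ v w) e) (eqᵇ-≢ p))
        go′ : ∀ r → firstJ (λ u → O₂ u v >>=ᴹ getP2) ≡ r → Rank v
        go′ nothing h = isO e p (trans par h)
        go′ (just (x , o′)) h with fromO₂ x v (firstJ-just _ h)
        ... | refl , (a , d , f) = isYr x e p (trans par h) a d f

    member : V → Bool
    member v = isX v ∨ is-just (parY v)

    par-X : ∀ v → isX v ≡ true → parY v ≡ nothing
    par-X v e = if-true (∨-introˡ e)

    par-root : parY w ≡ nothing
    par-root = if-true (∨-introʳ {isX w} (eqᵇ-refl w))

    member-root : member w ≡ false
    member-root = cong₂ (λ a r → a ∨ is-just r) X-root par-root

    memY-inf : ∀ v → inf (L₃ v) ≡ (if member v then act o (σ v) else inf (σ v))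
    memY-inf v with rank v
    ... | isRoot refl = trans (cong (λ r → inf (memY r (L₂ v))) par-root) (trans (cong inf (L₂-notX v X-root)) (sym (if-false member-root)))
    ... | isXr e = trans (cong (λ r → inf (memY r (L₂ v))) (par-X v e)) (trans (cong inf (if-true e)) (sym (if-true (∨-introˡ e))))
    ... | isYr x e p q _ _ _ = trans (cong (λ r → inf (memY r (L₂ v))) q) (trans (cong (act o) (L₂-notX v e)) (sym (if-true (trans (cong₂ (λ a r → a ∨ is-just r) e q) refl))))
    ... | isO e p q = trans (cong (λ r → inf (memY r (L₂ v))) q) (trans (cong inf (L₂-notX v e)) (sym (if-false (trans (cong₂ (λ a r → a ∨ is-just r) e q) refl))))

    inf-after : ∀ v → inf (after v) ≡ (if member v then act o (σ v) else inf (σ v))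
    inf-after = memY-inf

    hv-after : ∀ v → hv (inf (after v)) ≡ hv (inf (σ v))
    hv-after v = trans (cong hv (inf-after v)) (go (member v))
      where
      go : ∀ c → hv (if c then act o (σ v) else inf (σ v)) ≡ hv (inf (σ v))
      go true  = act-hv o (σ v)
      go false = refl

    keeps : ∀ {A : Set} (f : Loc → A) → (∀ i l → f (setInf i l) ≡ f l) → (∀ iv l → f (mg iv l) ≡ f l) → ∀ v → f (after v) ≡ f (σ v)
    keeps f h k v = trans (k (tabulate (λ u → O₄ u v)) (L₄ v)) (trans (k (tabulate (λ u → O₃ u v)) (L₃ v))
      (trans (k (tabulate (λ u → O₂ u v)) (memY (parY v) (L₂ v))) (trans (go (parY v))
        (trans (k (tabulate (λ u → O₁ u v)) (if isX v then setInf (act o (σ v)) (σ v) else σ v)) (go′ (isX v))))))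
      where
      go : ∀ r → f (memY r (L₂ v)) ≡ f (L₂ v)
      go nothing = refl
      go (just (x , o′)) = h (act o′ (L₂ v)) (L₂ v)
      go′ : ∀ c → f (if c then setInf (act o (σ v)) (σ v) else σ v) ≡ f (σ v)
      go′ true = h (act o (σ v)) (σ v)
      go′ false = refl

    nbr-after : ∀ v → nbr (after v) ≡ nbr (σ v)
    nbr-after = keeps nbr (λ _ _ → refl) (λ _ _ → refl)

    pin-after : ∀ v → pin (after v) ≡ pin (σ v)
    pin-after = keeps pin (λ _ _ → refl) (λ _ _ → refl)

    wf-after : Wf after
    wf-after = record
      { me≡ = λ v → trans (keeps me (λ _ _ → refl) (λ _ _ → refl) v) (me≡ wf v)
      ; nbr-sym = λ u v → trans (cong (λ f → f v) (nbr-after u)) (trans (nbr-sym wf u v) (cong (λ f → f u) (sym (nbr-after v))))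
      ; nbr-irr = λ u → trans (cong (λ f → f u) (nbr-after u)) (nbr-irr wf u) }

    -- Acting precedes sending, so every message of a pulse, in whichever round, already shows the
    -- final `Info` of its sender. A table entry is thus either untouched or up to date, and the
    -- order of arrival does not matter.
    Honest : (V → V → Maybe M) → Set
    Honest O = ∀ u v m → O u v ≡ just m → info m ≡ inf (after u)

    guarded : ∀ c {m m′ : M} {i} → (if c then just m else nothing) ≡ just m′ → (c ≡ true → info m ≡ i) → info m′ ≡ i
    guarded true refl h = h refl

    honest₁ : Honest O₁
    honest₁ u v m h = guarded (eqᵇ u w ∧ isX v) h λ c → trans (cong (λ z → inf (σ z)) (sym (eqᵇ⇒≡ {a = u} {w} (∧-trueˡ c))))
      (sym (trans (inf-after u) (if-false (trans (cong member (eqᵇ⇒≡ {a = u} {w} (∧-trueˡ c))) member-root))))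

    honest₂ : Honest O₂
    honest₂ u v m h = guarded (isX u ∧ (deep o ∧ fwd (σ u) v)) h λ c → sym (trans (inf-after u) (if-true {b = member u} (∨-introˡ {isX u} (∧-trueˡ {isX u} c))))

    honest₃ : Honest O₃
    honest₃ u v m h = go (rank u)
      where
      go : Rank u → info m ≡ inf (after u)
      go (isRoot refl) = case trans (sym (cong (λ r → outY r (L₂ u) v) par-root)) h of λ ()
      go (isXr e) = case trans (sym (cong (λ r → outY r (L₂ u) v) (par-X u e))) h of λ ()
      go (isO _ _ q) = case trans (sym (cong (λ r → outY r (L₂ u) v) q)) h of λ ()
      go (isYr x e p q _ _ _) = guarded (eqᵇ v x ∨ (ann o ∧ fwd (L₂ u) v)) (trans (sym (cong (λ r → outY r (L₂ u) v) q)) h)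
        λ _ → trans (cong (act o) (L₂-notX u e)) (sym (trans (inf-after u) (if-true (cong₂ (λ a r → a ∨ is-just r) e q))))

    honest₄ : Honest O₄
    honest₄ u v m h = guarded (isX u ∧ eqᵇ v w) h λ _ → refl

    merged : ∀ O l v u → Honest O → (tb (mg (tabulate (λ u → O u v)) l) u ≡ tb l u × O u v ≡ nothing) ⊎ tb (mg (tabulate (λ u → O u v)) l) u ≡ inf (after u)
    merged O l v u h = go (O u v) refl
      where
      go : ∀ r → O u v ≡ r → (tb (mg (tabulate (λ u → O u v)) l) u ≡ tb l u × O u v ≡ nothing) ⊎ tb (mg (tabulate (λ u → O u v)) l) u ≡ inf (after u)
      go nothing e = inj₁ (trans (tb-mg (λ u → O u v) l u) (cong (maybe info (tb l u)) e) , e)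
      go (just m) e = inj₂ (trans (tb-mg (λ u → O u v) l u) (trans (cong (maybe info (tb l u)) e) (h u v m e)))

    Unheard : V → V → Set
    Unheard v u = O₁ u v ≡ nothing × O₂ u v ≡ nothing × O₃ u v ≡ nothing × O₄ u v ≡ nothing

    heard : ∀ v u → (tb (after v) u ≡ tb (σ v) u × Unheard v u) ⊎ tb (after v) u ≡ inf (after u)
    heard v u = in₄ (merged O₄ (L₄ v) v u honest₄)
      where
      Kept : Loc → Loc → (V → V → Maybe M) → Set
      Kept l l′ O = (tb l u ≡ tb l′ u × O u v ≡ nothing) ⊎ tb l u ≡ inf (after u)
      Goal : Set
      Goal = (tb (after v) u ≡ tb (σ v) u × Unheard v u) ⊎ tb (after v) u ≡ inf (after u)
      m₂ m₁ : Loc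
      m₂ = memY (parY v) (L₂ v)
      m₁ = if isX v then setInf (act o (σ v)) (σ v) else σ v
      same₂ : ∀ r → tb (memY r (L₂ v)) u ≡ tb (L₂ v) u
      same₂ nothing = refl
      same₂ (just _) = refl
      same₁ : ∀ c → tb (if c then setInf (act o (σ v)) (σ v) else σ v) u ≡ tb (σ v) u
      same₁ true = refl
      same₁ false = refl
      in₁ : tb (after v) u ≡ tb (L₂ v) u → O₄ u v ≡ nothing → O₃ u v ≡ nothing → O₂ u v ≡ nothing → Kept (L₂ v) m₁ O₁ → Goal
      in₁ e h₄ h₃ h₂ (inj₂ e′) = inj₂ (trans e e′)
      in₁ e h₄ h₃ h₂ (inj₁ (e′ , h₁)) = inj₁ (trans e (trans e′ (same₁ (isX v))) , h₁ , h₂ , h₃ , h₄)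
      in₂ : tb (after v) u ≡ tb (L₃ v) u → O₄ u v ≡ nothing → O₃ u v ≡ nothing → Kept (L₃ v) m₂ O₂ → Goal
      in₂ e h₄ h₃ (inj₂ e′) = inj₂ (trans e e′)
      in₂ e h₄ h₃ (inj₁ (e′ , h₂)) = in₁ (trans e (trans e′ (same₂ (parY v)))) h₄ h₃ h₂ (merged O₁ m₁ v u honest₁)
      in₃ : tb (after v) u ≡ tb (L₄ v) u → O₄ u v ≡ nothing → Kept (L₄ v) (L₃ v) O₃ → Goal
      in₃ e h₄ (inj₂ e′) = inj₂ (trans e e′)
      in₃ e h₄ (inj₁ (e′ , h₃)) = in₂ (trans e e′) h₄ h₃ (merged O₂ m₂ v u honest₂)
      in₄ : Kept (after v) (L₄ v) O₄ → Goal
      in₄ (inj₂ e) = inj₂ e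
      in₄ (inj₁ (e , h₄)) = in₃ e h₄ (merged O₃ (L₃ v) v u honest₃)

    not-nothing : ∀ {A : Set} {c : Bool} {x : A} → c ≡ true → (if c then just x else nothing) ≡ nothing → ⊥
    not-nothing refl ()

    Tells : V → V → Set
    Tells u v = (isX v ≡ true × u ≡ w) ⊎ (isX u ≡ true × v ≡ w) ⊎ (member u ≡ true × deep o ≡ true × ann o ≡ true × fwd (σ u) v ≡ true)

    told : ∀ v u → Tells u v → tb (after v) u ≡ inf (after u)
    told v u h = pick (heard v u)
      where
      pick : (tb (after v) u ≡ tb (σ v) u × Unheard v u) ⊎ tb (after v) u ≡ inf (after u) → tb (after v) u ≡ inf (after u)
      pick (inj₂ e) = e
      pick (inj₁ (_ , h₁ , h₂ , h₃ , h₄)) = ⊥-elim (go h)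
        where
        byMember : member u ≡ true → deep o ≡ true → ann o ≡ true → fwd (σ u) v ≡ true → Rank u → ⊥
        byMember mu d a f (isRoot refl) = true≢false mu member-root
        byMember mu d a f (isXr e) = not-nothing (∧-intro e (∧-intro d f)) h₂
        byMember mu d a f (isO e _ q) = true≢false mu (cong₂ (λ a r → a ∨ is-just r) e q)
        byMember mu d a f (isYr x e _ q _ _ _) = not-nothing {c = eqᵇ v x ∨ (ann o ∧ fwd (L₂ u) v)} (∨-introʳ {eqᵇ v x} (∧-intro a (trans (cong (λ l → fwd l v) (L₂-notX u e)) f)))
          (trans (sym (cong (λ r → outY r (L₂ u) v) q)) h₃)
        go : Tells u v → ⊥
        go (inj₁ (e , refl)) = not-nothing (∧-intro (eqᵇ-refl w) e) h₁
        go (inj₂ (inj₁ (e , refl))) = not-nothing (∧-intro e (eqᵇ-refl w)) h₄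
        go (inj₂ (inj₂ (mu , d , a , f))) = byMember mu d a f (rank u)

    -- The state before the pulse: only Info of the root may be unknown, and then only to X.
    PreKnows : Set
    PreKnows = ∀ v u → nbr (σ v) u ≡ true → Knows σ v u ⊎ (u ≡ w × isX v ≡ true)

    -- After a quiet pulse, the root also learns the Info of X.
    PreKnows⁺ : Set
    PreKnows⁺ = ∀ v u → nbr (σ v) u ≡ true → Knows σ v u ⊎ (u ≡ w × isX v ≡ true) ⊎ (v ≡ w × isX u ≡ true)

    Quiet : Set
    Quiet = ∀ l → act o l ≡ inf l

    inf-quiet : Quiet → ∀ x → inf (after x) ≡ inf (σ x)
    inf-quiet q x = trans (inf-after x) (go (member x))
      where
      go : ∀ c → (if c then act o (σ x) else inf (σ x)) ≡ inf (σ x)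
      go true = q (σ x)
      go false = refl

    -- Nothing changes in a quiet pulse, so old knowledge survives; the entries about the root and
    -- those at the root are supplied by the first and the last round.
    knows-quiet : Quiet → PreKnows⁺ → ∀ v u → nbr (after v) u ≡ true → Knows after v u
    knows-quiet q pre v u nb = fin (heard v u) (pre v u (trans (cong (λ f → f u) (sym (nbr-after v))) nb))
      where
      inf≡ : ∀ x → inf (after x) ≡ inf (σ x)
      inf≡ = inf-quiet q
      fresh : tb (after v) u ≡ inf (after u) → Knows after v u
      fresh e = knows (λ _ → e) (cong hv e)
      fin : (_ × _) ⊎ tb (after v) u ≡ inf (after u) → Knows σ v u ⊎ (u ≡ w × isX v ≡ true) ⊎ (v ≡ w × isX u ≡ true) → Knows after v u
      fin (inj₂ e) _ = fresh e
      fin _ (inj₂ (inj₁ (e , x))) = fresh (told v u (inj₁ (x , e)))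
      fin _ (inj₂ (inj₂ (e , x))) = fresh (told v u (inj₂ (inj₁ (x , e))))
      fin (inj₁ (e , _)) (inj₁ k) = knows (λ { (inj₁ h) → trans e (trans (full k (inj₁ (trans (cong hv (sym (inf≡ v))) h))) (sym (inf≡ u)))
                                         ; (inj₂ h) → trans e (trans (full k (inj₂ (trans (cong hv (sym (inf≡ u))) h))) (sym (inf≡ u))) })
                                      (trans (cong hv e) (trans (flag k) (cong hv (sym (inf≡ u)))))

    module Narrow (narrow : allScope o ≡ false) (pre : PreKnows) where

      flag′ : ∀ v u → nbr (σ v) u ≡ true → u ≢ w → hv (tb (σ v) u) ≡ hv (inf (σ u))
      flag′ v u nb p with pre v u nb
      ... | inj₁ k = flag k
      ... | inj₂ (e , _) = ⊥-elim (p e)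

      X⇒hv : ∀ v → isX v ≡ true → hv (inf (σ v)) ≡ true
      X⇒hv v e = trans (sym (flag′ w v (isX⇒nbr v e) (isX⇒≢ v e)))
        (trans (cong (_∨ hv (tb (σ w) v)) (sym narrow)) (∧-trueʳ {nbr (σ w) v} (∧-trueˡ {nbr (σ w) v ∧ (allScope o ∨ hv (tb (σ w) v))} e)))

      ⇒X : ∀ v → nbr (σ w) v ≡ true → hv (inf (σ v)) ≡ true → isX v ≡ true
      ⇒X v nb h = ∧-intro (∧-intro nb (∨-introʳ {allScope o} (trans (flag′ w v nb v≢w) h)))
        (not-false (eqᵇ-≢ (λ e → v≢w (trans e (me≡ wf w)))))
        where
        v≢w : v ≢ w
        v≢w refl = true≢false nb (nbr-irr wf w)

      fwd⇒ : ∀ x v → v ≢ w → fwd (σ x) v ≡ true → nbr (σ x) v ≡ true × hv (inf (σ v)) ≡ true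
      fwd⇒ x v p f = ∧-trueˡ (∧-trueˡ {heavyNbr (σ x) v} f) ,
        trans (sym (flag′ x v (∧-trueˡ (∧-trueˡ {heavyNbr (σ x) v} f)) p)) (∧-trueʳ {nbr (σ x) v} (∧-trueˡ {heavyNbr (σ x) v} f))

      ⇒fwd : ∀ x v → v ≢ w → nbr (σ x) v ≡ true → hv (inf (σ v)) ≡ true → fwd (σ x) v ≡ true
      ⇒fwd x v p nb h = ∧-intro (∧-intro nb (trans (flag′ x v nb p) h)) (not-false (eqᵇ-≢ (λ e → true≢false nb (trans (cong (nbr (σ x)) (trans e (me≡ wf x))) (nbr-irr wf x)))))

      member⇒hv : ∀ v → member v ≡ true → hv (inf (σ v)) ≡ true
      member⇒hv v e with rank v
      ... | isRoot refl = true≢false e member-root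
      ... | isXr x = X⇒hv v x
      ... | isYr x _ p _ _ _ f = proj₂ (fwd⇒ x v p f)
      ... | isO x p q = true≢false e (cong₂ (λ a r → a ∨ is-just r) x q)

      member-reach : ∀ v → member v ≡ true → nbr (σ w) v ≡ true ⊎ (∃ λ x → nbr (σ w) x ≡ true × hv (inf (σ x)) ≡ true × nbr (σ x) v ≡ true)
      member-reach v e with rank v
      ... | isRoot refl = true≢false e member-root
      ... | isXr x = inj₁ (isX⇒nbr v x)
      ... | isYr x _ p _ a _ f = inj₂ (x , isX⇒nbr x a , X⇒hv x a , proj₁ (fwd⇒ x v p f))
      ... | isO x p q = true≢false e (cong₂ (λ a r → a ∨ is-just r) x q)

      near-member : deep o ≡ true → ∀ x v → isX x ≡ true → nbr (σ x) v ≡ true → hv (inf (σ v)) ≡ true → v ≢ w → member v ≡ true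
      near-member d x v ex nb h p with rank v
      ... | isRoot e = ⊥-elim (p e)
      ... | isXr e = ∨-introˡ e
      ... | isYr y e _ q _ _ _ = cong₂ (λ a r → a ∨ is-just r) e q
      ... | isO e _ q = case trans (sym (cong (_>>=ᴹ getP2) (if-true (∧-intro ex (∧-intro d (⇒fwd x v p nb h)))))) (firstJ-nothing _ (trans (sym (if-false (trans (cong (_∨ eqᵇ v w) e) (eqᵇ-≢ p)))) q) x) of λ ()

      -- A vertex whose `Info` may have changed is a heavy member. The root hears of it in the last
      -- round, other heavy neighbours by forwarding or announcement, and light neighbours need only
      -- the flag `hv`, which no operation changes.
      knows-loud : deep o ≡ true → ann o ≡ true → ∀ v u → nbr (after v) u ≡ true → Knows after v u
      knows-loud d a v u nb′ = go (member u) refl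
        where
        nb : nbr (σ v) u ≡ true
        nb = trans (cong (λ f → f u) (sym (nbr-after v))) nb′
        nbu : nbr (σ u) v ≡ true
        nbu = trans (nbr-sym wf u v) nb
        fresh : tb (after v) u ≡ inf (after u) → Knows after v u
        fresh e = knows (λ _ → e) (cong hv e)
        go : ∀ c → member u ≡ c → Knows after v u
        go false e = fin (heard v u) (pre v u nb)
          where
          same : inf (after u) ≡ inf (σ u)
          same = trans (inf-after u) (if-false e)
          fin : (_ × _) ⊎ tb (after v) u ≡ inf (after u) → Knows σ v u ⊎ (u ≡ w × isX v ≡ true) → Knows after v u
          fin (inj₂ e) _ = fresh e
          fin _ (inj₂ (e , x)) = fresh (told v u (inj₁ (x , e)))
          fin (inj₁ (t , _)) (inj₁ k) = knows
            (λ { (inj₁ h) → trans t (trans (full k (inj₁ (trans (sym (hv-after v)) h))) (sym same))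
               ; (inj₂ h) → trans t (trans (full k (inj₂ (trans (sym (hv-after u)) h))) (sym same)) })
            (trans (cong hv t) (trans (flag k) (sym (hv-after u))))
        go true e = heavy (hv (inf (σ v))) refl
          where
          hu : hv (inf (σ u)) ≡ true
          hu = member⇒hv u e
          u≢w : u ≢ w
          u≢w refl = true≢false e member-root
          heavy : ∀ c → hv (inf (σ v)) ≡ c → Knows after v u
          heavy true hv≡ = fresh (told v u (route (v ≟ w)))
            where
            route : Dec (v ≡ w) → Tells u v
            route (yes refl) = inj₂ (inj₁ (⇒X u nb hu , refl))
            route (no p) = inj₂ (inj₂ (e , d , a , ⇒fwd u v p nbu hv≡))
          heavy false hv≡ = light (heard v u)
            where
            light : (_ × _) ⊎ tb (after v) u ≡ inf (after u) → Knows after v u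
            light (inj₂ e) = fresh e
            light (inj₁ (t , _)) = knows (λ { (inj₁ h) → true≢false (trans (sym (hv-after v)) h) hv≡ ; (inj₂ h) → true≢false hu (trans (sym (hv-after u)) h) })
              (trans (cong hv t) (trans (flag′ v u nb u≢w) (sym (hv-after u))))

  -- Aggregation of answers and message count of a pulse

  module Collect (σ : V → Loc) (w : V) (o : Op) (wf : Wf σ) where
    open Effect σ w o wf using (L₂; L₂-notX; L₃; O₁; O₂; O₃; O₄; Rank; X-root; answer; isO; isRoot; isX; isXr; isYr; member; member-root; outY; par-X; par-root; parY; pulseMsgs; rank; tot; wf-after)

    isPar : Maybe (V × Op) → V → Bool
    isPar nothing        x = false
    isPar (just (y , _)) x = eqᵇ x y

    owner : V → V → Bool
    owner x u = eqᵇ x u ∨ isPar (parY u) x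

    sent : V → V → Maybe Res
    sent x u = if eqᵇ u (me (L₃ x)) then just (val o (σ x)) else (O₃ u x >>=ᴹ getUp)

    sent≡ : ∀ x u → isX x ≡ true → sent x u ≡ (if owner x u then just (val o (σ u)) else nothing)
    sent≡ x u ex with u ≟ x
    ... | yes refl = trans (if-true (trans (cong (eqᵇ x) (me≡ wf-after x)) (eqᵇ-refl x))) (sym (if-true (∨-introˡ (eqᵇ-refl x))))
    ... | no p = trans (if-false (trans (cong (eqᵇ u) (me≡ wf-after x)) (eqᵇ-≢ p))) (trans (go (rank u)) (sym (cong (λ c → if c ∨ isPar (parY u) x then just (val o (σ u)) else nothing) (eqᵇ-≢ (p ∘ sym)))))
      where
      Goal : Maybe (V × Op) → Set
      Goal r = (outY r (L₂ u) x >>=ᴹ getUp) ≡ (if isPar r x then just (val o (σ u)) else nothing)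
      go : Rank u → Goal (parY u)
      go (isRoot refl) = subst Goal (sym par-root) refl
      go (isXr e) = subst Goal (sym (par-X u e)) refl
      go (isO _ _ q) = subst Goal (sym q) refl
      go (isYr y e _ q _ _ _) = subst Goal (sym q) (trans (cong (λ l → ((if eqᵇ x y ∨ (ann o ∧ fwd l x) then just (mkM (p3 (eqᵇ x y) (val o l)) (act o l)) else nothing) >>=ᴹ getUp)) (L₂-notX u e))
          (go′ (eqᵇ x y) (ann o ∧ fwd (σ u) x)))
        where
        go′ : ∀ c d → ((if c ∨ d then just (mkM (p3 c (val o (σ u))) (act o (σ u))) else nothing) >>=ᴹ getUp) ≡ (if c then just (val o (σ u)) else nothing)
        go′ true  d     = refl
        go′ false true  = refl
        go′ false false = refl

    -- A vertex of X answers for itself and a vertex of Y has a single parent, so passing values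
    -- through X neither omits nor repeats a member.
    owners : ∀ u → count (λ x → isX x ∧ owner x u) ≡ b2n (member u)
    owners u with rank u
    ... | isRoot refl = trans (∑-zero {n} {λ x → b2n (isX x ∧ owner x u)} (λ x → cong b2n (¬true⇒false (λ h → ∨-elim {eqᵇ x u} (∧-trueʳ {isX x} h)
            (λ e → true≢false (trans (cong isX (sym (eqᵇ⇒≡ e))) (∧-trueˡ h)) X-root) (λ e → case trans (sym (cong (λ r → isPar r x) par-root)) e of λ ()))))) (sym (cong b2n member-root))
    ... | isO e p q = trans (∑-zero {n} {λ x → b2n (isX x ∧ owner x u)} (λ x → cong b2n (¬true⇒false (λ h → ∨-elim {eqᵇ x u} (∧-trueʳ {isX x} h)
            (λ e′ → true≢false (trans (cong isX (sym (eqᵇ⇒≡ e′))) (∧-trueˡ h)) e) (λ e′ → case trans (sym (cong (λ r → isPar r x) q)) e′ of λ ()))))) (sym (cong b2n (cong₂ (λ a r → a ∨ is-just r) e q)))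
    ... | isXr e = trans (∑-cong (λ x → cong b2n (bool-ext {isX x ∧ owner x u} {eqᵇ x u} (λ h → ∨-elim {eqᵇ x u} (∧-trueʳ {isX x} h) id (λ e′ → case trans (sym (cong (λ r → isPar r x) (par-X u e))) e′ of λ ()))
            (λ h → ∧-intro (trans (cong isX (eqᵇ⇒≡ h)) e) (∨-introˡ h))))) (trans (count-eq≡1 u) (sym (cong b2n (∨-introˡ {isX u} {is-just (parY u)} e))))
    ... | isYr y e p q ey _ _ = trans (∑-cong (λ x → cong b2n (bool-ext {isX x ∧ owner x u} {eqᵇ x y} (λ h → ∨-elim {eqᵇ x u} (∧-trueʳ {isX x} h) (λ e′ → true≢false (trans (cong isX (sym (eqᵇ⇒≡ e′))) (∧-trueˡ h)) e) (λ e′ → trans (sym (cong (λ r → isPar r x) q)) e′))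
            (λ h → ∧-intro (trans (cong isX (eqᵇ⇒≡ h)) ey) (∨-introʳ {eqᵇ x u} (trans (cong (λ r → isPar r x) q) h)))))) (trans (count-eq≡1 y) (sym (cong b2n (cong₂ (λ a r → a ∨ is-just r) e q))))

    owner-of : ∀ u → member u ≡ true → ∃ λ x → isX x ≡ true × owner x u ≡ true
    owner-of u h with rank u
    ... | isRoot refl = true≢false h member-root
    ... | isXr e = u , e , ∨-introˡ (eqᵇ-refl u)
    ... | isYr y e _ q ey _ _ = y , ey , ∨-introʳ {eqᵇ y u} (trans (cong (λ r → isPar r y) q) (eqᵇ-refl y))
    ... | isO e _ q = true≢false h (cong₂ (λ a r → a ∨ is-just r) e q)

    collected : ∀ x → (O₄ x w >>=ᴹ getP4) ≡ (if isX x then just (tot x) else nothing)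
    collected x = go (isX x) (eqᵇ w w) (eqᵇ-refl w)
      where
      go : ∀ c d → d ≡ true → ((if c ∧ d then just (mkM (p4 (tot x)) (inf (L₃ x))) else nothing) >>=ᴹ getP4) ≡ (if c then just (tot x) else nothing)
      go true  true refl = refl
      go false true refl = refl

    -- The partial sums at X are at most `n * r`, so the hypothesis on `vmax` excludes saturation;
    -- the rest is an exchange of sums.
    total-sum : (g : Res → Val) → (∀ x → g (tot x) ≡ toV (∑ (λ u → field₀ g (sent x u)))) → ∀ r → (∀ u → toℕ (g (val o (σ u))) ≤ r) → n * r ≤ vmax →
      ∑ (λ x → field₀ g (O₄ x w >>=ᴹ getP4)) ≡ ∑ (λ u → member u · toℕ (g (val o (σ u))))
    total-sum g hg r hr fits = begin
      ∑ (λ x → field₀ g (O₄ x w >>=ᴹ getP4)) ≡⟨ ∑-cong (λ x → trans (cong (field₀ g) (collected x)) (one x (isX x) refl)) ⟩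
      ∑ (λ x → ∑ (λ u → (isX x ∧ owner x u) · val₀ u)) ≡⟨ ∑-swap (λ x u → (isX x ∧ owner x u) · val₀ u) ⟩
      ∑ (λ u → ∑ (λ x → (isX x ∧ owner x u) · val₀ u)) ≡⟨ ∑-cong (λ u → ∑-cong (λ x → ·-b2n (isX x ∧ owner x u) (val₀ u))) ⟩
      ∑ (λ u → ∑ (λ x → val₀ u * b2n (isX x ∧ owner x u))) ≡⟨ ∑-cong (λ u → ∑-*ˡ (val₀ u) (λ x → b2n (isX x ∧ owner x u))) ⟩
      ∑ (λ u → val₀ u * count (λ x → isX x ∧ owner x u)) ≡⟨ ∑-cong (λ u → trans (cong (val₀ u *_) (owners u)) (sym (·-b2n (member u) (val₀ u)))) ⟩
      ∑ (λ u → member u · val₀ u) ∎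
      where
      open ≡-Reasoning
      val₀ : V → ℕ
      val₀ u = toℕ (g (val o (σ u)))
      cell : ∀ x u → isX x ≡ true → field₀ g (sent x u) ≡ owner x u · val₀ u
      cell x u e = trans (cong (field₀ g) (sent≡ x u e)) (go (owner x u))
        where
        go : ∀ c → field₀ g (if c then just (val o (σ u)) else nothing) ≡ c · val₀ u
        go true = refl
        go false = refl
      one : ∀ x c → isX x ≡ c → field₀ g (if c then just (tot x) else nothing) ≡ ∑ (λ u → (c ∧ owner x u) · val₀ u)
      one x false e = sym (∑-zero {n} (λ _ → refl))
      one x true  e = trans (cong toℕ (hg x)) (trans (toV-id (≤-trans (∑-bound r (λ u → ≤-trans (≤-reflexive (cell x u e)) (≤-trans (·≤ (owner x u)) (hr u)))) fits))
        (∑-cong (λ u → cell x u e)))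

    pkOf : V → Maybe (Val × V)
    pkOf u = pk (val o (σ u))

    bst-just : ∀ {x d z} → bst answer ≡ just (x , d , z) →
      isX x ≡ true × (∃ λ y → owner x y ≡ true × pkOf y ≡ just (d , z)) × (∀ y d′ z′ → member y ≡ true → pkOf y ≡ just (d′ , z′) → toℕ d ≤ toℕ d′)
    bst-just {x} {d} {z} h = ex , inner (tot-pk x ex (trans (sym (cong (_>>=ᴹ pk) (trans (collected x) (if-true ex)))) sel)) , minimal
      where
      sel : ((O₄ x w >>=ᴹ getP4) >>=ᴹ pk) ≡ just (d , z)
      sel = proj₁ (best-just _ h)
      ex : isX x ≡ true
      ex = go (isX x) refl (trans (sym (cong (_>>=ᴹ pk) (collected x))) sel)
        where
        go : ∀ c → isX x ≡ c → ((if c then just (tot x) else nothing) >>=ᴹ pk) ≡ just (d , z) → isX x ≡ true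
        go true e _ = e
      tot-pk : ∀ x → isX x ≡ true → ∀ {d z} → pk (tot x) ≡ just (d , z) → ∃ λ u → best (λ u → sent x u >>=ᴹ pk) ≡ just (u , d , z)
      tot-pk x ex {d} {z} e = go (best (λ u → sent x u >>=ᴹ pk)) refl e
        where
        go : ∀ r → best (λ u → sent x u >>=ᴹ pk) ≡ r → (r >>=ᴹ (λ p → just (proj₂ p))) ≡ just (d , z) → ∃ λ u → best (λ u → sent x u >>=ᴹ pk) ≡ just (u , d , z)
        go (just (u , _)) e refl = u , e
      inner : (∃ λ u → best (λ u → sent x u >>=ᴹ pk) ≡ just (u , d , z)) → ∃ λ y → owner x y ≡ true × pkOf y ≡ just (d , z)
      inner (u , e) = u , go (owner x u) refl (trans (sym (cong (_>>=ᴹ pk) (sent≡ x u ex))) (proj₁ (best-just _ e)))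
        where
        go : ∀ c → owner x u ≡ c → ((if c then just (val o (σ u)) else nothing) >>=ᴹ pk) ≡ just (d , z) → owner x u ≡ true × pkOf u ≡ just (d , z)
        go true e h = e , h
      minimal : ∀ y d′ z′ → member y ≡ true → pkOf y ≡ just (d′ , z′) → toℕ d ≤ toℕ d′
      minimal y d′ z′ my e = at (owner-of y my)
        where
        at : (∃ λ x → isX x ≡ true × owner x y ≡ true) → toℕ d ≤ toℕ d′
        at (x′ , ex′ , ow) = go (best (λ u → sent x′ u >>=ᴹ pk)) refl
          where
          here′ : (sent x′ y >>=ᴹ pk) ≡ just (d′ , z′)
          here′ = trans (cong (_>>=ᴹ pk) (trans (sent≡ x′ y ex′) (if-true ow))) e
          go : ∀ r → best (λ u → sent x′ u >>=ᴹ pk) ≡ r → toℕ d ≤ toℕ d′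
          go nothing e′ = case trans (sym (best-nothing (λ u → sent x′ u >>=ᴹ pk) e′ y)) here′ of λ ()
          go (just (u , d″ , z″)) e′ = ≤-trans (proj₂ (best-just (λ u → (O₄ u w >>=ᴹ getP4) >>=ᴹ pk) h) x′ d″ z″
              (trans (cong (_>>=ᴹ pk) (trans (collected x′) (if-true ex′))) (cong (_>>=ᴹ (λ p → just (proj₂ p))) e′)))
            (proj₂ (best-just (λ u → sent x′ u >>=ᴹ pk) e′) y d′ z′ here′)

    bst-nothing : bst answer ≡ nothing → ∀ y → member y ≡ true → pkOf y ≡ nothing
    bst-nothing h y my = at (owner-of y my)
      where
      at : (∃ λ x → isX x ≡ true × owner x y ≡ true) → pkOf y ≡ nothing
      at (x , ex , ow) = trans (sym (cong (_>>=ᴹ pk) (trans (sent≡ x y ex) (if-true ow)))) (best-nothing (λ u → sent x u >>=ᴹ pk) (go (best (λ u → sent x u >>=ᴹ pk)) refl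
            (trans (sym (cong (_>>=ᴹ pk) (trans (collected x) (if-true ex)))) (best-nothing (λ u → (O₄ u w >>=ᴹ getP4) >>=ᴹ pk) h x))) y)
        where
        go : ∀ r → best (λ u → sent x u >>=ᴹ pk) ≡ r → (r >>=ᴹ (λ p → just (proj₂ p))) ≡ nothing → best (λ u → sent x u >>=ᴹ pk) ≡ nothing
        go nothing e _ = e

    is-just-if : ∀ {A : Set} c {x : A} → is-just (if c then just x else nothing) ≡ c
    is-just-if true  = refl
    is-just-if false = refl

    isY : V → Bool
    isY u = is-just (parY u)

    rows : ∀ (p : V → Bool) (O : V → V → Maybe M) k → (∀ u → p u ≡ true → count (λ v → is-just (O u v)) ≤ k) → (∀ u → p u ≡ false → ∀ v → O u v ≡ nothing) →
      ∑ (λ u → count (λ v → is-just (O u v))) ≤ count p * k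
    rows p O k h h′ = ≤-trans (∑-mono (λ u → go u (p u) refl)) (≤-reflexive (∑-*ʳ k (λ u → b2n (p u))))
      where
      go : ∀ u c → p u ≡ c → count (λ v → is-just (O u v)) ≤ b2n c * k
      go u true  e = ≤-trans (h u e) (≤-reflexive (sym (+-identityʳ k)))
      go u false e = ≤-reflexive (∑-zero {n} (λ v → cong (b2n ∘ is-just) (h′ u e v)))

    -- The summands are the four sending rounds: requests to X, requests to Y, answers of Y with
    -- their announcements, and totals of X.
    pulse-cost : ∀ a d y e → count isX ≤ a → (∀ u → isX u ≡ true → deep o ≡ true → count (fwd (σ u)) ≤ d) → count isY ≤ y →
      (∀ u → isY u ≡ true → ann o ≡ true → count (fwd (σ u)) ≤ e) → pulseMsgs ≤ ((a + a * d) + y * suc e) + a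
    pulse-cost a d y e ha hd hy he = +-mono-≤ (+-mono-≤ (+-mono-≤ m₁ m₂) m₃) m₄
      where
      m₁ : ∑ (λ u → count (λ v → is-just (O₁ u v))) ≤ a
      m₁ = ≤-trans (rows (λ u → eqᵇ u w) O₁ a (λ u h → ≤-trans (count-mono (λ v e → ∧-trueʳ {eqᵇ u w} (trans (sym (is-just-if (eqᵇ u w ∧ isX v))) e))) ha)
             (λ u h v → if-false (cong (_∧ isX v) h))) (≤-trans (*-monoˡ-≤ a (count-eq≤1 w)) (≤-reflexive (+-identityʳ a)))
      m₂ : ∑ (λ u → count (λ v → is-just (O₂ u v))) ≤ a * d
      m₂ = ≤-trans (rows isX O₂ d (λ u h → go u h (deep o) refl) (λ u h v → if-false (cong (_∧ (deep o ∧ fwd (σ u) v)) h))) (*-monoˡ-≤ d ha)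
        where
        go : ∀ u → isX u ≡ true → ∀ c → deep o ≡ c → count (λ v → is-just (O₂ u v)) ≤ d
        go u h true e = ≤-trans (count-mono (λ v e′ → ∧-trueʳ {deep o} (∧-trueʳ {isX u} (trans (sym (is-just-if (isX u ∧ (deep o ∧ fwd (σ u) v)))) e′)))) (hd u h e)
        go u h false e = ≤-trans (≤-reflexive (∑-zero {n} (λ v → cong b2n (trans (is-just-if (isX u ∧ (deep o ∧ fwd (σ u) v))) (trans (cong (λ c → isX u ∧ (c ∧ fwd (σ u) v)) e) (∧-zeroʳ _)))))) z≤n
      m₃ : ∑ (λ u → count (λ v → is-just (O₃ u v))) ≤ y * suc e
      m₃ = ≤-trans (rows isY O₃ (suc e) (λ u h → go u h (rank u)) (λ u h v → go′ u v (parY u) refl h)) (*-monoˡ-≤ (suc e) hy)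
        where
        go′ : ∀ u v r → parY u ≡ r → is-just r ≡ false → outY r (L₂ u) v ≡ nothing
        go′ u v nothing q h = refl
        absurd : ∀ u → isY u ≡ true → parY u ≡ nothing → ∀ {A : Set} → A
        absurd u h q = case trans (sym h) (cong is-just q) of λ ()
        go : ∀ u → isY u ≡ true → Rank u → count (λ v → is-just (O₃ u v)) ≤ suc e
        go u h (isRoot refl) = absurd u h par-root
        go u h (isXr x) = absurd u h (par-X u x)
        go u h (isO _ _ q) = absurd u h q
        go u h (isYr x ex _ q _ _ _) = ≤-trans (∑-mono (λ v → cell v)) (≤-trans (≤-reflexive (∑-+ (λ v → b2n (eqᵇ v x)) (λ v → b2n (ann o ∧ fwd (σ u) v)))) (+-mono-≤ (count-eq≤1 x) (go″ (ann o) refl)))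
          where
          go″ : ∀ c → ann o ≡ c → count (λ v → c ∧ fwd (σ u) v) ≤ e
          go″ true a = he u h a
          go″ false a = ≤-trans (≤-reflexive (∑-zero {n} (λ _ → refl))) z≤n
          or≤ : ∀ c d → b2n (c ∨ d) ≤ b2n c + b2n d
          or≤ true d = s≤s z≤n
          or≤ false d = ≤-refl
          cell : ∀ v → b2n (is-just (O₃ u v)) ≤ b2n (eqᵇ v x) + b2n (ann o ∧ fwd (σ u) v)
          cell v = ≤-trans (≤-reflexive (cong b2n (trans (cong (λ r → is-just (outY r (L₂ u) v)) q) (trans (is-just-if (eqᵇ v x ∨ (ann o ∧ fwd (L₂ u) v))) (cong (λ l → eqᵇ v x ∨ (ann o ∧ fwd l v)) (L₂-notX u ex)))))) (or≤ (eqᵇ v x) (ann o ∧ fwd (σ u) v))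
      m₄ : ∑ (λ u → count (λ v → is-just (O₄ u v))) ≤ a
      m₄ = ≤-trans (rows isX O₄ 1 (λ u h → ≤-trans (count-mono (λ v e → ∧-trueʳ {isX u} (trans (sym (is-just-if (isX u ∧ eqᵇ v w))) e))) (count-eq≤1 w)) (λ u h v → if-false (cong (_∧ eqᵇ v w) h)))
             (≤-trans (≤-reflexive (*-identityʳ _)) ha)

    isY-shallow : deep o ≡ false → ∀ u → isY u ≡ false
    isY-shallow e u = go (rank u)
      where
      go : Rank u → isY u ≡ false
      go (isRoot refl) = cong is-just par-root
      go (isXr x) = cong is-just (par-X u x)
      go (isO _ _ q) = cong is-just q
      go (isYr _ _ _ _ _ d _) = true≢false d e

    isY-count : ∀ d → (∀ u → isX u ≡ true → count (fwd (σ u)) ≤ d) → count isY ≤ count isX * d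
    isY-count d h = ≤-trans (∑-mono (λ u → one u (rank u))) (≤-trans (≤-reflexive (∑-swap (λ u x → b2n (isX x ∧ fwd (σ x) u))))
      (≤-trans (∑-mono (λ x → go x (isX x) refl)) (≤-reflexive (∑-*ʳ d (λ u → b2n (isX u))))))
      where
      one : ∀ u → Rank u → b2n (isY u) ≤ ∑ (λ x → b2n (isX x ∧ fwd (σ x) u))
      one u (isRoot refl) = ≤-trans (≤-reflexive (cong (b2n ∘ is-just) par-root)) z≤n
      one u (isXr x) = ≤-trans (≤-reflexive (cong (b2n ∘ is-just) (par-X u x))) z≤n
      one u (isO _ _ q) = ≤-trans (≤-reflexive (cong (b2n ∘ is-just) q)) z≤n
      one u (isYr x _ _ q ex _ f) = ≤-trans (≤-reflexive (trans (cong (b2n ∘ is-just) q) (cong b2n (sym (∧-intro ex f))))) (term≤∑ (λ x → b2n (isX x ∧ fwd (σ x) u)) x)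
      go : ∀ x c → isX x ≡ c → count (λ u → c ∧ fwd (σ x) u) ≤ b2n c * d
      go x true  e = ≤-trans (h x e) (≤-reflexive (sym (+-identityʳ d)))
      go x false e = ≤-reflexive (∑-zero {n} (λ _ → refl))

  -- Local states as views of a global state

  Known : (V → Loc) → Set
  Known σ = ∀ v u → nbr (σ v) u ≡ true → Knows σ v u

  record View (N : V → V → Bool) (H P : V → Bool) (σ : V → Loc) (I A : V → Bool) : Set where
    field
      wf    : Wf σ
      known : Known σ
      n≡ : ∀ u v → nbr (σ u) v ≡ N u v
      h≡ : ∀ v → hv (inf (σ v)) ≡ H v
      p≡ : ∀ v → pin (σ v) ≡ P v
      i≡ : ∀ v → inn (inf (σ v)) ≡ I v
      a≡ : ∀ v → al (inf (σ v)) ≡ A v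

  module Local {N : V → V → Bool} {H P : V → Bool} {σ : V → Loc} {I A : V → Bool} (view : View N H P σ I A) where
    open View view
    open Domination N H using (AD; LD; UD; dom)

    tb-full : ∀ v u → N v u ≡ true → H v ≡ true ⊎ H u ≡ false → tb (σ v) u ≡ inf (σ u)
    tb-full v u e (inj₁ h) = full (known v u (trans (n≡ v u) e)) (inj₁ (trans (h≡ v) h))
    tb-full v u e (inj₂ h) = full (known v u (trans (n≡ v u) e)) (inj₂ (trans (h≡ u) h))

    tb-hv : ∀ v u → N v u ≡ true → hv (tb (σ v) u) ≡ H u
    tb-hv v u e = trans (flag (known v u (trans (n≡ v u) e))) (h≡ u)

    test : ∀ v u (f : Info → Bool) → nbr (σ v) u ∧ f (tb (σ v) u) ≡ N v u ∧ f (inf (σ u)) ⊎ N v u ≡ true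
    test v u f = go (N v u) refl
      where
      go : ∀ c → N v u ≡ c → nbr (σ v) u ∧ f (tb (σ v) u) ≡ N v u ∧ f (inf (σ u)) ⊎ N v u ≡ true
      go true  e = inj₂ e
      go false e = inj₁ (trans (cong (_∧ f (tb (σ v) u)) (trans (n≡ v u) e)) (sym (cong (_∧ f (inf (σ u))) e)))

    test-full : ∀ v u (f : Info → Bool) → (N v u ≡ true → f (tb (σ v) u) ≡ f (inf (σ u))) → nbr (σ v) u ∧ f (tb (σ v) u) ≡ N v u ∧ f (inf (σ u))
    test-full v u f h with test v u f
    ... | inj₁ e = e
    ... | inj₂ e = cong₂ _∧_ (n≡ v u) (h e)

    domL≡ : ∀ v → domL (σ v) ≡ LD I v
    domL≡ v = anyF-cong λ u → trans (test-full v u (λ i → inn i ∧ not (hv i)) (λ e → go u e (H u) refl))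
        (cong₂ (λ i h → N v u ∧ (i ∧ not h)) (i≡ u) (h≡ u))
      where
      go : ∀ u → N v u ≡ true → ∀ c → H u ≡ c → inn (tb (σ v) u) ∧ not (hv (tb (σ v) u)) ≡ inn (inf (σ u)) ∧ not (hv (inf (σ u)))
      go u e false h = cong (λ i → inn i ∧ not (hv i)) (tb-full v u e (inj₂ h))
      go u e true h = trans (cong (λ z → inn (tb (σ v) u) ∧ not z) (trans (tb-hv v u e) h))
        (trans (∧-zeroʳ _) (sym (trans (cong (λ z → inn (inf (σ u)) ∧ not z) (trans (h≡ u) h)) (∧-zeroʳ _))))

    domA≡ : ∀ v → H v ≡ true → domA (σ v) ≡ AD I v
    domA≡ v h = anyF-cong λ u → trans (test-full v u inn (λ e → cong inn (tb-full v u e (inj₁ h)))) (cong (N v u ∧_) (i≡ u))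

    dominated≡ : ∀ v → dominated (σ v) ≡ dom I v
    dominated≡ v = go (H v) refl
      where
      go : ∀ c → H v ≡ c → dominated (σ v) ≡ (if c then AD I v else LD I v)
      go true  h = trans (if-true (trans (h≡ v) h)) (domA≡ v h)
      go false h = trans (if-false (trans (h≡ v) h)) (domL≡ v)

    ud≡ : ∀ v → ud (σ v) ≡ UD I v
    ud≡ v = cong₂ (λ i d → not i ∧ not d) (i≡ v) (dominated≡ v)

    alNbr≡ : ∀ v → H v ≡ true → ∀ u → alNbr (σ v) u ≡ N v u ∧ A u
    alNbr≡ v h u = trans (test-full v u al (λ e → cong al (tb-full v u e (inj₁ h)))) (cong (N v u ∧_) (a≡ u))

    fwd⇒heavy : ∀ v u → fwd (σ v) u ≡ true → N v u ∧ H u ≡ true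
    fwd⇒heavy v u f = ∧-intro nvu (trans (sym (tb-hv v u nvu)) (∧-trueʳ {nbr (σ v) u} (∧-trueˡ {heavyNbr (σ v) u} f)))
      where
      nvu : N v u ≡ true
      nvu = trans (sym (n≡ v u)) (∧-trueˡ (∧-trueˡ {heavyNbr (σ v) u} f))

  -- Deep pulses reach the heavy vertices at distance one or two through heavy ones.
  Mb : (N : V → V → Bool) (H : V → Bool) → V → V → Bool
  Mb N H w v = H v ∧ (not (eqᵇ v w) ∧ (N w v ∨ anyF (λ x → (N w x ∧ H x) ∧ N x v)))

  module Members {N : V → V → Bool} {H P : V → Bool} {σ : V → Loc} {I A : V → Bool} (view : View N H P σ I A) (w : V) (o : Op)
    (narrow : allScope o ≡ false) where
    open View view
    open Effect σ w o wf public
    open Narrow narrow (λ v u e → inj₁ (known v u e)) public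

    member⇒Mb : ∀ v → member v ≡ true → Mb N H w v ≡ true
    member⇒Mb v e = ∧-intro (trans (sym (h≡ v)) (member⇒hv v e)) (∧-intro (not-false (eqᵇ-≢ {a = v} {w} (λ { refl → true≢false e member-root }))) (go (member-reach v e)))
      where
      go : nbr (σ w) v ≡ true ⊎ (∃ λ x → nbr (σ w) x ≡ true × hv (inf (σ x)) ≡ true × nbr (σ x) v ≡ true) → N w v ∨ anyF (λ x → (N w x ∧ H x) ∧ N x v) ≡ true
      go (inj₁ h) = ∨-introˡ (trans (sym (n≡ w v)) h)
      go (inj₂ (x , a , h , c)) = ∨-introʳ {N w v} (anyF-intro _ x (∧-intro (∧-intro (trans (sym (n≡ w x)) a) (trans (sym (h≡ x)) h)) (trans (sym (n≡ x v)) c)))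

    Mb⇒member : deep o ≡ true → ∀ v → Mb N H w v ≡ true → member v ≡ true
    Mb⇒member d v e = ∨-elim {N w v} (∧-trueʳ {not (eqᵇ v w)} (∧-trueʳ {H v} e)) (λ h → ∨-introˡ (⇒X v (trans (n≡ w v) h) hv′)) λ h →
      let (x , p) = anyF-elim _ h in near-member d x v (⇒X x (trans (n≡ w x) (∧-trueˡ (∧-trueˡ {N w x ∧ H x} p))) (trans (h≡ x) (∧-trueʳ {N w x} (∧-trueˡ {N w x ∧ H x} p))))
        (trans (n≡ x v) (∧-trueʳ {N w x ∧ H x} p)) hv′ (eqᵇ-false (not-true (∧-trueˡ {not (eqᵇ v w)} (∧-trueʳ {H v} e))))
      where
      hv′ : hv (inf (σ v)) ≡ true
      hv′ = trans (h≡ v) (∧-trueˡ e)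

    member≡Mb : deep o ≡ true → ∀ v → member v ≡ Mb N H w v
    member≡Mb d v = bool-ext (member⇒Mb v) (Mb⇒member d v)

    isX≡ : ∀ v → isX v ≡ N w v ∧ H v
    isX≡ v = bool-ext (λ e → ∧-intro (trans (sym (n≡ w v)) (isX⇒nbr v e)) (trans (sym (h≡ v)) (X⇒hv v e)))
      (λ e → ⇒X v (trans (n≡ w v) (∧-trueˡ e)) (trans (h≡ v) (∧-trueʳ {N w v} e)))

  -- Running Luby's algorithm from a root

  record Will (G : Graph n) (μ : ℕ) (w : V) (p : Prog) (σ : V → Loc) (t : ℕ) (Post : (V → Loc) → Set) : Set where
    constructor will
    field
      {σ′} : V → Loc
      runs : Run G μ w p σ t σ′
      post : Post σ′

  k<2^k : ∀ k → k < 2 ^ k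
  k<2^k zero    = s≤s z≤n
  k<2^k (suc k) = ≤-trans (+-mono-≤ (m^n>0 2 k) (k<2^k k)) (≤-reflexive (sym (double-^ k)))

  fitK : ∀ {k} → k ≤ seedLen b → k ≤ vmax
  fitK h = ≤-trans h (≤-trans (<⇒≤ (k<2^k (seedLen b))) fitSeed)

  module At (G : Graph n) (μ : ℕ) (N : V → V → Bool) (H P : V → Bool) (w : V)
    (N-sym : ∀ u v → N u v ≡ N v u) (N-irr : ∀ u → N u u ≡ false) (N⊆G : ∀ u v → N u v ≡ true → G u v ≡ true)
    (cM κ : ℕ) (hM : count (Mb N H w) ≤ cM) (hκ : ∀ v → Mb N H w v ≡ true → count (λ u → N v u ∧ H u) ≤ κ)
    (hμ : ((cM + cM * κ) + cM * suc κ) + cM ≤ 5 * μ) where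
    open Domination N H using (Ind; LD; LD-mono; UD; UD-dom; UD-in; UD-in-nbr; UD-intro; UD-mono; dom; dom-heavy)

    Vw : (V → Loc) → (V → Bool) → (V → Bool) → Set
    Vw = View N H P

    mb : V → Bool
    mb = Mb N H w

    mb⇒H : ∀ v → mb v ≡ true → H v ≡ true
    mb⇒H v e = ∧-trueˡ e

    mb-w : mb w ≡ false
    mb-w = trans (cong (λ c → H w ∧ (not c ∧ (N w w ∨ anyF (λ x → (N w x ∧ H x) ∧ N x w)))) (eqᵇ-refl w)) (∧-zeroʳ (H w))

    X⇒mb : ∀ v → N w v ≡ true → H v ≡ true → mb v ≡ true
    X⇒mb v e h = ∧-intro h (∧-intro (not-false (eqᵇ-≢ {a = v} {w} (λ { refl → true≢false e (N-irr w) }))) (∨-introˡ e))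

    Y⇒mb : ∀ x v → N w x ≡ true → H x ≡ true → N x v ≡ true → H v ≡ true → v ≢ w → mb v ≡ true
    Y⇒mb x v e hx e′ h p = ∧-intro h (∧-intro (not-false (eqᵇ-≢ p)) (∨-introʳ {N w v} (anyF-intro _ x (∧-intro (∧-intro e hx) e′))))

    -- In continuation-passing form, so that a chain of pulses reads like the program that it
    -- verifies, each step supplying the view for the next.
    loud : ∀ {σ I A f t Post} (view : Vw σ I A) o → allScope o ≡ false → deep o ≡ true → ann o ≡ true → ∀ I′ A′ →
      (∀ v → inn (if mb v then act o (σ v) else inf (σ v)) ≡ I′ v) → (∀ v → al (if mb v then act o (σ v) else inf (σ v)) ≡ A′ v) →
      (Vw (PulseOf.after σ w o) I′ A′ → (∀ v → inf (PulseOf.after σ w o v) ≡ (if mb v then act o (σ v) else inf (σ v))) →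
        Will G μ w (f (PulseOf.answer σ w o)) (PulseOf.after σ w o) t Post) →
      Will G μ w (pulse o f) σ (5 + t) Post
    loud {σ} view o nar dp an I′ A′ hi ha k = will (pulse (me≡ wf) (λ u v e → N⊆G u v (trans (sym (n≡ u v)) e)) cost (Will.runs rest)) (Will.post rest)
      where
      open View view
      open Members view w o nar using (after; hv-after; inf-after; isX; knows-loud; member; member⇒Mb; member≡Mb; nbr-after; pin-after; pulseMsgs; wf-after)
      open Collect σ w o wf using (pulse-cost; isY)
      inf≡ : ∀ v → inf (after v) ≡ (if mb v then act o (σ v) else inf (σ v))
      inf≡ v = trans (inf-after v) (cong (λ c → if c then act o (σ v) else inf (σ v)) (member≡Mb dp v))
      fwd≤ : ∀ u → member u ≡ true → count (fwd (σ u)) ≤ κ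
      fwd≤ u e = ≤-trans (count-mono (Local.fwd⇒heavy view u)) (hκ u (member⇒Mb u e))
      cost : pulseMsgs ≤ 5 * μ
      cost = ≤-trans (pulse-cost cM κ cM κ (≤-trans (count-mono (λ v e → member⇒Mb v (∨-introˡ e))) hM) (λ u e _ → fwd≤ u (∨-introˡ e))
               (≤-trans (count-mono (λ v e → member⇒Mb v (∨-introʳ {isX v} e))) hM) (λ u e _ → fwd≤ u (∨-introʳ {isX u} e))) hμ
      view′ : Vw after I′ A′
      view′ = record
        { wf = wf-after ; known = knows-loud dp an
        ; n≡ = λ u v → trans (cong (λ f → f v) (nbr-after u)) (n≡ u v) ; h≡ = λ v → trans (hv-after v) (h≡ v) ; p≡ = λ v → trans (pin-after v) (p≡ v)
        ; i≡ = λ v → trans (cong inn (inf≡ v)) (hi v) ; a≡ = λ v → trans (cong al (inf≡ v)) (ha v) }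
      rest = k view′ inf≡

    if-same : ∀ {A B : Set} (g : A → B) c {x y : A} {z : B} → (c ≡ true → g x ≡ z) → (c ≡ false → g y ≡ z) → g (if c then x else y) ≡ z
    if-same g true  p q = p refl
    if-same g false p q = q refl

    kicked : (V → Bool) → V → Bool
    kicked I v = I v ∧ not (mb v ∧ LD I v)

    alive : (V → Bool) → V → Bool
    alive I v = mb v ∧ UD I v

    E : (V → Bool) → V → V → Bool
    E I u v = N u v ∧ (alive I u ∧ alive I v)

    E-sym : ∀ I u v → E I u v ≡ E I v u
    E-sym I u v = cong₂ _∧_ (N-sym u v) (∧-comm (alive I u) (alive I v))

    E-irr : ∀ I u → E I u u ≡ false
    E-irr I u = cong (_∧ (alive I u ∧ alive I u)) (N-irr u)

    module Ph (I : V → Bool) = Phase b b-big (E I) (E-sym I) (E-irr I)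

    joined : (V → Bool) → ℕ → V → Bool
    joined I s v = I v ∨ (alive I v ∧ not (Ph.Seed.beaten I s v))

    E2 : (V → Bool) → ℕ
    E2 I = Ph.E2 I

    alive-H : ∀ {I v} → alive I v ≡ true → H v ≡ true
    alive-H {I} {v} e = mb⇒H v (∧-trueˡ {mb v} e)

    alive-UD : ∀ {I v} → alive I v ≡ true → UD I v ≡ true
    alive-UD {I} {v} e = ∧-trueʳ {mb v} e

    -- An alive vertex has no neighbour in the set, being heavy and undominated; and of two adjacent
    -- winners each would have the strictly smaller hash value.
    joined-Ind : ∀ I s → Ind I → Ind (joined I s)
    joined-Ind I s ind u v e iu iv = ∨-elim {I u} iu
      (λ ou → ∨-elim {I v} iv (λ ov → ind u v e ou ov) (λ nv → UD-in-nbr (alive-H (∧-trueˡ {alive I v} nv)) (alive-UD (∧-trueˡ {alive I v} nv)) u (trans (N-sym v u) e) ou))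
      (λ nu → ∨-elim {I v} iv (λ ov → UD-in-nbr (alive-H (∧-trueˡ {alive I u} nu)) (alive-UD (∧-trueˡ {alive I u} nu)) v e ov)
        (λ nv → <-asym (wins u v e (∧-trueˡ {alive I u} nu) (∧-trueˡ {alive I v} nv) (not-true (∧-trueʳ {alive I u} nu)))
                       (wins v u (trans (N-sym v u) e) (∧-trueˡ {alive I v} nv) (∧-trueˡ {alive I u} nu) (not-true (∧-trueʳ {alive I v} nv)))))
      where
      wins : ∀ u v → N u v ≡ true → alive I u ≡ true → alive I v ≡ true → Ph.Seed.beaten I s u ≡ false → hash b s (toℕ u) < hash b s (toℕ v)
      wins u v e au av nb = <ᵇ⇒<′ (¬false⇒true λ lt → true≢false (∧-intro (∧-intro e (∧-intro au av)) (not-false lt)) (anyF-false _ nb v))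

    joined-⊇ : ∀ I s v → I v ≡ true → joined I s v ≡ true
    joined-⊇ I s v e = ∨-introˡ e

    joined-out : ∀ I s v → mb v ≡ false → joined I s v ≡ I v
    joined-out I s v e = trans (cong (λ c → I v ∨ (c ∧ UD I v) ∧ not (Ph.Seed.beaten I s v)) e) (∨-identityʳ (I v))

    alive-shrinks : ∀ I s v → alive (joined I s) v ≡ true → alive I v ≡ true
    alive-shrinks I s v e = ∧-intro (∧-trueˡ {mb v} e) (UD-mono (joined-⊇ I s) v (alive-UD e))

    -- The unbeaten neighbour of a killed vertex joins, which dominates the killed vertex. This is
    -- the hypothesis that `progress` needs.
    E-shrinks : ∀ I s u v → E (joined I s) u v ≡ true → E I u v ≡ true × Ph.Seed.killed I s u ≡ false
    E-shrinks I s u v e = ∧-intro nuv (∧-intro (alive-shrinks I s u au) (alive-shrinks I s v av)) ,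
      ¬true⇒false λ k → let (x , p) = anyF-elim _ k in
        UD-in-nbr (alive-H au) (alive-UD au) x (∧-trueˡ {N u x} (∧-trueˡ {E I u x} p)) (∨-introʳ {I x} (∧-intro (∧-trueʳ {alive I u} (∧-trueʳ {N u x} (∧-trueˡ {E I u x} p))) (∧-trueʳ {E I u x} p)))
      where
      nuv : N u v ≡ true
      nuv = ∧-trueˡ {N u v} e
      au : alive (joined I s) u ≡ true
      au = ∧-trueˡ {alive (joined I s) u} (∧-trueʳ {N u v} e)
      av : alive (joined I s) v ≡ true
      av = ∧-trueʳ {alive (joined I s) u} (∧-trueʳ {N u v} e)

    -- Without edges nobody is beaten. Removing the last edge does not yet put isolated alive
    -- vertices into the set, so one more phase is required.
    all-join : ∀ I s → E2 I ≡ 0 → ∀ v → alive (joined I s) v ≡ false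
    all-join I s e v = ¬true⇒false λ a → true≢false
      (∨-introʳ {I v} (∧-intro (alive-shrinks I s v a) (not-false (anyF-none _ λ u → cong (_∧ not (hash b s (toℕ v) <ᵇ hash b s (toℕ u))) (no-edge u)))))
      (UD-in (alive-UD a))
      where
      no-edge : ∀ u → E I v u ≡ false
      no-edge u = ¬true⇒false λ h → case trans (sym (cong b2n h)) (∑≡0⇒ _ (∑≡0⇒ _ e v) u) of λ ()

    -- The invariant of the method of conditional expectations: the inequality of `average`, summed
    -- over the seeds that are still possible.
    Good : (V → Bool) → ℕ → ℕ → Set
    Good I a j = 2 ^ j * E2 I + 24 * sumTo (2 ^ j) (λ t → Ph.Loss I (a + t)) ≤ 24 * sumTo (2 ^ j) (λ t → Ph.Gain I (a + t))

    DgOK : (V → Bool) → (V → Loc) → Set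
    DgOK I σ = ∀ v → alive I v ≡ true → toℕ (dg (inf (σ v))) ≡ Ph.dE I v

    -- With the tables right about `al` and `dg`, the four aggregated numbers are exactly `Gain` and
    -- `Loss` of the two halves: dead vertices contribute 0, and no sum saturates.
    module Bits {I : V → Bool} {σ : V → Loc} (view : Vw σ I (alive I)) (dgok : DgOK I σ) (a j : ℕ) (ha : a + 2 ^ suc j ≤ 2 ^ seedLen b) (hj : suc j ≤ seedLen b) where
      open View view
      open Local view using (alNbr≡; tb-full)

      a≤ : a ≤ vmax
      a≤ = ≤-trans (≤-trans (m≤m+n a _) ha) fitSeed

      va : toℕ (toV a) ≡ a
      va = toV-id a≤

      vj : toℕ (toV j) ≡ j
      vj = toV-id (fitK (≤-trans (n≤1+n j) hj))

      o : Op
      o = bit (toV a) (toV j)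

      alN : ∀ v → alive I v ≡ true → ∀ u → alNbr (σ v) u ≡ E I v u
      alN v e u = trans (alNbr≡ v (alive-H e) u) (cong (N v u ∧_) (sym (cong (_∧ alive I u) e)))

      dgN : ∀ v → alive I v ≡ true → ∀ u → alNbr (σ v) u ≡ true → toℕ (dg (tb (σ v) u)) ≡ Ph.dE I u
      dgN v e u h = trans (cong (toℕ ∘ dg) (tb-full v u nvu (inj₁ (alive-H e)))) (dgok u (∧-trueʳ {N v u} h′))
        where
        h′ : N v u ∧ alive I u ≡ true
        h′ = trans (sym (alNbr≡ v (alive-H e) u)) h
        nvu : N v u ≡ true
        nvu = ∧-trueˡ h′

      gain≡ : ∀ v → alive I v ≡ true → ∀ a j → gainOn (σ v) a j ≡ sumTo (2 ^ j) (λ t → gain b (E I v) (Ph.dE I) (Ph.dE I v) v (a + t))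
      gain≡ v e a j = sumTo-cong (2 ^ j) λ t _ → trans (cong (λ z → gain b (alNbr (σ v)) (λ u → toℕ (dg (tb (σ v) u))) (toℕ (dg (inf (σ v)))) z (a + t)) (me≡ wf v))
        (gain-cong b (alN v e) (dgN v e) (dgok v e) v (a + t))

      loss≡ : ∀ v → alive I v ≡ true → ∀ a j → lossOn (σ v) a j ≡ sumTo (2 ^ j) (λ t → loss b (E I v) (Ph.dE I) (Ph.dE I v) v (a + t))
      loss≡ v e a j = sumTo-cong (2 ^ j) λ t _ → trans (cong (λ z → loss b (alNbr (σ v)) (λ u → toℕ (dg (tb (σ v) u))) (toℕ (dg (inf (σ v)))) z (a + t)) (me≡ wf v))
        (loss-cong b (alN v e) (dgN v e) (dgok v e) v (a + t))

      n³ : ℕ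
      n³ = n * (n * (n * 1)) + n * (n * (n * 1))

      R : ℕ
      R = 2 ^ seedLen b * n³

      pow≤ : 2 ^ j ≤ 2 ^ seedLen b
      pow≤ = ^-monoʳ-≤ 2 (≤-trans (n≤1+n j) hj)

      dE≤ : ∀ v → Ph.dE I v ≤ n
      dE≤ v = count≤n (E I v)

      n²≤ : n * (n * 1) ≤ n³
      n²≤ = ≤-trans (sq n) (m≤m+n _ _)
        where
        sq : ∀ n → n * (n * 1) ≤ n * (n * (n * 1))
        sq zero = z≤n
        sq (suc n) = *-monoʳ-≤ (suc n) (*-monoʳ-≤ (suc n) (s≤s z≤n))

      gain-fits : ∀ v a → sumTo (2 ^ j) (λ t → gain b (E I v) (Ph.dE I) (Ph.dE I v) v (a + t)) ≤ R
      gain-fits v a = ≤-trans (sumTo-bound (2 ^ j) n³ (λ t → ≤-trans (gain-bound b (E I v) (Ph.dE I) (Ph.dE I v) (λ u _ → dE≤ u) (dE≤ v) v (a + t)) n²≤)) (*-monoˡ-≤ n³ pow≤)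

      loss-fits : ∀ v a → sumTo (2 ^ j) (λ t → loss b (E I v) (Ph.dE I) (Ph.dE I v) v (a + t)) ≤ R
      loss-fits v a = ≤-trans (sumTo-bound (2 ^ j) n³ (λ t → loss-bound b (E I v) (Ph.dE I) (Ph.dE I v) (λ u _ → dE≤ u) (dE≤ v) v (a + t))) (*-monoˡ-≤ n³ pow≤)

      R≤ : 1 ≤ n → R ≤ vmax
      R≤ 1≤n = ≤-trans (≤-trans (≤-reflexive (sym (*-identityˡ R))) (*-monoˡ-≤ R 1≤n)) fits

      open Members view w o refl using (Mb⇒member; member)
      open Collect σ w o wf using (total-sum)

      sum≡ : (g : Res → Val) → (∀ x → g (PulseOf.tot σ w o x) ≡ toV (∑ (λ u → field₀ g (Collect.sent σ w o wf x u)))) →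
        (f : V → ℕ) → (∀ v → alive I v ≡ true → toℕ (g (val o (σ v))) ≡ f v) → (∀ v → alive I v ≡ false → toℕ (g (val o (σ v))) ≡ 0) → (∀ v → f v ≤ R) → (∀ v → alive I v ≡ false → f v ≡ 0) →
        ∑ (λ x → field₀ g (PulseOf.O₄ σ w o x w >>=ᴹ getP4)) ≡ ∑ f
      sum≡ g hg f ht hf hR h0 = trans (total-sum g hg R (λ v → bnd v (alive I v) refl) fits) (∑-cong (λ v → one v (alive I v) refl))
        where
        bnd : ∀ v c → alive I v ≡ c → toℕ (g (val o (σ v))) ≤ R
        bnd v true  e = ≤-trans (≤-reflexive (ht v e)) (hR v)
        bnd v false e = ≤-trans (≤-reflexive (hf v e)) z≤n
        one : ∀ v c → alive I v ≡ c → member v · toℕ (g (val o (σ v))) ≡ f v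
        one v true e = trans (if-true (Mb⇒member refl v (∧-trueˡ {mb v} e))) (ht v e)
        one v false e = trans (trans (cong (member v ·_) (hf v e)) (z (member v))) (sym (h0 v e))
          where
          z : ∀ c → c · 0 ≡ 0
          z true = refl
          z false = refl

      val-dead : ∀ v → alive I v ≡ false → val o (σ v) ≡ noRes
      val-dead v e = if-false (trans (a≡ v) e)

      reports : ∀ v → Res
      reports v = mkRes (toV (gainOn (σ v) (toℕ (toV a)) (toℕ (toV j)))) (toV (lossOn (σ v) (toℕ (toV a)) (toℕ (toV j))))
               (toV (gainOn (σ v) (toℕ (toV a) + 2 ^ toℕ (toV j)) (toℕ (toV j)))) (toV (lossOn (σ v) (toℕ (toV a) + 2 ^ toℕ (toV j)) (toℕ (toV j)))) nothing

      val-alive : ∀ v → alive I v ≡ true → val o (σ v) ≡ reports v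
      val-alive v e = if-true (trans (a≡ v) e)

      toV0 : toℕ (toV 0) ≡ 0
      toV0 = toV-id z≤n

      v≥1 : V → 1 ≤ n
      v≥1 v = ≤-trans (s≤s z≤n) (toℕ<n v)

      dead-edge : ∀ v → alive I v ≡ false → ∀ u → E I v u ≡ false
      dead-edge v e u = trans (cong (λ c → N v u ∧ (c ∧ alive I u)) e) (∧-zeroʳ (N v u))

      gain-dead : ∀ v → alive I v ≡ false → ∀ s → gain b (E I v) (Ph.dE I) (Ph.dE I v) v s ≡ 0
      gain-dead v e s = ∑-zero {n} (λ u → if-false (dead-edge v e u))

      loss-dead : ∀ v → alive I v ≡ false → ∀ s → loss b (E I v) (Ph.dE I) (Ph.dE I v) v s ≡ 0
      loss-dead v e s = cong₂ _+_ (∑-zero {n} (λ u → if-false (dead-edge v e u))) (∑-zero {n} (λ u → if-false (dead-edge v e u)))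

      zero-sum : ∀ m {f : ℕ → ℕ} → (∀ t → f t ≡ 0) → sumTo m f ≡ 0
      zero-sum zero h = refl
      zero-sum (suc m) h = cong₂ _+_ (h 0) (zero-sum m (h ∘ suc))

      g-sum l-sum : ℕ → V → ℕ
      g-sum a v = sumTo (2 ^ j) (λ t → gain b (E I v) (Ph.dE I) (Ph.dE I v) v (a + t))
      l-sum a v = sumTo (2 ^ j) (λ t → loss b (E I v) (Ph.dE I) (Ph.dE I v) v (a + t))

      gainV : ∀ v → alive I v ≡ true → ∀ a′ → toℕ (toV (gainOn (σ v) a′ (toℕ (toV j)))) ≡ g-sum a′ v
      gainV v e a′ = trans (cong (λ z → toℕ (toV (gainOn (σ v) a′ z))) vj) (trans (cong (toℕ ∘ toV) (gain≡ v e a′ j)) (toV-id (≤-trans (gain-fits v a′) (R≤ (v≥1 v)))))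

      lossV : ∀ v → alive I v ≡ true → ∀ a′ → toℕ (toV (lossOn (σ v) a′ (toℕ (toV j)))) ≡ l-sum a′ v
      lossV v e a′ = trans (cong (λ z → toℕ (toV (lossOn (σ v) a′ z))) vj) (trans (cong (toℕ ∘ toV) (loss≡ v e a′ j)) (toV-id (≤-trans (loss-fits v a′) (R≤ (v≥1 v)))))

      va′ : toℕ (toV a) + 2 ^ toℕ (toV j) ≡ a + 2 ^ j
      va′ = cong₂ (λ x y → x + 2 ^ y) va vj

      G₀ G₁ Lo₀ Lo₁ : ℕ
      G₀  = sumTo (2 ^ j) (λ t → Ph.Gain I (a + t))
      G₁  = sumTo (2 ^ j) (λ t → Ph.Gain I (a + 2 ^ j + t))
      Lo₀ = sumTo (2 ^ j) (λ t → Ph.Loss I (a + t))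
      Lo₁ = sumTo (2 ^ j) (λ t → Ph.Loss I (a + 2 ^ j + t))

      ans : Ans
      ans = PulseOf.answer σ w o

      s₀≡ : s₀ ans ≡ G₀
      s₀≡ = trans (sum≡ r₀ (λ x → refl) (g-sum a) (λ v e → trans (cong (toℕ ∘ r₀) (val-alive v e)) (trans (gainV v e (toℕ (toV a))) (cong (λ z → g-sum z v) va)))
        (λ v e → trans (cong (toℕ ∘ r₀) (val-dead v e)) toV0) (λ v → gain-fits v a) (λ v e → zero-sum (2 ^ j) (λ t → gain-dead v e (a + t)))) (sym (sumTo-∑ (2 ^ j) (λ v t → gain b (E I v) (Ph.dE I) (Ph.dE I v) v (a + t))))

      s₁≡ : s₁ ans ≡ Lo₀
      s₁≡ = trans (sum≡ r₁ (λ x → refl) (l-sum a) (λ v e → trans (cong (toℕ ∘ r₁) (val-alive v e)) (trans (lossV v e (toℕ (toV a))) (cong (λ z → l-sum z v) va)))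
        (λ v e → trans (cong (toℕ ∘ r₁) (val-dead v e)) toV0) (λ v → loss-fits v a) (λ v e → zero-sum (2 ^ j) (λ t → loss-dead v e (a + t)))) (sym (sumTo-∑ (2 ^ j) (λ v t → loss b (E I v) (Ph.dE I) (Ph.dE I v) v (a + t))))

      s₂≡ : s₂ ans ≡ G₁
      s₂≡ = trans (sum≡ r₂ (λ x → refl) (g-sum (a + 2 ^ j)) (λ v e → trans (cong (toℕ ∘ r₂) (val-alive v e)) (trans (gainV v e (toℕ (toV a) + 2 ^ toℕ (toV j))) (cong (λ z → g-sum z v) va′)))
        (λ v e → trans (cong (toℕ ∘ r₂) (val-dead v e)) toV0) (λ v → gain-fits v (a + 2 ^ j)) (λ v e → zero-sum (2 ^ j) (λ t → gain-dead v e (a + 2 ^ j + t)))) (sym (sumTo-∑ (2 ^ j) (λ v t → gain b (E I v) (Ph.dE I) (Ph.dE I v) v (a + 2 ^ j + t))))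

      s₃≡ : s₃ ans ≡ Lo₁
      s₃≡ = trans (sum≡ r₃ (λ x → refl) (l-sum (a + 2 ^ j)) (λ v e → trans (cong (toℕ ∘ r₃) (val-alive v e)) (trans (lossV v e (toℕ (toV a) + 2 ^ toℕ (toV j))) (cong (λ z → l-sum z v) va′)))
        (λ v e → trans (cong (toℕ ∘ r₃) (val-dead v e)) toV0) (λ v → loss-fits v (a + 2 ^ j)) (λ v e → zero-sum (2 ^ j) (λ t → loss-dead v e (a + 2 ^ j + t)))) (sym (sumTo-∑ (2 ^ j) (λ v t → loss b (E I v) (Ph.dE I) (Ph.dE I v) v (a + 2 ^ j + t))))

      pick : ℕ
      pick = if s₂ ans + s₁ ans ≤ᵇ s₀ ans + s₃ ans then a else a + 2 ^ j

      pick-good : Good I a (suc j) → Good I pick j × pick + 2 ^ j ≤ 2 ^ seedLen b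
      pick-good good = go (s₂ ans + s₁ ans ≤ᵇ s₀ ans + s₃ ans) refl
        where
        split : (f : ℕ → ℕ) → sumTo (2 ^ suc j) (λ t → f (a + t)) ≡ sumTo (2 ^ j) (λ t → f (a + t)) + sumTo (2 ^ j) (λ t → f (a + 2 ^ j + t))
        split f = trans (cong (λ m → sumTo m (λ t → f (a + t))) (double-^ j)) (trans (sumTo-split (2 ^ j) (2 ^ j) (λ t → f (a + t)))
          (cong (sumTo (2 ^ j) (λ t → f (a + t)) +_) (sumTo-cong (2 ^ j) (λ t _ → cong f (sym (+-assoc a (2 ^ j) t))))))
        good′ : (2 ^ j * E2 I + 2 ^ j * E2 I) + 24 * (Lo₀ + Lo₁) ≤ 24 * (G₀ + G₁)
        good′ = ≤-trans (≤-reflexive (cong₂ (λ x y → x + 24 * y) (trans (sym (*-distribʳ-+ (E2 I) (2 ^ j) (2 ^ j))) (cong (_* E2 I) (sym (double-^ j)))) (sym (split (Ph.Loss I)))))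
          (≤-trans good (≤-reflexive (cong (24 *_) (split (Ph.Gain I)))))
        halves = choose-half (2 ^ j * E2 I) G₀ Lo₀ G₁ Lo₁ good′
        cmp : (s₂ ans + s₁ ans ≤ᵇ s₀ ans + s₃ ans) ≡ (G₁ + Lo₀ ≤ᵇ G₀ + Lo₁)
        cmp = trans (cong₂ (λ x y → x + y ≤ᵇ s₀ ans + s₃ ans) s₂≡ s₁≡) (cong₂ (λ x y → G₁ + Lo₀ ≤ᵇ x + y) s₀≡ s₃≡)
        go : ∀ c → (s₂ ans + s₁ ans ≤ᵇ s₀ ans + s₃ ans) ≡ c → Good I (if c then a else a + 2 ^ j) j × (if c then a else a + 2 ^ j) + 2 ^ j ≤ 2 ^ seedLen b
        go true e = proj₁ halves (≤ᵇ⇒≤ _ _ (subst Data.Bool.T (sym (trans (sym cmp) e)) tt)) , ≤-trans (+-monoʳ-≤ a (≤-trans (m≤m+n (2 ^ j) _) ≤-refl)) ha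
        go false e = proj₂ halves (λ le → true≢false (dec-true (G₁ + Lo₀ ≤? G₀ + Lo₁) le) (trans (sym cmp) e)) ,
          ≤-trans (≤-reflexive (trans (+-assoc a (2 ^ j) (2 ^ j)) (cong (a +_) (sym (double-^ j))))) ha

    out-alive : ∀ I v → mb v ≡ false → alive I v ≡ false
    out-alive I v e = cong (_∧ UD I v) e

    bits-run : ∀ j {I σ k t Post} a → Vw σ I (alive I) → DgOK I σ → a + 2 ^ j ≤ 2 ^ seedLen b → j ≤ seedLen b → Good I a j →
      (∀ s {σ′} → Vw σ′ I (alive I) → s < 2 ^ seedLen b → Good I s 0 → Will G μ w (k s) σ′ t Post) → Will G μ w (bitsP j a k) σ (j * 5 + t) Post
    bits-run zero a view dgok ha hj good k = k a view (≤-trans (≤-reflexive (+-comm 1 a)) ha) good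
    bits-run (suc j) {I} {σ} a view dgok ha hj good k =
      loud view o refl refl refl I (alive I) (λ v → if-same inn (mb v) (λ _ → i≡ v) (λ _ → i≡ v)) (λ v → if-same al (mb v) (λ _ → a≡ v) (λ _ → a≡ v))
        λ view′ inf≡ → bits-run j pick view′ (λ v e → trans (cong (toℕ ∘ dg) (trans (inf≡ v) (if-same id (mb v) (λ _ → refl) (λ _ → refl)))) (dgok v e))
          (proj₂ (pick-good good)) (≤-trans (n≤1+n j) hj) (proj₁ (pick-good good)) k
      where
      open View view
      open Bits view dgok a j ha hj using (o; pick; pick-good)

    phase-time : ℕ
    phase-time = 5 + (5 + (seedLen b * 5 + 5))

    -- m + 1 phases, when m of them suffice to remove all edges between alive vertices.
    phases-run : ∀ m {I A σ k t Post} → Vw σ I A → (∀ v → mb v ≡ false → A v ≡ false) → Ind I → 23 ^ m * E2 I < 24 ^ m →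
      (∀ {I′ A′ σ′} → Vw σ′ I′ A′ → (∀ v → mb v ≡ false → A′ v ≡ false) → Ind I′ → (∀ v → I v ≡ true → I′ v ≡ true) →
        (∀ v → mb v ≡ false → I′ v ≡ I v) → (∀ v → alive I′ v ≡ false) → Will G μ w k σ′ t Post) →
      Will G μ w (phases (suc m) k) σ (suc m * phase-time + t) Post
    phases-run m {I} {A} {σ} {k} {t} {Post} view hA ind lt cont = subst (λ z → Will G μ w (phases (suc m) k) σ z Post) (time (m * phase-time) t)
      (loud view alv refl refl refl I (alive I) (λ v → if-same inn (mb v) (λ _ → View.i≡ view v) (λ _ → View.i≡ view v)) al′ λ view₁ _ →
       loud view₁ dgr refl refl refl I (alive I) (λ v → if-same inn (mb v) (λ _ → View.i≡ view₁ v) (λ _ → View.i≡ view₁ v)) (λ v → if-same al (mb v) (λ _ → View.a≡ view₁ v) (λ _ → View.a≡ view₁ v)) λ view₂ inf₂ →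
       bits-run (seedLen b) 0 view₂ (dg′ {σ₂ = PulseOf.after (PulseOf.after σ w alv) w dgr} view₁ inf₂) ≤-refl ≤-refl (Ph.average I) λ s view₃ s< good →
       loud view₃ (jn (toV s)) refl refl refl (joined I s) (alive I) (jn′ view₃ s s<) (λ v → if-same al (mb v) (λ _ → View.a≡ view₃ v) (λ _ → View.a≡ view₃ v)) λ view₄ _ →
       next m lt s good view₄)
      where
      time : ∀ x t → 5 + (5 + (seedLen b * 5 + (5 + (x + t)))) ≡ 5 + (5 + (seedLen b * 5 + 5)) + x + t
      time x t = eq (seedLen b * 5) x t
        where
        eq : ∀ s x t → 5 + (5 + (s + (5 + (x + t)))) ≡ 5 + (5 + (s + 5)) + x + t
        eq = solve-∀
      al′ : ∀ v → al (if mb v then act alv (σ v) else inf (σ v)) ≡ alive I v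
      al′ v = if-same al (mb v) (λ e → trans (cong₂ _∧_ (View.h≡ view v) (Local.ud≡ view v)) (trans (cong (_∧ UD I v) (mb⇒H v e)) (sym (cong (_∧ UD I v) e))))
        (λ e → trans (View.a≡ view v) (trans (hA v e) (sym (out-alive I v e))))
      dg′ : ∀ {σ₁ σ₂} → (view₁ : Vw σ₁ I (alive I)) → (∀ v → inf (σ₂ v) ≡ (if mb v then act dgr (σ₁ v) else inf (σ₁ v))) → DgOK I σ₂
      dg′ {σ₁} view₁ inf₂ v e = trans (cong (toℕ ∘ dg) (trans (inf₂ v) (if-true (∧-trueˡ {mb v} e)))) (trans (toV-id (≤-trans (count≤n (alNbr (σ₁ v))) fitN))
        (∑-cong (λ u → cong b2n (trans (Local.alNbr≡ view₁ v (alive-H e) u) (cong (N v u ∧_) (sym (cong (_∧ alive I u) e)))))))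
      jn′ : ∀ {σ₃} → Vw σ₃ I (alive I) → ∀ s → s < 2 ^ seedLen b → ∀ v → inn (if mb v then act (jn (toV s)) (σ₃ v) else inf (σ₃ v)) ≡ joined I s v
      jn′ {σ₃} view₃ s s< v = if-same inn (mb v)
        (λ e → cong₂ _∨_ (i≡ v) (trans (cong (_∧ not (beatenL (toℕ (toV s)) (σ₃ v))) (a≡ v)) (go (alive I v) refl)))
        (λ e → trans (i≡ v) (sym (joined-out I s v e)))
        where
        open View view₃
        go : ∀ c → alive I v ≡ c → c ∧ not (beatenL (toℕ (toV s)) (σ₃ v)) ≡ c ∧ not (Ph.Seed.beaten I s v)
        go false e = refl
        go true e = cong not (trans (cong (λ z → beatenL z (σ₃ v)) (toV-id (≤-trans (<⇒≤ s<) fitSeed)))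
          (anyF-cong λ u → cong₂ (λ c z → c ∧ not (hash b s (toℕ z) <ᵇ hash b s (toℕ u)))
            (trans (Local.alNbr≡ view₃ v (alive-H e) u) (cong (N v u ∧_) (sym (cong (_∧ alive I u) e)))) (me≡ wf v)))
      next : ∀ m → 23 ^ m * E2 I < 24 ^ m → ∀ s → Good I s 0 → ∀ {σ₄} → Vw σ₄ (joined I s) (alive I) → Will G μ w (phases m k) σ₄ (m * phase-time + t) Post
      next zero lt s good view₄ = cont view₄ (out-alive I) (joined-Ind I s ind) (joined-⊇ I s) (joined-out I s)
        (all-join I s (n<1⇒n≡0 (≤-trans (s≤s (≤-reflexive (sym (+-identityʳ (E2 I))))) lt)))
      next (suc m) lt s good view₄ = phases-run m view₄ (out-alive I) (joined-Ind I s ind) (halving (E2 (joined I s)) (E2 I) (Ph.Seed.progress I s (E (joined I s)) (E-shrinks I s) good′) m lt)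
        λ view₅ hA′ ind′ up out dead → cont view₅ hA′ ind′ (λ v e → up v (joined-⊇ I s v e)) (λ v e → trans (out v e) (joined-out I s v e)) dead
        where
        good′ : E2 I + 24 * Ph.Loss I s ≤ 24 * Ph.Gain I s
        good′ = ≤-trans (≤-reflexive (cong₂ (λ x y → x + 24 * y) (sym (+-identityʳ (E2 I))) (trans (cong (Ph.Loss I) (sym (+-identityʳ s))) (sym (+-identityʳ _)))))
          (≤-trans good (≤-reflexive (cong (24 *_) (trans (+-identityʳ _) (cong (Ph.Gain I) (+-identityʳ s))))))

    -- The only conflicts before the pulse that removes heavy vertices are with a light root.
    Conflicts : (V → Bool) → Set
    Conflicts I = ∀ u v → N u v ≡ true → I u ≡ true → I v ≡ true → H w ≡ false × ((u ≡ w × H v ≡ true) ⊎ (v ≡ w × H u ≡ true))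

    kicked-⊆ : ∀ I v → kicked I v ≡ true → I v ≡ true
    kicked-⊆ I v e = ∧-trueˡ {I v} e

    kicked-out : ∀ I v → mb v ≡ false → kicked I v ≡ I v
    kicked-out I v e = trans (cong (λ c → I v ∧ not (c ∧ LD I v)) e) (∧-identityʳ (I v))

    light-out : ∀ v → H v ≡ false → mb v ≡ false
    light-out v e = cong (_∧ (not (eqᵇ v w) ∧ (N w v ∨ anyF (λ x → (N w x ∧ H x) ∧ N x v)))) e

    kicked-Ind : ∀ I → Conflicts I → Ind (kicked I)
    kicked-Ind I conf u v e iu iv = go (conf u v e (kicked-⊆ I u iu) (kicked-⊆ I v iv))
      where
      clash : ∀ v → N v w ≡ true → H w ≡ false → H v ≡ true → I w ≡ true → kicked I v ≡ true → ⊥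
      clash v e lw hv iw iv = true≢false (∧-intro (X⇒mb v (trans (N-sym w v) e) hv) (anyF-intro _ w (∧-intro e (∧-intro iw (not-false lw))))) (not-true (∧-trueʳ {I v} iv))
      go : H w ≡ false × ((u ≡ w × H v ≡ true) ⊎ (v ≡ w × H u ≡ true)) → ⊥
      go (lw , inj₁ (refl , hv)) = clash v (trans (N-sym v u) e) lw hv (kicked-⊆ I u iu) iv
      go (lw , inj₂ (refl , hu)) = clash u e lw hu (kicked-⊆ I v iv) iu

    -- Evicted vertices are heavy, so light vertices do not miss them. A heavy vertex that loses an
    -- evicted dominator is linked to the root through that heavy neighbour of the root, hence lies
    -- in `mb`.
    kicked-UD : ∀ I → Conflicts I → ∀ v → mb v ≡ false → UD (kicked I) v ≡ true → UD I v ≡ true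
    kicked-UD I conf v mv e = UD-intro (trans (sym (kicked-out I v mv)) (UD-in e)) (¬true⇒false λ d → true≢false (keep (H v) refl d) (UD-dom e))
      where
      keep : ∀ c → H v ≡ c → dom I v ≡ true → dom (kicked I) v ≡ true
      keep false h d = trans (if-false h) (LD-mono (λ u hu iu → trans (kicked-out I u (light-out u hu)) iu) v (trans (sym (if-false h)) d))
      keep true h d with anyF-elim _ (trans (sym (if-true h)) d)
      ... | u , p = dom-heavy h u nvu (¬false⇒true away)
        where
        nvu : N v u ≡ true
        nvu = ∧-trueˡ {N v u} p
        away : kicked I u ≡ false → ⊥
        away ku = go (mb u ∧ LD I u) refl
          where
          go : ∀ c → mb u ∧ LD I u ≡ c → ⊥
          go false e′ = true≢false (∧-intro (∧-trueʳ {N v u} p) (not-false e′)) ku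
          go true e′ with anyF-elim _ (∧-trueʳ {mb u} e′)
          ... | y , q with conf u y (∧-trueˡ {N u y} q) (∧-trueʳ {N v u} p) (∧-trueˡ {I y} (∧-trueʳ {N u y} q))
          ...   | lw , inj₁ (_ , hy) = true≢false hy (not-true (∧-trueʳ {I y} (∧-trueʳ {N u y} q)))
          ...   | lw , inj₂ (refl , hu) = true≢false (Y⇒mb u v (trans (N-sym y u) (∧-trueˡ {N u y} q)) hu (trans (N-sym u v) nvu) h (λ { refl → true≢false h lw })) mv

    record Settled (I : V → Bool) (σ′ : V → Loc) : Set where
      field
        {I′} : V → Bool
        view : Vw σ′ I′ (λ _ → false)
        ind  : Ind I′
        same : ∀ v → mb v ≡ false → I′ v ≡ I v
        ud⊆  : ∀ v → UD I′ v ≡ true → UD I v ≡ true × mb v ≡ false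

    luby-time : ℕ
    luby-time = 5 + (suc phm * phase-time + 5)

    luby-run : ∀ {I σ} → Vw σ I (λ _ → false) → Conflicts I → Will G μ w luby σ luby-time (Settled I)
    luby-run {I} {σ} view conf = loud view kick refl refl refl (kicked I) (λ _ → false)
        (λ v → if-same inn (mb v) (λ e → cong₂ (λ i c → i ∧ not c) (i≡ v) (trans (cong₂ _∧_ (h≡ v) (Local.domL≡ view v)) (trans (cong (_∧ LD I v) (mb⇒H v e)) (sym (cong (_∧ LD I v) e)))))
                                   (λ e → trans (i≡ v) (sym (kicked-out I v e))))
        (λ v → if-same al (mb v) (λ _ → a≡ v) (λ _ → a≡ v)) λ view₁ _ →
      phases-run phm view₁ (λ _ _ → refl) (kicked-Ind I conf) (≤-<-trans (*-monoʳ-≤ (23 ^ phm) (∑-bound n (λ v → count≤n (E (kicked I) v)))) small)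
      λ {I′} {A′} view₂ hA ind′ up out dead →
      -- No member is undominated any more, so this pulse only clears the `al` flags.
      loud view₂ alv refl refl refl I′ (λ _ → false) (λ v → if-same inn (mb v) (λ _ → View.i≡ view₂ v) (λ _ → View.i≡ view₂ v))
        (λ v → if-same al (mb v) (λ e → trans (cong₂ _∧_ (View.h≡ view₂ v) (Local.ud≡ view₂ v)) (trans (cong (_∧ UD I′ v) (mb⇒H v e)) (trans (sym (cong (_∧ UD I′ v) e)) (dead v))))
          (λ e → trans (View.a≡ view₂ v) (hA v e))) λ view₃ _ →
      will halt (record { view = view₃ ; ind = ind′ ; same = λ v e → trans (out v e) (kicked-out I v e)
        ; ud⊆ = λ v e → let m = ¬true⇒false (λ e′ → true≢false (∧-intro e′ e) (dead v)) in kicked-UD I conf v m (UD-mono up v e) , m })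
      where open View view

  -- Encoding of messages with a constant number of base `N` digits

  module Messages (N : ℕ) (2≤N : 2 ≤ N) (1≤n : 1 ≤ n) (n≤ : n ≤ N ^ 1) (v≤ : suc vmax ≤ N ^ 18) where
    open Codecs N 2≤N using (bool-codec; bounded; pair-codec; retract; sum-codec; unit)

    val-codec : Codec N 18 Val
    val-codec = bounded 18 (s≤s z≤n) v≤

    vertex-codec : Codec N 1 V
    vertex-codec = bounded 1 1≤n n≤

    info-codec : Codec N 21 Info
    info-codec = retract (λ i → hv i , inn i , al i , dg i) (λ { (a , c , d , e) → mkInfo a c d e }) (λ _ → refl) (pair-codec bool-codec (pair-codec bool-codec (pair-codec bool-codec val-codec)))

    OpSum : Set
    OpSum = ⊤ ⊎ ⊤ ⊎ ⊤ ⊎ ⊤ ⊎ ⊤ ⊎ ⊤ ⊎ (Val × Val) ⊎ Val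

    op-codec : Codec N 61 Op
    op-codec = retract {A′ = OpSum} to′ from′ (λ { poll → refl ; cnt → refl ; cntD → refl ; kick → refl ; alv → refl ; dgr → refl ; (bit _ _) → refl ; (jn _) → refl })
      (sum-codec unit (sum-codec unit (sum-codec unit (sum-codec unit (sum-codec unit (sum-codec unit (sum-codec (pair-codec val-codec val-codec) val-codec)))))))
      where
      to′ : Op → OpSum
      to′ poll = inj₁ tt
      to′ cnt = inj₂ (inj₁ tt)
      to′ cntD = inj₂ (inj₂ (inj₁ tt))
      to′ kick = inj₂ (inj₂ (inj₂ (inj₁ tt)))
      to′ alv = inj₂ (inj₂ (inj₂ (inj₂ (inj₁ tt))))
      to′ dgr = inj₂ (inj₂ (inj₂ (inj₂ (inj₂ (inj₁ tt)))))
      to′ (bit x y) = inj₂ (inj₂ (inj₂ (inj₂ (inj₂ (inj₂ (inj₁ (x , y)))))))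
      to′ (jn x) = inj₂ (inj₂ (inj₂ (inj₂ (inj₂ (inj₂ (inj₂ x))))))
      from′ : OpSum → Op
      from′ (inj₁ _) = poll
      from′ (inj₂ (inj₁ _)) = cnt
      from′ (inj₂ (inj₂ (inj₁ _))) = cntD
      from′ (inj₂ (inj₂ (inj₂ (inj₁ _)))) = kick
      from′ (inj₂ (inj₂ (inj₂ (inj₂ (inj₁ _))))) = alv
      from′ (inj₂ (inj₂ (inj₂ (inj₂ (inj₂ (inj₁ _)))))) = dgr
      from′ (inj₂ (inj₂ (inj₂ (inj₂ (inj₂ (inj₂ (inj₁ (x , y)))))))) = bit x y
      from′ (inj₂ (inj₂ (inj₂ (inj₂ (inj₂ (inj₂ (inj₂ x))))))) = jn x

    CodeSum : Set
    CodeSum = ⊤ ⊎ ⊤ ⊎ ⊤ ⊎ ⊤ ⊎ ⊤ ⊎ V ⊎ V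

    code-codec : Codec N 8 Code
    code-codec = retract {A′ = CodeSum} to′ from′ (λ { red → refl ; settle → refl ; up → refl ; demote → refl ; fix → refl ; (relay _) → refl ; (link _) → refl })
      (sum-codec unit (sum-codec unit (sum-codec unit (sum-codec unit (sum-codec unit (sum-codec vertex-codec vertex-codec))))))
      where
      to′ : Code → CodeSum
      to′ red = inj₁ tt
      to′ settle = inj₂ (inj₁ tt)
      to′ up = inj₂ (inj₂ (inj₁ tt))
      to′ demote = inj₂ (inj₂ (inj₂ (inj₁ tt)))
      to′ fix = inj₂ (inj₂ (inj₂ (inj₂ (inj₁ tt))))
      to′ (relay x) = inj₂ (inj₂ (inj₂ (inj₂ (inj₂ (inj₁ x)))))
      to′ (link x) = inj₂ (inj₂ (inj₂ (inj₂ (inj₂ (inj₂ x)))))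
      from′ : CodeSum → Code
      from′ (inj₁ _) = red
      from′ (inj₂ (inj₁ _)) = settle
      from′ (inj₂ (inj₂ (inj₁ _))) = up
      from′ (inj₂ (inj₂ (inj₂ (inj₁ _)))) = demote
      from′ (inj₂ (inj₂ (inj₂ (inj₂ (inj₁ _))))) = fix
      from′ (inj₂ (inj₂ (inj₂ (inj₂ (inj₂ (inj₁ x)))))) = relay x
      from′ (inj₂ (inj₂ (inj₂ (inj₂ (inj₂ (inj₂ x)))))) = link x

    pick-codec : Codec N 20 (Maybe (Val × V))
    pick-codec = retract {A′ = ⊤ ⊎ (Val × V)} (λ { nothing → inj₁ tt ; (just p) → inj₂ p }) (λ { (inj₁ _) → nothing ; (inj₂ p) → just p }) (λ { nothing → refl ; (just _) → refl })
      (sum-codec unit (pair-codec val-codec vertex-codec))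

    res-codec : Codec N 92 Res
    res-codec = retract (λ r → r₀ r , r₁ r , r₂ r , r₃ r , pk r) (λ { (a , c , d , e , f) → mkRes a c d e f }) (λ _ → refl)
      (pair-codec val-codec (pair-codec val-codec (pair-codec val-codec (pair-codec val-codec pick-codec))))

    KindSum : Set
    KindSum = Op ⊎ Op ⊎ (Bool × Res) ⊎ Res ⊎ Code ⊎ ⊤

    kind-codec : Codec N 320 Kind
    kind-codec = retract {A′ = KindSum} to′ from′ (λ { (p1 _) → refl ; (p2 _) → refl ; (p3 _ _) → refl ; (p4 _) → refl ; (callK _) → refl ; retK → refl })
      (sum-codec op-codec (sum-codec op-codec (sum-codec (pair-codec bool-codec res-codec) (sum-codec res-codec (sum-codec code-codec unit)))))
      where
      to′ : Kind → KindSum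
      to′ (p1 x) = inj₁ x
      to′ (p2 x) = inj₂ (inj₁ x)
      to′ (p3 c x) = inj₂ (inj₂ (inj₁ (c , x)))
      to′ (p4 x) = inj₂ (inj₂ (inj₂ (inj₁ x)))
      to′ (callK x) = inj₂ (inj₂ (inj₂ (inj₂ (inj₁ x))))
      to′ retK = inj₂ (inj₂ (inj₂ (inj₂ (inj₂ tt))))
      from′ : KindSum → Kind
      from′ (inj₁ x) = p1 x
      from′ (inj₂ (inj₁ x)) = p2 x
      from′ (inj₂ (inj₂ (inj₁ (c , x)))) = p3 c x
      from′ (inj₂ (inj₂ (inj₂ (inj₁ x)))) = p4 x
      from′ (inj₂ (inj₂ (inj₂ (inj₂ (inj₁ x))))) = callK x
      from′ (inj₂ (inj₂ (inj₂ (inj₂ (inj₂ _))))) = retK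

    -- 320 digits for the kind and 21 for the `Info`; most of them are numbers of 18 digits, the
    -- size chosen for aggregated gains and losses.
    message-codec : Codec N 341 M
    message-codec = retract (λ m → kind m , info m) (λ { (k , i) → mkM k i }) (λ _ → refl) (pair-codec kind-codec info-codec)

  -- Invariants, the potential, and the amortised cost of the programs

  module On (ρ : ℕ) (1≤ρ : 1 ≤ ρ) (G : Graph n) (hE : ∑ (λ v → count (G v)) ≤ 2 * ρ ^ 3) where

    deg NH : Glob n → Fin n → ℕ
    deg g v = count (Nb g v)
    NH g v = count (λ u → Nb g v u ∧ Hv g u)

    UDg : Glob n → Fin n → Bool
    UDg g = Domination.UD (Nb g) (Hv g) (In g)

    φ : Bool → Bool → ℕ
    φ h i = if h then 2 else (if i then 0 else 1)

    Φ : Glob n → ℕ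
    Φ g = ∑ (λ v → φ (Hv g v) (In g v))

    -- One more than `cM`, the number of heavy vertices left around a reduced vertex: a vertex
    -- turning heavy, or a new edge, adds one heavy neighbour.
    κ : ℕ
    κ = 2 * ρ + 3

    -- `light` makes it affordable to address all neighbours of a light vertex, `heavy` to address
    -- the heavy neighbours of a heavy one. A light vertex may still have about `ρ²` heavy
    -- neighbours.
    record Inv (g : Glob n) : Set where
      field
        N-sym : ∀ u v → Nb g u v ≡ Nb g v u
        N-irr : ∀ u → Nb g u u ≡ false
        N⊆G   : ∀ u v → Nb g u v ≡ true → G u v ≡ true
        light : ∀ v → Hv g v ≡ false → deg g v ≤ 2 * ρ ^ 2
        heavy : ∀ v → Hv g v ≡ true → NH g v ≤ κ
        pins  : count (Pn g) ≤ 2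

    Indep : Glob n → Set
    Indep g = Domination.Ind (Nb g) (Hv g) (In g)

    -- What a caller may rely on across reductions and settlings. By `ud-back` no vertex becomes
    -- undominated, and one that stays undominated keeps its weight, so a caller's account of the
    -- vertices still to be repaired remains valid.
    record Trans (g g′ : Glob n) : Set where
      field
        N≡ : ∀ u v → Nb g′ u v ≡ Nb g u v
        P≡ : ∀ v → Pn g′ v ≡ Pn g v
        stay-light : ∀ v → Hv g v ≡ false → Hv g′ v ≡ false
        stay-in : ∀ v → Hv g v ≡ false → In g v ≡ true → In g′ v ≡ true
        stay-pin : ∀ v → Pn g v ≡ true → Hv g′ v ≡ Hv g v
        ud-back : ∀ v → UDg g′ v ≡ true → UDg g v ≡ true × Hv g′ v ≡ Hv g v
    open Trans public

    trans-refl : ∀ {g} → Trans g g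
    trans-refl = record { N≡ = λ _ _ → refl ; P≡ = λ _ → refl ; stay-light = λ _ h → h ; stay-in = λ _ _ i → i ; stay-pin = λ _ _ → refl ; ud-back = λ _ e → e , refl }

    trans-trans : ∀ {g g₁ g₂} → Trans g g₁ → Trans g₁ g₂ → Trans g g₂
    trans-trans a c = record
      { N≡ = λ u v → trans (N≡ c u v) (N≡ a u v) ; P≡ = λ v → trans (P≡ c v) (P≡ a v)
      ; stay-light = λ v h → stay-light c v (stay-light a v h)
      ; stay-in = λ v h i → stay-in c v (stay-light a v h) (stay-in a v h i)
      ; stay-pin = λ v p → trans (stay-pin c v (trans (P≡ a v) p)) (stay-pin a v p)
      ; ud-back = λ v e → proj₁ (ud-back a v (proj₁ (ud-back c v e))) , trans (proj₂ (ud-back c v e)) (proj₂ (ud-back a v (proj₁ (ud-back c v e)))) }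

    sum-deg : ∀ {g} → Inv g → ∑ (deg g) ≤ 2 * ρ ^ 3
    sum-deg I = ≤-trans (∑-mono (λ v → count-mono (λ u → Inv.N⊆G I v u))) hE

    cube-≤ : ∀ x y → x ^ 3 ≤ y ^ 3 → x ≤ y
    cube-≤ x y h = ≮⇒≥ λ lt → <⇒≱ (^-monoˡ-< 3 lt) h

    volume : ∀ {g} (I : Inv g) (S : Fin n → Bool) d → (∀ v → S v ≡ true → d ≤ deg g v) → count S * d ≤ 2 * ρ ^ 3
    volume {g} I S d h = ≤-trans (≤-reflexive (sym (∑-*ʳ d (λ v → b2n (S v))))) (≤-trans (∑-mono (λ v → go v (S v) refl)) (sum-deg I))
      where
      go : ∀ v c → S v ≡ c → b2n c * d ≤ deg g v
      go v true  e = ≤-trans (≤-reflexive (+-identityʳ d)) (h v e)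
      go v false e = z≤n

    -- r δ ≤ 2m and δ ≤ r² give δ³ ≤ (r δ)² ≤ 4 m².
    cheap : ∀ {g} (I : Inv g) (S : Fin n → Bool) d → (∀ v → S v ≡ true → d ≤ deg g v) → d ≤ count S * count S → d ≤ 2 * ρ ^ 2
    cheap I S d h le = cube-≤ d (2 * ρ ^ 2) (begin
      d ^ 3 ≡⟨ eq₁ d ⟩
      d * (d * d) ≤⟨ *-monoˡ-≤ (d * d) le ⟩
      count S * count S * (d * d) ≡⟨ eq₂ (count S) d ⟩
      (count S * d) * (count S * d) ≤⟨ *-mono-≤ (volume I S d h) (volume I S d h) ⟩
      (2 * ρ ^ 3) * (2 * ρ ^ 3) ≤⟨ m≤m+n _ _ ⟩
      (2 * ρ ^ 3) * (2 * ρ ^ 3) + (2 * ρ ^ 3) * (2 * ρ ^ 3) ≡⟨ eq₃ ρ ⟩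
      (2 * ρ ^ 2) ^ 3 ∎)
      where
      open ≤-Reasoning
      eq₁ : ∀ d → d * (d * (d * 1)) ≡ d * (d * d)
      eq₁ = solve-∀
      eq₂ : ∀ r d → r * r * (d * d) ≡ (r * d) * (r * d)
      eq₂ = solve-∀
      eq₃ : ∀ ρ → (2 * (ρ * (ρ * (ρ * 1)))) * (2 * (ρ * (ρ * (ρ * 1)))) + (2 * (ρ * (ρ * (ρ * 1)))) * (2 * (ρ * (ρ * (ρ * 1))))
        ≡ (2 * (ρ * (ρ * 1))) * ((2 * (ρ * (ρ * 1))) * ((2 * (ρ * (ρ * 1))) * 1))
      eq₃ = solve-∀

    few : ∀ {g} (I : Inv g) (S : Fin n → Bool) → (∀ v → S v ≡ true → count S * count S ≤ deg g v) → count S ≤ 2 * ρ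
    few I S h = cube-≤ (count S) (2 * ρ) (begin
      count S ^ 3 ≡⟨ eq₁ (count S) ⟩
      count S * (count S * count S) ≤⟨ volume I S (count S * count S) h ⟩
      2 * ρ ^ 3 ≤⟨ m≤m+n _ _ ⟩
      2 * ρ ^ 3 + 6 * ρ ^ 3 ≡⟨ eq₂ ρ ⟩
      (2 * ρ) ^ 3 ∎)
      where
      open ≤-Reasoning
      eq₁ : ∀ d → d * (d * (d * 1)) ≡ d * (d * d)
      eq₁ = solve-∀
      eq₂ : ∀ ρ → 2 * (ρ * (ρ * (ρ * 1))) + 6 * (ρ * (ρ * (ρ * 1))) ≡ (2 * ρ) * ((2 * ρ) * ((2 * ρ) * 1))
      eq₂ = solve-∀

    -- Pinned vertices must not be lightened, so the certificate ignores them; they add at most 2 to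
    -- the count, which is where `cM = 2 * ρ + 2` comes from.
    unpinned : ∀ {g} (I : Inv g) (S : Fin n → Bool) → count S ≤ count (λ v → S v ∧ not (Pn g v)) + 2
    unpinned {g} I S = ≤-trans (∑-mono (λ v → go (S v) (Pn g v))) (≤-trans (≤-reflexive (∑-+ (λ v → b2n (S v ∧ not (Pn g v))) (λ v → b2n (Pn g v)))) (+-monoʳ-≤ (count (λ v → S v ∧ not (Pn g v))) (Inv.pins I)))
      where
      go : ∀ s p → b2n s ≤ b2n (s ∧ not p) + b2n p
      go false p = z≤n
      go true true = ≤-refl
      go true false = ≤-refl

    setF : ∀ {A : Set} → Fin n → A → (Fin n → A) → Fin n → A
    setF w x f v = if eqᵇ v w then x else f v

    setF-self : ∀ {A : Set} w {x : A} f → setF w x f w ≡ x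
    setF-self w f = if-true (eqᵇ-refl w)

    setF-other : ∀ {A : Set} {w v} {x : A} f → v ≢ w → setF w x f v ≡ f v
    setF-other f p = if-false (eqᵇ-≢ p)

    ∑-set : (f f′ : Fin n → ℕ) (w : Fin n) → (∀ v → v ≢ w → f′ v ≤ f v) → ∀ d → f′ w + d ≤ f w → ∑ f′ + d ≤ ∑ f
    ∑-set f f′ w h d hw = ≤-trans (+-monoʳ-≤ (∑ f′) (term≤′ w d)) (≤-trans (≤-reflexive (sym (∑-+ f′ (λ v → if eqᵇ v w then d else 0)))) (∑-mono (λ v → one v (v ≟ w))))
      where
      term≤′ : ∀ w d → d ≤ ∑ (λ v → if eqᵇ v w then d else 0)
      term≤′ w d = ≤-trans (≤-reflexive (sym (if-true (eqᵇ-refl w)))) (term≤∑ (λ v → if eqᵇ v w then d else 0) w)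
      one : ∀ v → Dec (v ≡ w) → f′ v + (if eqᵇ v w then d else 0) ≤ f v
      one v (yes refl) = ≤-trans (≤-reflexive (cong (f′ v +_) (if-true (eqᵇ-refl v)))) hw
      one v (no p) = ≤-trans (≤-reflexive (trans (cong (f′ v +_) (if-false (eqᵇ-≢ p))) (+-identityʳ _))) (h v p)

    φ≤2 : ∀ h i → φ h i ≤ 2
    φ≤2 true i = ≤-refl
    φ≤2 false true = z≤n
    φ≤2 false false = s≤s z≤n

    φ-in : ∀ h {i j} → (h ≡ false → i ≡ true → j ≡ true) → φ h j ≤ φ h i
    φ-in true  k = ≤-refl
    φ-in false {true}  k = ≤-reflexive (cong (φ false) (k refl refl))
    φ-in false {false} {true}  k = z≤n
    φ-in false {false} {false} k = ≤-refl

    lightened : Fin n → Glob n → Glob n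
    lightened z g = record g { Hv = setF z false (Hv g) }

    Hv-lightened : ∀ {g z v} → Hv (lightened z g) v ≡ true → Hv g v ≡ true
    Hv-lightened {g} {z} {v} e with v ≟ z
    Hv-lightened () | yes _
    ... | no _ = e

    Inv-lightened : ∀ {g z} → Inv g → deg g z ≤ 2 * ρ ^ 2 → Inv (lightened z g)
    Inv-lightened {g} {z} I d = record
      { N-sym = N-sym ; N-irr = N-irr ; N⊆G = N⊆G ; pins = pins
      ; light = λ v e → go v e (v ≟ z)
      ; heavy = λ v e → ≤-trans (count-mono (λ u h → ∧-intro (∧-trueˡ h) (Hv-lightened {g} {z} (∧-trueʳ {Nb g v u} h)))) (heavy v (Hv-lightened {g} {z} e)) }
      where
      open Inv I
      go : ∀ v → Hv (lightened z g) v ≡ false → Dec (v ≡ z) → deg g v ≤ 2 * ρ ^ 2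
      go v e (yes refl) = d
      go v e (no p) = light v (trans (sym (setF-other (Hv g) p)) e)

    Φ-lightened : ∀ {g z} → Hv g z ≡ true → suc (Φ (lightened z g)) ≤ Φ g
    Φ-lightened {g} {z} h = ≤-trans (≤-reflexive (+-comm 1 _)) (∑-set (λ v → φ (Hv g v) (In g v)) (λ v → φ (Hv (lightened z g) v) (In g v)) z
      (λ v p → ≤-reflexive (cong (λ c → φ c (In g v)) (setF-other (Hv g) p))) 1
      (≤-trans (≤-reflexive (cong (λ c → φ c (In g z) + 1) (setF-self z (Hv g)))) (≤-trans (go (In g z)) (≤-reflexive (cong (λ c → φ c (In g z)) (sym h))))))
      where
      go : ∀ i → φ false i + 1 ≤ 2
      go true = s≤s z≤n
      go false = ≤-refl

    -- Lightening a vertex leaves the set as it is and can only add light dominators. Heavy vertices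
    -- accept any dominator, light ones keep theirs; only the lightened vertex itself applies a
    -- stricter test.
    UD-lightened : ∀ {g z v} → v ≢ z → UDg (lightened z g) v ≡ true → UDg g v ≡ true × Hv (lightened z g) v ≡ Hv g v
    UD-lightened {g} {z} {v} p e = D.UD-intro (D′.UD-in {In g} {v} e) (¬true⇒false λ d → true≢false (keep (Hv g v) refl d) (D′.UD-dom {In g} {v} e)) , same
      where
      module D = Domination (Nb g) (Hv g) using (UD-intro; dom)
      module D′ = Domination (Nb g) (Hv (lightened z g)) using (UD-dom; UD-in; dom; dom-light)
      same : Hv (lightened z g) v ≡ Hv g v
      same = setF-other (Hv g) p
      keep : ∀ c → Hv g v ≡ c → D.dom (In g) v ≡ true → D′.dom (In g) v ≡ true
      keep true h d = trans (if-true (trans same h)) (trans (sym (if-true h)) d)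
      keep false h d with anyF-elim _ (trans (sym (if-false h)) d)
      ... | u , q = D′.dom-light (trans same h) u (∧-trueˡ {Nb g v u} q) (∧-trueˡ {In g u} (∧-trueʳ {Nb g v u} q))
        (¬true⇒false λ t → true≢false (Hv-lightened {g} {z} t) (not-true (∧-trueʳ {In g u} (∧-trueʳ {Nb g v u} q))))

    -- The charge per round. A deep pulse sends at most `8ρ² + 26ρ + 18 ≤ 52ρ²` messages in five
    -- rounds, and 11 is the least integer whose fivefold reaches 52.
    μ : ℕ
    μ = 11 * (ρ * ρ)

    ρ≤ρ² : ρ ≤ ρ * ρ
    ρ≤ρ² = ≤-trans (≤-reflexive (sym (*-identityʳ ρ))) (*-monoʳ-≤ ρ 1≤ρ)

    1≤ρ² : 1 ≤ ρ * ρ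
    1≤ρ² = ≤-trans 1≤ρ ρ≤ρ²

    cM : ℕ
    cM = 2 * ρ + 2

    cost-deep : ((cM + cM * κ) + cM * suc κ) + cM ≤ 5 * μ
    cost-deep = ≤-trans (≤-reflexive (eq₁ ρ)) (≤-trans (+-mono-≤ (+-monoʳ-≤ (8 * (ρ * ρ)) (*-monoʳ-≤ 26 ρ≤ρ²)) (*-monoʳ-≤ 18 1≤ρ²)) (≤-trans (m≤m+n _ (3 * (ρ * ρ))) (≤-reflexive (eq₂ (ρ * ρ)))))
      where
      eq₁ : ∀ r → (((2 * r + 2) + (2 * r + 2) * (2 * r + 3)) + (2 * r + 2) * suc (2 * r + 3)) + (2 * r + 2) ≡ 8 * (r * r) + 26 * r + 18 * 1
      eq₁ = solve-∀
      eq₂ : ∀ q → 8 * q + 26 * q + 18 * q + 3 * q ≡ 5 * (11 * q)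
      eq₂ = solve-∀

    cost-deep₀ : ((cM + cM * κ) + (cM * κ) * 1) + cM ≤ 5 * μ
    cost-deep₀ = ≤-trans (+-monoˡ-≤ cM (+-monoʳ-≤ (cM + cM * κ) (≤-trans (≤-reflexive (*-identityʳ (cM * κ))) (*-monoʳ-≤ cM (n≤1+n κ))))) cost-deep

    cost-shallow : ∀ a → a ≤ κ ⊎ a ≤ 2 * ρ ^ 2 → ((a + a * 0) + 0 * 1) + a ≤ 5 * μ
    cost-shallow a h = ≤-trans (≤-reflexive (eq a)) (≤-trans (*-monoʳ-≤ 2 (bnd h)) (≤-trans (m≤m+n _ (45 * (ρ * ρ))) (≤-reflexive (eq₂ (ρ * ρ)))))
      where
      eq : ∀ a → ((a + a * 0) + 0 * 1) + a ≡ 2 * a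
      eq = solve-∀
      eq₂ : ∀ q → 2 * (5 * q) + 45 * q ≡ 5 * (11 * q)
      eq₂ = solve-∀
      bnd : a ≤ κ ⊎ a ≤ 2 * ρ ^ 2 → a ≤ 5 * (ρ * ρ)
      bnd (inj₁ h) = ≤-trans h (≤-trans (+-mono-≤ (*-monoʳ-≤ 2 ρ≤ρ²) (*-monoʳ-≤ 3 1≤ρ²)) (≤-reflexive (sym (*-distribʳ-+ (ρ * ρ) 2 3))))
      bnd (inj₂ h) = ≤-trans h (≤-trans (≤-reflexive (cong (λ z → 2 * (ρ * z)) (*-identityʳ ρ))) (*-monoˡ-≤ (ρ * ρ) {2} {5} (s≤s (s≤s z≤n))))

    VG : Glob n → (V → Loc) → Set
    VG g σ = View (Nb g) (Hv g) (Pn g) σ (In g) (λ _ → false)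

    record PreV (g : Glob n) (σ : V → Loc) : Set where
      field
        wf : Wf σ
        n≡ : ∀ u v → nbr (σ u) v ≡ Nb g u v
        h≡ : ∀ v → hv (inf (σ v)) ≡ Hv g v
        p≡ : ∀ v → pin (σ v) ≡ Pn g v
        i≡ : ∀ v → inn (inf (σ v)) ≡ In g v
        a≡ : ∀ v → al (inf (σ v)) ≡ false

    pre : ∀ {g σ} → VG g σ → PreV g σ
    pre v = record { wf = wf ; n≡ = n≡ ; h≡ = h≡ ; p≡ = p≡ ; i≡ = i≡ ; a≡ = a≡ }
      where open View v

    -- The postcondition may mention the time, because running time and loss of potential are
    -- bounded jointly.
    record Does (w : V) (p : Prog) (σ : V → Loc) (Post : ℕ → (V → Loc) → Set) : Set where
      constructor runsTo
      field
        {t}  : ℕ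
        {σ′} : V → Loc
        runs : Run G μ w p σ t σ′
        post : Post t σ′

    d-map : ∀ {w p σ} {P Q : ℕ → (V → Loc) → Set} → (∀ {t σ′} → P t σ′ → Q t σ′) → Does w p σ P → Does w p σ Q
    d-map f (runsTo r p) = runsTo r (f p)

    d-upd : ∀ {w f p σ Post} → Does w p (setL w (f (σ w)) σ) (λ t → Post (suc t)) → Does w (upd f p) σ Post
    d-upd (runsTo r p) = runsTo (upd r) p

    d-ask : ∀ {w f σ Post} → Does w (f (σ w)) σ (λ t → Post (suc t)) → Does w (ask f) σ Post
    d-ask (runsTo r p) = runsTo (ask r) p

    d-goto : ∀ {w c σ Post} → Does w (code c) σ (λ t → Post (suc t)) → Does w (goto c) σ Post
    d-goto (runsTo r p) = runsTo (goto r) p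

    d-sub : ∀ {w c p σ Post} {P : ℕ → (V → Loc) → Set} → Does w (code c) σ P → (∀ {t₁ σ₁} → P t₁ σ₁ → Does w p σ₁ (λ t₂ → Post (suc t₁ + suc t₂))) → Does w (sub c p) σ Post
    d-sub (runsTo r p) k with k p
    ... | runsTo r′ p′ = runsTo (sub r r′) p′

    d-call : ∀ {w z c p σ Post} {P : ℕ → (V → Loc) → Set} → w ≢ z → G w z ≡ true → Does z (code c) (hear w z σ) P →
      (∀ {t₁ σ₁} → P t₁ σ₁ → Does w p (hear z w σ₁) (λ t₂ → Post ((2 + t₁) + (2 + t₂)))) → Does w (call z c p) σ Post
    d-call q e (runsTo r p) k with k p
    ... | runsTo r′ p′ = runsTo (call q e r r′) p′

    hear-inf : ∀ a d σ x → inf (hear a d σ x) ≡ inf (σ x)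
    hear-inf a d σ x with x ≟ d
    ... | yes refl = refl
    ... | no _ = refl

    hear-keeps : ∀ {A : Set} (f : Loc → A) → (∀ u i l → f (learn u i l) ≡ f l) → ∀ a d σ x → f (hear a d σ x) ≡ f (σ x)
    hear-keeps f h a d σ x with x ≟ d
    ... | yes refl = h a (inf (σ a)) (σ x)
    ... | no _ = refl

    hear-tb : ∀ a d σ v u → tb (hear a d σ v) u ≡ tb (σ v) u ⊎ tb (hear a d σ v) u ≡ inf (σ u)
    hear-tb a d σ v u with v ≟ d
    ... | no _ = inj₁ refl
    ... | yes refl = subst (λ z → z ≡ tb (σ v) u ⊎ z ≡ inf (σ u)) (sym (tb-mg (λ x → if eqᵇ x a then just (mkM retK (inf (σ a))) else nothing) (σ v) u)) (go (u ≟ a))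
      where
      go : Dec (u ≡ a) → maybe info (tb (σ v) u) (if eqᵇ u a then just (mkM retK (inf (σ a))) else nothing) ≡ tb (σ v) u ⊎ maybe info (tb (σ v) u) (if eqᵇ u a then just (mkM retK (inf (σ a))) else nothing) ≡ inf (σ u)
      go (yes refl) = inj₂ (cong (maybe info (tb (σ v) u)) (if-true (eqᵇ-refl u)))
      go (no p) = inj₁ (cong (maybe info (tb (σ v) u)) (if-false (eqᵇ-≢ p)))

    Knows-hear : ∀ {σ} a d v u → Knows σ v u → Knows (hear a d σ) v u
    Knows-hear {σ} a d v u k = go (hear-tb a d σ v u)
      where
      iu = hear-inf a d σ u
      go : tb (hear a d σ v) u ≡ tb (σ v) u ⊎ tb (hear a d σ v) u ≡ inf (σ u) → Knows (hear a d σ) v u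
      go (inj₂ e) = knows (λ _ → trans e (sym iu)) (cong hv (trans e (sym iu)))
      go (inj₁ e) = knows (λ { (inj₁ h) → trans e (trans (full k (inj₁ (trans (cong hv (sym (hear-inf a d σ v))) h))) (sym iu))
                             ; (inj₂ h) → trans e (trans (full k (inj₂ (trans (cong hv (sym iu)) h))) (sym iu)) })
                          (trans (cong hv e) (trans (flag k) (cong hv (sym iu))))

    hear-pre : ∀ {g σ} a d → PreV g σ → PreV g (hear a d σ)
    hear-pre {g} {σ} a d view = record
      { wf = record { me≡ = λ v → trans (hear-keeps me (λ _ _ _ → refl) a d σ v) (me≡ wf v)
                    ; nbr-sym = λ u v → trans (nb u v) (trans (nbr-sym wf u v) (sym (nb v u)))
                    ; nbr-irr = λ u → trans (nb u u) (nbr-irr wf u) }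
      ; n≡ = λ u v → trans (nb u v) (n≡ u v)
      ; h≡ = λ v → trans (cong hv (hear-inf a d σ v)) (h≡ v)
      ; p≡ = λ v → trans (hear-keeps pin (λ _ _ _ → refl) a d σ v) (p≡ v)
      ; i≡ = λ v → trans (cong inn (hear-inf a d σ v)) (i≡ v)
      ; a≡ = λ v → trans (cong al (hear-inf a d σ v)) (a≡ v) }
      where
      open PreV view
      nb : ∀ u v → nbr (hear a d σ u) v ≡ nbr (σ u) v
      nb u v = cong (λ f → f v) (hear-keeps nbr (λ _ _ _ → refl) a d σ u)

    withKnown : ∀ {g σ} → PreV g σ → Known σ → VG g σ
    withKnown v k = record { wf = wf ; known = k ; n≡ = n≡ ; h≡ = h≡ ; p≡ = p≡ ; i≡ = i≡ ; a≡ = a≡ }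
      where open PreV v

    hear-view : ∀ {g σ} a d → VG g σ → VG g (hear a d σ)
    hear-view {g} {σ} a d view = withKnown (hear-pre a d (pre view))
      (λ v u e → Knows-hear a d v u (View.known view v u (trans (cong (λ f → f u) (sym (hear-keeps nbr (λ _ _ _ → refl) a d σ v))) e)))

    hush : ∀ {g σ w f Post} o → PreV g σ → Inv g → (∀ l → act o l ≡ inf l) → (wf : Wf σ) → Effect.PreKnows⁺ σ w o wf → PulseOf.pulseMsgs σ w o ≤ 5 * μ →
      (VG g (PulseOf.after σ w o) → Does w (f (PulseOf.answer σ w o)) (PulseOf.after σ w o) (λ t → Post (5 + t))) → Does w (pulse o f) σ Post
    hush {g} {σ} {w} {f} {Post} o view I q wf pk cost k = fin (k view′)
      where
      open Effect σ w o wf using (wf-after; knows-quiet; nbr-after; hv-after; pin-after; inf-quiet)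
      view′ : VG g (PulseOf.after σ w o)
      view′ = record { wf = wf-after ; known = knows-quiet q pk ; n≡ = λ u v → trans (cong (λ f → f v) (nbr-after u)) (PreV.n≡ view u v) ; h≡ = λ v → trans (hv-after v) (PreV.h≡ view v)
                     ; p≡ = λ v → trans (pin-after v) (PreV.p≡ view v) ; i≡ = λ v → trans (cong inn (inf-quiet q v)) (PreV.i≡ view v) ; a≡ = λ v → trans (cong al (inf-quiet q v)) (PreV.a≡ view v) }
      fin : Does w (f (PulseOf.answer σ w o)) (PulseOf.after σ w o) (λ t → Post (5 + t)) → Does w (pulse o f) σ Post
      fin (runsTo r p) = runsTo (pulse (me≡ wf) (λ u v e → Inv.N⊆G I u v (trans (sym (PreV.n≡ view u v)) e)) cost r) p

    module SetLoc {g : Glob n} {σ : V → Loc} (view : VG g σ) (w : V) (l : Loc) (g′ : Glob n)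
      (l-me : me l ≡ w) (l-nbr : nbr l ≡ nbr (σ w)) (l-tab : tab l ≡ tab (σ w)) (l-hv : hv (inf l) ≡ Hv g′ w) (l-pin : pin l ≡ Pn g′ w) (l-inn : inn (inf l) ≡ In g′ w) (l-al : al (inf l) ≡ false)
      (g-N : ∀ u v → Nb g u v ≡ Nb g′ u v) (g-H : ∀ v → v ≢ w → Hv g′ v ≡ Hv g v) (g-P : ∀ v → v ≢ w → Pn g′ v ≡ Pn g v) (g-I : ∀ v → v ≢ w → In g′ v ≡ In g v) where
      open View view

      σ₁ : V → Loc
      σ₁ = setL w l σ

      self : σ₁ w ≡ l
      self = if-true (eqᵇ-refl w)

      other : ∀ {v} → v ≢ w → σ₁ v ≡ σ v
      other p = if-false (eqᵇ-≢ p)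

      pointwise : ∀ {A : Set} (f : Loc → A) {h : V → A} → f l ≡ h w → (∀ v → v ≢ w → f (σ v) ≡ h v) → ∀ v → f (σ₁ v) ≡ h v
      pointwise f e k v = go (v ≟ w)
        where
        go : Dec (v ≡ w) → f (σ₁ v) ≡ _
        go (yes refl) = trans (cong f self) e
        go (no p) = trans (cong f (other p)) (k v p)

      nb : ∀ u v → nbr (σ₁ u) v ≡ nbr (σ u) v
      nb u v = cong (λ f → f v) (pointwise nbr {λ u → nbr (σ u)} l-nbr (λ _ _ → refl) u)

      tb₁ : ∀ u v → tb (σ₁ u) v ≡ tb (σ u) v
      tb₁ u v = cong (λ t → lookup t v) (pointwise tab {λ u → tab (σ u)} l-tab (λ _ _ → refl) u)

      preV : PreV g′ σ₁
      preV = record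
        { wf = record { me≡ = pointwise me l-me (λ v _ → me≡ wf v) ; nbr-sym = λ u v → trans (nb u v) (trans (nbr-sym wf u v) (sym (nb v u))) ; nbr-irr = λ u → trans (nb u u) (nbr-irr wf u) }
        ; n≡ = λ u v → trans (nb u v) (trans (n≡ u v) (g-N u v))
        ; h≡ = pointwise (hv ∘ inf) l-hv (λ v p → trans (h≡ v) (sym (g-H v p)))
        ; p≡ = pointwise pin l-pin (λ v p → trans (p≡ v) (sym (g-P v p)))
        ; i≡ = pointwise (inn ∘ inf) l-inn (λ v p → trans (i≡ v) (sym (g-I v p)))
        ; a≡ = pointwise (al ∘ inf) l-al (λ v _ → a≡ v) }

      Knows-other : ∀ v u → nbr (σ₁ v) u ≡ true → v ≢ w → u ≢ w → Knows σ₁ v u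
      Knows-other v u e p q = knows (λ { (inj₁ h) → trans (tb₁ v u) (trans (full k (inj₁ (trans (cong hv (sym iv)) h))) (sym iu))
                                       ; (inj₂ h) → trans (tb₁ v u) (trans (full k (inj₂ (trans (cong hv (sym iu)) h))) (sym iu)) })
                                    (trans (cong hv (tb₁ v u)) (trans (flag k) (cong hv (sym iu))))
        where
        k : Knows σ v u
        k = known v u (trans (sym (nb v u)) e)
        iv : inf (σ₁ v) ≡ inf (σ v)
        iv = cong inf (other p)
        iu : inf (σ₁ u) ≡ inf (σ u)
        iu = cong inf (other q)

      -- After any change, a poll informs everybody.
      poll-pre : Effect.PreKnows⁺ σ₁ w poll (PreV.wf preV)
      poll-pre v u e = go (u ≟ w) (v ≟ w)
        where
        open PulseOf σ₁ w poll using (isX)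
        scope₁ : ∀ x → nbr (σ₁ w) x ≡ true → isX x ≡ true
        scope₁ x h = ∧-intro (∧-intro h refl) (not-false (eqᵇ-≢ (λ q → true≢false h (trans (cong (nbr (σ₁ w)) (trans q (me≡ (PreV.wf preV) w))) (nbr-irr (PreV.wf preV) w)))))
        go : Dec (u ≡ w) → Dec (v ≡ w) → Knows σ₁ v u ⊎ (u ≡ w × isX v ≡ true) ⊎ (v ≡ w × isX u ≡ true)
        go (yes refl) _ = inj₂ (inj₁ (refl , scope₁ v (trans (nbr-sym (PreV.wf preV) w v) e)))
        go (no q) (yes refl) = inj₂ (inj₂ (refl , scope₁ u e))
        go (no q) (no p) = inj₁ (Knows-other v u e p q)

      -- If w is and stays heavy, it suffices to inform its heavy neighbours.
      cnt-pre : Hv g w ≡ true → Hv g′ w ≡ true → Effect.PreKnows σ₁ w cnt (PreV.wf preV)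
      cnt-pre hw hw′ v u e = go (u ≟ w) (v ≟ w)
        where
        open PulseOf σ₁ w cnt using (isX)
        infw : hv (inf (σ₁ w)) ≡ true
        infw = trans (PreV.h≡ preV w) hw′
        go : Dec (u ≡ w) → Dec (v ≡ w) → Knows σ₁ v u ⊎ (u ≡ w × isX v ≡ true)
        go (no q) (no p) = inj₁ (Knows-other v u e p q)
        go (no q) (yes refl) = inj₁ (knows (λ _ → trans (tb₁ v u) (trans (full k (inj₁ (trans (h≡ v) hw))) (sym iu))) (trans (cong hv (tb₁ v u)) (trans (flag k) (cong hv (sym iu)))))
          where
          k : Knows σ v u
          k = known v u (trans (sym (nb v u)) e)
          iu : inf (σ₁ u) ≡ inf (σ u)
          iu = cong inf (other q)
        go (yes refl) (yes refl) = true≢false e (nbr-irr (PreV.wf preV) u)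
        go (yes refl) (no p) = heavy? (hv (inf (σ₁ v))) refl
          where
          k : Knows σ v u
          k = known v u (trans (sym (nb v u)) e)
          back : nbr (σ u) v ≡ true
          back = trans (nbr-sym wf u v) (trans (sym (nb v u)) e)
          heavy? : ∀ c → hv (inf (σ₁ v)) ≡ c → Knows σ₁ v u ⊎ (u ≡ u × isX v ≡ true)
          heavy? true h = inj₂ (refl , ∧-intro (∧-intro (trans (nb u v) back) (trans (cong hv (tb₁ u v)) (trans (flag (known u v back)) (trans (cong (hv ∘ inf) (sym (other p))) h))))
            (not-false (eqᵇ-≢ (λ q → p (trans q (me≡ (PreV.wf preV) u))))))
          heavy? false h = inj₁ (knows (λ { (inj₁ h′) → true≢false h′ h ; (inj₂ h′) → true≢false infw h′ }) (trans (cong hv (tb₁ v u)) (trans (flag k) (trans (h≡ u) (trans hw (sym infw))))))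

    poll-cost : ∀ {g σ} w → PreV g σ → deg g w ≤ 2 * ρ ^ 2 → PulseOf.pulseMsgs σ w poll ≤ 5 * μ
    poll-cost {g} {σ} w view h = ≤-trans (pulse-cost (deg g w) 0 0 0 (count-mono (λ v e → trans (sym (n≡ w v)) (isX⇒nbr v e))) (λ _ _ ()) (≤-reflexive (∑-zero {n} (λ u → cong b2n (isY-shallow refl u)))) (λ _ _ ()))
        (cost-shallow (deg g w) (inj₂ h))
      where
      open PreV view
      open Effect σ w poll wf using (isX⇒nbr)
      open Collect σ w poll wf using (isY-shallow; pulse-cost)

    X-count : ∀ {g} → Inv g → ∀ w → NH g w ≤ κ ⊎ NH g w ≤ 2 * ρ ^ 2
    X-count {g} I w = go (Hv g w) refl
      where
      go : ∀ c → Hv g w ≡ c → NH g w ≤ κ ⊎ NH g w ≤ 2 * ρ ^ 2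
      go true h = inj₁ (Inv.heavy I w h)
      go false h = inj₂ (≤-trans (count-mono {p = λ u → Nb g w u ∧ Hv g u} {q = Nb g w} (λ u e → ∧-trueˡ e)) (Inv.light I w h))

    cnt-cost : ∀ {g σ} w (view : PreV g σ) → Effect.PreKnows σ w cnt (PreV.wf view) → NH g w ≤ κ ⊎ NH g w ≤ 2 * ρ ^ 2 → PulseOf.pulseMsgs σ w cnt ≤ 5 * μ
    cnt-cost {g} {σ} w view pk I = ≤-trans (pulse-cost (NH g w) 0 0 0 (count-mono (λ v e → ∧-intro (trans (sym (n≡ w v)) (isX⇒nbr v e)) (trans (sym (h≡ v)) (X⇒hv v e)))) (λ _ _ ())
          (≤-reflexive (∑-zero {n} (λ u → cong b2n (isY-shallow refl u)))) (λ _ _ ())) (cost-shallow (NH g w) I)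
      where
      open PreV view
      open Effect σ w cnt wf using (isX⇒nbr; module Narrow)
      open Narrow refl pk using (X⇒hv)
      open Collect σ w cnt wf using (isY-shallow; pulse-cost)

    preKnows : ∀ {g σ} (view : VG g σ) w o → Effect.PreKnows⁺ σ w o (View.wf view)
    preKnows view w o v u e = inj₁ (View.known view v u e)

    preKnows′ : ∀ {g σ} (view : VG g σ) w o → Effect.PreKnows σ w o (View.wf view)
    preKnows′ view w o v u e = inj₁ (View.known view v u e)

    toV-deg : ∀ g v → toℕ (toV (deg g v)) ≡ deg g v
    toV-deg g v = toV-id (≤-trans (count≤n (Nb g v)) fitN)

    module Certificate {g : Glob n} (I : Inv g) (ans : Ans) (member isX : V → Bool) (owner : V → V → Bool) (pkOf : V → Maybe (Val × V))
      (bst-just : ∀ {x d z} → bst ans ≡ just (x , d , z) → isX x ≡ true × (∃ λ y → owner x y ≡ true × pkOf y ≡ just (d , z)) × (∀ y d′ z′ → member y ≡ true → pkOf y ≡ just (d′ , z′) → toℕ d ≤ toℕ d′))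
      (bst-nothing : bst ans ≡ nothing → ∀ y → member y ≡ true → pkOf y ≡ nothing)
      (owned : ∀ x y → isX x ≡ true → owner x y ≡ true → member y ≡ true)
      (pk-pinned : ∀ v → Pn g v ≡ true → pkOf v ≡ nothing) (pk-free : ∀ v → Pn g v ≡ false → pkOf v ≡ just (toV (deg g v) , v))
      (s₀≡ : s₀ ans ≡ count (λ v → member v ∧ not (Pn g v))) where

      S : V → Bool
      S v = member v ∧ not (Pn g v)

      record Cheapest (x z : V) : Set where
        constructor cheapest
        field
          x∈X  : isX x ≡ true
          own  : owner x z ≡ true
          inM  : member z ≡ true
          free : Pn g z ≡ false
          low  : deg g z ≤ 2 * ρ ^ 2

      private
        below-all : ∀ {x d z} → bst ans ≡ just (x , d , z) → ∀ v → S v ≡ true → toℕ d ≤ deg g v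
        below-all e v s = ≤-trans (proj₂ (proj₂ (bst-just e)) v (toV (deg g v)) v (∧-trueˡ {member v} s) (pk-free v (not-true (∧-trueʳ {member v} s)))) (≤-reflexive (toV-deg g v))

        same-pick : ∀ {y d z} → just (toV (deg g y) , y) ≡ just (d , z) → y ≡ z × toℕ d ≡ deg g y
        same-pick {y} refl = refl , toV-deg g y

        found : ∀ {x d z} → bst ans ≡ just (x , d , z) → toℕ d ≤ s₀ ans * s₀ ans → ∀ y → owner x y ≡ true → pkOf y ≡ just (d , z) → ∀ p → Pn g y ≡ p → Cheapest x z
        found e le y ow pe true p = case trans (sym (pk-pinned y p)) pe of λ ()
        found {x} {d} {z} e le y ow pe false p with same-pick (trans (sym (pk-free y p)) pe)
        ... | refl , d≡ = cheapest (proj₁ (bst-just e)) ow (owned x y (proj₁ (bst-just e)) ow) p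
          (subst (_≤ 2 * ρ ^ 2) d≡ (cheap I S (toℕ d) (below-all e) (≤-trans le (≤-reflexive (cong₂ _*_ s₀≡ s₀≡)))))

        certify-just : ∀ {x z} r → bst ans ≡ r → (r >>=ᴹ certify (s₀ ans)) ≡ just (x , z) → Cheapest x z
        certify-just {x} {z} (just (x′ , δ , z′)) e h = go (toℕ δ ≤ᵇ s₀ ans * s₀ ans) refl h
          where
          go : ∀ c → (toℕ δ ≤ᵇ s₀ ans * s₀ ans) ≡ c → (if c then just (x′ , z′) else nothing) ≡ just (x , z) → Cheapest x z
          go true le refl = let (y , ow , pe) = proj₁ (proj₂ (bst-just e)) in
            found e (≤ᵇ⇒≤ (toℕ δ) (s₀ ans * s₀ ans) (subst Data.Bool.T (sym le) tt)) y ow pe (Pn g y) refl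

        certify-nothing : ∀ r → bst ans ≡ r → (r >>=ᴹ certify (s₀ ans)) ≡ nothing → count S ≤ 2 * ρ
        certify-nothing nothing e _ = ≤-trans (≤-reflexive (∑-zero {n} {λ v → b2n (S v)} (λ v → cong b2n (¬true⇒false λ s → case trans (sym (pk-free v (not-true (∧-trueʳ {member v} s)))) (bst-nothing e v (∧-trueˡ {member v} s)) of λ ())))) z≤n
        certify-nothing (just (x′ , δ , z′)) e h = go (toℕ δ ≤ᵇ s₀ ans * s₀ ans) refl h
          where
          go : ∀ c → (toℕ δ ≤ᵇ s₀ ans * s₀ ans) ≡ c → (if c then just (x′ , z′) else nothing) ≡ nothing → count S ≤ 2 * ρ
          go false gt _ = few I S λ v s → ≤-trans (≤-reflexive (sym (cong₂ _*_ s₀≡ s₀≡))) (≤-trans (<⇒≤ (≰⇒> (λ le → true≢false (dec-true (toℕ δ ≤? s₀ ans * s₀ ans) le) gt))) (below-all e v s))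

      cert-just : ∀ {x z} → cert ans ≡ just (x , z) → Cheapest x z
      cert-just = certify-just (bst ans) refl

      cert-nothing : cert ans ≡ nothing → count S ≤ 2 * ρ
      cert-nothing = certify-nothing (bst ans) refl

    module Count {g : Glob n} {σ : V → Loc} (view : VG g σ) (I : Inv g) (w : V) (o : Op) (nar : allScope o ≡ false) (o-val : ∀ l → val o l ≡ val cnt l) where
      open View view
      open Members view w o nar using (Rank; answer; fwd⇒; isO; isRoot; isX; isXr; isX⇒nbr; isYr; member; member⇒hv; par-X; par-root; parY; rank)
      open Collect σ w o wf using (bst-just; bst-nothing; isPar; owner; owners; pkOf; total-sum)

      1≤vmax : 1 ≤ vmax
      1≤vmax = ≤-trans (m^n>0 2 (seedLen b)) fitSeed

      S : V → Bool
      S v = member v ∧ not (Pn g v)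

      deg≡ : ∀ v → count (nbr (σ v)) ≡ deg g v
      deg≡ v = ∑-cong (λ u → cong b2n (n≡ v u))

      r₀≡ : ∀ v → toℕ (r₀ (val o (σ v))) ≡ b2n (not (Pn g v))
      r₀≡ v = trans (cong (toℕ ∘ r₀) (o-val (σ v))) (trans (cong (λ c → toℕ (r₀ (if c then noRes else record noRes { r₀ = toV 1 ; pk = just (toV (count (nbr (σ v))) , me (σ v)) }))) (p≡ v)) (go (Pn g v)))
        where
        go : ∀ c → toℕ (r₀ (if c then noRes else record noRes { r₀ = toV 1 ; pk = just (toV (count (nbr (σ v))) , me (σ v)) })) ≡ b2n (not c)
        go true = toV-id z≤n
        go false = toV-id 1≤vmax

      pk-pinned : ∀ v → Pn g v ≡ true → pkOf v ≡ nothing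
      pk-pinned v e = trans (cong pk (o-val (σ v))) (cong (λ c → pk (if c then noRes else record noRes { r₀ = toV 1 ; pk = just (toV (count (nbr (σ v))) , me (σ v)) })) (trans (p≡ v) e))

      pk-free : ∀ v → Pn g v ≡ false → pkOf v ≡ just (toV (deg g v) , v)
      pk-free v e = trans (cong pk (o-val (σ v))) (trans (cong (λ c → pk (if c then noRes else record noRes { r₀ = toV 1 ; pk = just (toV (count (nbr (σ v))) , me (σ v)) })) (trans (p≡ v) e))
        (cong₂ (λ d m → just (toV d , m)) (deg≡ v) (me≡ wf v)))

      s₀≡ : s₀ answer ≡ count S
      s₀≡ = trans (total-sum r₀ (λ _ → refl) 1 (λ v → ≤-trans (≤-reflexive (r₀≡ v)) (b2n≤1 (not (Pn g v)))) (≤-trans (≤-reflexive (*-identityʳ n)) fitN))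
        (∑-cong (λ v → trans (cong (member v ·_) (r₀≡ v)) (go (member v))))
        where
        go : ∀ {p} c → c · b2n (not p) ≡ b2n (c ∧ not p)
        go true = refl
        go false = refl

      owned : ∀ x y → isX x ≡ true → owner x y ≡ true → member y ≡ true
      owned x y ex ow = ¬false⇒true λ m → case trans (sym (cong b2n (∧-intro ex ow))) (∑≡0⇒ (λ x → b2n (isX x ∧ owner x y)) (trans (owners y) (cong b2n m)) x) of λ ()

      owner-via : ∀ x y → owner x y ≡ true → x ≡ y ⊎ Nb g x y ≡ true
      owner-via x y ow = ∨-elim {eqᵇ x y} ow (λ q → inj₁ (eqᵇ⇒≡ q)) (λ q → inj₂ (par q (rank y)))
        where
        par : isPar (parY y) x ≡ true → Rank y → Nb g x y ≡ true
        par q (isRoot refl) = case trans (sym (cong (λ r → isPar r x) par-root)) q of λ ()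
        par q (isXr e) = case trans (sym (cong (λ r → isPar r x) (par-X y e))) q of λ ()
        par q (isO _ _ e) = case trans (sym (cong (λ r → isPar r x) e)) q of λ ()
        par q (isYr x₁ _ p′ e _ _ f) = trans (cong (λ z → Nb g z y) (eqᵇ⇒≡ {a = x} {x₁} (trans (sym (cong (λ r → isPar r x) e)) q))) (trans (sym (n≡ x₁ y)) (proj₁ (fwd⇒ x₁ y p′ f)))

      open Certificate I answer member isX owner pkOf bst-just bst-nothing owned pk-pinned pk-free s₀≡ using (Cheapest; cheapest; cert-nothing; cert-just)

      record Cheap (x z : V) : Set where
        field
          x∈X : Nb g w x ≡ true
          via : x ≡ z ⊎ Nb g x z ≡ true
          z-heavy : Hv g z ≡ true
          z-free  : Pn g z ≡ false
          z-deg   : deg g z ≤ 2 * ρ ^ 2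

      cheap-pick : ∀ {x z} → cert answer ≡ just (x , z) → Cheap x z
      cheap-pick {x} {z} h = record { x∈X = trans (sym (n≡ w x)) (isX⇒nbr x ex) ; via = owner-via x z own ; z-heavy = trans (sym (h≡ z)) (member⇒hv z inM) ; z-free = free ; z-deg = low }
        where open Cheapest (cert-just h) renaming (x∈X to ex)

      count-member : cert answer ≡ nothing → count member ≤ cM
      count-member h = ≤-trans (unpinned I member) (+-monoˡ-≤ 2 (cert-nothing h))

    -- Reducing the heavy vertices and settling a vertex

    lubyT : ℕ
    lubyT = 5 + (suc phm * (5 + (5 + (seedLen b * 5 + 5))) + 5)

    -- Settling takes at most A rounds, plus C for every unit of potential; a vertex that becomes
    -- light leaves D unspent.
    A D C : ℕ
    A = 20 + lubyT
    D = 60 + A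
    C = D + D

    record Good (g g′ : Glob n) (t k : ℕ) (σ′ : V → Loc) : Set where
      field
        gview : VG g′ σ′
        ginv  : Inv g′
        gind  : Indep g′
        gtr   : Trans g g′
        gtime : t + C * Φ g′ ≤ k + C * Φ g
    open Good public

    -- Ten rounds are the two counting pulses. A reduction that lightens anything leaves `D`
    -- unspent; `settle` passes this on when the reduction, rather than a joining, ends the
    -- undominated state of a light `w`. The count of members makes Luby's algorithm affordable.
    RedPost SettlePost : V → Glob n → ℕ → (V → Loc) → Set
    RedPost w g t σ′ = ∃ λ g′ → Good g g′ t 10 σ′ × (g′ ≡ g ⊎ t + C * Φ g′ + D ≤ 10 + C * Φ g) × count (Mb (Nb g′) (Hv g′) w) ≤ cM
    SettlePost w g t σ′ = ∃ λ g′ → Good g g′ t A σ′ × (UDg g w ≡ true → Hv g w ≡ false → t + C * Φ g′ + D ≤ A + C * Φ g) × UDg g′ w ≡ false × (∀ v → Nb g′ w v ≡ true → Hv g′ v ≡ true → UDg g′ v ≡ false)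

    -- Reducing, lightening and settling call each other. The recursion is well founded because
    -- every lightening lowers the potential, so the specifications are indexed by a bound on it.
    RedSpec SettleSpec : ℕ → Set
    RedSpec k = ∀ w g σ → Φ g < k → VG g σ → Inv g → Indep g → Does w (code red) σ (RedPost w g)
    SettleSpec k = ∀ w g σ → Φ g < k → VG g σ → Inv g → Indep g → Does w (code settle) σ (SettlePost w g)

    Φ-mono : ∀ {g g′} → (∀ v → Hv g′ v ≡ Hv g v) → (∀ v → Hv g v ≡ false → In g v ≡ true → In g′ v ≡ true) → Φ g′ ≤ Φ g
    Φ-mono {g} {g′} h i = ∑-mono λ v → ≤-trans (≤-reflexive (cong (λ c → φ c (In g′ v)) (h v))) (φ-in (Hv g v) (i v))

    module Core (w : V) (g : Glob n) (inv : Inv g) (few-members : count (Mb (Nb g) (Hv g) w) ≤ cM) where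
      open Inv inv

      open At G μ (Nb g) (Hv g) (Pn g) w N-sym N-irr N⊆G cM κ few-members (λ v e → heavy v (∧-trueˡ e)) cost-deep using (Conflicts; Settled; X⇒mb; light-out; luby-run; luby-time; mb-w) public
      open Domination (Nb g) (Hv g) public

      record Finished (I : V → Bool) (t : ℕ) (σ′ : V → Loc) : Set where
        constructor finished
        field
          {I′}   : V → Bool
          t≡     : t ≡ lubyT
          view′  : VG (record g { In = I′ }) σ′
          ind′   : Indep (record g { In = I′ })
          keep   : ∀ v → Hv g v ≡ false → In g v ≡ true → I′ v ≡ true
          ud⊆′   : ∀ v → UD I′ v ≡ true → UD (In g) v ≡ true
          ¬ud-w  : UD I′ w ≡ false
          ¬ud-X  : ∀ v → Nb g w v ≡ true → Hv g v ≡ true → UD I′ v ≡ false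
          same-w : I′ w ≡ I w

      finish : ∀ {σ} I → VG (record g { In = I }) σ → Conflicts I → (∀ v → In g v ≡ true → I v ≡ true) → UD I w ≡ false → Does w luby σ (Finished I)
      finish {σ} I view clashes grow nw = fin (luby-run view clashes)
        where
        fin : Will G μ w luby σ luby-time (Settled I) → Does w luby σ (Finished I)
        fin (will r s) = runsTo r (finished refl S.view S.ind (λ v h i → trans (S.same v (light-out v h)) (grow v i)) (λ v e → UD-mono grow v (proj₁ (S.ud⊆ v e)))
            (¬true⇒false λ e → true≢false (proj₁ (S.ud⊆ w e)) nw) (λ v e h → ¬true⇒false λ u → true≢false (X⇒mb v e h) (proj₂ (S.ud⊆ v u))) (S.same w mb-w))
          where module S = Settled s

    redo : ∀ g (I : V → Bool) → Inv g → Inv (record g { In = I })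
    redo g I inv = record { N-sym = N-sym ; N-irr = N-irr ; N⊆G = N⊆G ; light = light ; heavy = heavy ; pins = pins }
      where open Inv inv

    settle-from : ∀ {k} → RedSpec k → SettleSpec k
    settle-from {k} redS w g σ lt view inv ind = d-sub (redS w g σ lt view inv ind) after-red
      where
      after-red : ∀ {t₁ σ₁} → RedPost w g t₁ σ₁ → Does w (ask settleAct) σ₁ (λ t₂ → SettlePost w g (suc t₁ + suc t₂))
      after-red {t₁} {σ₁} (g₁ , R , spare , fewM) = d-ask (subst (λ p → Does w p σ₁ (λ t₂ → SettlePost w g (suc t₁ + suc (suc t₂)))) (sym (cong (λ c → if c then upd join (pulse (if hv (inf (σ₁ w)) then cnt else poll) (λ _ → luby)) else luby) (Local.ud≡ view₁ w))) (go (UD (In g₁) w) refl))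
        where
        view₁ = gview R
        inv₁ = ginv R
        module I₁ = Inv (ginv R)
        open Core w g₁ (ginv R) fewM using (Conflicts; UD; UD-dom; UD-in; UD-in-nbr; dom; dom-light; finish; finished)

        conclude : ∀ {t₂ σ₂} I′ → t₂ ≤ 6 + lubyT → VG (record g₁ { In = I′ }) σ₂ → Indep (record g₁ { In = I′ }) →
          (∀ v → Hv g₁ v ≡ false → In g₁ v ≡ true → I′ v ≡ true) → (∀ v → UD I′ v ≡ true → UD (In g₁) v ≡ true) → UD I′ w ≡ false →
          (∀ v → Nb g₁ w v ≡ true → Hv g₁ v ≡ true → UD I′ v ≡ false) →
          (UDg g w ≡ true → Hv g w ≡ false → t₁ + C * Φ (record g₁ { In = I′ }) + D ≤ 10 + C * Φ g) → SettlePost w g (suc t₁ + suc (suc t₂)) σ₂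
        conclude {t₂} I′ t≤ view₂ ind₂ keep ud₂ nw nx sur = record g₁ { In = I′ } , record
          { gview = view₂ ; ginv = redo g₁ I′ (ginv R) ; gind = ind₂
          ; gtr = trans-trans (gtr R) (record { N≡ = λ _ _ → refl ; P≡ = λ _ → refl ; stay-light = λ _ h → h ; stay-in = keep ; stay-pin = λ _ _ → refl ; ud-back = λ v e → ud₂ v e , refl })
          ; gtime = begin
              suc t₁ + suc (suc t₂) + C * Φ (record g₁ { In = I′ }) ≤⟨ +-mono-≤ (+-monoʳ-≤ (suc t₁) (s≤s (s≤s t≤))) (*-monoʳ-≤ C (Φ-mono {g₁} {record g₁ { In = I′ }} (λ _ → refl) keep)) ⟩
              suc t₁ + suc (suc (6 + lubyT)) + C * Φ g₁ ≡⟨ eq t₁ lubyT (C * Φ g₁) ⟩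
              9 + lubyT + (t₁ + C * Φ g₁) ≤⟨ +-monoʳ-≤ (9 + lubyT) (gtime R) ⟩
              9 + lubyT + (10 + C * Φ g) ≡⟨ eq′ lubyT (C * Φ g) ⟩
              19 + lubyT + C * Φ g ≤⟨ n≤1+n _ ⟩
              A + C * Φ g ∎
          } , (λ e h → begin
              suc t₁ + suc (suc t₂) + C * Φ (record g₁ { In = I′ }) + D ≤⟨ +-monoˡ-≤ D (+-monoˡ-≤ (C * Φ (record g₁ { In = I′ })) (+-monoʳ-≤ (suc t₁) (s≤s (s≤s t≤)))) ⟩
              suc t₁ + suc (suc (6 + lubyT)) + C * Φ (record g₁ { In = I′ }) + D ≡⟨ eq₃ t₁ lubyT (C * Φ (record g₁ { In = I′ })) D ⟩
              9 + lubyT + (t₁ + C * Φ (record g₁ { In = I′ }) + D) ≤⟨ +-monoʳ-≤ (9 + lubyT) (sur e h) ⟩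
              9 + lubyT + (10 + C * Φ g) ≡⟨ eq′ lubyT (C * Φ g) ⟩
              19 + lubyT + C * Φ g ≤⟨ n≤1+n _ ⟩
              A + C * Φ g ∎) , nw , nx
          where
          open ≤-Reasoning
          eq : ∀ t l c → suc t + suc (suc (6 + l)) + c ≡ 9 + l + (t + c)
          eq = solve-∀
          eq′ : ∀ l c → 9 + l + (10 + c) ≡ 19 + l + c
          eq′ = solve-∀
          eq₃ : ∀ t l c d → suc t + suc (suc (6 + l)) + c + d ≡ 9 + l + (t + c + d)
          eq₃ = solve-∀

        go : ∀ c → UD (In g₁) w ≡ c → Does w (if c then upd join (pulse (if hv (inf (σ₁ w)) then cnt else poll) (λ _ → luby)) else luby) σ₁ (λ t₂ → SettlePost w g (suc t₁ + suc (suc t₂)))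
        go false e = d-map (λ { (finished {I′} t≡ a b c d x y _) → conclude I′ (≤-trans (≤-reflexive t≡) (m≤n+m lubyT 6)) a b c d x y (λ u _ → spent I′ c u spare) })
          (finish (In g₁) view₁ (λ u v n iu iv → ⊥-elim (gind R u v n iu iv)) (λ _ i → i) e)
          where
          -- If `w` was undominated before the reduction and no longer is, the reduction has
          -- lightened something and left its surplus.
          spent : ∀ I′ → (∀ v → Hv g₁ v ≡ false → In g₁ v ≡ true → I′ v ≡ true) → UDg g w ≡ true → g₁ ≡ g ⊎ t₁ + C * Φ g₁ + D ≤ 10 + C * Φ g → t₁ + C * Φ (record g₁ { In = I′ }) + D ≤ 10 + C * Φ g
          spent I′ c u (inj₁ refl) = true≢false u e
          spent I′ c u (inj₂ le) = ≤-trans (+-monoˡ-≤ D (+-monoʳ-≤ t₁ (*-monoʳ-≤ C (Φ-mono {g₁} {record g₁ { In = I′ }} (λ _ → refl) c)))) le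
        go true e = d-upd (announce (Hv g₁ w) refl)
          where
          J : V → Bool
          J = setF w true (In g₁)
          g₂ : Glob n
          g₂ = record g₁ { In = J }
          grow : ∀ v → In g₁ v ≡ true → J v ≡ true
          grow v i = ¬false⇒true λ f → bad (v ≟ w) f
            where
            bad : Dec (v ≡ w) → J v ≡ false → ⊥
            bad (yes refl) f = true≢false (setF-self w (In g₁)) f
            bad (no p) f = true≢false i (trans (sym (setF-other (In g₁) p)) f)
          only : ∀ v → J v ≡ true → v ≢ w → In g₁ v ≡ true
          only v j p = trans (sym (setF-other (In g₁) p)) j
          Jw : J w ≡ true
          Jw = setF-self w (In g₁)
          module Sl = SetLoc view₁ w (join (σ₁ w)) g₂ (me≡ (View.wf view₁) w) refl refl (View.h≡ view₁ w) (View.p≡ view₁ w) (sym Jw) (View.a≡ view₁ w)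
            (λ _ _ → refl) (λ _ _ → refl) (λ _ _ → refl) (λ v p → setF-other (In g₁) p) using (cnt-pre; poll-pre; preV; σ₁)
          -- If `w` were heavy, `v` would have dominated it; and as `w` is light, a light `v` would
          -- have dominated it too. So a joining vertex conflicts only if it is light, and only with
          -- heavy vertices.
          clash : ∀ v → Nb g₁ w v ≡ true → J v ≡ true → Hv g₁ w ≡ false × Hv g₁ v ≡ true
          clash v nb j = lw , ¬false⇒true (λ lv → true≢false (dom-light lw v nb iv lv) (UD-dom e))
            where
            iv : In g₁ v ≡ true
            iv = only v j (λ { refl → true≢false nb (I₁.N-irr w) })
            lw : Hv g₁ w ≡ false
            lw = ¬true⇒false λ h → UD-in-nbr h e v nb iv
          clashes : Conflicts J
          clashes u v nb iu iv = cases (u ≟ w) (v ≟ w)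
            where
            cases : Dec (u ≡ w) → Dec (v ≡ w) → Hv g₁ w ≡ false × ((u ≡ w × Hv g₁ v ≡ true) ⊎ (v ≡ w × Hv g₁ u ≡ true))
            cases (yes refl) _ = proj₁ (clash v nb iv) , inj₁ (refl , proj₂ (clash v nb iv))
            cases (no _) (yes refl) = proj₁ (clash u (trans (I₁.N-sym v u) nb) iu) , inj₂ (refl , proj₂ (clash u (trans (I₁.N-sym v u) nb) iu))
            cases (no p) (no q) = ⊥-elim (gind R u v nb (only u iu p) (only v iv q))
          nw : UD J w ≡ false
          nw = cong (λ c → not c ∧ not (dom J w)) Jw
          -- A light vertex that joins lowers the potential by one. This frees `C = D + D`, of which
          -- only `D` is claimed.
          joins : ∀ I′ → (∀ v → Hv g₁ v ≡ false → In g₁ v ≡ true → I′ v ≡ true) → I′ w ≡ true → Hv g₁ w ≡ false → t₁ + C * Φ (record g₁ { In = I′ }) + D ≤ 10 + C * Φ g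
          joins I′ keep jw lw = begin
            t₁ + C * Φ g₃ + D ≤⟨ +-monoʳ-≤ (t₁ + C * Φ g₃) (m≤m+n D D) ⟩
            t₁ + C * Φ g₃ + C ≡⟨ trans (+-assoc t₁ (C * Φ g₃) C) (cong (t₁ +_) (trans (cong (C * Φ g₃ +_) (sym (*-identityʳ C))) (sym (*-distribˡ-+ C (Φ g₃) 1)))) ⟩
            t₁ + C * (Φ g₃ + 1) ≤⟨ +-monoʳ-≤ t₁ (*-monoʳ-≤ C (∑-set (λ v → φ (Hv g₁ v) (In g₁ v)) (λ v → φ (Hv g₁ v) (I′ v)) w (λ v _ → φ-in (Hv g₁ v) (keep v)) 1
                (≤-reflexive (trans (cong₂ (λ h i → φ h i + 1) lw jw) (sym (cong₂ φ lw (UD-in {In g₁} {w} e))))))) ⟩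
            t₁ + C * Φ g₁ ≤⟨ gtime R ⟩
            10 + C * Φ g ∎
            where
            open ≤-Reasoning
            g₃ : Glob n
            g₃ = record g₁ { In = I′ }
          run-luby : ∀ {σ₂} → VG g₂ σ₂ → Does w luby σ₂ (λ t → SettlePost w g (suc t₁ + suc (suc (suc (5 + t)))))
          run-luby view₂ = d-map (λ { (finished {I′} t≡ a b c d x y j) → conclude I′ (≤-reflexive (cong (6 +_) t≡)) a b c d x y (λ _ h → joins I′ c (trans j Jw) (stay-light (gtr R) w h)) })
            (finish J view₂ clashes grow nw)
          announce : ∀ c → Hv g₁ w ≡ c → Does w (pulse (if hv (inf (σ₁ w)) then cnt else poll) (λ _ → luby)) Sl.σ₁ (λ t → SettlePost w g (suc t₁ + suc (suc (suc t))))
          announce true h = subst (λ c → Does w (pulse (if c then cnt else poll) (λ _ → luby)) Sl.σ₁ (λ t → SettlePost w g (suc t₁ + suc (suc (suc t))))) (sym (trans (View.h≡ view₁ w) h))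
            (hush cnt Sl.preV (redo g₁ J (ginv R)) (λ _ → refl) (PreV.wf Sl.preV) (λ v u e → widen (Sl.cnt-pre h h v u e)) (cnt-cost w Sl.preV (Sl.cnt-pre h h) (X-count (ginv R) w)) run-luby)
            where
            widen : ∀ {P Q R : Set} → P ⊎ Q → P ⊎ Q ⊎ R
            widen (inj₁ x) = inj₁ x
            widen (inj₂ y) = inj₂ (inj₁ y)
          announce false h = subst (λ c → Does w (pulse (if c then cnt else poll) (λ _ → luby)) Sl.σ₁ (λ t → SettlePost w g (suc t₁ + suc (suc (suc t))))) (sym (trans (View.h≡ view₁ w) h))
            (hush poll Sl.preV (redo g₁ J (ginv R)) (λ _ → refl) (PreV.wf Sl.preV) Sl.poll-pre (poll-cost w Sl.preV (I₁.light w h)) run-luby)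

    UpPost : V → Glob n → ℕ → (V → Loc) → Set
    UpPost z g t σ′ = ∃ λ g′ → Good g g′ t (7 + A) σ′ × suc (Φ g′) ≤ Φ g × t + C * Φ g′ + C ≤ 7 + A + C * Φ g

    -- The potential falls before settling starts. So the specification of settling is needed only
    -- for a smaller bound, and a full `C` is left unspent at the end.
    up-from : ∀ {k} → SettleSpec k → ∀ z g σ → Φ g < suc k → VG g σ → Inv g → Indep g → Hv g z ≡ true → Pn g z ≡ false → deg g z ≤ 2 * ρ ^ 2 → Does z (code up) σ (UpPost z g)
    up-from {k} settleS z g σ lt view inv ind hz fz dz = d-upd (hush poll Sl.preV inv₁ (λ _ → refl) (PreV.wf Sl.preV) Sl.poll-pre (poll-cost z Sl.preV dz) λ view₁ →
        d-goto (d-map fin (settleS z g₁ _ (≤-trans drop (≤-pred lt)) view₁ inv₁ ind)))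
      where
      g₁ : Glob n
      g₁ = lightened z g
      inv₁ : Inv g₁
      inv₁ = Inv-lightened inv dz
      drop : suc (Φ g₁) ≤ Φ g
      drop = Φ-lightened {g} {z} hz
      module Sl = SetLoc view z (lighten (σ z)) g₁ (me≡ (View.wf view) z) refl refl (sym (setF-self z (Hv g))) (View.p≡ view z) (View.i≡ view z) (View.a≡ view z)
        (λ _ _ → refl) (λ v p → setF-other (Hv g) p) (λ _ _ → refl) (λ _ _ → refl) using (poll-pre; preV)
      fin : ∀ {t σ′} → SettlePost z g₁ t σ′ → UpPost z g (suc (5 + suc t)) σ′
      fin {t} (g′ , S , _ , nz , _) = g′ , record
        { gview = gview S ; ginv = ginv S ; gind = gind S
        ; gtr = record
            { N≡ = N≡ (gtr S) ; P≡ = P≡ (gtr S)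
            ; stay-light = λ v h → stay-light (gtr S) v (low v h)
            ; stay-in = λ v h i → stay-in (gtr S) v (low v h) i
            ; stay-pin = λ v p → trans (stay-pin (gtr S) v p) (setF-other (Hv g) (λ { refl → true≢false p fz }))
            ; ud-back = λ v e → back v e (v ≟ z) }
        ; gtime = ≤-trans (m≤m+n _ C) paid } , small′ , paid
        where
        low : ∀ v → Hv g v ≡ false → Hv g₁ v ≡ false
        low v h = ¬true⇒false λ h′ → true≢false (Hv-lightened {g} {z} h′) h
        back : ∀ v → UDg g′ v ≡ true → Dec (v ≡ z) → UDg g v ≡ true × Hv g′ v ≡ Hv g v
        back v e (yes refl) = true≢false e nz
        back v e (no p) = let (u₁ , h₁) = ud-back (gtr S) v e ; (u₂ , h₂) = UD-lightened {g} {z} p u₁ in u₂ , trans h₁ h₂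
        open ≤-Reasoning
        paid : suc (5 + suc t) + C * Φ g′ + C ≤ 7 + A + C * Φ g
        paid = begin
          suc (5 + suc t) + C * Φ g′ + C ≡⟨ eq t (C * Φ g′) C ⟩
          7 + (t + C * Φ g′) + C ≤⟨ +-monoˡ-≤ C (+-monoʳ-≤ 7 (gtime S)) ⟩
          7 + (A + C * Φ g₁) + C ≡⟨ eq′ A (C * Φ g₁) C ⟩
          7 + A + (C + C * Φ g₁) ≡⟨ cong (7 + A +_) (sym (*-suc C (Φ g₁))) ⟩
          7 + A + C * suc (Φ g₁) ≤⟨ +-monoʳ-≤ (7 + A) (*-monoʳ-≤ C drop) ⟩
          7 + A + C * Φ g ∎
          where
          eq : ∀ t x c → suc (5 + suc t) + x + c ≡ 7 + (t + x) + c
          eq = solve-∀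
          eq′ : ∀ a x c → 7 + (a + x) + c ≡ 7 + a + (c + x)
          eq′ = solve-∀
        -- The potential cannot grow, since C exceeds the additive cost of settling.
        small′ : suc (Φ g′) ≤ Φ g
        small′ = *-cancelˡ-< C (Φ g′) (Φ g) (+-cancelʳ-< (7 + A) (C * Φ g′) (C * Φ g) (begin-strict
          C * Φ g′ + (7 + A) <⟨ +-monoʳ-< (C * Φ g′) (≤-trans (s≤s (+-monoˡ-≤ A {7} {59} (≤ᵇ⇒≤ 7 59 tt))) (m≤m+n D D)) ⟩
          C * Φ g′ + C ≤⟨ +-monoˡ-≤ C (m≤n+m (C * Φ g′) (suc (5 + suc t))) ⟩
          suc (5 + suc t) + C * Φ g′ + C ≤⟨ paid ⟩
          7 + A + C * Φ g ≡⟨ +-comm (7 + A) (C * Φ g) ⟩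
          C * Φ g + (7 + A) ∎))

    -- Each turn of the loop lightens one cheap vertex. The loop stops when neither the shallow nor
    -- the deep count yields a certificate, and the failure of the deep one bounds the members.
    red-spec : ∀ k → RedSpec k
    red-spec zero w g σ () view inv ind
    red-spec (suc k) w g σ lt view inv ind =
      hush cnt (pre view) inv (λ _ → refl) (View.wf view) (preKnows view w cnt) (cnt-cost w (pre view) (preKnows′ view w cnt) (X-count inv w)) λ view₁ →
        shallow view₁ (cert (PulseOf.answer σ w cnt)) refl
      where
      open Inv inv
      module C₀ = Count view inv w cnt refl (λ _ → refl) using (Cheap; cheap-pick; count-member)

      loop : ∀ j → j ≤ 10 → ∀ {σ₁} → VG g σ₁ → ∀ x z → Nb g w x ≡ true → x ≡ z ⊎ Nb g x z ≡ true → Hv g z ≡ true → Pn g z ≡ false → deg g z ≤ 2 * ρ ^ 2 →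
        Does w (redDeep (just (x , z))) σ₁ (λ t → RedPost w g (j + t))
      loop j j≤ {σ₁} view₁ x z nwx via hz fz dz = d-call {P = λ t σ′ → ∃ λ s → t ≤ 4 + s × UpPost z g s σ′} w≢x (N⊆G w x nwx) (enter (x ≟ z)) back
        where
        w≢x : w ≢ x
        w≢x refl = true≢false nwx (N-irr w)
        upz : ∀ {σ₂} → VG g σ₂ → Does z (code up) σ₂ (UpPost z g)
        upz view₂ = up-from (settle-from (red-spec k)) z g _ lt view₂ inv ind hz fz dz
        enter : Dec (x ≡ z) → Does x (code (if eqᵇ x z then up else relay z)) (hear w x σ₁) (λ t σ′ → ∃ λ s → t ≤ 4 + s × UpPost z g s σ′)
        enter (yes refl) = subst (λ c → Does x (code (if c then up else relay z)) (hear w x σ₁) (λ t σ′ → ∃ λ s → t ≤ 4 + s × UpPost z g s σ′)) (sym (eqᵇ-refl x))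
          (d-map (λ {t} p → t , m≤n+m t 4 , p) (upz (hear-view w x view₁)))
        enter (no p) = subst (λ c → Does x (code (if c then up else relay z)) (hear w x σ₁) (λ t σ′ → ∃ λ s → t ≤ 4 + s × UpPost z g s σ′)) (sym (eqᵇ-≢ p))
          (d-call p (N⊆G x z (edge via)) (upz (hear-view x z (hear-view w x view₁)))
            λ { {t} (g′ , U , lt′ , paid) → runsTo halt (t , ≤-reflexive (eq t) , g′ , record { gview = hear-view z x (gview U) ; ginv = ginv U ; gind = gind U ; gtr = gtr U ; gtime = gtime U } , lt′ , paid) })
          where
          edge : x ≡ z ⊎ Nb g x z ≡ true → Nb g x z ≡ true
          edge (inj₁ q) = ⊥-elim (p q)
          edge (inj₂ q) = q
          eq : ∀ t → (2 + t) + 2 ≡ 4 + t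
          eq = solve-∀
        back : ∀ {t₁ σ₂} → (∃ λ s → t₁ ≤ 4 + s × UpPost z g s σ₂) → Does w (goto red) (hear x w σ₂) (λ t₂ → RedPost w g (j + ((2 + t₁) + (2 + t₂))))
        back {t₁} (s , t≤ , g′ , U , lt′ , paid) = d-goto (d-map fin (red-spec k w g′ _ (≤-trans lt′ (≤-pred lt)) (hear-view x w (gview U)) (ginv U) (gind U)))
          where
          fin : ∀ {t₂ σ₃} → RedPost w g′ t₂ σ₃ → RedPost w g (j + ((2 + t₁) + (2 + suc t₂))) σ₃
          fin {t₂} (g″ , R , _ , few′) = g″ , record { gview = gview R ; ginv = ginv R ; gind = gind R ; gtr = trans-trans (gtr U) (gtr R) ; gtime = ≤-trans (m≤m+n _ D) bound } , inj₂ bound , few′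
            where
            open ≤-Reasoning
            eq : ∀ j s t x c → j + ((2 + (4 + s)) + (2 + suc t)) + x + c ≡ j + 9 + s + (t + x) + c
            eq = solve-∀
            eq′ : ∀ j s x c → j + 9 + s + (10 + x) + c ≡ j + 19 + (s + x + c)
            eq′ = solve-∀
            eq″ : ∀ a y → 10 + 19 + (7 + a + y) + 24 ≡ y + (60 + a)
            eq″ = solve-∀
            -- One half of the `C` left by `up` pays for this turn and for the next start of the
            -- loop, together at most `36 + A`, which the `60 + A` of `D` covers; the other half is
            -- the promised surplus.
            bound : j + ((2 + t₁) + (2 + suc t₂)) + C * Φ g″ + D ≤ 10 + C * Φ g
            bound = +-cancelʳ-≤ D _ _ (begin
              j + ((2 + t₁) + (2 + suc t₂)) + C * Φ g″ + D + D ≡⟨ +-assoc _ D D ⟩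
              j + ((2 + t₁) + (2 + suc t₂)) + C * Φ g″ + C ≤⟨ +-monoˡ-≤ C (+-monoˡ-≤ (C * Φ g″) (+-monoʳ-≤ j (+-monoˡ-≤ (2 + suc t₂) (+-monoʳ-≤ 2 t≤)))) ⟩
              j + ((2 + (4 + s)) + (2 + suc t₂)) + C * Φ g″ + C ≡⟨ eq j s t₂ (C * Φ g″) C ⟩
              j + 9 + s + (t₂ + C * Φ g″) + C ≤⟨ +-monoˡ-≤ C (+-monoʳ-≤ (j + 9 + s) (gtime R)) ⟩
              j + 9 + s + (10 + C * Φ g′) + C ≡⟨ eq′ j s (C * Φ g′) C ⟩
              j + 19 + (s + C * Φ g′ + C) ≤⟨ +-mono-≤ (+-monoˡ-≤ 19 j≤) paid ⟩
              10 + 19 + (7 + A + C * Φ g) ≤⟨ m≤m+n _ 24 ⟩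
              10 + 19 + (7 + A + C * Φ g) + 24 ≡⟨ eq″ A (C * Φ g) ⟩
              C * Φ g + D ≤⟨ +-monoˡ-≤ D (m≤n+m (C * Φ g) 10) ⟩
              10 + C * Φ g + D ∎)

      shallow : ∀ {σ₁} → VG g σ₁ → ∀ r → cert (PulseOf.answer σ w cnt) ≡ r → Does w (redShallow r) σ₁ (λ t → RedPost w g (5 + t))
      shallow view₁ (just (x , z)) e = loop 5 (≤ᵇ⇒≤ 5 10 tt) view₁ x z x∈X via z-heavy z-free z-deg
        where open C₀.Cheap (C₀.cheap-pick e)
      -- The deep count is affordable only now: a light root may have about `ρ²` heavy neighbours,
      -- but the failed shallow certificate bounds them by `cM`.
      shallow {σ₁} view₁ nothing e =
        hush cntD (pre view₁) inv (λ _ → refl) (View.wf view₁) (preKnows view₁ w cntD) cost λ view₂ → deep′ view₂ (cert (PulseOf.answer σ₁ w cntD)) refl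
        where
        module C₁ = Count view₁ inv w cntD refl (λ _ → refl) using (Cheap; cheap-pick; count-member)
        open Members view₁ w cntD refl using (isX; isX≡; member≡Mb; pulseMsgs)
        open Collect σ₁ w cntD (View.wf view₁) using (isY-count; pulse-cost)
        module M₀ = Members view w cnt refl using (isX; isX≡)
        X≤ : count isX ≤ cM
        X≤ = ≤-trans (count-mono (λ v ex → ∨-introˡ {M₀.isX v} (trans (M₀.isX≡ v) (trans (sym (isX≡ v)) ex)))) (C₀.count-member e)
        fwd≤ : ∀ u → isX u ≡ true → count (fwd (σ₁ u)) ≤ κ
        fwd≤ u ex = ≤-trans (count-mono (Local.fwd⇒heavy view₁ u)) (heavy u (∧-trueʳ {Nb g w u} (trans (sym (isX≡ u)) ex)))
        cost : pulseMsgs ≤ 5 * μ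
        cost = ≤-trans (pulse-cost cM κ (cM * κ) 0 X≤ (λ u ex _ → fwd≤ u ex) (≤-trans (isY-count κ fwd≤) (*-monoˡ-≤ κ X≤)) (λ _ _ ())) cost-deep₀
        deep′ : ∀ {σ₂} → VG g σ₂ → ∀ r → cert (PulseOf.answer σ₁ w cntD) ≡ r → Does w (redDeep r) σ₂ (λ t → RedPost w g (5 + (5 + t)))
        deep′ view₂ (just (x , z)) e′ = loop 10 ≤-refl view₂ x z x∈X via z-heavy z-free z-deg
          where open C₁.Cheap (C₁.cheap-pick e′)
        deep′ view₂ nothing e′ = runsTo halt (g , record { gview = view₂ ; ginv = inv ; gind = ind ; gtr = trans-refl ; gtime = ≤-refl } , inj₁ refl ,
          ≤-trans (≤-reflexive (∑-cong (λ v → cong b2n (sym (member≡Mb refl v))))) (C₁.count-member e′))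

    settle-spec : ∀ w g σ → VG g σ → Inv g → Indep g → Does w (code settle) σ (SettlePost w g)
    settle-spec w g σ = settle-from (red-spec (suc (Φ g))) w g σ ≤-refl

    redu : ∀ w g σ → VG g σ → Inv g → Indep g → Does w (code red) σ (RedPost w g)
    redu w g σ = red-spec (suc (Φ g)) w g σ ≤-refl

    -- Turning a vertex heavy

    NoUD : Glob n → Set
    NoUD g = ∀ v → UDg g v ≡ false

    Pending : V → Glob n → Set
    Pending w g = ∀ v → UDg g v ≡ true → v ≡ w ⊎ Nb g w v ≡ true

    FixPost : V → Glob n → ℕ → (V → Loc) → Set
    FixPost w g t σ′ = ∃ λ g′ → Good g g′ t (6 + A) σ′ × NoUD g′

    module PollAnswer {g : Glob n} {σ : V → Loc} (view : VG g σ) (w : V) where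
      open View view
      open Effect σ w poll wf using (answer; isX; isX⇒nbr; parY)
      open Collect σ w poll wf using (bst-just; bst-nothing; isPar; isY-shallow; owner; pkOf)

      pick-val : Bool → V → Maybe (Val × V)
      pick-val c y = pk (if c then record noRes { pk = just (toV 0 , me (σ y)) } else noRes)

      pk≡ : ∀ y → pkOf y ≡ pick-val (not (Hv g y) ∧ UDg g y) y
      pk≡ y = cong (λ c → pick-val c y) (cong₂ (λ h u → not h ∧ u) (h≡ y) (Local.ud≡ view y))

      picked : ∀ c y {p} → pick-val c y ≡ just p → c ≡ true
      picked true y e = refl

      owner-self : ∀ x y → owner x y ≡ true → x ≡ y
      owner-self x y ow = ∨-elim {eqᵇ x y} ow eqᵇ⇒≡ (λ q → absurd (parY y) (isY-shallow refl y) q)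
        where
        absurd : ∀ r → is-just r ≡ false → isPar r x ≡ true → x ≡ y
        absurd nothing _ ()

      found : ∀ {x p} → bst answer ≡ just (x , p) → Nb g w x ≡ true × Hv g x ≡ false × UDg g x ≡ true
      found {x} {d , z} e = step (bst-just e)
        where
        step : isX x ≡ true × (∃ λ y → owner x y ≡ true × pkOf y ≡ just (d , z)) × _ → Nb g w x ≡ true × Hv g x ≡ false × UDg g x ≡ true
        step (ex , (y , ow , pe) , _) = trans (sym (n≡ w x)) (isX⇒nbr x ex) , subst (λ v → Hv g v ≡ false × UDg g v ≡ true) (sym (owner-self x y ow)) (not-true (∧-trueˡ {not (Hv g y)} c) , ∧-trueʳ {not (Hv g y)} c)
          where
          c : not (Hv g y) ∧ UDg g y ≡ true
          c = picked _ y (trans (sym (pk≡ y)) pe)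

      none-left : bst answer ≡ nothing → ∀ v → Nb g w v ≡ true → Hv g v ≡ false → UDg g v ≡ false
      none-left e v nb lv = ¬true⇒false λ u → case trans (sym (cong (λ c → pick-val c v) (∧-intro (not-false lv) u))) (trans (sym (pk≡ v)) (bst-nothing e v (∨-introˡ ex))) of λ ()
        where
        ex : isX v ≡ true
        ex = ∧-intro (∧-intro (trans (n≡ w v) nb) refl) (not-false (eqᵇ-≢ λ q → true≢false (trans (n≡ w v) nb) (trans (cong (nbr (σ w)) (trans q (me≡ wf w))) (nbr-irr wf w))))

    deg-same : ∀ {g g′} → Trans g g′ → ∀ v → deg g′ v ≡ deg g v
    deg-same T v = ∑-cong (λ u → cong b2n (N≡ T v u))

    pending-trans : ∀ {g g′ w} → Trans g g′ → Pending w g → Pending w g′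
    pending-trans {w = w} T p v e = lift (p v (proj₁ (ud-back T v e)))
      where
      lift : _ ⊎ _ → _ ⊎ _
      lift (inj₁ q) = inj₁ q
      lift (inj₂ q) = inj₂ (trans (N≡ T w v) q)

    -- `w` has only just become heavy, so its degree still allows repeated polls. Every light
    -- undominated neighbour that settles leaves `D` unspent, which pays for the turn and lowers the
    -- potential; the settling of `w` at the end repairs the heavy neighbours at once.
    fix-spec : ∀ k w g σ → Φ g < k → VG g σ → Inv g → Indep g → Hv g w ≡ true → Pn g w ≡ true → deg g w ≤ 2 * ρ ^ 2 → Pending w g → Does w (code fix) σ (FixPost w g)
    fix-spec (suc k) w g σ lt view inv ind hw pw dw pend =
      hush poll (pre view) inv (λ _ → refl) (View.wf view) (preKnows view w poll) (poll-cost w (pre view) dw) λ view₁ → go view₁ (bst (PulseOf.answer σ w poll)) refl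
      where
      open Inv inv
      module PA = PollAnswer view w using (found; none-left)
      go : ∀ {σ₁} → VG g σ₁ → ∀ r → bst (PulseOf.answer σ w poll) ≡ r → Does w (fixNext r) σ₁ (λ t → FixPost w g (5 + t))
      go {σ₁} view₁ nothing e = d-goto (d-map fin (settle-spec w g σ₁ view₁ inv ind))
        where
        fin : ∀ {t σ′} → SettlePost w g t σ′ → FixPost w g (5 + suc t) σ′
        fin {t} (g′ , S , _ , nw , nx) = g′ , record { gview = gview S ; ginv = ginv S ; gind = gind S ; gtr = gtr S ; gtime = ≤-trans (≤-reflexive (eq t (C * Φ g′))) (≤-trans (+-monoʳ-≤ 6 (gtime S)) (≤-reflexive (sym (+-assoc 6 A (C * Φ g))))) } ,
          λ v → ¬true⇒false λ u → bad v u (pend v (proj₁ (ud-back (gtr S) v u)))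
          where
          eq : ∀ t x → 5 + suc t + x ≡ 6 + (t + x)
          eq = solve-∀
          bad : ∀ v → UDg g′ v ≡ true → v ≡ w ⊎ Nb g w v ≡ true → ⊥
          bad v u (inj₁ refl) = true≢false u nw
          bad v u (inj₂ nb) = heavy? (Hv g v) refl
            where
            heavy? : ∀ c → Hv g v ≡ c → ⊥
            heavy? true h = true≢false u (nx v (trans (N≡ (gtr S) w v) nb) (trans (proj₂ (ud-back (gtr S) v u)) h))
            heavy? false h = true≢false (proj₁ (ud-back (gtr S) v u)) (PA.none-left e v nb h)
      go {σ₁} view₁ (just (x , p)) e = d-call w≢x (N⊆G w x nwx) (settle-spec x g (hear w x σ₁) (hear-view w x view₁) inv ind) back
        where
        nwx : Nb g w x ≡ true
        nwx = proj₁ (PA.found e)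
        w≢x : w ≢ x
        w≢x refl = true≢false nwx (N-irr w)
        back : ∀ {t₁ σ₂} → SettlePost x g t₁ σ₂ → Does w (goto fix) (hear x w σ₂) (λ t₂ → FixPost w g (5 + ((2 + t₁) + (2 + t₂))))
        back {t₁} (g₁ , S , spare , _) = d-goto (d-map fin (fix-spec k w g₁ _ (≤-trans less (≤-pred lt)) (hear-view x w (gview S)) (ginv S) (gind S)
            (trans (stay-pin (gtr S) w pw) hw) (trans (P≡ (gtr S) w) pw) (≤-trans (≤-reflexive (deg-same (gtr S) w)) dw) (pending-trans {w = w} (gtr S) pend)))
          where
          paid : t₁ + C * Φ g₁ + D ≤ A + C * Φ g
          paid = spare (proj₂ (proj₂ (PA.found e))) (proj₁ (proj₂ (PA.found e)))
          open ≤-Reasoning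
          less : suc (Φ g₁) ≤ Φ g
          less = *-cancelˡ-< C (Φ g₁) (Φ g) (+-cancelʳ-< A (C * Φ g₁) (C * Φ g) (begin-strict
            C * Φ g₁ + A <⟨ +-monoʳ-< (C * Φ g₁) (s≤s (m≤n+m A 59)) ⟩
            C * Φ g₁ + D ≤⟨ +-monoˡ-≤ D (m≤n+m (C * Φ g₁) t₁) ⟩
            t₁ + C * Φ g₁ + D ≤⟨ paid ⟩
            A + C * Φ g ≡⟨ +-comm A (C * Φ g) ⟩
            C * Φ g + A ∎))
          fin : ∀ {t₂ σ₃} → FixPost w g₁ t₂ σ₃ → FixPost w g (5 + ((2 + t₁) + (2 + suc t₂))) σ₃
          fin {t₂} (g₂ , F , clean) = g₂ , record { gview = gview F ; ginv = ginv F ; gind = gind F ; gtr = trans-trans (gtr S) (gtr F) ; gtime = +-cancelʳ-≤ D _ _ (begin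
              5 + ((2 + t₁) + (2 + suc t₂)) + C * Φ g₂ + D ≡⟨ eq t₁ t₂ (C * Φ g₂) D ⟩
              10 + t₁ + (t₂ + C * Φ g₂) + D ≤⟨ +-monoˡ-≤ D (+-monoʳ-≤ (10 + t₁) (gtime F)) ⟩
              10 + t₁ + (6 + A + C * Φ g₁) + D ≡⟨ eq′ t₁ A (C * Φ g₁) D ⟩
              16 + A + (t₁ + C * Φ g₁ + D) ≤⟨ +-monoʳ-≤ (16 + A) paid ⟩
              16 + A + (A + C * Φ g) ≤⟨ m≤m+n _ 50 ⟩
              16 + A + (A + C * Φ g) + 50 ≡⟨ eq″ A (C * Φ g) ⟩
              6 + A + C * Φ g + D ∎) } , clean
            where
            eq : ∀ t s x d → 5 + ((2 + t) + (2 + suc s)) + x + d ≡ 10 + t + (s + x) + d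
            eq = solve-∀
            eq′ : ∀ t a x d → 10 + t + (6 + a + x) + d ≡ 16 + a + (t + x + d)
            eq′ = solve-∀
            eq″ : ∀ a x → 16 + a + (a + x) + 50 ≡ 6 + a + x + (60 + a)
            eq″ = solve-∀

    -- `C + C` pays for the potential, which rises by up to 2 when a light member of the set turns
    -- heavy.
    Kd : ℕ
    Kd = 30 + A + (C + C)

    record Demoted (w : V) (g g′ : Glob n) (t : ℕ) (σ′ : V → Loc) : Set where
      field
        dview : VG g′ σ′
        dinv  : Inv g′
        dind  : Indep g′
        dno   : NoUD g′
        dN    : ∀ u v → Nb g′ u v ≡ Nb g u v
        dP    : ∀ v → v ≢ w → Pn g′ v ≡ Pn g v
        dpin  : Pn g′ w ≡ true
        dH    : Hv g′ w ≡ true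
        dkeep : ∀ v → Pn g v ≡ true → Hv g′ v ≡ Hv g v
        ddown : ∀ v → v ≢ w → Hv g′ v ≡ true → Hv g v ≡ true
        dNH   : NH g′ w ≤ cM
        dtime : t + C * Φ g′ ≤ Kd + C * Φ g
    open Demoted public

    count-set : (f : V → Bool) (w : V) → count (setF w true f) ≤ suc (count f)
    count-set f w = ≤-trans (∑-mono (λ v → one v (v ≟ w))) (≤-trans (≤-reflexive (∑-+ (λ v → b2n (eqᵇ v w)) (λ v → b2n (f v)))) (+-monoˡ-≤ (count f) (count-eq≤1 w)))
      where
      one : ∀ v → Dec (v ≡ w) → b2n (setF w true f v) ≤ b2n (eqᵇ v w) + b2n (f v)
      one v (yes refl) = ≤-trans (b2n≤1 (setF v true f v)) (≤-trans (≤-reflexive (cong b2n (sym (eqᵇ-refl v)))) (m≤m+n _ _))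
      one v (no p) = ≤-trans (≤-reflexive (cong b2n (setF-other f p))) (m≤n+m _ _)

    NH-Mb : ∀ g w → Inv g → NH g w ≤ count (Mb (Nb g) (Hv g) w)
    NH-Mb g w inv = count-mono λ u e → ∧-intro (∧-trueʳ {Nb g w u} e) (∧-intro (not-false (eqᵇ-≢ {a = u} {w} λ { refl → true≢false (∧-trueˡ e) (Inv.N-irr inv u) })) (∨-introˡ {Nb g w u} (∧-trueˡ {Nb g w u} e)))

    pinned : V → Glob n → Glob n
    pinned w g = record g { Pn = setF w true (Pn g) }

    heavied : V → Glob n → Glob n
    heavied w g = record g { Hv = setF w true (Hv g) ; Pn = setF w true (Pn g) ; In = setF w false (In g) }

    heavied-⊆ : ∀ g w u → Hv (heavied w g) u ≡ true → u ≢ w → Hv g u ≡ true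
    heavied-⊆ g w u h p = trans (sym (setF-other (Hv g) p)) h

    -- Only `w` changes its weight and membership, so a vertex that is not adjacent to `w` keeps its
    -- dominators.
    heavied-pend : ∀ g w → NoUD g → Inv g → Pending w (heavied w g)
    heavied-pend g w clean inv v e = go (v ≟ w) (Nb g w v) refl
      where
      g₂ = heavied w g
      module D₁ = Domination (Nb g) (Hv g) using (UD-intro; dom)
      module D₂ = Domination (Nb g) (Hv g₂) using (UD-dom; UD-in; dom; dom-heavy; dom-light)
      go : Dec (v ≡ w) → ∀ c → Nb g w v ≡ c → v ≡ w ⊎ c ≡ true
      go (yes q) c _ = inj₁ q
      go (no q) true _ = inj₂ refl
      go (no q) false nb = ⊥-elim (true≢false (D₁.UD-intro (trans (sym (setF-other (In g) q)) (D₂.UD-in {In g₂} {v} e)) (¬true⇒false λ d → true≢false (keep (Hv g v) refl d) (D₂.UD-dom {In g₂} {v} e))) (clean v))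
        where
        away : ∀ u → Nb g v u ≡ true → u ≢ w
        away u n refl = true≢false (trans (Inv.N-sym inv u v) n) nb
        keep : ∀ c → Hv g v ≡ c → D₁.dom (In g) v ≡ true → D₂.dom (In g₂) v ≡ true
        keep true h d = let (u , p) = anyF-elim _ (trans (sym (if-true h)) d) ; n = ∧-trueˡ {Nb g v u} p in
          D₂.dom-heavy (trans (setF-other (Hv g) q) h) u n (trans (setF-other (In g) (away u n)) (∧-trueʳ {Nb g v u} p))
        keep false h d = let (u , p) = anyF-elim _ (trans (sym (if-false h)) d) ; n = ∧-trueˡ {Nb g v u} p in
          D₂.dom-light (trans (setF-other (Hv g) q) h) u n (trans (setF-other (In g) (away u n)) (∧-trueˡ {In g u} (∧-trueʳ {Nb g v u} p)))
            (trans (setF-other (Hv g) (away u n)) (not-true (∧-trueʳ {In g u} (∧-trueʳ {Nb g v u} p))))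

    -- The reason for counting up to distance two: the other heavy neighbours of a heavy neighbour
    -- of `w` all lie in `Mb`, so at most `cM` of them exist, and `w` itself is the one more that
    -- `κ` allows.
    heavied-Inv : ∀ g w → Inv g → Hv g w ≡ false → count (Mb (Nb g) (Hv g) w) ≤ cM → count (Pn g) ≤ 1 → Inv (heavied w g)
    heavied-Inv g w inv lw fewM one-pin = record
      { N-sym = N-sym ; N-irr = N-irr ; N⊆G = N⊆G
      ; light = λ v h → light v (lower v h (v ≟ w))
      ; heavy = λ v h → go v h (v ≟ w) (Nb g w v) refl
      ; pins = ≤-trans (count-set (Pn g) w) (s≤s one-pin) }
      where
      open Inv inv
      g₂ = heavied w g
      lower : ∀ v → Hv g₂ v ≡ false → Dec (v ≡ w) → Hv g v ≡ false
      lower v h (yes refl) = lw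
      lower v h (no p) = trans (sym (setF-other (Hv g) p)) h
      cM≤ : suc cM ≤ κ
      cM≤ = ≤-reflexive (eq ρ)
        where
        eq : ∀ r → suc (2 * r + 2) ≡ 2 * r + 3
        eq = solve-∀
      go : ∀ v → Hv g₂ v ≡ true → Dec (v ≡ w) → ∀ c → Nb g w v ≡ c → NH g₂ v ≤ κ
      go v h (yes refl) c _ = ≤-trans (≤-trans (count-mono (λ u e → ∧-intro (∧-trueˡ {Nb g v u} e) (heavied-⊆ g v u (∧-trueʳ {Nb g v u} e) λ { refl → true≢false (∧-trueˡ {Nb g v u} e) (N-irr u) }))) (NH-Mb g v inv)) (≤-trans fewM (≤-trans (n≤1+n cM) cM≤))
      go v h (no p) false nb = ≤-trans (count-mono (λ u e → ∧-intro (∧-trueˡ {Nb g v u} e) (heavied-⊆ g w u (∧-trueʳ {Nb g v u} e) λ { refl → true≢false (trans (N-sym u v) (∧-trueˡ {Nb g v u} e)) nb }))) (heavy v (heavied-⊆ g w v h p))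
      go v h (no p) true nb = ≤-trans (≤-trans (∑-mono (λ u → one u (u ≟ w))) (≤-trans (≤-reflexive (∑-+ (λ u → b2n (eqᵇ u w)) (λ u → b2n (Mb (Nb g) (Hv g) w u)))) (+-mono-≤ (count-eq≤1 w) fewM))) cM≤
        where
        one : ∀ u → Dec (u ≡ w) → b2n (Nb g v u ∧ Hv g₂ u) ≤ b2n (eqᵇ u w) + b2n (Mb (Nb g) (Hv g) w u)
        one u (yes refl) = ≤-trans (b2n≤1 (Nb g v u ∧ Hv g₂ u)) (≤-trans (≤-reflexive (cong b2n (sym (eqᵇ-refl u)))) (m≤m+n _ _))
        one u (no q) = ≤-trans (b2n-mono (λ e → let hu = heavied-⊆ g w u (∧-trueʳ {Nb g v u} e) q in
          ∧-intro hu (∧-intro (not-false (eqᵇ-≢ q)) (∨-introʳ {Nb g w u} (anyF-intro _ v (∧-intro (∧-intro nb (heavied-⊆ g w v h p)) (∧-trueˡ {Nb g v u} e))))))) (m≤n+m _ _)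

    demote-spec : ∀ w g σ → VG g σ → Inv g → Indep g → NoUD g → Pn g w ≡ false → count (Pn g) ≤ 1 → Does w (code demote) σ (λ t σ′ → ∃ λ g′ → Demoted w g g′ t σ′)
    demote-spec w g σ view inv ind clean pw one-pin = d-sub (redu w g σ view inv ind) after-red
      where
      after-red : ∀ {t₁ σ₁} → RedPost w g t₁ σ₁ → Does w (ask demoteAct) σ₁ (λ t₂ σ′ → ∃ λ g′ → Demoted w g g′ (suc t₁ + suc t₂) σ′)
      after-red {t₁} {σ₁} (g₁ , R , _ , fewM) = d-ask (subst (λ c → Does w (if c then upd setPin halt else upd toHeavy (pulse poll (λ _ → goto fix))) σ₁ (λ t₂ σ′ → ∃ λ g′ → Demoted w g g′ (suc t₁ + suc (suc t₂)) σ′)) (sym (View.h≡ view₁ w)) (go (Hv g₁ w) refl))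
        where
        view₁ = gview R
        T = gtr R
        no₁ : NoUD g₁
        no₁ v = ¬true⇒false λ u → true≢false (proj₁ (ud-back T v u)) (clean v)
        one-pin′ : count (Pn g₁) ≤ 1
        one-pin′ = ≤-trans (≤-reflexive (∑-cong (λ v → cong b2n (P≡ T v)))) one-pin
        up₁ : ∀ v → Hv g₁ v ≡ true → Hv g v ≡ true
        up₁ v h = ¬false⇒true λ l → true≢false h (stay-light T v l)
        go : ∀ c → Hv g₁ w ≡ c → Does w (if c then upd setPin halt else upd toHeavy (pulse poll (λ _ → goto fix))) σ₁ (λ t₂ σ′ → ∃ λ g′ → Demoted w g g′ (suc t₁ + suc (suc t₂)) σ′)
        go true h = runsTo (upd halt) (g₂ , record
            { dview = withKnown Sl.preV known₂ ; dinv = record { N-sym = N-sym ; N-irr = N-irr ; N⊆G = N⊆G ; light = light ; heavy = heavy ; pins = ≤-trans (count-set (Pn g₁) w) (s≤s one-pin′) }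
            ; dind = gind R ; dno = no₁ ; dN = N≡ T ; dP = λ v q → trans (setF-other (Pn g₁) q) (P≡ T v) ; dpin = setF-self w (Pn g₁) ; dH = h
            ; dkeep = stay-pin T ; ddown = λ v _ → up₁ v ; dNH = ≤-trans (NH-Mb g₁ w (ginv R)) fewM
            ; dtime = ≤-trans (≤-reflexive (eq t₁ (C * Φ g₁))) (≤-trans (+-monoʳ-≤ 4 (gtime R)) (≤-trans (m≤m+n _ (16 + A + (C + C))) (≤-reflexive (eq′ (C * Φ g) A (C + C))))) })
          where
          g₂ = pinned w g₁
          open Inv (ginv R)
          eq : ∀ t x → suc t + suc (suc 1) + x ≡ 4 + (t + x)
          eq = solve-∀
          eq′ : ∀ x a c → 4 + (10 + x) + (16 + a + c) ≡ 30 + a + c + x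
          eq′ = solve-∀
          module Sl = SetLoc view₁ w (setPin (σ₁ w)) g₂ (me≡ (View.wf view₁) w) refl refl (View.h≡ view₁ w) (sym (setF-self w (Pn g₁))) (View.i≡ view₁ w) (View.a≡ view₁ w)
            (λ _ _ → refl) (λ _ _ → refl) (λ v q → setF-other (Pn g₁) q) (λ _ _ → refl) using (nb; pointwise; preV; tb₁; σ₁)
          known₂ : Known Sl.σ₁
          known₂ v u e = knows (λ { (inj₁ x) → trans (Sl.tb₁ v u) (trans (full k (inj₁ (trans (cong hv (sym (same v))) x))) (sym (same u)))
                                  ; (inj₂ x) → trans (Sl.tb₁ v u) (trans (full k (inj₂ (trans (cong hv (sym (same u))) x))) (sym (same u))) })
                               (trans (cong hv (Sl.tb₁ v u)) (trans (flag k) (cong hv (sym (same u)))))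
            where
            k : Knows σ₁ v u
            k = View.known view₁ v u (trans (sym (Sl.nb v u)) e)
            same : ∀ x → inf (Sl.σ₁ x) ≡ inf (σ₁ x)
            same = Sl.pointwise inf {λ x → inf (σ₁ x)} refl (λ _ _ → refl)
        go false h = d-upd (hush poll Sl.preV inv₂ (λ _ → refl) (PreV.wf Sl.preV) Sl.poll-pre (poll-cost w Sl.preV dw) λ view₂ →
            d-goto (d-map fin (fix-spec (suc (Φ g₂)) w g₂ _ ≤-refl view₂ inv₂ ind₂ (setF-self w (Hv g₁)) (setF-self w (Pn g₁)) dw (heavied-pend g₁ w no₁ (ginv R)))))
          where
          g₂ = heavied w g₁
          inv₂ : Inv g₂
          inv₂ = heavied-Inv g₁ w (ginv R) h fewM one-pin′
          dw : deg g₁ w ≤ 2 * ρ ^ 2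
          dw = Inv.light (ginv R) w h
          old : ∀ v → In g₂ v ≡ true → In g₁ v ≡ true
          old v e = go′ (v ≟ w)
            where
            go′ : Dec (v ≡ w) → In g₁ v ≡ true
            go′ (yes refl) = true≢false e (setF-self w (In g₁))
            go′ (no q) = trans (sym (setF-other (In g₁) q)) e
          ind₂ : Indep g₂
          ind₂ u v nb iu iv = gind R u v nb (old u iu) (old v iv)
          module Sl = SetLoc view₁ w (toHeavy (σ₁ w)) g₂ (me≡ (View.wf view₁) w) refl refl (sym (setF-self w (Hv g₁))) (sym (setF-self w (Pn g₁))) (sym (setF-self w (In g₁))) (View.a≡ view₁ w)
            (λ _ _ → refl) (λ v q → setF-other (Hv g₁) q) (λ v q → setF-other (Pn g₁) q) (λ v q → setF-other (In g₁) q) using (poll-pre; preV)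
          Φ₂ : Φ g₂ ≤ 2 + Φ g₁
          Φ₂ = ≤-trans (∑-mono (λ v → one v (v ≟ w))) (≤-trans (≤-reflexive (trans (∑-+ (λ v → 2 * b2n (eqᵇ v w)) (λ v → φ (Hv g₁ v) (In g₁ v))) (cong (_+ Φ g₁) (∑-*ˡ 2 (λ v → b2n (eqᵇ v w)))))) (+-monoˡ-≤ (Φ g₁) (*-monoʳ-≤ 2 (count-eq≤1 w))))
            where
            one : ∀ v → Dec (v ≡ w) → φ (Hv g₂ v) (In g₂ v) ≤ 2 * b2n (eqᵇ v w) + φ (Hv g₁ v) (In g₁ v)
            one v (yes refl) = ≤-trans (φ≤2 (Hv g₂ v) (In g₂ v)) (≤-trans (≤-reflexive (cong (λ c → 2 * b2n c) (sym (eqᵇ-refl v)))) (m≤m+n _ _))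
            one v (no q) = ≤-trans (≤-reflexive (cong₂ φ (setF-other (Hv g₁) q) (setF-other (In g₁) q))) (m≤n+m _ _)
          fin : ∀ {t σ′} → FixPost w g₂ t σ′ → ∃ λ g′ → Demoted w g g′ (suc t₁ + suc (suc (suc (5 + suc t)))) σ′
          fin {t} (g′ , F , no′) = g′ , record
            { dview = gview F ; dinv = ginv F ; dind = gind F ; dno = no′ ; dN = λ u v → trans (N≡ (gtr F) u v) (N≡ T u v)
            ; dP = λ v q → trans (P≡ (gtr F) v) (trans (setF-other (Pn g₁) q) (P≡ T v)) ; dpin = trans (P≡ (gtr F) w) (setF-self w (Pn g₁))
            ; dH = trans (stay-pin (gtr F) w (setF-self w (Pn g₁))) (setF-self w (Hv g₁))
            ; dkeep = λ v p → let q = λ { refl → true≢false p pw } in trans (stay-pin (gtr F) v (trans (setF-other (Pn g₁) q) (trans (P≡ T v) p))) (trans (setF-other (Hv g₁) q) (stay-pin T v p))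
            ; ddown = λ v q e → up₁ v (heavied-⊆ g₁ w v (down v e) q)
            ; dNH = ≤-trans (count-mono (λ u e → let nb = trans (sym (N≡ (gtr F) w u)) (∧-trueˡ e) in ∧-intro nb (heavied-⊆ g₁ w u (down u (∧-trueʳ {Nb g′ w u} e)) λ { refl → true≢false nb (Inv.N-irr (ginv R) u) }))) (≤-trans (NH-Mb g₁ w (ginv R)) fewM)
            ; dtime = begin
                suc t₁ + suc (suc (suc (5 + suc t))) + C * Φ g′ ≡⟨ eq t₁ t (C * Φ g′) ⟩
                10 + t₁ + (t + C * Φ g′) ≤⟨ +-monoʳ-≤ (10 + t₁) (≤-trans (gtime F) (+-monoʳ-≤ (6 + A) (≤-trans (*-monoʳ-≤ C Φ₂) (≤-reflexive (*-distribˡ-+ C 2 (Φ g₁)))))) ⟩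
                10 + t₁ + (6 + A + (C * 2 + C * Φ g₁)) ≡⟨ eq′ t₁ A C (C * Φ g₁) ⟩
                16 + A + (C + C) + (t₁ + C * Φ g₁) ≤⟨ +-monoʳ-≤ (16 + A + (C + C)) (gtime R) ⟩
                16 + A + (C + C) + (10 + C * Φ g) ≤⟨ m≤m+n _ 4 ⟩
                16 + A + (C + C) + (10 + C * Φ g) + 4 ≡⟨ eq″ A (C + C) (C * Φ g) ⟩
                Kd + C * Φ g ∎ }
            where
            open ≤-Reasoning
            down : ∀ v → Hv g′ v ≡ true → Hv g₂ v ≡ true
            down v e = ¬false⇒true λ l → true≢false e (stay-light (gtr F) v l)
            eq : ∀ t s x → suc t + suc (suc (suc (5 + suc s))) + x ≡ 10 + t + (s + x)
            eq = solve-∀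
            eq′ : ∀ t a c x → 10 + t + (6 + a + (c * 2 + x)) ≡ 16 + a + (c + c) + (t + x)
            eq′ = solve-∀
            eq″ : ∀ a c x → 16 + a + c + (10 + x) + 4 ≡ 30 + a + c + x
            eq″ = solve-∀

    -- Insertion of an edge

    linked : V → V → Glob n → Glob n
    linked a c g = glob (λ u v → samePair a c u v ∨ Nb g u v) (Hv g) (setF c false (setF a false (Pn g))) (setF c (In g c ∧ not (In g a)) (In g))

    samePair-sym : ∀ (a c u v : V) → samePair a c u v ≡ samePair a c v u
    samePair-sym a c u v = trans (∨-comm (eqᵇ u a ∧ eqᵇ v c) _) (cong₂ _∨_ (∧-comm (eqᵇ u c) _) (∧-comm (eqᵇ u a) _))

    samePair-elim : ∀ {a c u v : V} {P : Set} → samePair a c u v ≡ true → (u ≡ a → v ≡ c → P) → (u ≡ c → v ≡ a → P) → P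
    samePair-elim {a} {c} {u} {v} e f g = ∨-elim {eqᵇ u a ∧ eqᵇ v c} e (λ h → f (eqᵇ⇒≡ (∧-trueˡ {eqᵇ u a} h)) (eqᵇ⇒≡ (∧-trueʳ {eqᵇ u a} h))) (λ h → g (eqᵇ⇒≡ (∧-trueˡ {eqᵇ u c} h)) (eqᵇ⇒≡ (∧-trueʳ {eqᵇ u c} h)))

    module Link {g : Glob n} {τ : V → Loc} (view : VG g τ) (inv : Inv g) (ind : Indep g) (clean : NoUD g) {a c : V} (a≢c : a ≢ c) (far : Nb g a c ≡ false) (edge : G a c ≡ true) (G-sym : ∀ u v → G u v ≡ G v u)
      (ha : Hv g a ≡ true) (hc : Hv g c ≡ true) (la : NH g a ≤ cM) (lc : NH g c ≤ cM) where
      open View view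
      open Inv inv

      τ₁ τ₂ τ₃ : V → Loc
      τ₁ = setL a (addNbr c (τ a)) τ
      τ₂ = hear a c τ₁
      τ₃ = setL c (linkTo a (τ₂ c)) τ₂

      locA locC : Loc
      locA = addNbr c (τ a)
      locC = linkTo a (learn a (inf locA) (τ c))

      τ₁-a : τ₁ a ≡ locA
      τ₁-a = if-true (eqᵇ-refl a)

      τ₁-other : ∀ {v} → v ≢ a → τ₁ v ≡ τ v
      τ₁-other p = if-false (eqᵇ-≢ p)

      τ₃-c : τ₃ c ≡ locC
      τ₃-c = trans (if-true (eqᵇ-refl c)) (cong (linkTo a) (trans (if-true (eqᵇ-refl c)) (cong₂ (λ x y → learn a (inf x) y) τ₁-a (τ₁-other (a≢c ∘ sym)))))

      τ₃-a : τ₃ a ≡ locA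
      τ₃-a = trans (if-false (eqᵇ-≢ a≢c)) (trans (if-false (eqᵇ-≢ a≢c)) τ₁-a)

      τ₃-other : ∀ {v} → v ≢ a → v ≢ c → τ₃ v ≡ τ v
      τ₃-other p q = trans (if-false (eqᵇ-≢ q)) (trans (if-false (eqᵇ-≢ q)) (τ₁-other p))

      data Place (v : V) : Set where
        atA : v ≡ a → Place v
        atC : v ≡ c → Place v
        off : v ≢ a → v ≢ c → Place v

      place : ∀ v → Place v
      place v with v ≟ a | v ≟ c
      ... | yes p | _ = atA p
      ... | no p | yes q = atC q
      ... | no p | no q = off p q

      tbC-a : tb locC a ≡ inf (τ a)
      tbC-a = trans (tb-mg (λ x → if eqᵇ x a then just (mkM retK (inf locA)) else nothing) (τ c) a) (cong (maybe info (tb (τ c) a)) (if-true (eqᵇ-refl a)))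

      tbC-other : ∀ {u} → u ≢ a → tb locC u ≡ tb (τ c) u
      tbC-other {u} p = trans (tb-mg (λ x → if eqᵇ x a then just (mkM retK (inf locA)) else nothing) (τ c) u) (cong (maybe info (tb (τ c) u)) (if-false (eqᵇ-≢ p)))

      tb₃ : ∀ v u → v ≢ c → tb (τ₃ v) u ≡ tb (τ v) u
      tb₃ v u q with place v
      ... | atA refl = cong (λ l → tb l u) τ₃-a
      ... | atC p = ⊥-elim (q p)
      ... | off p _ = cong (λ l → tb l u) (τ₃-other p q)

      inf₃ : ∀ v → v ≢ c → inf (τ₃ v) ≡ inf (τ v)
      inf₃ v q with place v
      ... | atA refl = cong inf τ₃-a
      ... | atC p = ⊥-elim (q p)
      ... | off p _ = cong inf (τ₃-other p q)

      hv₃ : ∀ v → hv (inf (τ₃ v)) ≡ Hv g v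
      hv₃ v with place v
      ... | atC refl = trans (cong (hv ∘ inf) τ₃-c) (h≡ v)
      ... | atA refl = trans (cong hv (inf₃ v a≢c)) (h≡ v)
      ... | off _ q = trans (cong hv (inf₃ v q)) (h≡ v)

      gL : Glob n
      gL = linked a c g

      if-or : ∀ c x → (if c then true else x) ≡ c ∨ x
      if-or true x = refl
      if-or false x = refl

      nbr₃ : ∀ u v → nbr (τ₃ u) v ≡ samePair a c u v ∨ Nb g u v
      nbr₃ u v with place u
      ... | atA refl = trans (cong (λ l → nbr l v) τ₃-a) (trans (cong (λ z → if eqᵇ v c then true else z) (n≡ u v)) (trans (if-or (eqᵇ v c) (Nb g u v))
          (cong (_∨ Nb g u v) (sym (trans (cong₂ (λ x y → (x ∧ eqᵇ v c) ∨ (y ∧ eqᵇ v a)) (eqᵇ-refl u) (eqᵇ-≢ a≢c)) (∨-identityʳ (eqᵇ v c)))))))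
      ... | atC refl = trans (cong (λ l → nbr l v) τ₃-c) (trans (cong (λ z → if eqᵇ v a then true else z) (n≡ u v)) (trans (if-or (eqᵇ v a) (Nb g u v))
          (cong (_∨ Nb g u v) (sym (cong₂ (λ x y → (x ∧ eqᵇ v c) ∨ (y ∧ eqᵇ v a)) (eqᵇ-≢ (a≢c ∘ sym)) (eqᵇ-refl u))))))
      ... | off p q = trans (cong (λ l → nbr l v) (τ₃-other p q)) (trans (n≡ u v) (cong (_∨ Nb g u v) (sym (cong₂ (λ x y → (x ∧ eqᵇ v c) ∨ (y ∧ eqᵇ v a)) (eqᵇ-≢ p) (eqᵇ-≢ q)))))

      me₃ : ∀ v → me (τ₃ v) ≡ v
      me₃ v with place v
      ... | atA refl = trans (cong me τ₃-a) (me≡ wf v)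
      ... | atC refl = trans (cong me τ₃-c) (me≡ wf v)
      ... | off p q = trans (cong me (τ₃-other p q)) (me≡ wf v)

      irr-L : ∀ u → samePair a c u u ∨ Nb g u u ≡ false
      irr-L u = ¬true⇒false λ e → ∨-elim {samePair a c u u} e (λ s → samePair-elim {a} {c} {u} {u} s (λ p q → a≢c (trans (sym p) q)) (λ p q → a≢c (trans (sym q) p))) (λ n → true≢false n (N-irr u))

      sym-L : ∀ u v → samePair a c u v ∨ Nb g u v ≡ samePair a c v u ∨ Nb g v u
      sym-L u v = cong₂ _∨_ (samePair-sym a c u v) (N-sym u v)

      preL : PreV gL τ₃
      preL = record
        { wf = record { me≡ = me₃ ; nbr-sym = λ u v → trans (nbr₃ u v) (trans (sym-L u v) (sym (nbr₃ v u))) ; nbr-irr = λ u → trans (nbr₃ u u) (irr-L u) }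
        ; n≡ = nbr₃ ; h≡ = hv₃ ; p≡ = pin₃ ; i≡ = inn₃ ; a≡ = al₃ }
        where
        pin₃ : ∀ v → pin (τ₃ v) ≡ setF c false (setF a false (Pn g)) v
        pin₃ v with place v
        ... | atA refl = trans (cong pin τ₃-a) (sym (trans (setF-other (setF v false (Pn g)) a≢c) (setF-self v (Pn g))))
        ... | atC refl = trans (cong pin τ₃-c) (sym (setF-self v (setF a false (Pn g))))
        ... | off p q = trans (cong pin (τ₃-other p q)) (trans (p≡ v) (sym (trans (setF-other (setF a false (Pn g)) q) (setF-other (Pn g) p))))
        inn₃ : ∀ v → inn (inf (τ₃ v)) ≡ setF c (In g c ∧ not (In g a)) (In g) v
        inn₃ v with place v
        ... | atC refl = trans (cong (inn ∘ inf) τ₃-c) (trans (cong₂ (λ x y → x ∧ not y) (i≡ v) (trans (cong inn tbC-a) (i≡ a))) (sym (setF-self v (In g))))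
        ... | atA refl = trans (cong inn (inf₃ v a≢c)) (trans (i≡ v) (sym (setF-other (In g) a≢c)))
        ... | off p q = trans (cong inn (inf₃ v q)) (trans (i≡ v) (sym (setF-other (In g) q)))
        al₃ : ∀ v → al (inf (τ₃ v)) ≡ false
        al₃ v with place v
        ... | atC refl = trans (cong (al ∘ inf) τ₃-c) (a≡ v)
        ... | atA refl = trans (cong al (inf₃ v a≢c)) (a≡ v)
        ... | off p q = trans (cong al (inf₃ v q)) (a≡ v)

      old-edge : ∀ v u → nbr (τ₃ v) u ≡ true → (v ≡ a → u ≡ c → ⊥) → (v ≡ c → u ≡ a → ⊥) → nbr (τ v) u ≡ true
      old-edge v u e f h = ∨-elim {samePair a c v u} (trans (sym (nbr₃ v u)) e) (λ s → ⊥-elim (samePair-elim {a} {c} s f h)) (trans (n≡ v u))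

      -- The `Info` of `a` came with the call and is unchanged. What is new at `c` concerns its
      -- heavy neighbours, `a` included, which the pulse addresses; light neighbours need only the
      -- flag of `c`, which did not change.
      pkL : Effect.PreKnows τ₃ c cnt (PreV.wf preL)
      pkL v u e = go (place v) (place u)
        where
        module L = PulseOf τ₃ c cnt using (isX)
        inX : ∀ x → nbr (τ₃ c) x ≡ true → hv (tb locC x) ≡ true → L.isX x ≡ true
        inX x nb h = ∧-intro (∧-intro nb (trans (cong (λ l → hv (tb l x)) τ₃-c) h)) (not-false (eqᵇ-≢ λ q → true≢false nb (trans (cong (nbr (τ₃ c)) (trans q (me₃ c))) (trans (nbr₃ c c) (irr-L c)))))
        plain : v ≢ c → u ≢ c → nbr (τ v) u ≡ true → Knows τ₃ v u
        plain p q nb = knows (λ { (inj₁ h) → trans (tb₃ v u p) (trans (full k (inj₁ (trans (cong hv (sym (inf₃ v p))) h))) (sym (inf₃ u q)))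
                                ; (inj₂ h) → trans (tb₃ v u p) (trans (full k (inj₂ (trans (cong hv (sym (inf₃ u q))) h))) (sym (inf₃ u q))) })
                             (trans (cong hv (tb₃ v u p)) (trans (flag k) (cong hv (sym (inf₃ u q)))))
          where
          k : Knows τ v u
          k = known v u nb
        fromC : v ≡ c → u ≢ c → Dec (u ≡ a) → Knows τ₃ v u
        fromC refl q (yes refl) = knows (λ _ → t) (cong hv t)
          where
          t : tb (τ₃ v) u ≡ inf (τ₃ u)
          t = trans (cong (λ l → tb l u) τ₃-c) (trans tbC-a (sym (inf₃ u q)))
        fromC refl q (no p) = knows (λ _ → t) (cong hv t)
          where
          t : tb (τ₃ v) u ≡ inf (τ₃ u)
          t = trans (cong (λ l → tb l u) τ₃-c) (trans (tbC-other p) (trans (full (known v u (old-edge v u e (λ r _ → a≢c (sym r)) (λ _ → p))) (inj₁ (trans (h≡ v) hc))) (sym (inf₃ u q))))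
        toC : u ≡ c → v ≢ c → Dec (v ≡ a) → ∀ h → Hv g v ≡ h → Knows τ₃ v u ⊎ (u ≡ c × L.isX v ≡ true)
        toC refl q (yes refl) _ _ = inj₂ (refl , inX v (trans (nbr-sym (PreV.wf preL) u v) e) (trans (cong hv tbC-a) (trans (h≡ v) ha)))
        toC refl q (no p) true h = inj₂ (refl , inX v (trans (nbr-sym (PreV.wf preL) u v) e) (trans (cong hv (tbC-other p)) (trans (flag (known u v (trans (nbr-sym wf u v) nb))) (trans (h≡ v) h))))
          where
          nb : nbr (τ v) u ≡ true
          nb = old-edge v u e (λ r _ → p r) (λ r _ → q r)
        toC refl q (no p) false h = inj₁ (knows (λ { (inj₁ x) → true≢false x (trans (hv₃ v) h) ; (inj₂ x) → true≢false (trans (hv₃ u) hc) x })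
            (trans (cong hv (tb₃ v u q)) (trans (flag (known v u (old-edge v u e (λ r _ → p r) (λ r _ → q r)))) (trans (h≡ u) (sym (hv₃ u))))))
        go : Place v → Place u → Knows τ₃ v u ⊎ (u ≡ c × L.isX v ≡ true)
        go (atC p) (atC q) = true≢false e (trans (nbr₃ v u) (trans (cong₂ (λ x y → samePair a c x y ∨ Nb g x y) p q) (irr-L c)))
        go (atC p) (atA q) = inj₁ (fromC p (λ r → a≢c (trans (sym q) r)) (yes q))
        go (atC p) (off q r) = inj₁ (fromC p r (no q))
        go (atA p) (atC q) = toC q (λ r → a≢c (trans (sym p) r)) (yes p) (Hv g v) refl
        go (off p r) (atC q) = toC q r (no p) (Hv g v) refl
        go (atA p) (atA q) = true≢false e (trans (nbr₃ v u) (trans (cong₂ (λ x y → samePair a c x y ∨ Nb g x y) p q) (irr-L a)))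
        go (atA p) (off q r) = inj₁ (plain (λ s → a≢c (trans (sym p) s)) r (old-edge v u e (λ _ → r) (λ _ → q)))
        go (off p s) (atA q) = inj₁ (plain s (λ r → a≢c (trans (sym q) r)) (old-edge v u e (λ r _ → p r) (λ r _ → s r)))
        go (off p s) (off q r) = inj₁ (plain s r (old-edge v u e (λ x _ → p x) (λ x _ → s x)))

      cM<κ : suc cM ≤ κ
      cM<κ = ≤-reflexive (eq ρ)
        where
        eq : ∀ r → suc (2 * r + 2) ≡ 2 * r + 3
        eq = solve-∀

      -- The endpoints were reduced to `cM` heavy neighbours rather than `κ`, exactly to make room
      -- for the new one.
      NH-L : ∀ x y → (∀ v → samePair a c x v ≡ true → v ≡ y) → NH g x ≤ cM → NH gL x ≤ κ
      NH-L x y h le = ≤-trans (∑-mono one) (≤-trans (≤-reflexive (∑-+ (λ v → b2n (eqᵇ v y)) (λ v → b2n (Nb g x v ∧ Hv g v)))) (≤-trans (+-mono-≤ (count-eq≤1 y) le) cM<κ))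
        where
        one : ∀ v → b2n ((samePair a c x v ∨ Nb g x v) ∧ Hv g v) ≤ b2n (eqᵇ v y) + b2n (Nb g x v ∧ Hv g v)
        one v = go (samePair a c x v) refl
          where
          go : ∀ s → samePair a c x v ≡ s → b2n ((s ∨ Nb g x v) ∧ Hv g v) ≤ b2n (eqᵇ v y) + b2n (Nb g x v ∧ Hv g v)
          go true e = ≤-trans (b2n≤1 (Hv g v)) (≤-trans (≤-reflexive (cong b2n (sym (trans (cong (λ z → eqᵇ z y) (h v e)) (eqᵇ-refl y))))) (m≤m+n _ _))
          go false e = m≤n+m _ _

      invL : Inv gL
      invL = record
        { N-sym = sym-L ; N-irr = irr-L
        ; N⊆G = λ u v e → ∨-elim {samePair a c u v} e (λ s → samePair-elim {a} {c} {u} {v} s (λ { refl refl → edge }) (λ { refl refl → trans (G-sym u v) edge })) (N⊆G u v)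
        ; light = λ v l → ≤-trans (≤-reflexive (∑-cong (λ u → cong b2n (cong (_∨ Nb g v u) (¬true⇒false λ s → samePair-elim {a} {c} {v} {u} s (λ { refl _ → true≢false ha l }) (λ { refl _ → true≢false hc l })))))) (light v l)
        ; heavy = λ v h → hvy v h (place v)
        ; pins = ≤-trans (count-mono (λ v e → ¬false⇒true λ f → unset v e f (place v))) pins }
        where
        unset : ∀ v → setF c false (setF a false (Pn g)) v ≡ true → Pn g v ≡ false → Place v → ⊥
        unset v e f (atA refl) = true≢false e (trans (setF-other (setF v false (Pn g)) a≢c) (setF-self v (Pn g)))
        unset v e f (atC refl) = true≢false e (setF-self v (setF a false (Pn g)))
        unset v e f (off p q) = true≢false e (trans (setF-other (setF a false (Pn g)) q) (trans (setF-other (Pn g) p) f))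
        hvy : ∀ v → Hv g v ≡ true → Place v → NH gL v ≤ κ
        hvy v h (atA refl) = NH-L v c (λ u s → samePair-elim {v} {c} s (λ _ q → q) (λ p _ → ⊥-elim (a≢c p))) la
        hvy v h (atC refl) = NH-L v a (λ u s → samePair-elim {a} {v} s (λ p _ → ⊥-elim (a≢c (sym p))) (λ _ q → q)) lc
        hvy v h (off p q) = ≤-trans (≤-reflexive (∑-cong (λ u → cong b2n (cong (λ z → (z ∨ Nb g v u) ∧ Hv g u) (¬true⇒false λ s → samePair-elim {a} {c} {v} {u} s (λ r _ → p r) (λ r _ → q r)))))) (heavy v h)

      In-L : ∀ v → In gL v ≡ true → In g v ≡ true
      In-L v e = go (v ≟ c)
        where
        go : Dec (v ≡ c) → In g v ≡ true
        go (yes refl) = ∧-trueˡ (trans (sym (setF-self v (In g))) e)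
        go (no q) = trans (sym (setF-other (In g) q)) e

      indL : Indep gL
      indL u v e iu iv = ∨-elim {samePair a c u v} e (λ s → samePair-elim {a} {c} {u} {v} s (λ { refl refl → clash iu iv }) (λ { refl refl → clash iv iu })) (λ nb → ind u v nb (In-L u iu) (In-L v iv))
        where
        clash : In gL a ≡ true → In gL c ≡ true → ⊥
        clash ia ic = true≢false (In-L a ia) (not-true (∧-trueʳ {In g c} (trans (sym (setF-self c (In g))) ic)))

      -- If `c` leaves the set, only its heavy neighbours can miss it, since a heavy vertex never
      -- counts as dominator of a light one. All of these are within reach of a settling at `c`.
      udL : ∀ v → UDg gL v ≡ true → v ≡ c ⊎ (Nb gL c v ≡ true × Hv g v ≡ true)
      udL v e = go (v ≟ c) (Nb g c v) refl (Hv g v) refl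
        where
        module D = Domination (Nb g) (Hv g) using (UD-intro; dom)
        module DL = Domination (Nb gL) (Hv g) using (UD-dom; UD-in; dom; dom-heavy; dom-light)
        lost : v ≢ c → (∀ u → Nb g v u ≡ true → In g u ≡ true → (Hv g v ≡ false → Hv g u ≡ false) → In gL u ≡ true) → ⊥
        lost q keep = true≢false (D.UD-intro (trans (sym (setF-other (In g) q)) (DL.UD-in {In gL} {v} e)) (¬true⇒false λ d → true≢false (lift (Hv g v) refl d) (DL.UD-dom {In gL} {v} e))) (clean v)
          where
          lift : ∀ h → Hv g v ≡ h → D.dom (In g) v ≡ true → DL.dom (In gL) v ≡ true
          lift true h d = let (u , p) = anyF-elim _ (trans (sym (if-true h)) d) ; nb = ∧-trueˡ {Nb g v u} p in
            DL.dom-heavy h u (∨-introʳ {samePair a c v u} nb) (keep u nb (∧-trueʳ {Nb g v u} p) (λ l → true≢false h l))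
          lift false h d = let (u , p) = anyF-elim _ (trans (sym (if-false h)) d) ; nb = ∧-trueˡ {Nb g v u} p ; i = ∧-trueˡ {In g u} (∧-trueʳ {Nb g v u} p) ; l = not-true (∧-trueʳ {In g u} (∧-trueʳ {Nb g v u} p)) in
            DL.dom-light h u (∨-introʳ {samePair a c v u} nb) (keep u nb i (λ _ → l)) l
        go : Dec (v ≡ c) → ∀ k → Nb g c v ≡ k → ∀ h → Hv g v ≡ h → v ≡ c ⊎ (Nb gL c v ≡ true × h ≡ true)
        go (yes q) _ _ _ _ = inj₁ q
        go (no q) true nb true h = inj₂ (∨-introʳ {samePair a c c v} nb , refl)
        go (no q) false nb h′ _ = ⊥-elim (lost q (λ u n i _ → trans (setF-other (In g) (λ { refl → true≢false (trans (N-sym u v) n) nb })) i))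
        go (no q) true nb false h = ⊥-elim (lost q (λ u n i k → trans (setF-other (In g) (λ { refl → true≢false hc (k h) })) i))

      -- A heavy vertex weighs 2 in or out of the set, so resolving the conflict between the
      -- endpoints costs no potential.
      ΦL : Φ gL ≤ Φ g
      ΦL = ∑-mono λ v → go v (v ≟ c)
        where
        go : ∀ v → Dec (v ≡ c) → φ (Hv g v) (In gL v) ≤ φ (Hv g v) (In g v)
        go v (yes refl) = ≤-reflexive (trans (cong (λ h → φ h (In gL v)) hc) (sym (cong (λ h → φ h (In g v)) hc)))
        go v (no q) = ≤-reflexive (cong (φ (Hv g v)) (setF-other (In g) q))

      LinkPost : ℕ → (V → Loc) → Set
      LinkPost t σ′ = ∃ λ g′ → VG g′ σ′ × Inv g′ × Indep g′ × NoUD g′ × (∀ u v → Nb g′ u v ≡ samePair a c u v ∨ Nb g u v) × (∀ v → Pn g′ v ≡ Pn gL v) × t + C * Φ g′ ≤ 7 + A + C * Φ g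

      link-run : Does c (code (link a)) τ₂ LinkPost
      link-run = d-upd (hush cnt preL invL (λ _ → refl) (PreV.wf preL) (λ v u e → widen (pkL v u e)) (cnt-cost c preL pkL (inj₁ (Inv.heavy invL c hc))) λ view₁ →
          d-goto (d-map fin (settle-spec c gL _ view₁ invL indL)))
        where
        widen : ∀ {P Q R : Set} → P ⊎ Q → P ⊎ Q ⊎ R
        widen (inj₁ x) = inj₁ x
        widen (inj₂ y) = inj₂ (inj₁ y)
        fin : ∀ {t σ′} → SettlePost c gL t σ′ → LinkPost (suc (5 + suc t)) σ′
        fin {t} (g′ , S , _ , nc , nx) = g′ , gview S , ginv S , gind S , (λ v → ¬true⇒false λ u → bad v u (udL v (proj₁ (ud-back (gtr S) v u)))) , N≡ (gtr S) , P≡ (gtr S) ,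
            ≤-trans (≤-reflexive (eq t (C * Φ g′))) (≤-trans (+-monoʳ-≤ 7 (≤-trans (gtime S) (+-monoʳ-≤ A (*-monoʳ-≤ C ΦL)))) (≤-reflexive (sym (+-assoc 7 A (C * Φ g)))))
          where
          eq : ∀ t x → suc (5 + suc t) + x ≡ 7 + (t + x)
          eq = solve-∀
          bad : ∀ v → UDg g′ v ≡ true → v ≡ c ⊎ (Nb gL c v ≡ true × Hv g v ≡ true) → ⊥
          bad v u (inj₁ refl) = true≢false u nc
          bad v u (inj₂ (nb , h)) = true≢false u (nx v (trans (N≡ (gtr S) c v) nb) (trans (proj₂ (ud-back (gtr S) v u)) h))

    Ki : ℕ
    Ki = 25 + A + (Kd + Kd)

    InsertPost : V → V → Glob n → ℕ → (V → Loc) → Set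
    InsertPost a c g t σ′ = ∃ λ g′ → VG g′ σ′ × Inv g′ × Indep g′ × NoUD g′ × (∀ u v → Nb g′ u v ≡ samePair a c u v ∨ Nb g u v) × (∀ v → Pn g′ v ≡ false) × t + C * Φ g′ ≤ Ki + C * Φ g

    insert-spec : ∀ {a c g σ} → VG g σ → Inv g → Indep g → NoUD g → (∀ v → Pn g v ≡ false) → a ≢ c → Nb g a c ≡ false → G a c ≡ true → (∀ u v → G u v ≡ G v u) → Does a (insProg a c) σ (InsertPost a c g)
    insert-spec {a} {c} {g} {σ} view inv ind clean free a≢c far edge G-sym =
      d-sub (demote-spec a g σ view inv ind clean (free a) (≤-trans (≤-reflexive (∑-zero {n} (λ v → cong b2n (free v)))) z≤n)) after-a
      where
      after-a : ∀ {t₁ σ₁} → (∃ λ g₁ → Demoted a g g₁ t₁ σ₁) → Does a (call c demote (upd (addNbr c) (call c (link a) halt))) σ₁ (λ t → InsertPost a c g (suc t₁ + suc t))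
      after-a {t₁} {σ₁} (g₁ , D₁) = d-call a≢c edge (demote-spec c g₁ (hear a c σ₁) (hear-view a c (dview D₁)) (dinv D₁) (dind D₁) (dno D₁) (trans (dP D₁ c (a≢c ∘ sym)) (free c)) pins₁) after-c
        where
        pins₁ : count (Pn g₁) ≤ 1
        pins₁ = ≤-trans (count-mono (λ v e → ¬false⇒true λ ne → true≢false e (trans (dP D₁ v (eqᵇ-false ne)) (free v)))) (count-eq≤1 a)
        after-c : ∀ {t₂ σ₂} → (∃ λ g₂ → Demoted c g₁ g₂ t₂ σ₂) → Does a (upd (addNbr c) (call c (link a) halt)) (hear c a σ₂) (λ t → InsertPost a c g (suc t₁ + suc ((2 + t₂) + (2 + t))))
        after-c {t₂} {σ₂} (g₂ , D₂) = d-upd (d-call a≢c edge L.link-run fin)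
          where
          N₂ : ∀ u v → Nb g₂ u v ≡ Nb g u v
          N₂ u v = trans (dN D₂ u v) (dN D₁ u v)
          -- The pin on `a` pays off here: no reduction during the treatment of `c` could lighten
          -- it.
          ha₂ : Hv g₂ a ≡ true
          ha₂ = trans (dkeep D₂ a (dpin D₁)) (dH D₁)
          -- Treating `c` may make `c` heavy, but `c` is not yet a neighbour of `a` in the tables,
          -- so the heavy neighbours of `a` cannot have increased.
          la₂ : NH g₂ a ≤ cM
          la₂ = ≤-trans (count-mono (λ u e → let nb = trans (sym (dN D₂ a u)) (∧-trueˡ {Nb g₂ a u} e) in
            ∧-intro nb (ddown D₂ u (λ { refl → true≢false (trans (sym (dN D₁ a u)) nb) far }) (∧-trueʳ {Nb g₂ a u} e)))) (dNH D₁)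
          module L = Link (hear-view c a (dview D₂)) (dinv D₂) (dind D₂) (dno D₂) a≢c (trans (N₂ a c) far) edge G-sym ha₂ (dH D₂) la₂ (dNH D₂) using (LinkPost; link-run)
          fin : ∀ {t₃ σ₃} → L.LinkPost t₃ σ₃ → Does a halt (hear c a σ₃) (λ t → InsertPost a c g (suc t₁ + suc ((2 + t₂) + (2 + suc ((2 + t₃) + (2 + t))))))
          fin {t₃} (g₃ , v₃ , i₃ , d₃ , n₃ , N₃ , P₃ , le) = runsTo halt (g₃ , hear-view c a v₃ , i₃ , d₃ , n₃ , (λ u v → trans (N₃ u v) (cong (samePair a c u v ∨_) (N₂ u v))) , (λ v → trans (P₃ v) (unpinned′ v)) , (begin
              suc t₁ + suc ((2 + t₂) + (2 + suc ((2 + t₃) + (2 + 0)))) + C * Φ g₃ ≡⟨ eq t₁ t₂ t₃ (C * Φ g₃) ⟩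
              11 + t₁ + t₂ + (t₃ + C * Φ g₃) ≤⟨ +-monoʳ-≤ (11 + t₁ + t₂) le ⟩
              11 + t₁ + t₂ + (7 + A + C * Φ g₂) ≡⟨ eq₁ t₁ t₂ A (C * Φ g₂) ⟩
              18 + A + t₁ + (t₂ + C * Φ g₂) ≤⟨ +-monoʳ-≤ (18 + A + t₁) (dtime D₂) ⟩
              18 + A + t₁ + (Kd + C * Φ g₁) ≡⟨ eq₂ A t₁ Kd (C * Φ g₁) ⟩
              18 + A + Kd + (t₁ + C * Φ g₁) ≤⟨ +-monoʳ-≤ (18 + A + Kd) (dtime D₁) ⟩
              18 + A + Kd + (Kd + C * Φ g) ≤⟨ m≤m+n _ 7 ⟩
              18 + A + Kd + (Kd + C * Φ g) + 7 ≡⟨ eq₃ A Kd (C * Φ g) ⟩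
              Ki + C * Φ g ∎))
            where
            open ≤-Reasoning
            eq : ∀ x y z f → suc x + suc ((2 + y) + (2 + suc ((2 + z) + (2 + 0)))) + f ≡ 11 + x + y + (z + f)
            eq = solve-∀
            eq₁ : ∀ x y a f → 11 + x + y + (7 + a + f) ≡ 18 + a + x + (y + f)
            eq₁ = solve-∀
            eq₂ : ∀ a x k f → 18 + a + x + (k + f) ≡ 18 + a + k + (x + f)
            eq₂ = solve-∀
            eq₃ : ∀ a k f → 18 + a + k + (k + f) + 7 ≡ 25 + a + (k + k) + f
            eq₃ = solve-∀
            unpinned′ : ∀ v → setF c false (setF a false (Pn g₂)) v ≡ false
            unpinned′ v = go (v ≟ c) (v ≟ a)
              where
              go : Dec (v ≡ c) → Dec (v ≡ a) → setF c false (setF a false (Pn g₂)) v ≡ false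
              go (yes refl) _ = setF-self v (setF a false (Pn g₂))
              go (no p) (yes refl) = trans (setF-other (setF v false (Pn g₂)) p) (setF-self v (Pn g₂))
              go (no p) (no q) = trans (setF-other (setF a false (Pn g₂)) p) (trans (setF-other (Pn g₂) q) (trans (dP D₂ v p) (trans (dP D₁ v q) (free v))))

  -- Executing programs by rounds of the distributed algorithm

  module Coded (B : ℕ) (enc : M → Msg n B) (dec : Msg n B → M) (dec-enc : ∀ m → dec (enc m) ≡ m) where

    emap : Maybe M → Maybe (Msg n B)
    emap (just m) = just (enc m)
    emap nothing  = nothing

    dmap : Maybe (Msg n B) → Maybe M
    dmap (just m) = just (dec m)
    dmap nothing  = nothing

    onEvent : State → Event n → State
    onEvent s (added v)   = onAdded v s
    onEvent s (removed v) = onRemoved v s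

    algo : Algorithm n B
    algo = record
      { State = State
      ; init  = start
      ; wake  = onEvent
      ; step  = λ s inb → proj₁ (vstep s (tabulate (dmap ∘ inb))) , emap ∘ proj₂ (vstep s (tabulate (dmap ∘ inb)))
      ; done  = inert
      ; inMIS = λ s → inn (inf (loc s))
      }

    open Exec algo using (Config; config; round; runUpdate; runSeq; wakeAll; endpoints; hasMsg)
    open Config

    dmap-emap : ∀ x → dmap (emap x) ≡ x
    dmap-emap (just m) = cong just (dec-enc m)
    dmap-emap nothing  = refl

    is-just-emap : ∀ x → is-just (emap x) ≡ is-just x
    is-just-emap (just m) = refl
    is-just-emap nothing  = refl

    Mail : Set
    Mail = V → V → Maybe M

    to : Mail → V → Inbox
    to I v = tabulate (λ u → I u v)

    noMail : Mail
    noMail _ _ = nothing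

    record Rep (c : Config) (S : V → State) (I : Mail) : Set where
      field
        st : ∀ v → states c v ≡ S v
        ib : ∀ v u → inbox c v u ≡ emap (I u v)
        aw : ∀ v → inert (S v) ≡ false → awake c v ≡ true
    open Rep

    mailCount : Mail → ℕ
    mailCount O = ∑ (λ u → count (λ v → is-just (O u v)))

    mg-empty : ∀ iv l → (∀ u → lookup iv u ≡ nothing) → mg iv l ≡ l
    mg-empty iv l h = cong (λ t → record l { tab = t })
      (trans (tabulate-cong (λ u → cong (maybe info (tb l u)) (h u))) (tabulate∘lookup (tab l)))

    grab-none : ∀ {A : Set} (g : M → Maybe A) iv → (∀ u → lookup iv u ≡ nothing) → ∀ u → grab g iv u ≡ nothing
    grab-none g iv h u = cong (_>>=ᴹ g) (h u)

    dispatch-cong : ∀ l k iv {a a′ b b′ c c′ d d′} → a ≡ a′ → b ≡ b′ → c ≡ c′ → d ≡ d′ →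
      dispatch l k iv a b c d ≡ dispatch l k iv a′ b′ c′ d′
    dispatch-cong l k iv refl refl refl refl = refl

    idle-merge : ∀ l k iv → (∀ u → grab getP1 iv u ≡ nothing) → (∀ u → grab getP2 iv u ≡ nothing) →
      (∀ u → grab getCall iv u ≡ nothing) → (∀ u → grab getRet iv u ≡ nothing) →
      vstep (mkSt l idle k none) iv ≡ (mkSt (mg iv l) idle k none , silent)
    idle-merge l k iv h₁ h₂ h₃ h₄ = dispatch-cong l k iv (firstJ-none _ h₁) (firstJ-none _ h₂) (firstJ-none _ h₃) (firstJ-none _ h₄)

    -- Lets the analysis pretend that all vertices step in every round: for a vertex that the model
    -- leaves asleep, the step would change nothing and send nothing.
    inert-step : ∀ s iv → inert s ≡ true → (∀ u → lookup iv u ≡ nothing) → vstep s iv ≡ (s , silent)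
    inert-step (mkSt l idle k none) iv e h =
      trans (idle-merge l k iv (grab-none getP1 iv h) (grab-none getP2 iv h) (grab-none getCall iv h) (grab-none getRet iv h))
        (cong (λ l → mkSt l idle k none , silent) (mg-empty iv l h))
    inert-step (mkSt l (exec p) k m) iv () h
    inert-step (mkSt l (pulsing j f) k m) iv () h
    inert-step (mkSt l idle k (hold j w r)) iv () h

    -- Compares a round of the model with one in which every vertex steps on decoded mail. `hG` is
    -- needed because the model silently drops messages between vertices that are not adjacent.
    module OneRound (G : Graph n) (c : Config) (S : V → State) (I : Mail) (R : Rep c S I) (S′ : V → State) (O : Mail)
      (hS : ∀ v → proj₁ (vstep (S v) (to I v)) ≡ S′ v) (hO : ∀ u v → proj₂ (vstep (S u) (to I u)) v ≡ O u v)
      (hG : ∀ u v → is-just (O u v) ≡ true → G u v ≡ true) where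

      c′ : Config
      c′ = proj₁ (round G c)

      active : V → Bool
      active v = awake c v ∨ hasMsg (inbox c v)

      res′ : V → State × (V → Maybe (Msg n B))
      res′ v = if active v then Algorithm.step algo (states c v) (inbox c v) else (states c v , λ _ → nothing)

      same-inbox : ∀ v → tabulate (dmap ∘ inbox c v) ≡ to I v
      same-inbox v = tabulate-cong (λ u → trans (cong dmap (ib R v u)) (dmap-emap (I u v)))

      same-step : ∀ v → vstep (states c v) (tabulate (dmap ∘ inbox c v)) ≡ vstep (S v) (to I v)
      same-step v = cong₂ vstep (st R v) (same-inbox v)

      asleep : ∀ v → active v ≡ false → inert (S v) ≡ true × (∀ u → lookup (to I v) u ≡ nothing)
      asleep v e = ¬false⇒true (λ h → true≢false (aw R v h) (∨-falseˡ e)) ,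
        λ u → trans (lookup∘tabulate (λ u → I u v) u) (noth (I u v)
          (trans (sym (is-just-emap (I u v))) (trans (cong is-just (sym (ib R v u))) (any-allFin-false _ (∨-falseʳ {awake c v} e) u))))
        where
        noth : ∀ (x : Maybe M) → is-just x ≡ false → x ≡ nothing
        noth nothing _ = refl

      stepped : ∀ v → proj₁ (res′ v) ≡ S′ v × (∀ u → proj₂ (res′ v) u ≡ emap (O v u))
      stepped v = go (active v) refl
        where
        go : ∀ a → active v ≡ a →
          proj₁ (if a then Algorithm.step algo (states c v) (inbox c v) else (states c v , λ _ → nothing)) ≡ S′ v ×
          (∀ u → proj₂ (if a then Algorithm.step algo (states c v) (inbox c v) else (states c v , λ _ → nothing)) u ≡ emap (O v u))
        go true  e = trans (cong proj₁ (same-step v)) (hS v) , λ u → cong emap (trans (cong (λ p → proj₂ p u) (same-step v)) (hO v u))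
        go false e = trans (st R v) (trans (sym (cong proj₁ quietStep)) (hS v)) ,
                     λ u → sym (cong emap (trans (sym (hO v u)) (cong (λ p → proj₂ p u) quietStep)))
          where
          quietStep : vstep (S v) (to I v) ≡ (S v , silent)
          quietStep = inert-step (S v) (to I v) (proj₁ (asleep v e)) (proj₂ (asleep v e))

      rep : Rep c′ S′ O
      rep = record
        { st = λ v → proj₁ (stepped v)
        ; ib = λ v u → deliver v u (G u v) refl
        ; aw = λ v h → ¬false⇒true (λ e → true≢false (proj₁ (asleep v e))
                 (trans (cong inert (trans (sym (cong proj₁ (inert-step (S v) (to I v) (proj₁ (asleep v e)) (proj₂ (asleep v e))))) (hS v))) h))
        }
        where
        deliver : ∀ v u g → G u v ≡ g → (if g then proj₂ (res′ u) v else nothing) ≡ emap (O u v)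
        deliver v u true  e = proj₂ (stepped u) v
        deliver v u false e = none′ (O u v) refl
          where
          none′ : ∀ x → O u v ≡ x → nothing ≡ emap x
          none′ nothing  h = refl
          none′ (just m) h = true≢false (hG u v (cong is-just h)) e

      cnt≡ : proj₁ (proj₂ (round G c)) ≡ mailCount O
      cnt≡ = trans (sum-map-allFin (λ v → countFin (λ w → is-just (proj₂ (res′ v) w))))
        (∑-cong (λ v → trans (countFin-count (λ w → is-just (proj₂ (res′ v) w))) (∑-cong (λ u → cong b2n (trans (cong is-just (proj₂ (stepped v) u)) (is-just-emap (O v u)))))))

      quiet : Bool
      quiet = proj₂ (proj₂ (round G c))

      busy : ∀ v → inert (S′ v) ≡ false → quiet ≡ false
      busy v h = trans (cong (does (proj₁ (proj₂ (round G c)) Data.Nat.≟ 0) ∧_) (all-allFin-false _ v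
        (trans (cong₂ (λ a s → not a ∨ inert s) (aw rep v h) (st rep v)) h))) (∧-zeroʳ _)

      sends : ∀ u v → is-just (O u v) ≡ true → quiet ≡ false
      sends u v h = cong (_∧ all (λ v → not (awake c′ v) ∨ inert (states c′ v)) (allFin n)) (dec-false (proj₁ (proj₂ (round G c)) Data.Nat.≟ 0) (λ e →
        1≰0 (≤-trans (≤-reflexive (cong b2n (sym h))) (≤-trans (≤-trans (term≤∑ _ v) (term≤∑ (λ u → count (λ v → is-just (O u v))) u))
          (≤-reflexive (trans (sym cnt≡) e))))))
        where
        1≰0 : ¬ (1 ≤ 0)
        1≰0 ()

      finished : mailCount O ≡ 0 → (∀ v → inert (S′ v) ≡ true) → quiet ≡ true
      finished e h = ∧-intro (dec-true (proj₁ (proj₂ (round G c)) Data.Nat.≟ 0) (trans cnt≡ e))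
        (all-allFin _ (λ v → ∨-introʳ {not (awake c′ v)} (trans (cong inert (st rep v)) (h v))))

    data Reach (G : Graph n) : Config → ℕ → ℕ → Config → Set where
      here : ∀ {c} → Reach G c 0 0 c
      next : ∀ {c c₁ c′ t m k} → round G c ≡ (c₁ , m , false) → Reach G c₁ t k c′ → Reach G c (suc t) (m + k) c′

    reach-trans : ∀ {G c c₁ c₂ t t′ m m′} → Reach G c t m c₁ → Reach G c₁ t′ m′ c₂ → Reach G c (t + t′) (m + m′) c₂
    reach-trans here q = q
    reach-trans {G} {c} {c₂ = c₂} {t′ = t′} {m′ = m′} (next {t = t} {m = m} {k = k} e p) q =
      subst (λ z → Reach G c (suc (t + t′)) z c₂) (sym (+-assoc m k m′)) (next e (reach-trans p q))

    runUpdate-next : ∀ {G c c₁ m f s r k} → round G c ≡ (c₁ , m , false) → runUpdate f G c₁ ≡ just (s , r , k) →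
      runUpdate (suc f) G c ≡ just (s , suc r , m + k)
    runUpdate-next {G} {c} e h with round G c | e
    ... | ._ | refl rewrite h = refl

    runUpdate-end : ∀ {G c c₁ m f} → round G c ≡ (c₁ , m , true) → runUpdate (suc f) G c ≡ just (states c₁ , 1 , m)
    runUpdate-end {G} {c} e with round G c | e
    ... | ._ | refl = refl

    reach-run : ∀ {G c c₁ t m f s r k} → Reach G c t m c₁ → runUpdate f G c₁ ≡ just (s , r , k) →
      runUpdate (t + f) G c ≡ just (s , t + r , m + k)
    reach-run here h = h
    reach-run {s = s} {r} {k₁} (next {t = t} {m = m} {k = k} e p) h =
      trans (runUpdate-next e (reach-run p h)) (cong (λ z → just (s , suc (t + r) , z)) (sym (+-assoc m k k₁)))

    runUpdate-mono : ∀ {G c s} f g → runUpdate f G c ≡ just s → runUpdate (f + g) G c ≡ just s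
    runUpdate-mono {G} {c} (suc f) g h with round G c
    ... | (c′ , m , true) = h
    ... | (c′ , m , false) with runUpdate f G c′ in e
    ...   | just (s′ , r , ms) rewrite runUpdate-mono f g e = h

    conf : V → Ctl → (V → Loc) → (V → List Frame) → V → State
    conf w x σ κ v = mkSt (σ v) (if eqᵇ v w then x else idle) (κ v) none

    record Adv (G : Graph n) (c : Config) (r k : ℕ) (S : V → State) (O : Mail) : Set where
      constructor adv
      field
        {cfg} : Config
        path  : Reach G c r k cfg
        repr  : Rep cfg S O
    open Adv public

    adv-trans : ∀ {G c r k S O r′ k′ S′ O′} → Adv G c r k S O → (∀ {c₁} → Rep c₁ S O → Adv G c₁ r′ k′ S′ O′) → Adv G c (r + r′) (k + k′) S′ O′
    adv-trans (adv p R) f = adv (reach-trans p (path (f R))) (repr (f R))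

    vnext : ∀ {G c} (S : V → State) (I : Mail) (R : Rep c S I) (S′ : V → State) (O : Mail)
      (hS : ∀ v → proj₁ (vstep (S v) (to I v)) ≡ S′ v) (hO : ∀ u v → proj₂ (vstep (S u) (to I u)) v ≡ O u v)
      (hG : ∀ u v → is-just (O u v) ≡ true → G u v ≡ true) →
      (∃ λ v → inert (S′ v) ≡ false) ⊎ (∃ λ u → ∃ λ v → is-just (O u v) ≡ true) →
      Adv G c 1 (mailCount O) S′ O
    vnext {G} {c} S I R S′ O hS hO hG nq =
      adv (subst (λ z → Reach G c 1 z c′) (trans (+-identityʳ _) cnt≡) (next (cong (λ q → c′ , proj₁ (proj₂ (round G c)) , q) (nq′ nq)) here)) rep
      where
      open OneRound G c S I R S′ O hS hO hG using (busy; cnt≡; c′; quiet; rep; sends)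
      nq′ : (∃ λ v → inert (S′ v) ≡ false) ⊎ (∃ λ u → ∃ λ v → is-just (O u v) ≡ true) → quiet ≡ false
      nq′ (inj₁ (v , h))     = busy v h
      nq′ (inj₂ (u , v , h)) = sends u v h

    lookup-to : ∀ I v u → lookup (to I v) u ≡ I u v
    lookup-to I v u = lookup∘tabulate (λ u → I u v) u

    if-eq : ∀ {A : Set} (w : V) {x y : A} → (if eqᵇ w w then x else y) ≡ x
    if-eq w = if-true (eqᵇ-refl w)

    mailCount-noMail : mailCount noMail ≡ 0
    mailCount-noMail = ∑-zero {n} (λ u → ∑-zero {n} (λ v → refl))

    agg-cong : ∀ {f g : V → Maybe Res} → (∀ u → f u ≡ g u) → agg f ≡ agg g
    agg-cong {f} {g} h = go (λ u → cong (field₀ r₀) (h u)) (λ u → cong (field₀ r₁) (h u)) (λ u → cong (field₀ r₂) (h u))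
        (λ u → cong (field₀ r₃) (h u)) (best-cong (λ u → cong (_>>=ᴹ pk) (h u)))
      where
      best-cong : ∀ {m} {f g : Fin m → Maybe (Val × V)} → (∀ i → f i ≡ g i) → best f ≡ best g
      best-cong {zero}  h = refl
      best-cong {suc m} h = cong₂ better (cong zeroIdx (h zero)) (cong sucIdx (best-cong (h ∘ suc)))
      go : (∀ u → field₀ r₀ (f u) ≡ field₀ r₀ (g u)) → (∀ u → field₀ r₁ (f u) ≡ field₀ r₁ (g u)) →
        (∀ u → field₀ r₂ (f u) ≡ field₀ r₂ (g u)) → (∀ u → field₀ r₃ (f u) ≡ field₀ r₃ (g u)) →
        best (λ u → f u >>=ᴹ pk) ≡ best (λ u → g u >>=ᴹ pk) → agg f ≡ agg g
      go a b c d e rewrite ∑-cong a | ∑-cong b | ∑-cong c | ∑-cong d | e = refl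

    grab-to : ∀ {A : Set} (g : M → Maybe A) I v u → grab g (to I v) u ≡ (I u v >>=ᴹ g)
    grab-to g I v u = cong (_>>=ᴹ g) (lookup-to I v u)

    if-app : ∀ {A B : Set} (f : A → B) c {x y} → f (if c then x else y) ≡ (if c then f x else f y)
    if-app f true  = refl
    if-app f false = refl

    vnext₀ : ∀ {G c} (S : V → State) (I : Mail) (R : Rep c S I) (S′ : V → State)
      (hS : ∀ v → proj₁ (vstep (S v) (to I v)) ≡ S′ v) (hO : ∀ u v → proj₂ (vstep (S u) (to I u)) v ≡ nothing) →
      (∃ λ v → inert (S′ v) ≡ false) → Adv G c 1 0 S′ noMail
    vnext₀ {G} {c} S I R S′ hS hO ni = subst (λ z → Adv G c 1 z S′ noMail) mailCount-noMail
      (vnext S I R S′ noMail hS hO (λ u v ()) (inj₁ ni))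

    module PulseRounds (G : Graph n) (G-sym : ∀ u v → G u v ≡ G v u) (σ : V → Loc) (w : V) (o : Op) (f : Ans → Prog) (κ : V → List Frame)
      (me≡ : ∀ v → me (σ v) ≡ v) (nbr⊆ : ∀ u v → nbr (σ u) v ≡ true → G u v ≡ true) where
      open PulseOf σ w o using (L₂; L₃; L₄; O₁; O₂; O₃; O₄; after; answer; isX; memY; outY; parY; pulseMsgs; tot)

      X-root : isX w ≡ false
      X-root = trans (cong (λ z → (nbr (σ w) w ∧ (allScope o ∨ hv (tb (σ w) w))) ∧ not (eqᵇ w z)) (me≡ w))
        (trans (cong (λ z → (nbr (σ w) w ∧ (allScope o ∨ hv (tb (σ w) w))) ∧ not z) (eqᵇ-refl w)) (∧-zeroʳ _))

      S₁ S₂ S₃ S₄ S₅ : V → State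
      S₁ v = mkSt (σ v) (if eqᵇ v w then pulsing 3 f else idle) (κ v) none
      S₂ v = mkSt (L₂ v) (if eqᵇ v w then pulsing 2 f else idle) (κ v) (if isX v then hold 1 w (val o (σ v)) else none)
      S₃ v = mkSt (L₃ v) (if eqᵇ v w then pulsing 1 f else idle) (κ v) (if isX v then hold 0 w (val o (σ v)) else none)
      S₄ v = mkSt (L₄ v) (if eqᵇ v w then pulsing 0 f else idle) (κ v) none
      S₅ v = mkSt (after v) (if eqᵇ v w then exec (f answer) else idle) (κ v) none

      data Role (v : V) : Set where
        root : v ≡ w → eqᵇ v w ≡ true → isX v ≡ false → Role v
        inX  : eqᵇ v w ≡ false → isX v ≡ true → Role v
        else : eqᵇ v w ≡ false → isX v ≡ false → Role v

      role : ∀ v → Role v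
      role v with v ≟ w in e | isX v in x
      ... | yes refl | _ = root refl (eqᵇ-refl w) X-root
      ... | no p | true  = inX (eqᵇ-≢ p) x
      ... | no p | false = else (eqᵇ-≢ p) x

      st-cong : ∀ {c m : Bool} {l l′ : Loc} {x y : Ctl} {p q : Mem} {k} {c′ m′} → c ≡ c′ → m ≡ m′ → l ≡ l′ →
        mkSt l (if c then x else y) k (if m then p else q) ≡ mkSt l′ (if c′ then x else y) k (if m′ then p else q)
      st-cong refl refl refl = refl

      round₀ : ∀ v → vstep (conf w (exec (pulse o f)) σ κ v) (to noMail v) ≡ (S₁ v , proj₂ (vstep (conf w (exec (pulse o f)) σ κ v) (to noMail v)))
        × (∀ u → proj₂ (vstep (conf w (exec (pulse o f)) σ κ v) (to noMail v)) u ≡ O₁ v u)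
      round₀ v = go (eqᵇ v w) refl
        where
        go : ∀ c → eqᵇ v w ≡ c → vstep (mkSt (σ v) (if c then exec (pulse o f) else idle) (κ v) none) (to noMail v) ≡
            (mkSt (σ v) (if c then pulsing 3 f else idle) (κ v) none , proj₂ (vstep (mkSt (σ v) (if c then exec (pulse o f) else idle) (κ v) none) (to noMail v)))
          × (∀ u → proj₂ (vstep (mkSt (σ v) (if c then exec (pulse o f) else idle) (κ v) none) (to noMail v)) u ≡ (if c ∧ isX u then just (mkM (p1 o) (inf (σ w))) else nothing))
        go true e = refl , λ u → cong (λ z → if scope o (σ z) u then just (mkM (p1 o) (inf (σ z))) else nothing) (eqᵇ⇒≡ e)
        go false e = cong (λ p → (proj₁ p , proj₂ (vstep (mkSt (σ v) idle (κ v) none) (to noMail v)))) eq , λ u → cong (λ p → proj₂ p u) eq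
          where
          eq : vstep (mkSt (σ v) idle (κ v) none) (to noMail v) ≡ (mkSt (σ v) idle (κ v) none , silent)
          eq = inert-step (mkSt (σ v) idle (κ v) none) (to noMail v) refl (lookup-to noMail v)

      Step : (V → State) → Mail → (V → State) → Mail → V → Set
      Step S I S′ O v = proj₁ (vstep (S v) (to I v)) ≡ S′ v × (∀ u → proj₂ (vstep (S v) (to I v)) u ≡ O v u)

      O₁-w : ∀ v → isX v ≡ true → O₁ w v ≡ just (mkM (p1 o) (inf (σ w)))
      O₁-w v e = if-true (∧-intro (eqᵇ-refl w) e)

      O₁-≢ : ∀ u v → u ≢ w → O₁ u v ≡ nothing
      O₁-≢ u v p = if-false (cong (_∧ isX v) (eqᵇ-≢ p))

      O₁-notX : ∀ u v → isX v ≡ false → O₁ u v ≡ nothing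
      O₁-notX u v e = if-false (trans (cong (eqᵇ u w ∧_) e) (∧-zeroʳ _))

      O₂-notX : ∀ u v → isX u ≡ false → O₂ u v ≡ nothing
      O₂-notX u v e = if-false (cong (_∧ (deep o ∧ fwd (σ u) v)) e)

      O₄-notX : ∀ u v → isX u ≡ false → O₄ u v ≡ nothing
      O₄-notX u v e = if-false (cong (_∧ eqᵇ v w) e)

      L₂-X : ∀ v → isX v ≡ true → L₂ v ≡ atX (to O₁ v) (σ v) o
      L₂-X v e = cong (mg (to O₁ v)) (if-true e)

      L₂-notX : ∀ v → isX v ≡ false → L₂ v ≡ mg (to O₁ v) (σ v)
      L₂-notX v e = cong (mg (to O₁ v)) (if-false e)

      par-X : ∀ v → isX v ≡ true → parY v ≡ nothing
      par-X v e = if-true (∨-introˡ e)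

      par-root : parY w ≡ nothing
      par-root = if-true (∨-introʳ {isX w} (eqᵇ-refl w))

      par-else : ∀ v → eqᵇ v w ≡ false → isX v ≡ false → parY v ≡ firstJ (λ u → O₂ u v >>=ᴹ getP2)
      par-else v e x = if-false (trans (cong (_∨ eqᵇ v w) x) e)

      fromCase : ∀ S I S′ O v s r → S v ≡ s → vstep s (to I v) ≡ r → proj₁ r ≡ S′ v → (∀ u → proj₂ r u ≡ O v u) → Step S I S′ O v
      fromCase S I S′ O v s r refl refl h h′ = h , h′

      round₁ : ∀ v → Step S₁ O₁ S₂ O₂ v
      round₁ v with role v
      ... | root refl e x = fromCase S₁ O₁ S₂ O₂ v (mkSt (σ v) (pulsing 3 f) (κ v) none) _
              (cong (λ c → mkSt (σ v) (if c then pulsing 3 f else idle) (κ v) none) e) refl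
              (sym (trans (st-cong e x (L₂-notX v x)) refl)) (λ u → sym (O₂-notX v u x))
      ... | inX e x = fromCase S₁ O₁ S₂ O₂ v (mkSt (σ v) idle (κ v) none) _
              (cong (λ c → mkSt (σ v) (if c then pulsing 3 f else idle) (κ v) none) e)
              (dispatch-cong (σ v) (κ v) (to O₁ v) {a′ = just (w , o)}
                (firstJ-unique _ w o (trans (grab-to getP1 O₁ v w) (cong (_>>=ᴹ getP1) (O₁-w v x)))
                  (λ j j≢ → trans (grab-to getP1 O₁ v j) (cong (_>>=ᴹ getP1) (O₁-≢ j v j≢)))) refl refl refl)
              (sym (st-cong e x (L₂-X v x))) (λ u → sym (cong (λ z → if z ∧ (deep o ∧ fwd (σ v) u) then just (mkM (p2 o) (act o (σ v))) else nothing) x))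
      ... | else e x = fromCase S₁ O₁ S₂ O₂ v (mkSt (σ v) idle (κ v) none) _
              (cong (λ c → mkSt (σ v) (if c then pulsing 3 f else idle) (κ v) none) e)
              (idle-merge (σ v) (κ v) (to O₁ v) (gr getP1) (gr getP2) (gr getCall) (gr getRet))
              (sym (st-cong e x (L₂-notX v x))) (λ u → sym (O₂-notX v u x))
        where
        gr : ∀ {A : Set} (g : M → Maybe A) u → grab g (to O₁ v) u ≡ nothing
        gr g u = trans (grab-to g O₁ v u) (cong (_>>=ᴹ g) (O₁-notX u v x))

      O₂-only : ∀ {A : Set} (g : M → Maybe A) → (∀ i → g (mkM (p2 o) i) ≡ nothing) → ∀ v u → grab g (to O₂ v) u ≡ nothing
      O₂-only g h v u = trans (grab-to g O₂ v u) (go (isX u ∧ (deep o ∧ fwd (σ u) v)))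
        where
        go : ∀ c → ((if c then just (mkM (p2 o) (act o (σ u))) else nothing) >>=ᴹ g) ≡ nothing
        go true  = h _
        go false = refl

      round₂ : ∀ v → Step S₂ O₂ S₃ O₃ v
      round₂ v with role v
      ... | root refl e x = fromCase S₂ O₂ S₃ O₃ v (mkSt (L₂ v) (pulsing 2 f) (κ v) none) _
              (st-cong e x refl) refl (sym (st-cong e x (cong (λ r → mg (to O₂ v) (memY r (L₂ v))) par-root)))
              (λ u → sym (cong (λ r → outY r (L₂ v) u) par-root))
      ... | inX e x = fromCase S₂ O₂ S₃ O₃ v (mkSt (L₂ v) idle (κ v) (hold 1 w (val o (σ v)))) _
              (st-cong e x refl) refl (sym (st-cong e x (cong (λ r → mg (to O₂ v) (memY r (L₂ v))) (par-X v x))))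
              (λ u → sym (cong (λ r → outY r (L₂ v) u) (par-X v x)))
      ... | else e x = go (firstJ (grab getP2 (to O₂ v))) refl
        where
        par : ∀ r → firstJ (grab getP2 (to O₂ v)) ≡ r → parY v ≡ r
        par r h = trans (par-else v e x) (trans (firstJ-cong (λ u → sym (grab-to getP2 O₂ v u))) h)
        S₂v : S₂ v ≡ mkSt (L₂ v) idle (κ v) none
        S₂v = st-cong {x = pulsing 2 f} {y = idle} {p = hold 1 w (val o (σ v))} {q = none} e x refl
        S₃v : ∀ r → parY v ≡ r → mkSt (mg (to O₂ v) (memY r (L₂ v))) idle (κ v) none ≡ S₃ v
        S₃v r h = sym (st-cong {x = pulsing 1 f} {y = idle} {p = hold 0 w (val o (σ v))} {q = none} e x (cong (λ r → mg (to O₂ v) (memY r (L₂ v))) h))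
        go : ∀ r → firstJ (grab getP2 (to O₂ v)) ≡ r → Step S₂ O₂ S₃ O₃ v
        go (just (y , o′)) h = fromCase S₂ O₂ S₃ O₃ v (mkSt (L₂ v) idle (κ v) none) _ S₂v
          (dispatch-cong (L₂ v) (κ v) (to O₂ v) {a′ = nothing} {b′ = just (y , o′)} (firstJ-none _ (O₂-only getP1 (λ _ → refl) v)) h refl refl)
          (S₃v _ (par _ h)) (λ u → sym (cong (λ r → outY r (L₂ v) u) (par _ h)))
        go nothing h = fromCase S₂ O₂ S₃ O₃ v (mkSt (L₂ v) idle (κ v) none) _ S₂v
          (idle-merge (L₂ v) (κ v) (to O₂ v) (O₂-only getP1 (λ _ → refl) v) (firstJ-nothing _ h) (O₂-only getCall (λ _ → refl) v) (O₂-only getRet (λ _ → refl) v))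
          (S₃v _ (par _ h)) (λ u → sym (cong (λ r → outY r (L₂ v) u) (par _ h)))

      O₃-only : ∀ {A : Set} (g : M → Maybe A) → (∀ c r i → g (mkM (p3 c r) i) ≡ nothing) → ∀ v u → grab g (to O₃ v) u ≡ nothing
      O₃-only g h v u = trans (grab-to g O₃ v u) (go (parY u))
        where
        go : ∀ r → (outY r (L₂ u) v >>=ᴹ g) ≡ nothing
        go nothing = refl
        go (just (x , o′)) = go′ (eqᵇ v x ∨ (ann o′ ∧ fwd (L₂ u) v))
          where
          go′ : ∀ c → ((if c then just (mkM (p3 (eqᵇ v x) (val o′ (L₂ u))) (act o′ (L₂ u))) else nothing) >>=ᴹ g) ≡ nothing
          go′ true  = h _ _ _
          go′ false = refl

      round₃ : ∀ v → Step S₃ O₃ S₄ O₄ v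
      round₃ v with role v
      ... | root refl e x = fromCase S₃ O₃ S₄ O₄ v (mkSt (L₃ v) (pulsing 1 f) (κ v) none) _
              (st-cong e x refl) refl (sym (st-cong {m = false} {p = none} {q = none} e refl refl)) (λ u → sym (O₄-notX v u x))
      ... | inX e x = fromCase S₃ O₃ S₄ O₄ v (mkSt (L₃ v) idle (κ v) (hold 0 w (val o (σ v)))) _
              (st-cong e x refl) refl (sym (st-cong {m = false} {p = none} {q = none} e refl refl))
              (λ u → trans (cong (λ z → if eqᵇ u w then just (mkM (p4 z) (inf (L₃ v))) else nothing) tot≡)
                (sym (cong (λ z → if z ∧ eqᵇ u w then just (mkM (p4 (tot v)) (inf (L₃ v))) else nothing) x)))
        where
        tot≡ : total (L₃ v) (val o (σ v)) (grab getUp (to O₃ v)) ≡ tot v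
        tot≡ = cong squash (agg-cong (λ u → cong (λ z → if eqᵇ u (me (L₃ v)) then just (val o (σ v)) else z) (grab-to getUp O₃ v u)))
      ... | else e x = fromCase S₃ O₃ S₄ O₄ v (mkSt (L₃ v) idle (κ v) none) _
              (st-cong {x = pulsing 1 f} {y = idle} {p = hold 0 w (val o (σ v))} {q = none} e x refl)
              (idle-merge (L₃ v) (κ v) (to O₃ v) (O₃-only getP1 (λ _ _ _ → refl) v) (O₃-only getP2 (λ _ _ _ → refl) v)
                (O₃-only getCall (λ _ _ _ → refl) v) (O₃-only getRet (λ _ _ _ → refl) v))
              (sym (st-cong {m = false} {x = pulsing 0 f} {p = none} {q = none} e refl refl)) (λ u → sym (O₄-notX v u x))

      round₄ : ∀ v → Step S₄ O₄ S₅ noMail v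
      round₄ v = go (eqᵇ v w) refl
        where
        go : ∀ c → eqᵇ v w ≡ c → Step S₄ O₄ S₅ noMail v
        go true e = fromCase S₄ O₄ S₅ noMail v (mkSt (L₄ v) (pulsing 0 f) (κ v) none) _
          (cong (λ c → mkSt (L₄ v) (if c then pulsing 0 f else idle) (κ v) none) e) refl
          (trans (cong (λ z → mkSt (after v) (exec (f z)) (κ v) none) (agg-cong (λ u → trans (grab-to getP4 O₄ v u) (cong (λ z → O₄ u z >>=ᴹ getP4) (eqᵇ⇒≡ {a = v} {w} e)))))
            (cong (λ c → mkSt (after v) (if c then exec (f answer) else idle) (κ v) none) (sym e))) (λ u → refl)
        go false e = fromCase S₄ O₄ S₅ noMail v (mkSt (L₄ v) idle (κ v) none) _
          (cong (λ c → mkSt (L₄ v) (if c then pulsing 0 f else idle) (κ v) none) e)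
          (idle-merge (L₄ v) (κ v) (to O₄ v) (gr getP1) (gr getP2) (gr getCall) (gr getRet))
          (cong (λ c → mkSt (after v) (if c then exec (f answer) else idle) (κ v) none) (sym e)) (λ u → refl)
          where
          gr : ∀ {A : Set} (g : M → Maybe A) u → grab g (to O₄ v) u ≡ nothing
          gr g u = trans (grab-to g O₄ v u) (cong (_>>=ᴹ g) (if-false (trans (cong (isX u ∧_) e) (∧-zeroʳ _))))

      is-just-if : ∀ {A : Set} c {x : A} → is-just (if c then just x else nothing) ≡ true → c ≡ true
      is-just-if true h = refl

      nbr-L₂ : ∀ u → nbr (L₂ u) ≡ nbr (σ u)
      nbr-L₂ u = trans (if-app nbr (isX u)) (go (isX u))
        where
        go : ∀ c → (if c then nbr (setInf (act o (σ u)) (σ u)) else nbr (σ u)) ≡ nbr (σ u)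
        go true  = refl
        go false = refl

      X-edge : ∀ v → isX v ≡ true → G w v ≡ true
      X-edge v e = nbr⊆ w v (∧-trueˡ (∧-trueˡ {nbr (σ w) v ∧ _} e))

      G₁ : ∀ u v → is-just (O₁ u v) ≡ true → G u v ≡ true
      G₁ u v h = subst (λ z → G z v ≡ true) (sym (eqᵇ⇒≡ (∧-trueˡ (is-just-if _ h)))) (X-edge v (∧-trueʳ {eqᵇ u w} (is-just-if _ h)))

      G₂ : ∀ u v → is-just (O₂ u v) ≡ true → G u v ≡ true
      G₂ u v h = nbr⊆ u v (∧-trueˡ (∧-trueˡ {heavyNbr (σ u) v} (∧-trueʳ {deep o} (∧-trueʳ {isX u} (is-just-if _ h)))))

      par-sender : ∀ u {x o′} → parY u ≡ just (x , o′) → is-just (O₂ x u) ≡ true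
      par-sender u {x} {o′} h = go (isX u ∨ eqᵇ u w) h
        where
        j : ∀ (m : Maybe M) → (m >>=ᴹ getP2) ≡ just o′ → is-just m ≡ true
        j (just m) _ = refl
        go : ∀ c → (if c then nothing else firstJ (λ u′ → O₂ u′ u >>=ᴹ getP2)) ≡ just (x , o′) → is-just (O₂ x u) ≡ true
        go false h = j (O₂ x u) (firstJ-just _ h)

      G₃ : ∀ u v → is-just (O₃ u v) ≡ true → G u v ≡ true
      G₃ u v h = go (parY u) refl h
        where
        go : ∀ r → parY u ≡ r → is-just (outY r (L₂ u) v) ≡ true → G u v ≡ true
        go (just (x , o′)) e h = ∨-elim {eqᵇ v x} (is-just-if _ h)
          (λ v≡x → subst (λ z → G u z ≡ true) (sym (eqᵇ⇒≡ v≡x)) (trans (G-sym u x) (G₂ x u (par-sender u e))))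
          (λ a → nbr⊆ u v (trans (cong (λ g → g v) (sym (nbr-L₂ u))) (∧-trueˡ (∧-trueˡ {heavyNbr (L₂ u) v} (∧-trueʳ {ann o′} a)))))

      G₄ : ∀ u v → is-just (O₄ u v) ≡ true → G u v ≡ true
      G₄ u v h = subst (λ z → G u z ≡ true) (sym (eqᵇ⇒≡ (∧-trueʳ {isX u} (is-just-if _ h)))) (trans (G-sym u w) (X-edge u (∧-trueˡ (is-just-if _ h))))

      awake-root : ∀ {l x k m} → inert (mkSt l x k m) ≡ false → ∀ v → v ≡ w → inert (mkSt l (if eqᵇ v w then x else idle) k m) ≡ false
      awake-root h v refl = trans (cong (λ c → inert (mkSt _ (if c then _ else idle) _ _)) (eqᵇ-refl w)) h

      pulse-rounds : ∀ {c} → Rep c (conf w (exec (pulse o f)) σ κ) noMail → Adv G c 5 pulseMsgs (conf w (exec (f answer)) after κ) noMail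
      pulse-rounds {c} R = subst (λ z → Adv G c 5 z S₅ noMail) (assoc (mailCount O₁) (mailCount O₂) (mailCount O₃) (mailCount O₄))
        (adv-trans (vnext (conf w (exec (pulse o f)) σ κ) noMail R S₁ O₁ (λ v → cong proj₁ (proj₁ (round₀ v))) (λ v → proj₂ (round₀ v)) G₁ (inj₁ (w , awake-root {x = pulsing 3 f} refl w refl))) λ R₁ →
        adv-trans (vnext S₁ O₁ R₁ S₂ O₂ (λ v → proj₁ (round₁ v)) (λ v → proj₂ (round₁ v)) G₂ (inj₁ (w , awake-root {x = pulsing 2 f} refl w refl))) λ R₂ →
        adv-trans (vnext S₂ O₂ R₂ S₃ O₃ (λ v → proj₁ (round₂ v)) (λ v → proj₂ (round₂ v)) G₃ (inj₁ (w , awake-root {x = pulsing 1 f} refl w refl))) λ R₃ →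
        adv-trans (vnext S₃ O₃ R₃ S₄ O₄ (λ v → proj₁ (round₃ v)) (λ v → proj₂ (round₃ v)) G₄ (inj₁ (w , awake-root {x = pulsing 0 f} refl w refl))) λ R₄ →
        vnext₀ S₄ O₄ R₄ S₅ (λ v → proj₁ (round₄ v)) (λ v → proj₂ (round₄ v)) (w , awake-root {x = exec (f answer)} refl w refl))
        where
        assoc : ∀ a b c d → a + (b + (c + (d + 0))) ≡ ((a + b) + c) + d
        assoc = solve-∀

    -- Calls and returns, and the simulation of whole programs

    push : V → Frame → (V → List Frame) → V → List Frame
    push w x κ v = if eqᵇ v w then x ∷ κ v else κ v

    conf-self : ∀ w x σ κ → conf w x σ κ w ≡ mkSt (σ w) x (κ w) none
    conf-self w x σ κ = cong (λ c → mkSt (σ w) (if c then x else idle) (κ w) none) (eqᵇ-refl w)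

    conf-other : ∀ {w v} x σ κ → v ≢ w → conf w x σ κ v ≡ mkSt (σ v) idle (κ v) none
    conf-other {w} {v} x σ κ p = cong (λ c → mkSt (σ v) (if c then x else idle) (κ v) none) (eqᵇ-≢ p)

    module CallRounds (G : Graph n) (G-sym : ∀ u v → G u v ≡ G v u) {w z : V} (w≢z : w ≢ z) (edge : G w z ≡ true) where

      mail : V → V → Kind → Info → Mail
      mail a d k i u v = if eqᵇ u a then (if eqᵇ v d then just (mkM k i) else nothing) else nothing

      mail-only : ∀ a d k i → (∀ u v → is-just (mail a d k i u v) ≡ true → u ≡ a × v ≡ d)
      mail-only a d k i u v h with u ≟ a | v ≟ d
      ... | yes p | yes q = p , q

      mail-one : ∀ a d k i → mail a d k i a d ≡ just (mkM k i)
      mail-one a d k i = trans (if-eq a) (if-eq d)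

      mail-other : ∀ a d k i u v → v ≢ d → mail a d k i u v ≡ nothing
      mail-other a d k i u v p with u ≟ a
      ... | yes _ = if-false (eqᵇ-≢ p)
      ... | no _  = refl

      mail-other′ : ∀ a d k i u v → u ≢ a → mail a d k i u v ≡ nothing
      mail-other′ a d k i u v p = if-false (eqᵇ-≢ p)

      mailCount-mail : ∀ a d k i → mailCount (mail a d k i) ≤ 1
      mailCount-mail a d k i = ≤-trans (∑-mono (λ u → row u)) (count-eq≤1 a)
        where
        cell : ∀ v → b2n (is-just (if eqᵇ v d then just (mkM k i) else nothing)) ≤ b2n (eqᵇ v d)
        cell v with v ≟ d
        ... | yes _ = ≤-refl
        ... | no _  = ≤-refl
        row : ∀ u → count (λ v → is-just (mail a d k i u v)) ≤ b2n (eqᵇ u a)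
        row u with u ≟ a
        ... | yes _ = ≤-trans (∑-mono cell) (count-eq≤1 d)
        ... | no _  = ≤-reflexive (∑-zero {n} (λ _ → refl))

      mail-G : ∀ a d k i → G a d ≡ true → ∀ u v → is-just (mail a d k i u v) ≡ true → G u v ≡ true
      mail-G a d k i g u v h with mail-only a d k i u v h
      ... | refl , refl = g

      learn-mail : ∀ a d k i l → mg (to (mail a d k i) d) l ≡ learn a i l
      learn-mail a d k i l = cong (λ t → record l { tab = t }) (tabulate-cong (λ u →
        trans (cong (maybe info (tb l u)) (trans (lookup-to (mail a d k i) d u) (inner u))) (same u)))
        where
        inner : ∀ u → mail a d k i u d ≡ (if eqᵇ u a then just (mkM k i) else nothing)
        inner u with u ≟ a
        ... | yes _ = if-eq d
        ... | no _  = refl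
        same : ∀ u → maybe info (tb l u) (if eqᵇ u a then just (mkM k i) else nothing)
          ≡ maybe info (tb l u) (lookup (tabulate (λ x → if eqᵇ x a then just (mkM retK i) else nothing)) u)
        same u = trans (flip-kind (eqᵇ u a)) (cong (maybe info (tb l u)) (sym (lookup∘tabulate (λ x → if eqᵇ x a then just (mkM retK i) else nothing) u)))
          where
          flip-kind : ∀ c → maybe info (tb l u) (if c then just (mkM k i) else nothing) ≡ maybe info (tb l u) (if c then just (mkM retK i) else nothing)
          flip-kind true  = refl
          flip-kind false = refl

      send : ∀ {c a d x k} (σ : V → Loc) (κ K : V → List Frame) → G a d ≡ true → Rep c (conf a x σ κ) noMail →
        (vstep (mkSt (σ a) x (κ a) none) (to noMail a) ≡ (mkSt (σ a) idle (K a) none , sendTo d k (σ a))) → (∀ v → v ≢ a → K v ≡ κ v) →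
        Adv G c 1 (mailCount (mail a d k (inf (σ a)))) (λ v → mkSt (σ v) idle (K v) none) (mail a d k (inf (σ a)))
      send {a = a} {d} {x} {k} σ κ K g R e hK =
        vnext (conf a x σ κ) noMail R (λ v → mkSt (σ v) idle (K v) none) (mail a d k (inf (σ a))) (λ v → proj₁ (all′ v (v ≟ a))) (λ v → proj₂ (all′ v (v ≟ a)))
          (mail-G a d k (inf (σ a)) g) (inj₂ (a , d , cong is-just (mail-one a d k (inf (σ a)))))
        where
        all′ : ∀ v → Dec (v ≡ a) → proj₁ (vstep (conf a x σ κ v) (to noMail v)) ≡ mkSt (σ v) idle (K v) none
          × (∀ u → proj₂ (vstep (conf a x σ κ v) (to noMail v)) u ≡ mail a d k (inf (σ a)) v u)
        all′ v (yes refl) = cong proj₁ eq , λ u → trans (cong (λ p → proj₂ p u) eq) (sym (if-eq a))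
          where
          eq : vstep (conf a x σ κ a) (to noMail a) ≡ (mkSt (σ a) idle (K a) none , sendTo d k (σ a))
          eq = trans (cong (λ s → vstep s (to noMail a)) (conf-self a x σ κ)) e
        all′ v (no p) = trans (cong proj₁ eq) (cong (λ q → mkSt (σ v) idle q none) (sym (hK v p))) ,
                        λ u → trans (cong (λ p → proj₂ p u) eq) (sym (mail-other′ a d k (inf (σ a)) v u p))
          where
          eq : vstep (conf a x σ κ v) (to noMail v) ≡ (mkSt (σ v) idle (κ v) none , silent)
          eq = trans (cong (λ s → vstep s (to noMail v)) (conf-other x σ κ p)) (inert-step (mkSt (σ v) idle (κ v) none) (to noMail v) refl (lookup-to noMail v))

      receive : ∀ {c a d k x} i (σ : V → Loc) (κ K : V → List Frame) → Rep c (λ v → mkSt (σ v) idle (κ v) none) (mail a d k i) →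
        (vstep (mkSt (σ d) idle (κ d) none) (to (mail a d k i) d) ≡ (mkSt (learn a i (σ d)) (exec x) (K d) none , silent)) → (∀ v → v ≢ d → K v ≡ κ v) →
        Adv G c 1 0 (conf d (exec x) (setL d (learn a i (σ d)) σ) K) noMail
      receive {a = a} {d} {k} {x} i σ κ K R e hK =
        vnext₀ (λ v → mkSt (σ v) idle (κ v) none) (mail a d k i) R (conf d (exec x) σ₁ K) (λ v → proj₁ (all′ v (v ≟ d))) (λ v → proj₂ (all′ v (v ≟ d)))
          (d , cong inert (conf-self d (exec x) σ₁ K))
        where
        σ₁ : V → Loc
        σ₁ = setL d (learn a i (σ d)) σ
        all′ : ∀ v → Dec (v ≡ d) → proj₁ (vstep (mkSt (σ v) idle (κ v) none) (to (mail a d k i) v)) ≡ conf d (exec x) σ₁ K v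
          × (∀ u → proj₂ (vstep (mkSt (σ v) idle (κ v) none) (to (mail a d k i) v)) u ≡ nothing)
        all′ v (yes refl) = trans (cong proj₁ e) (sym (trans (conf-self d (exec x) σ₁ K) (cong (λ l → mkSt l (exec x) (K d) none) (if-eq d)))) , λ u → cong (λ p → proj₂ p u) e
        all′ v (no p) = trans (cong proj₁ eq) (sym (trans (conf-other (exec x) σ₁ K p) (cong₂ (λ l q → mkSt l idle q none) (if-false (eqᵇ-≢ p)) (hK v p)))) , λ u → cong (λ p → proj₂ p u) eq
          where
          eq : vstep (mkSt (σ v) idle (κ v) none) (to (mail a d k i) v) ≡ (mkSt (σ v) idle (κ v) none , silent)
          eq = inert-step (mkSt (σ v) idle (κ v) none) (to (mail a d k i) v) refl (λ u → trans (lookup-to (mail a d k i) v u) (mail-other a d k i u v p))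

      grab-mail : ∀ {A : Set} (g : M → Maybe A) a d k i → (g (mkM k i) ≡ nothing) → ∀ u → grab g (to (mail a d k i) d) u ≡ nothing
      grab-mail g a d k i h u = trans (grab-to g (mail a d k i) d u) (go (eqᵇ u a) (eqᵇ d d))
        where
        go : ∀ p q → ((if p then (if q then just (mkM k i) else nothing) else nothing) >>=ᴹ g) ≡ nothing
        go true  true  = h
        go true  false = refl
        go false q     = refl

      step-call : ∀ a d c i l k → vstep (mkSt l idle k none) (to (mail a d (callK c) i) d) ≡ (mkSt (learn a i l) (exec (code c)) (ret a ∷ k) none , silent)
      step-call a d c i l k = trans (dispatch-cong l k (to (mail a d (callK c) i) d) {a′ = nothing} {b′ = nothing} {c′ = just (a , c)}
          (firstJ-none _ (grab-mail getP1 a d (callK c) i refl)) (firstJ-none _ (grab-mail getP2 a d (callK c) i refl))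
          (firstJ-unique _ a c (trans (grab-to getCall (mail a d (callK c) i) d a) (cong (_>>=ᴹ getCall) (mail-one a d (callK c) i)))
            (λ j j≢ → trans (grab-to getCall (mail a d (callK c) i) d j) (cong (_>>=ᴹ getCall) (mail-other′ a d (callK c) i j d j≢)))) refl)
        (cong (λ l → mkSt l (exec (code c)) (ret a ∷ k) none , silent) (learn-mail a d (callK c) i l))

      step-ret : ∀ a d i l p k → vstep (mkSt l idle (res p ∷ k) none) (to (mail a d retK i) d) ≡ (mkSt (learn a i l) (exec p) k none , silent)
      step-ret a d i l p k = trans (dispatch-cong l (res p ∷ k) (to (mail a d retK i) d) {a′ = nothing} {b′ = nothing} {c′ = nothing} {d′ = just (a , tt)}
          (firstJ-none _ (grab-mail getP1 a d retK i refl)) (firstJ-none _ (grab-mail getP2 a d retK i refl)) (firstJ-none _ (grab-mail getCall a d retK i refl))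
          (firstJ-unique _ a tt (trans (grab-to getRet (mail a d retK i) d a) (cong (_>>=ᴹ getRet) (mail-one a d retK i)))
            (λ j j≢ → trans (grab-to getRet (mail a d retK i) d j) (cong (_>>=ᴹ getRet) (mail-other′ a d retK i j d j≢)))))
        (cong (λ l → mkSt l (exec p) k none , silent) (learn-mail a d retK i l))

    module _ {G : Graph n} (G-sym : ∀ u v → G u v ≡ G v u) {μ : ℕ} (1≤μ : 1 ≤ μ) where

      record Ends (c : Config) (t : ℕ) (S : V → State) : Set where
        constructor ends
        field
          {msg} : ℕ
          cost  : msg ≤ t * μ
          track : Adv G c t msg S noMail

      ends-trans : ∀ {c r k S S′ t} → Adv G c r k S noMail → k ≤ r * μ → (∀ {c₁} → Rep c₁ S noMail → Ends c₁ t S′) → Ends c (r + t) S′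
      ends-trans {r = r} {t = t} p q f = ends (≤-trans (+-mono-≤ q (Ends.cost (f (repr p)))) (≤-reflexive (sym (*-distribʳ-+ μ r t))))
        (adv (reach-trans (path p) (path (Ends.track (f (repr p))))) (repr (Ends.track (f (repr p)))))

      ends-seq : ∀ {c t S t′ S′} → Ends c t S → (∀ {c₁} → Rep c₁ S noMail → Ends c₁ t′ S′) → Ends c (t + t′) S′
      ends-seq (ends q p) f = ends-trans p q f

      one : ∀ {w x y} σ σ₁ κ κ₁ {c} → Rep c (conf w (exec x) σ κ) noMail →
        (vstep (mkSt (σ w) (exec x) (κ w) none) (to noMail w) ≡ (mkSt (σ₁ w) (exec y) (κ₁ w) none , silent)) →
        (∀ v → v ≢ w → σ₁ v ≡ σ v × κ₁ v ≡ κ v) → Adv G c 1 0 (conf w (exec y) σ₁ κ₁) noMail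
      one {w} {x} {y} σ σ₁ κ κ₁ {c} R e h =
        vnext₀ (conf w (exec x) σ κ) noMail R (conf w (exec y) σ₁ κ₁) (λ v → cong proj₁ (all′ v (v ≟ w))) (λ u v → cong (λ p → proj₂ p v) (all′ u (u ≟ w)))
          (w , cong inert (conf-self w (exec y) σ₁ κ₁))
        where
        all′ : ∀ v → Dec (v ≡ w) → vstep (conf w (exec x) σ κ v) (to noMail v) ≡ (conf w (exec y) σ₁ κ₁ v , silent)
        all′ v (yes refl) = trans (cong (λ s → vstep s (to noMail w)) (conf-self w (exec x) σ κ)) (trans e (cong (_, silent) (sym (conf-self w (exec y) σ₁ κ₁))))
        all′ v (no p) = trans (cong (λ s → vstep s (to noMail v)) (conf-other (exec x) σ κ p))
          (trans (inert-step (mkSt (σ v) idle (κ v) none) (to noMail v) refl (lookup-to noMail v))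
            (cong (_, silent) (sym (trans (conf-other (exec y) σ₁ κ₁ p) (cong₂ (λ a b → mkSt a idle b none) (proj₁ (h v p)) (proj₂ (h v p)))))))

      push-self : ∀ w x κ → push w x κ w ≡ x ∷ κ w
      push-self w x κ = if-eq w

      push-other : ∀ {w v} x κ → v ≢ w → push w x κ v ≡ κ v
      push-other x κ p = if-false (eqᵇ-≢ p)

      -- Induction on the run. The stacks `κ` are arbitrary because a called program runs on top of
      -- the frames of its callers. A call and its return take two rounds each, one for sending and
      -- one for receiving.
      simulate : ∀ {w p σ t σ′} → Run G μ w p σ t σ′ → ∀ κ {c} → Rep c (conf w (exec p) σ κ) noMail → Ends c t (conf w (exec halt) σ′ κ)
      simulate halt κ R = ends z≤n (adv here R)
      simulate {w} {σ = σ} (upd {f} r) κ R = ends-trans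
        (one σ (setL w (f (σ w)) σ) κ κ R (cong (λ l → mkSt l _ (κ w) none , silent) (sym (if-eq w))) (λ v p → if-false (eqᵇ-≢ p) , refl)) z≤n (simulate r κ)
      simulate {w} {σ = σ} (ask r) κ R = ends-trans (one σ σ κ κ R refl (λ v p → refl , refl)) z≤n (simulate r κ)
      simulate {w} {σ = σ} (goto r) κ R = ends-trans (one σ σ κ κ R refl (λ v p → refl , refl)) z≤n (simulate r κ)
      simulate {w} {σ = σ} (sub {c} {p} {σ₁ = σ₁} r₁ r₂) κ R = ends-seq
        (ends-trans (one σ σ κ (push w (res p) κ) R (cong (λ k → mkSt (σ w) (exec (code c)) k none , silent) (sym (push-self w (res p) κ))) (λ v q → refl , push-other (res p) κ q)) z≤n
          (simulate r₁ (push w (res p) κ)))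
        (λ R₁ → ends-trans (one σ₁ σ₁ (push w (res p) κ) κ R₁ (cong (haltStep (σ₁ w)) (push-self w (res p) κ)) (λ v q → refl , sym (push-other (res p) κ q))) z≤n (simulate r₂ κ))
      simulate {w} {σ = σ} (call {z} {c} {p} {t₁ = t₁} {σ₁} {t₂} w≢z g r₁ r₂) κ R = ends-seq
        (ends-trans (adv-trans (send σ κ κ₁ g R (cong (λ k → mkSt (σ w) idle k none , sendTo z (callK c) (σ w)) (sym (push-self w (res p) κ))) (λ v q → push-other (res p) κ q))
            (λ R₁ → receive (inf (σ w)) σ κ₁ κ₂ R₁ (trans (step-call w z c (inf (σ w)) (σ z) (κ₁ z)) (cong (λ k → mkSt (learn w (inf (σ w)) (σ z)) (exec (code c)) k none , silent) (sym (push-self z (ret w) κ₁))))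
              (λ v q → push-other (ret w) κ₁ q)))
          (fit w z (callK c) (inf (σ w)))
          (simulate r₁ κ₂))
        (λ R₂ → ends-trans (adv-trans (send σ₁ κ₂ κ₁ (trans (G-sym z w) g) R₂ (trans (cong (haltStep (σ₁ z)) (push-self z (ret w) κ₁)) refl) (λ v q → sym (push-other (ret w) κ₁ q)))
            (λ R₃ → receive (inf (σ₁ z)) σ₁ κ₁ κ R₃ (trans (cong (λ k → vstep (mkSt (σ₁ w) idle k none) (to (mail z w retK (inf (σ₁ z))) w)) (push-self w (res p) κ)) (step-ret z w (inf (σ₁ z)) (σ₁ w) p (κ w)))
              (λ v q → sym (push-other (res p) κ q))))
          (fit z w retK (inf (σ₁ z)))
          (simulate r₂ κ))
        where
        open CallRounds G G-sym w≢z g using (mail; mailCount-mail; receive; send; step-call; step-ret)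
        κ₁ κ₂ : V → List Frame
        κ₁ = push w (res p) κ
        κ₂ = push z (ret w) κ₁
        fit : ∀ a d k i → mailCount (mail a d k i) + 0 ≤ 2 * μ
        fit a d k i = ≤-trans (≤-reflexive (+-identityʳ _)) (≤-trans (mailCount-mail a d k i) (≤-trans 1≤μ (m≤m+n μ _)))
      simulate {w} {σ = σ} (pulse {o} {f} me≡ nbr⊆ h r) κ R = ends-trans (pulse-rounds R) h (simulate r κ)
        where open PulseRounds G G-sym σ w o f κ me≡ nbr⊆ using (pulse-rounds)

    atRest : (V → Loc) → V → State
    atRest σ v = mkSt (σ v) idle [] none

    record Stops (G : Graph n) (c : Config) (t m : ℕ) (σ′ : V → Loc) : Set where
      field
        {s′}  : V → State
        run≡  : runUpdate t G c ≡ just (s′ , t , m)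
        rests : ∀ v → s′ v ≡ atRest σ′ v

    stop : ∀ {G c σ w} x → Rep c (conf w x σ (λ _ → [])) noMail →
      (∀ v → vstep (conf w x σ (λ _ → []) v) (to noMail v) ≡ (atRest σ v , silent)) → Stops G c 1 0 σ
    stop {G} {c} {σ} {w} x R h = record
      { run≡ = trans (runUpdate-end {G} {c} (cong (λ q → O.c′ , proj₁ (proj₂ (round G c)) , q) (O.finished mailCount-noMail (λ _ → refl)))) (cong (λ m → just (Exec.Config.states O.c′ , 1 , m)) (trans O.cnt≡ mailCount-noMail))
      ; rests = Rep.st O.rep }
      where
      module O = OneRound G c (conf w x σ (λ _ → [])) noMail R (atRest σ) noMail (λ v → cong proj₁ (h v)) (λ u v → cong (λ p → proj₂ p v) (h u)) (λ u v ()) using (cnt≡; c′; finished; rep)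

    -- The additional round executes `halt` on an empty stack; it sends nothing and leaves all
    -- vertices inert, by which the model detects the end of the update.
    complete : ∀ {G} → (∀ u v → G u v ≡ G v u) → ∀ {μ} → 1 ≤ μ → ∀ {w p σ t σ′ c} → Run G μ w p σ t σ′ → Rep c (conf w (exec p) σ (λ _ → [])) noMail →
      ∃ λ m → m ≤ t * μ × Stops G c (t + 1) m σ′
    complete {G} G-sym 1≤μ {w} {t = t} {σ′} {c} r R with simulate G-sym 1≤μ r (λ _ → []) R
    ... | ends {m} cost (adv p R′) = m + 0 , ≤-trans (≤-reflexive (+-identityʳ m)) cost , record { run≡ = reach-run p (Stops.run≡ last) ; rests = Stops.rests last }
      where
      halted : ∀ v → Dec (v ≡ w) → vstep (conf w (exec halt) σ′ (λ _ → []) v) (to noMail v) ≡ (atRest σ′ v , silent)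
      halted v (yes refl) = cong (λ s → vstep s (to noMail v)) (conf-self v (exec halt) σ′ (λ _ → []))
      halted v (no q) = trans (cong (λ s → vstep s (to noMail v)) (conf-other (exec halt) σ′ (λ _ → []) q)) (inert-step (atRest σ′ v) (to noMail v) refl (lookup-to noMail v))
      last : Stops G _ 1 0 σ′
      last = stop {G} {w = w} (exec halt) R′ (λ v → halted v (v ≟ w))

    nothing-to-do : ∀ {G c σ} (w : V) → Rep c (atRest σ) noMail → Stops G c 1 0 σ
    nothing-to-do {G} {c} {σ} w R = stop {G} {w = w} idle (rep-cong (λ v → same v (v ≟ w)) R) (λ v → trans (cong (λ s → vstep s (to noMail v)) (sym (same v (v ≟ w)))) (inert-step (atRest σ v) (to noMail v) refl (lookup-to noMail v)))
      where
      same : ∀ v → Dec (v ≡ w) → atRest σ v ≡ conf w idle σ (λ _ → []) v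
      same v (yes refl) = sym (conf-self v idle σ (λ _ → []))
      same v (no q) = sym (conf-other idle σ (λ _ → []) q)
      rep-cong : ∀ {c S S′ O} → (∀ v → S v ≡ S′ v) → Rep c S O → Rep c S′ O
      rep-cong h R = record { st = λ v → trans (Rep.st R v) (h v) ; ib = Rep.ib R ; aw = λ v e → Rep.aw R v (trans (cong inert (h v)) e) }

    -- Sequences of updates

    module Dynamic (ρ : ℕ) (1≤ρ : 1 ≤ ρ) where

      record Calm (G : Graph n) (hE : ∑ (λ v → count (G v)) ≤ 2 * ρ ^ 3) (s : V → State) (g : Glob n) : Set where
        open On ρ 1≤ρ G hE using (Indep; Inv; NoUD; VG)
        field
          {σ}   : V → Loc
          rest  : ∀ v → s v ≡ atRest σ v
          view  : VG g σ
          inv   : Inv g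
          ind   : Indep g
          clean : NoUD g
          free  : ∀ v → Pn g v ≡ false
          N≡G   : ∀ u v → Nb g u v ≡ G u v

      module _ {G : Graph n} {hE : ∑ (λ v → count (G v)) ≤ 2 * ρ ^ 3} {s : V → State} {g : Glob n} (calm : Calm G hE s g) where
        open Calm calm
        module Cur = On ρ 1≤ρ G hE using (Inv)

        calm-sym : ∀ u v → G u v ≡ G v u
        calm-sym u v = trans (sym (N≡G u v)) (trans (Cur.Inv.N-sym inv u v) (N≡G v u))

        calm-irr : ∀ u → G u u ≡ false
        calm-irr u = trans (sym (N≡G u u)) (Cur.Inv.N-irr inv u)

        -- Both tests of domination yield a neighbour in the set, which blocks any independent
        -- superset; maximality needs no distinction between light and heavy.
        calm-MIS : IsMIS G (λ v → inn (inf (loc (s v))))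
        calm-MIS = (λ u v e su → ¬true⇒false λ sv → ind u v (trans (N≡G u v) e) (trans (sym (in≡ u)) su) (trans (sym (in≡ v)) sv)) ,
          λ T indT S⊆T v tv → ¬false⇒true λ sv → blocked T indT S⊆T v tv (Hv g v) refl (¬false⇒true λ d → true≢false (D.UD-intro (trans (sym (in≡ v)) sv) d) (clean v))
          where
          module D = Domination (Nb g) (Hv g) using (UD-intro; dom)
          in≡ : ∀ v → inn (inf (loc (s v))) ≡ In g v
          in≡ v = trans (cong (inn ∘ inf ∘ loc) (rest v)) (View.i≡ view v)
          blocked : ∀ T → Independent G T → (∀ v → inn (inf (loc (s v))) ≡ true → T v ≡ true) → ∀ v → T v ≡ true → ∀ h → Hv g v ≡ h → D.dom (In g) v ≡ true → ⊥
          blocked T indT S⊆T v tv true h d = let (u , p) = anyF-elim _ (trans (sym (if-true h)) d) in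
            true≢false (S⊆T u (trans (in≡ u) (∧-trueʳ {Nb g v u} p))) (indT v u (trans (sym (N≡G v u)) (∧-trueˡ {Nb g v u} p)) tv)
          blocked T indT S⊆T v tv false h d = let (u , p) = anyF-elim _ (trans (sym (if-false h)) d) in
            true≢false (S⊆T u (trans (in≡ u) (∧-trueˡ {In g u} (∧-trueʳ {Nb g v u} p)))) (indT v u (trans (sym (N≡G v u)) (∧-trueˡ {Nb g v u} p)) tv)

        Inv-on : ∀ {G′ hE′} → (∀ u v → G u v ≡ true → G′ u v ≡ true) → On.Inv ρ 1≤ρ G′ hE′ g
        Inv-on h = record { N-sym = N-sym ; N-irr = N-irr ; N⊆G = λ u v e → h u v (trans (sym (N≡G u v)) e) ; light = light ; heavy = heavy ; pins = pins }
          where open Cur.Inv inv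

      calm-start : (hE : ∑ {n} (λ v → count (emptyGraph {n} v)) ≤ 2 * ρ ^ 3) → Calm emptyGraph hE start (glob emptyGraph (λ _ → false) (λ _ → false) (λ _ → true))
      calm-start hE = record
        { σ = λ v → loc (start v) ; rest = λ _ → refl
        ; view = record { wf = record { me≡ = λ _ → refl ; nbr-sym = λ _ _ → refl ; nbr-irr = λ _ → refl } ; known = λ _ _ () ; n≡ = λ _ _ → refl ; h≡ = λ _ → refl ; p≡ = λ _ → refl ; i≡ = λ _ → refl ; a≡ = λ _ → refl }
        ; inv = record { N-sym = λ _ _ → refl ; N-irr = λ _ → refl ; N⊆G = λ _ _ e → e ; light = λ v _ → ≤-trans (≤-reflexive (∑-zero {n} (λ _ → refl))) z≤n ; heavy = λ _ () ; pins = ≤-trans (≤-reflexive (∑-zero {n} (λ _ → refl))) z≤n }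
        ; ind = λ _ _ () ; clean = λ _ → refl ; free = λ _ → refl ; N≡G = λ _ _ → refl }

      module Step {G : Graph n} {hE : ∑ (λ v → count (G v)) ≤ 2 * ρ ^ 3} {s : V → State} {g : Glob n} (calm : Calm G hE s g) where
        open Calm calm

        boot : Update n → Config
        boot x = config (wakeAll s x) (endpoints x) (λ _ _ → nothing)

        record Updated (x : Update n) (hE′ : ∑ (λ v → count (applyUpdate G x v)) ≤ 2 * ρ ^ 3) : Set where
          open On ρ 1≤ρ (applyUpdate G x) hE′ using (C; Ki; Φ; μ)
          field
            {s′} : V → State
            {g′} : Glob n
            {t m} : ℕ
            run≡  : runUpdate t (applyUpdate G x) (boot x) ≡ just (s′ , t , m)
            calm′ : Calm (applyUpdate G x) hE′ s′ g′
            time  : t + C * Φ g′ ≤ suc Ki + C * Φ g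
            mail  : m ≤ t * μ

        boot-rep : ∀ x (S : V → State) → (∀ v → wakeAll s x v ≡ S v) → (∀ v → inert (S v) ≡ false → endpoints x v ≡ true) → Rep (boot x) S noMail
        boot-rep x S h k = record { st = h ; ib = λ _ _ → refl ; aw = k }

        1≤μ : ∀ {G′ hE′} → 1 ≤ On.μ ρ 1≤ρ G′ hE′
        1≤μ = ≤-trans (*-mono-≤ 1≤ρ 1≤ρ) (m≤n*m (ρ * ρ) 11)

        module Insert (u v : V) (u≢v : u ≢ v) (new : G u v ≡ false) (hE′ : ∑ (λ y → count (applyUpdate G (insert u v) y)) ≤ 2 * ρ ^ 3) where
          G′ : Graph n
          G′ = applyUpdate G (insert u v)
          module O = On ρ 1≤ρ G′ hE′ using (C; Does; InsertPost; insert-spec; runsTo; samePair-sym; Φ; μ)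

          G′-sym : ∀ x y → G′ x y ≡ G′ y x
          G′-sym x y = cong₂ _∨_ (O.samePair-sym u v x y) (calm-sym calm x y)

          pair-edge : G′ u v ≡ true
          pair-edge = ∨-introˡ (∨-introˡ (∧-intro (eqᵇ-refl u) (eqᵇ-refl v)))

          me-s : ∀ x → me (loc (s x)) ≡ x
          me-s x = trans (cong (me ∘ loc) (rest x)) (me≡ (View.wf view) x)

          lead : ∀ {x y} → toℕ x < toℕ y → onAdded y (s x) ≡ mkSt (σ x) (exec (insProg x y)) [] none
          lead {x} {y} lt = trans (if-true (<ᵇ-true (subst (_< toℕ y) (cong toℕ (sym (me-s x))) lt))) (cong₂ (λ z i → record z { ctl = exec (insProg i y) }) (rest x) (me-s x))

          follow : ∀ {x y} → toℕ y < toℕ x → onAdded y (s x) ≡ atRest σ x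
          follow {x} {y} lt = trans (if-false (<ᵇ-false (subst (toℕ y ≤_) (cong toℕ (sym (me-s x))) (<⇒≤ lt)))) (rest x)

          woken : ∀ a c → (a ≡ u × c ≡ v) ⊎ (a ≡ v × c ≡ u) → toℕ a < toℕ c → Rep (boot (insert u v)) (conf a (exec (insProg a c)) σ (λ _ → [])) noMail
          woken a c side lt = boot-rep (insert u v) (conf a (exec (insProg a c)) σ (λ _ → [])) (λ x → go x (x ≟ a)) (λ x e → awake′ x e (x ≟ a))
            where
            awake′ : ∀ x → inert (conf a (exec (insProg a c)) σ (λ _ → []) x) ≡ false → Dec (x ≡ a) → endpoints (insert u v) x ≡ true
            awake′ x e (yes refl) = pick side
              where
              pick : (x ≡ u × c ≡ v) ⊎ (x ≡ v × c ≡ u) → eqᵇ x u ∨ eqᵇ x v ≡ true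
              pick (inj₁ (refl , _)) = ∨-introˡ (eqᵇ-refl x)
              pick (inj₂ (refl , _)) = ∨-introʳ {eqᵇ x u} (eqᵇ-refl x)
            awake′ x e (no q) = case trans (sym (cong inert (conf-other (exec (insProg a c)) σ (λ _ → []) q))) e of λ ()
            go : ∀ x → Dec (x ≡ a) → wakeAll s (insert u v) x ≡ conf a (exec (insProg a c)) σ (λ _ → []) x
            go x (yes refl) = trans (at side) (sym (conf-self x (exec (insProg x c)) σ (λ _ → [])))
              where
              at : (x ≡ u × c ≡ v) ⊎ (x ≡ v × c ≡ u) → wakeAll s (insert u v) x ≡ mkSt (σ x) (exec (insProg x c)) [] none
              at (inj₁ (refl , refl)) = trans (if-true (eqᵇ-refl x)) (lead lt)
              at (inj₂ (refl , refl)) = trans (if-false (eqᵇ-≢ (u≢v ∘ sym))) (trans (if-true (eqᵇ-refl x)) (lead lt))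
            go x (no q) = trans (at side (x ≟ c)) (sym (conf-other (exec (insProg a c)) σ (λ _ → []) q))
              where
              at : (a ≡ u × c ≡ v) ⊎ (a ≡ v × c ≡ u) → Dec (x ≡ c) → wakeAll s (insert u v) x ≡ atRest σ x
              at (inj₁ (refl , refl)) (yes refl) = trans (if-false (eqᵇ-≢ (u≢v ∘ sym))) (trans (if-true (eqᵇ-refl x)) (follow lt))
              at (inj₂ (refl , refl)) (yes refl) = trans (if-true (eqᵇ-refl x)) (follow lt)
              at (inj₁ (refl , refl)) (no r) = trans (if-false (eqᵇ-≢ q)) (trans (if-false (eqᵇ-≢ r)) (rest x))
              at (inj₂ (refl , refl)) (no r) = trans (if-false (eqᵇ-≢ r)) (trans (if-false (eqᵇ-≢ q)) (rest x))

          go : ∀ a c → (a ≡ u × c ≡ v) ⊎ (a ≡ v × c ≡ u) → toℕ a < toℕ c → Updated (insert u v) hE′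
          go a c side lt = finish (O.insert-spec view (Inv-on calm (λ x y e → ∨-introʳ {samePair u v x y} e)) ind clean free a≢c far edge G′-sym)
            where
            a≢c : a ≢ c
            a≢c refl = <-irrefl refl lt
            far : Nb g a c ≡ false
            far = trans (N≡G a c) (at side)
              where
              at : (a ≡ u × c ≡ v) ⊎ (a ≡ v × c ≡ u) → G a c ≡ false
              at (inj₁ (refl , refl)) = new
              at (inj₂ (refl , refl)) = trans (calm-sym calm a c) new
            edge : G′ a c ≡ true
            edge = at side
              where
              at : (a ≡ u × c ≡ v) ⊎ (a ≡ v × c ≡ u) → G′ a c ≡ true
              at (inj₁ (refl , refl)) = pair-edge
              at (inj₂ (refl , refl)) = trans (G′-sym a c) pair-edge
            pairs : ∀ x y → samePair a c x y ≡ samePair u v x y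
            pairs x y = at side
              where
              at : (a ≡ u × c ≡ v) ⊎ (a ≡ v × c ≡ u) → samePair a c x y ≡ samePair u v x y
              at (inj₁ (refl , refl)) = refl
              at (inj₂ (refl , refl)) = ∨-comm (eqᵇ x a ∧ eqᵇ y c) _
            finish : O.Does a (insProg a c) σ (O.InsertPost a c g) → Updated (insert u v) hE′
            finish (O.runsTo {t} {σ′} r (g′ , view′ , inv′ , ind′ , clean′ , N′ , free′ , le)) = out (complete G′-sym (1≤μ {G′} {hE′}) r (woken a c side lt))
              where
              out : (∃ λ m → m ≤ t * O.μ × Stops G′ (boot (insert u v)) (t + 1) m σ′) → Updated (insert u v) hE′
              out (m , m≤ , S) = record { run≡ = Stops.run≡ S ; calm′ = record { σ = σ′ ; rest = Stops.rests S ; view = view′ ; inv = inv′ ; ind = ind′ ; clean = clean′ ; free = free′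
                  ; N≡G = λ x y → trans (N′ x y) (cong₂ _∨_ (pairs x y) (N≡G x y)) }
                ; time = ≤-trans (≤-reflexive (cong (_+ O.C * O.Φ g′) (+-comm t 1))) (s≤s le) ; mail = ≤-trans m≤ (*-monoˡ-≤ O.μ (m≤m+n t 1)) }

          updated : Updated (insert u v) hE′
          updated with <-cmp (toℕ u) (toℕ v)
          ... | tri< lt _ _ = go u v (inj₁ (refl , refl)) lt
          ... | tri> _ _ gt = go v u (inj₂ (refl , refl)) gt
          ... | tri≈ _ e _ = ⊥-elim (u≢v (toℕ-injective e))

        module Delete (u v : V) (u≢v : u ≢ v) (hE′ : ∑ (λ y → count (applyUpdate G (delete u v) y)) ≤ 2 * ρ ^ 3) where
          G′ : Graph n
          G′ = applyUpdate G (delete u v)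
          module O = On ρ 1≤ρ G′ hE′ using (A; C; Does; Indep; Inv; Kd; Ki; N≡; P≡; SettlePost; UDg; VG; gind; ginv; gtime; gtr; gview; runsTo; samePair-elim; samePair-sym; settle-spec; ud-back; Φ; μ)
          module I = On.Inv inv

          G′-sym : ∀ x y → G′ x y ≡ G′ y x
          G′-sym x y = cong₂ (λ a c → not a ∧ c) (O.samePair-sym u v x y) (calm-sym calm x y)

          g₁ : Glob n
          g₁ = record g { Nb = λ x y → not (samePair u v x y) ∧ Nb g x y }

          σ₁ : V → Loc
          σ₁ x = if eqᵇ x u then delNbr v (σ x) else if eqᵇ x v then delNbr u (σ x) else σ x

          keep : ∀ {A : Set} (f : Loc → A) → (∀ y l → f (delNbr y l) ≡ f l) → ∀ x → f (σ₁ x) ≡ f (σ x)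
          keep f h x = go (eqᵇ x u) (eqᵇ x v)
            where
            go : ∀ p q → f (if p then delNbr v (σ x) else if q then delNbr u (σ x) else σ x) ≡ f (σ x)
            go true  q     = h v (σ x)
            go false true  = h u (σ x)
            go false false = refl

          nbr₁ : ∀ x y → nbr (σ₁ x) y ≡ not (samePair u v x y) ∧ Nb g x y
          nbr₁ x y = trans (go (eqᵇ x u) refl (eqᵇ x v) refl) (cong (not (samePair u v x y) ∧_) (View.n≡ view x y))
            where
            if-del : ∀ c d → (if c then false else d) ≡ not c ∧ d
            if-del true  d = refl
            if-del false d = refl
            go : ∀ p → eqᵇ x u ≡ p → ∀ q → eqᵇ x v ≡ q → nbr (if p then delNbr v (σ x) else if q then delNbr u (σ x) else σ x) y ≡ not ((p ∧ eqᵇ y v) ∨ (q ∧ eqᵇ y u)) ∧ nbr (σ x) y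
            go true p true q = ⊥-elim (u≢v (trans (sym (eqᵇ⇒≡ {a = x} {u} p)) (eqᵇ⇒≡ {a = x} {v} q)))
            go true p false q = trans (if-del (eqᵇ y v) (nbr (σ x) y)) (cong (λ z → not z ∧ nbr (σ x) y) (sym (∨-identityʳ (eqᵇ y v))))
            go false p true q = if-del (eqᵇ y u) (nbr (σ x) y)
            go false p false q = refl

          sub-edge : ∀ x y → Nb g₁ x y ≡ true → Nb g x y ≡ true
          sub-edge x y e = ∧-trueʳ {not (samePair u v x y)} e

          inf₁ : ∀ x → inf (σ₁ x) ≡ inf (σ x)
          inf₁ = keep inf (λ _ _ → refl)

          view₁ : O.VG g₁ σ₁
          view₁ = record
            { wf = record { me≡ = λ x → trans (keep me (λ _ _ → refl) x) (me≡ wf x) ; nbr-sym = λ x y → trans (nbr₁ x y) (trans (sym₁ x y) (sym (nbr₁ y x)))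
                          ; nbr-irr = λ x → trans (nbr₁ x x) (trans (cong (not (samePair u v x x) ∧_) (I.N-irr x)) (∧-zeroʳ _)) }
            ; known = λ x y e → step x y (known x y (trans (n≡ x y) (sub-edge x y (trans (sym (nbr₁ x y)) e))))
            ; n≡ = nbr₁ ; h≡ = λ x → trans (cong hv (inf₁ x)) (h≡ x) ; p≡ = λ x → trans (keep pin (λ _ _ → refl) x) (p≡ x) ; i≡ = λ x → trans (cong inn (inf₁ x)) (i≡ x) ; a≡ = λ x → trans (cong al (inf₁ x)) (a≡ x) }
            where
            open View view
            sym₁ : ∀ x y → Nb g₁ x y ≡ Nb g₁ y x
            sym₁ x y = cong₂ (λ a c → not a ∧ c) (O.samePair-sym u v x y) (I.N-sym x y)
            step : ∀ x y → Knows σ x y → Knows σ₁ x y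
            step x y k = knows (λ { (inj₁ h) → trans t (trans (full k (inj₁ (trans (cong hv (sym (inf₁ x))) h))) (sym (inf₁ y)))
                                  ; (inj₂ h) → trans t (trans (full k (inj₂ (trans (cong hv (sym (inf₁ y))) h))) (sym (inf₁ y))) })
                               (trans (cong hv t) (trans (flag k) (cong hv (sym (inf₁ y)))))
              where
              t : tb (σ₁ x) y ≡ tb (σ x) y
              t = cong (λ z → lookup z y) (keep tab (λ _ _ → refl) x)

          inv₁ : O.Inv g₁
          inv₁ = record
            { N-sym = λ x y → cong₂ (λ a c → not a ∧ c) (O.samePair-sym u v x y) (I.N-sym x y) ; N-irr = λ x → trans (cong (not (samePair u v x x) ∧_) (I.N-irr x)) (∧-zeroʳ _)
            ; N⊆G = λ x y e → trans (cong (not (samePair u v x y) ∧_) (sym (N≡G x y))) e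
            ; light = λ x h → ≤-trans (count-mono (sub-edge x)) (I.light x h)
            ; heavy = λ x h → ≤-trans (count-mono (λ y e → ∧-intro (sub-edge x y (∧-trueˡ {Nb g₁ x y} e)) (∧-trueʳ {Nb g₁ x y} e))) (I.heavy x h) ; pins = I.pins }

          ind₁ : O.Indep g₁
          ind₁ x y e = ind x y (sub-edge x y e)

          -- A vertex that was clean before the deletion has lost a dominator, which can only be the
          -- other end of the deleted edge.
          lost : ∀ x → O.UDg g₁ x ≡ true → (x ≡ u × In g v ≡ true) ⊎ (x ≡ v × In g u ≡ true)
          lost x e = go (Hv g x) refl (¬false⇒true λ d → true≢false (D.UD-intro (D₁.UD-in {In g} {x} e) d) (clean x))
            where
            module D = Domination (Nb g) (Hv g) using (UD-intro; dom)
            module D₁ = Domination (Nb g₁) (Hv g) using (UD-dom; UD-in; dom-heavy; dom-light)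
            pair : ∀ y → In g y ≡ true → samePair u v x y ≡ true → (x ≡ u × In g v ≡ true) ⊎ (x ≡ v × In g u ≡ true)
            pair y i s = O.samePair-elim {u} {v} {x} {y} s (λ p q → inj₁ (p , trans (cong (In g) (sym q)) i)) (λ p q → inj₂ (p , trans (cong (In g) (sym q)) i))
            go : ∀ h → Hv g x ≡ h → D.dom (In g) x ≡ true → (x ≡ u × In g v ≡ true) ⊎ (x ≡ v × In g u ≡ true)
            go true h d = let (y , p) = anyF-elim _ (trans (sym (if-true h)) d) ; i = ∧-trueʳ {Nb g x y} p in
              boolCase (samePair u v x y) (pair y i) (λ s → true≢false (D₁.dom-heavy h y (∧-intro (not-false s) (∧-trueˡ {Nb g x y} p)) i) (D₁.UD-dom {In g} {x} e))
            go false h d = let (y , p) = anyF-elim _ (trans (sym (if-false h)) d) ; q = ∧-trueʳ {Nb g x y} p in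
              boolCase (samePair u v x y) (pair y (∧-trueˡ {In g y} q)) (λ s → true≢false (D₁.dom-light h y (∧-intro (not-false s) (∧-trueˡ {Nb g x y} p)) (∧-trueˡ {In g y} q) (not-true (∧-trueʳ {In g y} q))) (D₁.UD-dom {In g} {x} e))

          -- If both endpoints were undominated, each would be in the set as lost dominator of the
          -- other and outside it as undominated vertex. This justifies starting a token at every
          -- undominated endpoint.
          only-one : ∀ w → O.UDg g₁ w ≡ true → ∀ x → x ≢ w → O.UDg g₁ x ≡ false
          only-one w e x p = ¬true⇒false λ e′ → go (lost w e) (lost x e′) (Domination.UD-in (Nb g₁) (Hv g) {In g} {w} e) (Domination.UD-in (Nb g₁) (Hv g) {In g} {x} e′)
            where
            go : (w ≡ u × In g v ≡ true) ⊎ (w ≡ v × In g u ≡ true) → (x ≡ u × In g v ≡ true) ⊎ (x ≡ v × In g u ≡ true) → In g w ≡ false → In g x ≡ false → ⊥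
            go (inj₁ (refl , iv)) (inj₁ (q , _)) _ _ = p q
            go (inj₂ (refl , iu)) (inj₂ (q , _)) _ _ = p q
            go (inj₁ (refl , iv)) (inj₂ (refl , _)) _ ox = true≢false iv ox
            go (inj₂ (refl , iu)) (inj₁ (refl , _)) _ ox = true≢false iu ox

          wake-state : V → State
          wake-state x = mkSt (σ₁ x) (if O.UDg g₁ x then exec (code settle) else idle) [] none

          woken : ∀ x → wakeAll s (delete u v) x ≡ wake-state x
          woken x = go (eqᵇ x u) refl (eqᵇ x v) refl
            where
            removed′ : ∀ y → σ₁ x ≡ delNbr y (σ x) → onRemoved y (s x) ≡ wake-state x
            removed′ y e = trans (cong (onRemoved y) (rest x)) (trans (cong (λ l → mkSt l (if ud l then exec (code settle) else idle) [] none) (sym e))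
              (cong (λ c → mkSt (σ₁ x) (if c then exec (code settle) else idle) [] none) (Local.ud≡ view₁ x)))
            go : ∀ p → eqᵇ x u ≡ p → ∀ q → eqᵇ x v ≡ q → (if p then onRemoved v (s x) else if q then onRemoved u (s x) else s x) ≡ wake-state x
            go true p q _ = removed′ v (if-true p)
            go false p true q = removed′ u (trans (if-false p) (if-true q))
            go false p false q = trans (rest x) (trans (cong (λ l → mkSt l idle [] none) (sym (trans (if-false p) (if-false q)))) (cong (λ c → mkSt (σ₁ x) (if c then exec (code settle) else idle) [] none) (sym quiet)))
              where
              quiet : O.UDg g₁ x ≡ false
              quiet = ¬true⇒false λ e → ends′ (lost x e)
                where
                ends′ : (x ≡ u × In g v ≡ true) ⊎ (x ≡ v × In g u ≡ true) → ⊥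
                ends′ (inj₁ (r , _)) = eqᵇ-false {a = x} {u} p r
                ends′ (inj₂ (r , _)) = eqᵇ-false {a = x} {v} q r

          settleAt : ∀ w → O.UDg g₁ w ≡ true → Updated (delete u v) hE′
          settleAt w e = finish (O.settle-spec w g₁ σ₁ view₁ inv₁ ind₁)
            where
            S : V → State
            S = conf w (exec (code settle)) σ₁ (λ _ → [])
            S≡ : ∀ x → Dec (x ≡ w) → wake-state x ≡ S x
            S≡ x (yes refl) = trans (cong (λ c → mkSt (σ₁ x) (if c then exec (code settle) else idle) [] none) e) (sym (conf-self x (exec (code settle)) σ₁ (λ _ → [])))
            S≡ x (no q) = trans (cong (λ c → mkSt (σ₁ x) (if c then exec (code settle) else idle) [] none) (only-one w e x q)) (sym (conf-other (exec (code settle)) σ₁ (λ _ → []) q))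
            awake′ : ∀ x → inert (S x) ≡ false → Dec (x ≡ w) → endpoints (delete u v) x ≡ true
            awake′ x _ (yes refl) = at (lost x e)
              where
              at : (x ≡ u × In g v ≡ true) ⊎ (x ≡ v × In g u ≡ true) → eqᵇ x u ∨ eqᵇ x v ≡ true
              at (inj₁ (refl , _)) = ∨-introˡ (eqᵇ-refl x)
              at (inj₂ (refl , _)) = ∨-introʳ {eqᵇ x u} (eqᵇ-refl x)
            awake′ x h (no q) = case trans (sym (cong inert (conf-other (exec (code settle)) σ₁ (λ _ → []) q))) h of λ ()
            finish : O.Does w (code settle) σ₁ (O.SettlePost w g₁) → Updated (delete u v) hE′
            finish (O.runsTo {t} {σ′} r (g′ , P , _ , nw , _)) = out (complete G′-sym (1≤μ {G′} {hE′}) r (boot-rep (delete u v) S (λ x → trans (woken x) (S≡ x (x ≟ w))) (λ x h → awake′ x h (x ≟ w))))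
              where
              out : (∃ λ m → m ≤ t * O.μ × Stops G′ (boot (delete u v)) (t + 1) m σ′) → Updated (delete u v) hE′
              out (m , m≤ , St) = record { run≡ = Stops.run≡ St
                ; calm′ = record { σ = σ′ ; rest = Stops.rests St ; view = O.gview P ; inv = O.ginv P ; ind = O.gind P ; clean = λ x → ¬true⇒false λ h → bad x h (x ≟ w)
                                 ; free = λ x → trans (O.P≡ (O.gtr P) x) (free x) ; N≡G = λ x y → trans (O.N≡ (O.gtr P) x y) (cong (not (samePair u v x y) ∧_) (N≡G x y)) }
                ; time = ≤-trans (≤-reflexive (cong (_+ O.C * O.Φ g′) (+-comm t 1))) (s≤s (≤-trans (O.gtime P) (+-monoˡ-≤ (O.C * O.Φ g) (≤-trans (m≤n+m O.A 25) (m≤m+n (25 + O.A) (O.Kd + O.Kd)))))) ; mail = ≤-trans m≤ (*-monoˡ-≤ O.μ (m≤m+n t 1)) }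
                where
                bad : ∀ x → O.UDg g′ x ≡ true → Dec (x ≡ w) → ⊥
                bad x h (yes refl) = true≢false h nw
                bad x h (no q) = true≢false (proj₁ (O.ud-back (O.gtr P) x h)) (only-one w e x q)

          idle-update : (∀ x → O.UDg g₁ x ≡ false) → Updated (delete u v) hE′
          idle-update none′ = out (nothing-to-do u (boot-rep (delete u v) (atRest σ₁) (λ x → trans (woken x) (cong (λ c → mkSt (σ₁ x) (if c then exec (code settle) else idle) [] none) (none′ x))) (λ _ ())))
            where
            out : Stops G′ (boot (delete u v)) 1 0 σ₁ → Updated (delete u v) hE′
            out St = record { run≡ = Stops.run≡ St ; calm′ = record { σ = σ₁ ; rest = Stops.rests St ; view = view₁ ; inv = inv₁ ; ind = ind₁ ; clean = none′ ; free = free ; N≡G = λ x y → cong (not (samePair u v x y) ∧_) (N≡G x y) }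
              ; time = s≤s (m≤n+m (O.C * O.Φ g) O.Ki) ; mail = z≤n }

          updated : Updated (delete u v) hE′
          updated = boolCase (anyF (O.UDg g₁)) (λ e → let (w , h) = anyF-elim (O.UDg g₁) e in settleAt w h) (λ e → idle-update (anyF-false (O.UDg g₁) e))

        update : ∀ x → ValidUpdate G x → (hE′ : ∑ (λ y → count (applyUpdate G x y)) ≤ 2 * ρ ^ 3) → Updated x hE′
        update (insert u v) (ins p e) hE′ = Insert.updated u v p e hE′
        update (delete u v) (del p e) hE′ = Delete.updated u v p hE′

      runSeq-next : ∀ f G s x xs {s′ r m os} → runUpdate f (applyUpdate G x) (config (wakeAll s x) (endpoints x) (λ _ _ → nothing)) ≡ just (s′ , r , m) →
        runSeq f (applyUpdate G x) s′ xs ≡ just os → runSeq f G s (x ∷ xs) ≡ just (outcome (applyUpdate G x) (λ v → inn (inf (loc (s′ v)))) r m ∷ os)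
      runSeq-next f G s x xs e h rewrite e | h = refl

      record Served (G : Graph n) (s : V → State) (us : List (Update n)) (k slack : ℕ) : Set where
        field
          {fuel} : ℕ
          {os}   : List (Outcome algo)
          run≡   : ∀ f → fuel ≤ f → runSeq f G s us ≡ just os
          mis✓   : All (λ o → IsMIS (graph o) (mis o)) os
          max≡   : mMax os ≡ maxEdges G us
          rounds≤ : totalRounds os ≤ length us * k + slack
          msgs≤  : totalMsgs os ≤ totalRounds os * (11 * (ρ * ρ))

      -- Time plus `C` times the new potential is at most a constant plus `C` times the old one, and
      -- this telescopes. `ρ` stays fixed along the sequence, so the invariants of one graph carry
      -- over to the next.
      serve : ∀ us {G hE s g} → Calm G hE s g → ValidSeq G us → maxEdges G us ≤ ρ ^ 3 → Served G s us (suc (On.Ki ρ 1≤ρ G hE)) (On.C ρ 1≤ρ G hE * On.Φ ρ 1≤ρ G hE g)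
      serve [] calm [] le = record { fuel = 0 ; run≡ = λ _ _ → refl ; mis✓ = [] ; max≡ = refl ; rounds≤ = z≤n ; msgs≤ = z≤n }
      serve (x ∷ xs) {G} {hE} {s} {g} calm (valid ∷ vs) le = join′ (Step.update calm x valid hE′)
        where
        G′ : Graph n
        G′ = applyUpdate G x
        hE′ : ∑ (λ v → count (G′ v)) ≤ 2 * ρ ^ 3
        hE′ = ≤-trans (≤-reflexive (∑∑-edges G′ (apply-sym x (calm-sym calm)) (apply-irr valid (calm-irr calm)))) (*-monoʳ-≤ 2 (≤-trans (m≤m⊔n (edgeCount G′) (maxEdges G′ xs)) le))
        join′ : Step.Updated calm x hE′ → Served G s (x ∷ xs) (suc (On.Ki ρ 1≤ρ G hE)) (On.C ρ 1≤ρ G hE * On.Φ ρ 1≤ρ G hE g)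
        join′ U = record
          { fuel = U.t + S.fuel
          ; run≡ = λ f h → runSeq-next f G s x xs (subst (λ z → runUpdate z G′ (Step.boot calm x) ≡ just (U.s′ , U.t , U.m)) (m+[n∸m]≡n (≤-trans (m≤m+n U.t S.fuel) h)) (runUpdate-mono U.t (f ∸ U.t) U.run≡)) (S.run≡ f (≤-trans (m≤n+m S.fuel U.t) h))
          ; mis✓ = calm-MIS U.calm′ ∷ S.mis✓
          ; max≡ = cong (edgeCount G′ ⊔_) S.max≡
          ; rounds≤ = begin
              U.t + totalRounds S.os ≤⟨ +-monoʳ-≤ U.t S.rounds≤ ⟩
              U.t + (length xs * k + slack′) ≡⟨ eq U.t (length xs * k) slack′ ⟩
              length xs * k + (U.t + slack′) ≤⟨ +-monoʳ-≤ (length xs * k) U.time ⟩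
              length xs * k + (k + slack) ≡⟨ eq′ (length xs * k) k slack ⟩
              k + length xs * k + slack ∎
          ; msgs≤ = ≤-trans (+-mono-≤ U.mail S.msgs≤) (≤-reflexive (sym (*-distribʳ-+ (11 * (ρ * ρ)) U.t (totalRounds S.os)))) }
          where
          module U = Step.Updated U
          module S = Served (serve xs U.calm′ vs (≤-trans (m≤n⊔m (edgeCount G′) (maxEdges G′ xs)) le))
          open ≤-Reasoning
          k slack slack′ : ℕ
          k = suc (On.Ki ρ 1≤ρ G hE)
          slack = On.C ρ 1≤ρ G hE * On.Φ ρ 1≤ρ G hE g
          slack′ = On.C ρ 1≤ρ G′ hE′ * On.Φ ρ 1≤ρ G′ hE′ U.g′
          eq : ∀ a c d → a + (c + d) ≡ c + (a + d)
          eq = solve-∀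
          eq′ : ∀ a c d → a + (c + d) ≡ c + a + d
          eq′ = solve-∀

      serve-all : ∀ us → ValidSeq emptyGraph us → maxEdges emptyGraph us ≤ ρ ^ 3 → Served emptyGraph start us (updateRounds (lubyRounds phm b)) 0
      serve-all us valid le = record { fuel = S.fuel ; os = S.os ; run≡ = S.run≡ ; mis✓ = S.mis✓ ; max≡ = S.max≡ ; msgs≤ = S.msgs≤
          ; rounds≤ = ≤-trans S.rounds≤ (+-monoʳ-≤ (length us * updateRounds (lubyRounds phm b)) (≤-reflexive (trans (cong (On.C ρ 1≤ρ emptyGraph hE *_) (∑-zero {n} (λ _ → refl))) (*-zeroʳ (On.C ρ 1≤ρ emptyGraph hE))))) }
        where
        hE : ∑ {n} (λ v → count (emptyGraph {n} v)) ≤ 2 * ρ ^ 3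
        hE = ≤-trans (≤-reflexive (∑-zero {n} (λ _ → ∑-zero {n} (λ _ → refl)))) z≤n
        module S = Served (serve us (calm-start hE) valid le)


-- Constants

n<2^lg : ∀ n → n < 2 ^ lg n
n<2^lg n = ≰⇒> λ le → 1+n≰n (≤-trans (≤-reflexive (sym (⌊log₂[2^n]⌋≡n (lg n)))) (⌊log₂⌋-mono-≤ le))

2^log≤n : ∀ n → 1 ≤ n → 2 ^ ⌊log₂ n ⌋ ≤ n
2^log≤n n = go n n ≤-refl
  where
  go : ∀ k n → n ≤ k → 1 ≤ n → 2 ^ ⌊log₂ n ⌋ ≤ n
  go k 1 le h = ≤-refl
  go (suc k) (suc (suc m)) (s≤s le) h = ≤-trans (≤-reflexive (cong (2 ^_) log≡)) (≤-trans (*-monoʳ-≤ 2 (go k half (≤-trans (⌊n/2⌋≤n′ m) le) (s≤s z≤n)))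
      (≤-trans (≤-reflexive (cong (half +_) (+-identityʳ half))) (≤-trans (+-monoʳ-≤ half (⌊n/2⌋≤⌈n/2⌉ (suc (suc m)))) (≤-reflexive (⌊n/2⌋+⌈n/2⌉≡n (suc (suc m)))))))
    where
    half : ℕ
    half = ⌊ suc (suc m) /2⌋
    ⌊n/2⌋≤n′ : ∀ m → suc ⌊ m /2⌋ ≤ suc m
    ⌊n/2⌋≤n′ m = s≤s (⌊n/2⌋≤n m)
    pos : 1 ≤ ⌊log₂ suc (suc m) ⌋
    pos = ⌊log₂⌋-mono-≤ {2} {suc (suc m)} (s≤s (s≤s z≤n))
    log≡ : ⌊log₂ suc (suc m) ⌋ ≡ suc ⌊log₂ half ⌋
    log≡ = sym (trans (cong suc (⌊log₂⌊n/2⌋⌋≡⌊log₂n⌋∸1 (suc (suc m)))) (m+[n∸m]≡n pos))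

-- Opaque, so that these numbers are never unfolded into unary ones.
opaque
  bitsFor phasesFor valFor : ℕ → ℕ
  bitsFor n   = lg n + 2
  phasesFor n = 34 * lg n
  valFor n    = suc n ^ 18 ∸ 1

module Sizes (n : ℕ) (1≤n : 1 ≤ n) where

  private
    N L : ℕ
    N = suc n
    L = lg n

  opaque
    unfolding bitsFor phasesFor valFor

    -- `n < 2 ^ lg n`, and the two additional bits provide the factor 4.
    b-big : suc (4 * n) ≤ 2 ^ bitsFor n
    b-big = ≤-trans (≤-trans (≤-trans (s≤s (m≤n+m (4 * n) 3)) (≤-reflexive (sym (*-suc 4 n)))) (≤-trans (*-monoʳ-≤ 4 (n<2^lg n)) (≤-reflexive (*-comm 4 (2 ^ L))))) (≤-reflexive (sym (^-distribˡ-+-* 2 L 2)))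

    power-gap : ∀ p q → p * 4 ≤ q → ∀ L → p ^ L * 4 ^ L ≤ q ^ L
    power-gap p q h zero = ≤-refl
    power-gap p q h (suc L) = ≤-trans (≤-reflexive ([m*n]*[o*p]≡[m*o]*[n*p] p (p ^ L) 4 (4 ^ L))) (*-mono-≤ h (power-gap p q h L))

    -- Starting from at most `n² < 4^lg n` ordered pairs, 34 phases shrink the number by more than a
    -- factor 4, as `4 · 23^34 ≤ 24^34`; hence 34 phases per unit of `lg n`.
    small : 23 ^ phasesFor n * (n * n) < 24 ^ phasesFor n
    small = <-≤-trans (*-monoʳ-< (23 ^ phasesFor n) {{m^n≢0 23 (phasesFor n)}} n²<) (≤-trans (*-monoˡ-≤ (4 ^ L) (≤-reflexive (sym (^-*-assoc 23 34 L)))) (≤-trans (power-gap (23 ^ 34) (24 ^ 34) (≤ᵇ⇒≤ (23 ^ 34 * 4) (24 ^ 34) tt) L) (≤-reflexive (^-*-assoc 24 34 L))))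
      where
      n²< : n * n < 4 ^ L
      n²< = <-≤-trans (*-mono-< (n<2^lg n) (n<2^lg n)) (≤-reflexive (trans (sym (^-distribˡ-+-* 2 L L)) (trans (cong (λ z → 2 ^ (L + z)) (sym (+-identityʳ L))) (sym (^-*-assoc 2 2 L)))))

    N≥2 : 2 ≤ N
    N≥2 = s≤s 1≤n

    2^b≤ : 2 ^ bitsFor n ≤ N ^ 4
    2^b≤ = ≤-trans (≤-reflexive (^-distribˡ-+-* 2 L 2)) (≤-trans (*-monoˡ-≤ 4 (*-monoʳ-≤ 2 (2^log≤n n 1≤n))) (≤-trans (≤-reflexive (eq n)) (≤-trans (*-mono-≤ (≤-reflexive {8} refl) (n≤1+n n)) (≤-trans (*-monoˡ-≤ N (^-monoˡ-≤ 3 N≥2)) (≤-reflexive (*-comm (N ^ 3) N))))))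
      where
      eq : ∀ n → 2 * n * 4 ≡ 8 * n
      eq = solve-∀

    seeds≤ : 2 ^ seedLen (bitsFor n) ≤ N ^ 12
    seeds≤ = ≤-trans (≤-reflexive (trans (^-distribˡ-+-* 2 (bitsFor n + bitsFor n) (bitsFor n)) (cong (_* 2 ^ bitsFor n) (^-distribˡ-+-* 2 (bitsFor n) (bitsFor n)))))
      (≤-trans (*-mono-≤ (*-mono-≤ 2^b≤ 2^b≤) 2^b≤) (≤-reflexive (trans (cong (_* N ^ 4) (sym (^-distribˡ-+-* N 4 4))) (sym (^-distribˡ-+-* N 8 4)))))

    suc-val : suc (valFor n) ≡ N ^ 18
    suc-val = m+[n∸m]≡n (m^n>0 N 18)

    below-val : ∀ {x} k → k < 18 → x ≤ N ^ k → x ≤ valFor n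
    below-val k lt h = ≤-pred (≤-trans (s≤s h) (≤-trans (^-monoʳ-< N N≥2 lt) (≤-reflexive (sym suc-val))))

    -- Exponents 1 for the vertices, 12 for the seeds and 4 for a single loss sum to 17, one less
    -- than the 18 digits of a number.
    fits : n * (2 ^ seedLen (bitsFor n) * (n * (n * (n * 1)) + n * (n * (n * 1)))) ≤ valFor n
    fits = below-val 17 (≤ᵇ⇒≤ 18 18 tt) (≤-trans (*-mono-≤ n≤N (*-mono-≤ seeds≤ cubes)) (≤-reflexive (trans (cong (N *_) (sym (^-distribˡ-+-* N 12 4))) refl)))
      where
      n≤N : n ≤ N
      n≤N = n≤1+n n
      cube : n * (n * (n * 1)) ≤ N ^ 3
      cube = ^-monoˡ-≤ 3 n≤N
      cubes : n * (n * (n * 1)) + n * (n * (n * 1)) ≤ N ^ 4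
      cubes = ≤-trans (+-mono-≤ cube cube) (≤-trans (≤-reflexive (cong (N ^ 3 +_) (sym (+-identityʳ (N ^ 3))))) (*-monoˡ-≤ (N ^ 3) N≥2))

    fitSeed : 2 ^ seedLen (bitsFor n) ≤ valFor n
    fitSeed = below-val 12 (≤ᵇ⇒≤ 13 18 tt) seeds≤

    fitN : n ≤ valFor n
    fitN = below-val 1 (≤ᵇ⇒≤ 2 18 tt) (≤-trans (n≤1+n n) (≤-reflexive (sym (*-identityʳ N))))

opaque
  unfolding bitsFor phasesFor

  -- At most `35 L` phases of `15 L + 45 ≤ 60 L` rounds each give 2100, and the remaining 10 rounds
  -- belong to the first and the last pulse.
  lubyRounds≤ : ∀ n → lubyRounds (phasesFor n) (bitsFor n) ≤ 2110 * (lg n * lg n)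
  lubyRounds≤ n = ≤-trans (≤-reflexive (eq (suc (phasesFor n) * (5 + (5 + (seedLen (bitsFor n) * 5 + 5)))))) (≤-trans (+-mono-≤ (*-monoʳ-≤ 10 1≤L²)
      (≤-trans (*-mono-≤ {suc (34 * L)} {35 * L} (+-monoˡ-≤ (34 * L) 1≤L) inner) (≤-reflexive ([m*n]*[o*p]≡[m*o]*[n*p] 35 L 60 L)))) (≤-reflexive (sym (*-distribʳ-+ (L * L) 10 2100))))
    where
    L : ℕ
    L = lg n
    1≤L : 1 ≤ L
    1≤L = s≤s z≤n
    1≤L² : 1 ≤ L * L
    1≤L² = *-mono-≤ 1≤L 1≤L
    eq : ∀ x → 5 + (x + 5) ≡ 10 * 1 + x
    eq = solve-∀
    inner : 5 + (5 + (seedLen (L + 2) * 5 + 5)) ≤ 60 * L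
    inner = ≤-trans (≤-reflexive (eq′ L)) (≤-trans (+-monoʳ-≤ (15 * L) (*-monoʳ-≤ 45 1≤L)) (≤-reflexive (sym (*-distribʳ-+ L 15 45))))
      where
      eq′ : ∀ L → 5 + (5 + (((L + 2) + (L + 2) + (L + 2)) * 5 + 5)) ≡ 15 * L + 45 * 1
      eq′ = solve-∀

opaque
  -- An update is charged `786 + 11 l` rounds for `l` rounds of Luby's algorithm, and
  -- `786 + 11 · 2110 = 23996`. Cubing the message bound gives the cube with the 11 of `μ`, and
  -- `64 = 8²` from `ρ³ ≤ 8m`; adding both constants serves both bounds.
  roundConst totalConst : ℕ
  roundConst = 23996
  totalConst = roundConst + (roundConst * 11) ^ 3 * 64

  updateRounds≤ : ∀ n → updateRounds (lubyRounds (phasesFor n) (bitsFor n)) ≤ roundConst * (lg n * lg n)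
  updateRounds≤ n = ≤-trans (≤-reflexive (eq (lubyRounds (phasesFor n) (bitsFor n)))) (≤-trans (+-mono-≤ (*-monoʳ-≤ 786 {1} {L²} (*-mono-≤ {1} {lg n} {1} {lg n} (s≤s z≤n) (s≤s z≤n))) (*-monoʳ-≤ 11 (lubyRounds≤ n)))
      (≤-reflexive (trans (cong (786 * L² +_) (sym (*-assoc 11 2110 L²))) (sym (*-distribʳ-+ L² 786 23210)))))
    where
    L² : ℕ
    L² = lg n * lg n
    eq : ∀ l → suc (25 + (20 + l) + ((30 + (20 + l) + ((60 + (20 + l)) + (60 + (20 + l)) + ((60 + (20 + l)) + (60 + (20 + l))))) + (30 + (20 + l) + ((60 + (20 + l)) + (60 + (20 + l)) + ((60 + (20 + l)) + (60 + (20 + l))))))) ≡ 786 * 1 + 11 * l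
    eq = solve-∀

  total-bounds : ∀ k ℓ L ρ m R S → k ≤ roundConst * (L * L) → R ≤ ℓ * k → S ≤ R * (11 * (ρ * ρ)) → ρ ^ 3 ≤ 8 * m →
    R ≤ totalConst * ℓ * L ^ 2 × S ^ 3 ≤ totalConst * ℓ ^ 3 * m ^ 2 * L ^ 6
  total-bounds k ℓ L ρ m R S hk hR hS hρ = generic roundConst hk
    where
    generic : ∀ c → k ≤ c * (L * L) → R ≤ (c + (c * 11) ^ 3 * 64) * ℓ * L ^ 2 × S ^ 3 ≤ (c + (c * 11) ^ 3 * 64) * ℓ ^ 3 * m ^ 2 * L ^ 6
    generic c hk = ≤-trans R≤ (≤-trans (≤-reflexive (eq₁ c ℓ L)) (*-monoˡ-≤ (L ^ 2) (*-monoˡ-≤ ℓ (m≤m+n c _)))) , (begin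
        S ^ 3 ≤⟨ ^-monoˡ-≤ 3 (≤-trans hS (*-monoˡ-≤ (11 * (ρ * ρ)) R≤)) ⟩
        (ℓ * (c * (L * L)) * (11 * (ρ * ρ))) ^ 3 ≡⟨ eq₂ c ℓ L ρ ⟩
        (c * 11) ^ 3 * ℓ ^ 3 * (ρ ^ 3 * ρ ^ 3) * L ^ 6 ≤⟨ *-monoˡ-≤ (L ^ 6) (*-monoʳ-≤ ((c * 11) ^ 3 * ℓ ^ 3) (*-mono-≤ hρ hρ)) ⟩
        (c * 11) ^ 3 * ℓ ^ 3 * (8 * m * (8 * m)) * L ^ 6 ≡⟨ cong (_* L ^ 6) (eq₃ ((c * 11) ^ 3) (ℓ ^ 3) m) ⟩
        (c * 11) ^ 3 * 64 * ℓ ^ 3 * m ^ 2 * L ^ 6 ≤⟨ *-monoˡ-≤ (L ^ 6) (*-monoˡ-≤ (m ^ 2) (*-monoˡ-≤ (ℓ ^ 3) (m≤n+m ((c * 11) ^ 3 * 64) c))) ⟩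
        (c + (c * 11) ^ 3 * 64) * ℓ ^ 3 * m ^ 2 * L ^ 6 ∎)
      where
      open ≤-Reasoning
      R≤ : R ≤ ℓ * (c * (L * L))
      R≤ = ≤-trans hR (*-monoʳ-≤ ℓ hk)
      eq₁ : ∀ c ℓ L → ℓ * (c * (L * L)) ≡ c * ℓ * (L * (L * 1))
      eq₁ = solve-∀
      eq₂ : ∀ c ℓ L ρ → (ℓ * (c * (L * L)) * (11 * (ρ * ρ))) * ((ℓ * (c * (L * L)) * (11 * (ρ * ρ))) * ((ℓ * (c * (L * L)) * (11 * (ρ * ρ))) * 1))
        ≡ (c * 11) * ((c * 11) * ((c * 11) * 1)) * (ℓ * (ℓ * (ℓ * 1))) * ((ρ * (ρ * (ρ * 1))) * (ρ * (ρ * (ρ * 1)))) * (L * (L * (L * (L * (L * (L * 1))))))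
      eq₂ = solve-∀
      eq₃ : ∀ x y m → x * y * (8 * m * (8 * m)) ≡ x * 64 * y * (m * (m * 1))
      eq₃ = solve-∀

-- With `r` the integer cube root of `m`, the witness `r + 1` is at most `2r`, which costs the
-- factor 8.
cube-root : ∀ m → 1 ≤ m → ∃ λ ρ → 1 ≤ ρ × m ≤ ρ ^ 3 × ρ ^ 3 ≤ 8 * m
cube-root m 1≤m = let (r , 1≤r , lo , hi) = floor m 1≤m in suc r , s≤s z≤n , <⇒≤ hi ,
    ≤-trans (^-monoˡ-≤ 3 (≤-trans (+-monoˡ-≤ r 1≤r) (≤-reflexive (cong (r +_) (sym (+-identityʳ r)))))) (≤-trans (≤-reflexive (eq r)) (*-monoʳ-≤ 8 lo))
  where
  eq : ∀ r → (2 * r) * ((2 * r) * ((2 * r) * 1)) ≡ 8 * (r * (r * (r * 1)))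
  eq = solve-∀
  floor : ∀ m → 1 ≤ m → ∃ λ r → 1 ≤ r × r ^ 3 ≤ m × m < suc r ^ 3
  floor (suc zero) h = 1 , ≤-refl , ≤-refl , s≤s (s≤s z≤n)
  floor (suc (suc m)) h with floor (suc m) (s≤s z≤n)
  ... | r , 1≤r , lo , hi with suc r ^ 3 ≤? suc (suc m)
  ...   | yes le = suc r , s≤s z≤n , le , ≤-<-trans hi (^-monoˡ-< 3 (n<1+n (suc r)))
  ...   | no gt  = r , 1≤r , ≤-trans lo (n≤1+n _) , ≰⇒> gt

-- A valid first update of the empty graph is an insertion; `cube-root` needs a positive number.
maxEdges-pos : ∀ {n} (x : Update n) xs → ValidUpdate emptyGraph x → 1 ≤ maxEdges emptyGraph (x ∷ xs)
maxEdges-pos {n} (insert u v) xs (ins u≢v e) = ≤-trans 1≤ (m≤m⊔n (edgeCount G) (maxEdges G xs))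
  where
  G : Graph n
  G = applyUpdate emptyGraph (insert u v)
  twice : ∑ (λ y → count (G y)) ≡ 2 * edgeCount G
  twice = ∑∑-edges G (apply-sym {G = emptyGraph} (insert u v) (λ _ _ → refl)) (apply-irr {G = emptyGraph} {insert u v} (ins u≢v e) (λ _ → refl))
  uv : G u v ≡ true
  uv = ∨-introˡ (∨-introˡ (∧-intro (eqᵇ-refl u) (eqᵇ-refl v)))
  1≤ : 1 ≤ edgeCount G
  1≤ = n≢0⇒n>0 λ z → case trans (sym (cong b2n uv)) (∑≡0⇒ (λ y → b2n (G u y)) (∑≡0⇒ (λ y → count (G y)) (trans twice (trans (cong (2 *_) z) refl)) u) v) of λ ()

idleAlgorithm : ∀ n B → Algorithm n B
idleAlgorithm n B = record { State = ⊤ ; init = λ _ → tt ; wake = λ _ _ → tt ; step = λ _ _ → tt , λ _ → nothing ; done = λ _ → true ; inMIS = λ _ → true }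

opaque
  messageSize : ℕ
  messageSize = 341

  messageSize≡ : messageSize ≡ 341
  messageSize≡ = refl

module Solution (n : ℕ) (1≤n : 1 ≤ n) where
  open Sizes n 1≤n using (N≥2; b-big; fitN; fitSeed; fits; small; suc-val)

  Message : Set
  Message = MIS.M n (valFor n) (bitsFor n) (phasesFor n) b-big small fits fitSeed fitN

  opaque
    messageCodec : Codec (suc n) messageSize Message
    messageCodec = subst (λ k → Codec (suc n) k Message) (sym messageSize≡)
      (MIS.Messages.message-codec n (valFor n) (bitsFor n) (phasesFor n) b-big small fits fitSeed fitN (suc n) N≥2 1≤n (≤-trans (n≤1+n n) (≤-reflexive (sym (*-identityʳ (suc n))))) (≤-reflexive suc-val))

  module Encoded (B : ℕ) (c : Codec (suc n) B Message) where

    enc : Message → Msg n B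
    enc m = fromℕ< (Codec.encode< c m)

    dec : Msg n B → Message
    dec i = Codec.decode c (toℕ i)

    dec-enc : ∀ m → dec (enc m) ≡ m
    dec-enc m = trans (cong (Codec.decode c) (toℕ-fromℕ< (Codec.encode< c m))) (Codec.decode-encode c m)

    theAlgorithm : Algorithm n B
    theAlgorithm = MIS.Coded.algo n (valFor n) (bitsFor n) (phasesFor n) b-big small fits fitSeed fitN B enc dec dec-enc

    works : ∀ (us : List (Update n)) → ValidSeq emptyGraph us →
      ∃ λ (fuel : ℕ) → ∃ λ (os : List (Outcome theAlgorithm)) →
        run theAlgorithm fuel us ≡ just os ×
        All (λ o → IsMIS (graph o) (mis o)) os ×
        totalRounds os ≤ totalConst * length us * lg n ^ 2 ×
        totalMsgs os ^ 3 ≤ totalConst * length us ^ 3 * mMax os ^ 2 * lg n ^ 6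
    works [] [] = 0 , [] , refl , [] , z≤n , z≤n
    -- `ρ` is fitted in hindsight to the whole sequence; `theAlgorithm` does not depend on it.
    works (x ∷ xs) (valid ∷ vs) = go (cube-root (maxEdges emptyGraph us) (maxEdges-pos x xs valid))
      where
      us : List (Update n)
      us = x ∷ xs
      go : (∃ λ ρ → 1 ≤ ρ × maxEdges emptyGraph us ≤ ρ ^ 3 × ρ ^ 3 ≤ 8 * maxEdges emptyGraph us) →
        ∃ λ (fuel : ℕ) → ∃ λ (os : List (Outcome theAlgorithm)) → run theAlgorithm fuel us ≡ just os × All (λ o → IsMIS (graph o) (mis o)) os ×
          totalRounds os ≤ totalConst * length us * lg n ^ 2 × totalMsgs os ^ 3 ≤ totalConst * length us ^ 3 * mMax os ^ 2 * lg n ^ 6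
      go (ρ , 1≤ρ , lo , hi) = S.fuel , S.os , S.run≡ S.fuel ≤-refl , S.mis✓ , proj₁ bounds , proj₂ bounds
        where
        served : MIS.Coded.Dynamic.Served n (valFor n) (bitsFor n) (phasesFor n) b-big small fits fitSeed fitN B enc dec dec-enc ρ 1≤ρ emptyGraph _ us (updateRounds (lubyRounds (phasesFor n) (bitsFor n))) 0
        served = MIS.Coded.Dynamic.serve-all n (valFor n) (bitsFor n) (phasesFor n) b-big small fits fitSeed fitN B enc dec dec-enc ρ 1≤ρ us (valid ∷ vs) lo
        module S = MIS.Coded.Dynamic.Served served
        bounds : totalRounds S.os ≤ totalConst * length us * lg n ^ 2 × totalMsgs S.os ^ 3 ≤ totalConst * length us ^ 3 * mMax S.os ^ 2 * lg n ^ 6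
        bounds = total-bounds (updateRounds (lubyRounds (phasesFor n) (bitsFor n))) (length us) (lg n) ρ (mMax S.os) (totalRounds S.os) (totalMsgs S.os) (updateRounds≤ n)
          (≤-trans S.rounds≤ (≤-reflexive (+-identityʳ _))) S.msgs≤ (≤-trans hi (≤-reflexive (cong (8 *_) (sym S.max≡))))

-- The message bound is cubed to express the exponent 2/3 in natural numbers, with `length us`
-- turning averages into totals. `B` and `C` are chosen before `n`, so messages have `O(log n)`
-- bits.
theorem4 : ∃ λ (B : ℕ) → ∃ λ (C : ℕ) → Σ ((n : ℕ) → Algorithm n B) λ A →
    ∀ (n : ℕ) (us : List (Update n)) → ValidSeq emptyGraph us →
      ∃ λ (fuel : ℕ) → ∃ λ (os : List (Outcome (A n))) →
        run (A n) fuel us ≡ just os ×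
        All (λ o → IsMIS (graph o) (mis o)) os ×
        totalRounds os ≤ C * length us * lg n ^ 2 ×
        totalMsgs os ^ 3 ≤ C * length us ^ 3 * mMax os ^ 2 * lg n ^ 6
theorem4 = messageSize , totalConst , algorithm , correct
  where
  algorithm : ∀ n → Algorithm n messageSize
  algorithm zero    = idleAlgorithm 0 messageSize
  algorithm (suc n) = Solution.Encoded.theAlgorithm (suc n) (s≤s z≤n) messageSize (Solution.messageCodec (suc n) (s≤s z≤n))
  correct : ∀ n us → ValidSeq emptyGraph us → ∃ λ (fuel : ℕ) → ∃ λ (os : List (Outcome (algorithm n))) →
    run (algorithm n) fuel us ≡ just os × All (λ o → IsMIS (graph o) (mis o)) os × totalRounds os ≤ totalConst * length us * lg n ^ 2 ×
    totalMsgs os ^ 3 ≤ totalConst * length us ^ 3 * mMax os ^ 2 * lg n ^ 6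
  correct zero []              [] = 0 , [] , refl , [] , z≤n , z≤n
  correct zero (insert () v ∷ us)
  correct zero (delete () v ∷ us)
  correct (suc n) us valid = Solution.Encoded.works (suc n) (s≤s z≤n) messageSize (Solution.messageCodec (suc n) (s≤s z≤n)) us valid
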